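{- For every non-empty index $\boldsymbol{k}=(k_1,\ldots,k_r)$, the following equality holds in $(\mathcal{Z}/\zeta(2)\mathcal{Z})[[t]]$: \begin{align*} &\sum_{i=1}^r \sum_{j=0}^{k_i-2} \zeta_{\widehat{\mathcal{S}}}(j+1,k_{i+1},\ldots,k_r,k_1,\ldots,k_{i-1},k_i-j)\\ &=\sum_{i=1}^r \sum_{j=0}^\infty\left(\zeta_{\widehat{\mathcal{S}}}(k_i+j+1,k_{i+1},\ldots,k_r,k_1,\ldots,k_{i-1})+\zeta_{\widehat{\mathcal{S}}}(j+1,k_{i+1},\ldots,k_r,k_1,\ldots,k_i)\right)t^j\\ &\quad+\sum_{i=1}^r \zeta_{\widehat{\mathcal{S}}}(k_{i+1},\ldots,k_r,k_1,\ldots,k_{i-1},k_i+1). \end{align*}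
   Context: An index is a tuple $\boldsymbol{k}=(k_1,\dots,k_r)$ of positive integers ($r\ge 0$; $r=0$ gives the empty index $\varnothing$). It is admissible if it is empty or $k_r\ge 2$. For admissible $\boldsymbol{k}$, $\zeta(k_1,\dots,k_r)=\sum_{1\le n_1<\cdots<n_r}\frac{1}{n_1^{k_1}\cdots n_r^{k_r}}$, $\zeta(\varnothing)=1$. $\mathcal{Z}\subset\mathbb{R}$ is the $\mathbb{Q}$-linear span of $1$ and all multiple zeta values; it is a $\mathbb{Q}$-algebra. Empty sums are $0$; for $i=r$ the string $k_{i+1},\dots,k_r$ is empty, and for $i=1$ the string $k_1,\dots,k_{i-1}$ is empty. Let $\mathfrak{H}=\mathbb{Q}\langle x,y\rangle$, $\mathfrak{H}^1=\mathbb{Q}+y\mathfrak{H}\supset\mathfrak{H}^0=\mathbb{Q}+y\mathfrak{H}x$, $z_k=yx^{k-1}$, $z_{\boldsymbol{k}}=z_{k_1}\cdots z_{k_r}$. Let $Z:\mathfrak{H}^0\to\mathbb{R}$ be the $\mathbb{Q}$-linear map with $Z(z_{\boldsymbol{k}})=\zeta(\boldsymbol{k})$ for admissible $\boldsymbol{k}$. The harmonic product $\ast$ on $\mathfrak{H}^1$ is the $\mathbb{Q}$-bilinear product with $w\ast1=1\ast w=w$ and $w_1z_k\ast w_2z_l=(w_1\ast w_2z_l)z_k+(w_1z_k\ast w_2)z_l+(w_1\ast w_2)z_{k+l}$. The shuffle product $\mathrm{sh}$ on $\mathfrak{H}$ is the $\mathbb{Q}$-bilinear product with $w\,\mathrm{sh}\,1=1\,\mathrm{sh}\,w=w$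 and $w_1u_1\,\mathrm{sh}\,w_2u_2=(w_1\,\mathrm{sh}\,w_2u_2)u_1+(w_1u_1\,\mathrm{sh}\,w_2)u_2$ for $u_1,u_2\in\{x,y\}$. For $\bullet\in\{\ast,\mathrm{sh}\}$, $Z$ is a homomorphism for $\bullet$ on $\mathfrak{H}^0$, $(\mathfrak{H}^1,\bullet)\cong(\mathfrak{H}^0,\bullet)[y]$, and $Z^{\bullet}:(\mathfrak{H}^1,\bullet)\to\mathbb{R}[T]$, $w\mapsto Z^\bullet(w;T)$, is the unique $\mathbb{Q}$-algebra homomorphism extending $Z$ with $Z^{\bullet}(y;T)=T$; its image lies in $\mathcal{Z}[T]$. Put $\zeta^{\bullet}(\boldsymbol{k})=Z^{\bullet}(z_{\boldsymbol{k}};0)\in\mathcal{Z}$. For $\bullet\in\{\ast,\mathrm{sh}\}$ the $t$-adic symmetric multiple zeta values are the elements of $\mathcal{Z}[[t]]$ $$\zeta^{\bullet}_{\widehat{\mathcal{S}}}(k_1,\ldots,k_r)=\sum_{i=0}^r(-1)^{k_{i+1}+\cdots+k_r}\zeta^{\bullet}(k_1,\ldots,k_i)\sum_{l_{i+1},\ldots,l_r\ge0}\ \prod_{j=i+1}^r\binom{k_j+l_j-1}{l_j}\,\zeta^{\bullet}(k_r+l_r,\ldots,k_{i+1}+l_{i+1})\,t^{l_{i+1}+\cdots+l_r}.$$ It is known (Ono–Seki–Yamamoto) that $\zeta^{\ast}_{\widehat{\mathcal{S}}}(\boldsymbol{k})\equiv\zeta^{\mathrm{sh}}_{\widehat{\mathcal{S}}}(\boldsymbol{k})$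 modulo $\zeta(2)\mathcal{Z}[[t]]$; $\zeta_{\widehat{\mathcal{S}}}(\boldsymbol{k})\in(\mathcal{Z}/\zeta(2)\mathcal{Z})[[t]]$ denotes their common reduction, taken coefficientwise. -}

module Defs where

import Algebra.Definitions.RawSemiring as RawSemiring
open import Data.Integer.Base as ℤ using (+_)
import Data.Integer.Properties as ℤ
open import Data.Nat.Base as ℕ using (ℕ; zero; suc)
import Data.Nat.Properties as ℕ
open import Data.Nat.Combinatorics using () renaming (_C_ to _choose_)
open import Data.Nat.ListAction using (sum; product)
open import Data.Fin.Base using (Fin; toℕ)
open import Data.List.Base
  using (List; []; _∷_; _∷ʳ_; _++_; map; concatMap; foldr; reverse; replicate; length; take; drop; upTo; zipWith)
open import Data.List.Properties using (reverse-++)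
open import Data.Product.Base using (∃; _×_; _,_; proj₁; proj₂)
open import Data.Rational.Base as ℚ using (ℚ; 0ℚ; 1ℚ; ½; _/_; _≤_; _<_; ∣_∣)
import Data.Rational.Properties as ℚ
import Data.Rational.Unnormalised.Base as ℚᵘ
import Data.Rational.Unnormalised.Properties as ℚᵘ
open import Data.Rational.Solver using (module +-*-Solver)
open import Data.Nat.Solver using () renaming (module +-*-Solver to ℕSolver)
open import Data.Sum.Base using (inj₁; inj₂)
open import Function.Base using (_∘_)
open import Relation.Binary.PropositionalEquality

open RawSemiring ℚ.+-*-rawSemiring using (_^_)

------------------------------------------------------------------------
-- Real numbers: Cauchy sequences of rationals up to null sequences

IsCauchy : (ℕ → ℚ) → Set
IsCauchy s = ∀ ε → 0ℚ < ε → ∃ λ N → ∀ m n → N ℕ.≤ m → N ℕ.≤ n → ∣ s m ℚ.- s n ∣ < ε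

record ℝ : Set where
  constructor mkℝ
  field
    seq    : ℕ → ℚ
    cauchy : IsCauchy seq

open ℝ public

infix 4 _≈_
record _≈_ (x y : ℝ) : Set where
  constructor mk≈
  field
    null : ∀ ε → 0ℚ < ε → ∃ λ N → ∀ n → N ℕ.≤ n → ∣ seq x n ℚ.- seq y n ∣ < ε

halve-pos : ∀ {ε} → 0ℚ < ε → 0ℚ < ½ ℚ.* ε
halve-pos {ε} 0<ε = subst (_< ½ ℚ.* ε) (ℚ.*-zeroʳ ½) (ℚ.*-monoʳ-<-pos ½ 0<ε)

halves : ∀ ε → ½ ℚ.* ε ℚ.+ ½ ℚ.* ε ≡ ε
halves = solve 1 (λ e → con ½ :* e :+ con ½ :* e := e) refl
  where open +-*-Solver

cauchy-const : ∀ q → IsCauchy (λ _ → q)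
cauchy-const q ε 0<ε =
  0 , λ _ _ _ _ → subst (λ p → ∣ p ∣ < ε) (sym (ℚ.+-inverseʳ q)) 0<ε

cauchy-+ : ∀ s t → IsCauchy s → IsCauchy t → IsCauchy (λ n → s n ℚ.+ t n)
cauchy-+ s t cs ct ε 0<ε = N ℕ.⊔ M , bound
  where
  N = proj₁ (cs _ (halve-pos 0<ε))
  M = proj₁ (ct _ (halve-pos 0<ε))
  regroup : ∀ a b c d → (a ℚ.+ b) ℚ.- (c ℚ.+ d) ≡ (a ℚ.- c) ℚ.+ (b ℚ.- d)
  regroup = solve 4 (λ a b c d → (a :+ b) :- (c :+ d) := (a :- c) :+ (b :- d)) refl
    where open +-*-Solver
  bound : ∀ m n → N ℕ.⊔ M ℕ.≤ m → N ℕ.⊔ M ℕ.≤ n → ∣ (s m ℚ.+ t m) ℚ.- (s n ℚ.+ t n) ∣ < ε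
  bound m n ≤m ≤n = begin-strict
    ∣ (s m ℚ.+ t m) ℚ.- (s n ℚ.+ t n) ∣        ≡⟨ cong ∣_∣ (regroup (s m) (t m) (s n) (t n)) ⟩
    ∣ (s m ℚ.- s n) ℚ.+ (t m ℚ.- t n) ∣        ≤⟨ ℚ.∣p+q∣≤∣p∣+∣q∣ (s m ℚ.- s n) (t m ℚ.- t n) ⟩
    ∣ s m ℚ.- s n ∣ ℚ.+ ∣ t m ℚ.- t n ∣        <⟨ ℚ.+-mono-<
      (proj₂ (cs _ (halve-pos 0<ε)) m n (ℕ.m⊔n≤o⇒m≤o N M ≤m) (ℕ.m⊔n≤o⇒m≤o N M ≤n))
      (proj₂ (ct _ (halve-pos 0<ε)) m n (ℕ.m⊔n≤o⇒n≤o N M ≤m) (ℕ.m⊔n≤o⇒n≤o N M ≤n)) ⟩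
    ½ ℚ.* ε ℚ.+ ½ ℚ.* ε                        ≡⟨ halves ε ⟩
    ε                                          ∎
    where open ℚ.≤-Reasoning

cauchy-neg : ∀ s → IsCauchy s → IsCauchy (λ n → ℚ.- s n)
cauchy-neg s cs ε 0<ε = proj₁ (cs ε 0<ε) , λ m n ≤m ≤n →
  subst (_< ε) (sym (flip-sign m n)) (proj₂ (cs ε 0<ε) m n ≤m ≤n)
  where
  flip-sign : ∀ m n → ∣ (ℚ.- s m) ℚ.- (ℚ.- s n) ∣ ≡ ∣ s m ℚ.- s n ∣
  flip-sign m n = trans (cong ∣_∣ (sym (ℚ.neg-distrib-+ (s m) (ℚ.- s n)))) (ℚ.∣-p∣≡∣p∣ (s m ℚ.- s n))

cauchy-bounded : ∀ s → IsCauchy s →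
                 ∃ λ B → 0ℚ < B × ∃ λ N → ∀ n → N ℕ.≤ n → ∣ s n ∣ ≤ B
cauchy-bounded s cs = 1ℚ ℚ.+ ∣ s N ∣ , 0<B , N , bound
  where
  0<1 : 0ℚ < 1ℚ
  0<1 = ℚ.positive⁻¹ 1ℚ
  N = proj₁ (cs 1ℚ 0<1)
  0<B : 0ℚ < 1ℚ ℚ.+ ∣ s N ∣
  0<B = ℚ.+-mono-<-≤ 0<1 (ℚ.0≤∣p∣ (s N))
  split : ∀ a b → a ≡ (a ℚ.- b) ℚ.+ b
  split = solve 2 (λ a b → a := (a :- b) :+ b) refl
    where open +-*-Solver
  bound : ∀ n → N ℕ.≤ n → ∣ s n ∣ ≤ 1ℚ ℚ.+ ∣ s N ∣
  bound n N≤n = begin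
    ∣ s n ∣                        ≡⟨ cong ∣_∣ (split (s n) (s N)) ⟩
    ∣ (s n ℚ.- s N) ℚ.+ s N ∣      ≤⟨ ℚ.∣p+q∣≤∣p∣+∣q∣ (s n ℚ.- s N) (s N) ⟩
    ∣ s n ℚ.- s N ∣ ℚ.+ ∣ s N ∣    ≤⟨ ℚ.+-monoˡ-≤ ∣ s N ∣ (ℚ.<⇒≤ (proj₂ (cs 1ℚ 0<1) n N N≤n ℕ.≤-refl)) ⟩
    1ℚ ℚ.+ ∣ s N ∣                 ∎
    where open ℚ.≤-Reasoning

cauchy-* : ∀ s t → IsCauchy s → IsCauchy t → IsCauchy (λ n → s n ℚ.* t n)
cauchy-* s t cs ct ε 0<ε = K , bound
  where
  A  = proj₁ (cauchy-bounded s cs)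
  B  = proj₁ (cauchy-bounded t ct)
  0<A = proj₁ (proj₂ (cauchy-bounded s cs))
  0<B = proj₁ (proj₂ (cauchy-bounded t ct))
  NA = proj₁ (proj₂ (proj₂ (cauchy-bounded s cs)))
  NB = proj₁ (proj₂ (proj₂ (cauchy-bounded t ct)))
  M  = A ℚ.+ B
  instance
    M-pos : ℚ.Positive M
    M-pos = ℚ.positive (ℚ.+-mono-< 0<A 0<B)
    M-nonZero : ℚ.NonZero M
    M-nonZero = ℚ.pos⇒nonZero M
    M⁻¹-pos : ℚ.Positive (ℚ.1/ M)
    M⁻¹-pos = ℚ.1/pos⇒pos M
  A≤M : A ≤ M
  A≤M = subst (_≤ M) (ℚ.+-identityʳ A) (ℚ.+-monoʳ-≤ A (ℚ.<⇒≤ 0<B))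
  B≤M : B ≤ M
  B≤M = subst (_≤ M) (ℚ.+-identityˡ B) (ℚ.+-monoˡ-≤ B (ℚ.<⇒≤ 0<A))
  δ = ℚ.1/ M ℚ.* (½ ℚ.* ε)
  0<δ : 0ℚ < δ
  0<δ = subst (_< δ) (ℚ.*-zeroʳ (ℚ.1/ M)) (ℚ.*-monoʳ-<-pos (ℚ.1/ M) (halve-pos 0<ε))
  Mδ : M ℚ.* δ ≡ ½ ℚ.* ε
  Mδ = trans (sym (ℚ.*-assoc M (ℚ.1/ M) (½ ℚ.* ε)))
         (trans (cong (ℚ._* (½ ℚ.* ε)) (ℚ.*-inverseʳ M)) (ℚ.*-identityˡ (½ ℚ.* ε)))
  Ns = proj₁ (cs δ 0<δ)
  Nt = proj₁ (ct δ 0<δ)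
  K  = (NA ℕ.⊔ NB) ℕ.⊔ (Ns ℕ.⊔ Nt)
  small : ∀ a d → ∣ a ∣ ≤ M → ∣ d ∣ < δ → ∣ a ℚ.* d ∣ < ½ ℚ.* ε
  small a d a≤ d< = begin-strict
    ∣ a ℚ.* d ∣        ≡⟨ ℚ.∣p*q∣≡∣p∣*∣q∣ a d ⟩
    ∣ a ∣ ℚ.* ∣ d ∣    ≤⟨ ℚ.*-monoʳ-≤-nonNeg ∣ d ∣ {{ℚ.∣-∣-nonNeg d}} a≤ ⟩
    M ℚ.* ∣ d ∣        <⟨ ℚ.*-monoʳ-<-pos M d< ⟩
    M ℚ.* δ            ≡⟨ Mδ ⟩
    ½ ℚ.* ε            ∎
    where open ℚ.≤-Reasoning
  regroup : ∀ a b c d → a ℚ.* b ℚ.- c ℚ.* d ≡ a ℚ.* (b ℚ.- d) ℚ.+ d ℚ.* (a ℚ.- c)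
  regroup = solve 4 (λ a b c d → a :* b :- c :* d := a :* (b :- d) :+ d :* (a :- c)) refl
    where open +-*-Solver
  bound : ∀ m n → K ℕ.≤ m → K ℕ.≤ n → ∣ s m ℚ.* t m ℚ.- s n ℚ.* t n ∣ < ε
  bound m n ≤m ≤n = begin-strict
    ∣ s m ℚ.* t m ℚ.- s n ℚ.* t n ∣
      ≡⟨ cong ∣_∣ (regroup (s m) (t m) (s n) (t n)) ⟩
    ∣ s m ℚ.* (t m ℚ.- t n) ℚ.+ t n ℚ.* (s m ℚ.- s n) ∣
      ≤⟨ ℚ.∣p+q∣≤∣p∣+∣q∣ (s m ℚ.* (t m ℚ.- t n)) (t n ℚ.* (s m ℚ.- s n)) ⟩
    ∣ s m ℚ.* (t m ℚ.- t n) ∣ ℚ.+ ∣ t n ℚ.* (s m ℚ.- s n) ∣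
      <⟨ ℚ.+-mono-<
           (small (s m) (t m ℚ.- t n)
             (ℚ.≤-trans (proj₂ (proj₂ (proj₂ (cauchy-bounded s cs))) m (ℕ.m⊔n≤o⇒m≤o NA NB (left ≤m))) A≤M)
             (proj₂ (ct δ 0<δ) m n (ℕ.m⊔n≤o⇒n≤o Ns Nt (right ≤m)) (ℕ.m⊔n≤o⇒n≤o Ns Nt (right ≤n))))
           (small (t n) (s m ℚ.- s n)
             (ℚ.≤-trans (proj₂ (proj₂ (proj₂ (cauchy-bounded t ct))) n (ℕ.m⊔n≤o⇒n≤o NA NB (left ≤n))) B≤M)
             (proj₂ (cs δ 0<δ) m n (ℕ.m⊔n≤o⇒m≤o Ns Nt (right ≤m)) (ℕ.m⊔n≤o⇒m≤o Ns Nt (right ≤n)))) ⟩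
    ½ ℚ.* ε ℚ.+ ½ ℚ.* ε
      ≡⟨ halves ε ⟩
    ε ∎
    where
    open ℚ.≤-Reasoning
    left : ∀ {o} → K ℕ.≤ o → NA ℕ.⊔ NB ℕ.≤ o
    left = ℕ.m⊔n≤o⇒m≤o (NA ℕ.⊔ NB) (Ns ℕ.⊔ Nt)
    right : ∀ {o} → K ℕ.≤ o → Ns ℕ.⊔ Nt ℕ.≤ o
    right = ℕ.m⊔n≤o⇒n≤o (NA ℕ.⊔ NB) (Ns ℕ.⊔ Nt)

fromℚ : ℚ → ℝ
fromℚ q = mkℝ (λ _ → q) (cauchy-const q)

0ℝ : ℝ
0ℝ = fromℚ 0ℚ

infixl 6 _+_ _-_
infixl 7 _*_

_+_ : ℝ → ℝ → ℝ
x + y = mkℝ (λ n → seq x n ℚ.+ seq y n) (cauchy-+ (seq x) (seq y) (cauchy x) (cauchy y))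

_*_ : ℝ → ℝ → ℝ
x * y = mkℝ (λ n → seq x n ℚ.* seq y n) (cauchy-* (seq x) (seq y) (cauchy x) (cauchy y))

_-_ : ℝ → ℝ → ℝ
x - y = mkℝ (λ n → seq x n ℚ.- seq y n) (cauchy-+ (seq x) (ℚ.-_ ∘ seq y) (cauchy x) (cauchy-neg (seq y) (cauchy y)))

infix 5 ∑
∑ : {A : Set} → List A → (A → ℝ) → ℝ
∑ xs f = foldr (λ a s → f a + s) 0ℝ xs

syntax ∑ xs (λ a → e) = ∑[ a ∈ xs ] e

------------------------------------------------------------------------
-- Indices and truncated multiple harmonic sums

infix 9 1+_
data ℕ⁺ : Set where
  1+_ : ℕ → ℕ⁺

val : ℕ⁺ → ℕ
val (1+ n) = suc n

infixl 6 _⊕_ _⊕⁺_ _⊖_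

_⊕_ : ℕ⁺ → ℕ → ℕ⁺
(1+ m) ⊕ n = 1+ (m ℕ.+ n)

_⊕⁺_ : ℕ⁺ → ℕ⁺ → ℕ⁺
k ⊕⁺ l = k ⊕ val l

-- Truncated at 1; only ever applied with n < k.
_⊖_ : ℕ⁺ → ℕ → ℕ⁺
(1+ m) ⊖ n = 1+ (m ℕ.∸ n)

Index : Set
Index = List ℕ⁺

data Admissible : Index → Set where
  empty : Admissible []
  last≥2 : ∀ k l → 2 ℕ.≤ val l → Admissible (k ∷ʳ l)

∑< : ℕ → (ℕ → ℚ) → ℚ
∑< zero    f = 0ℚ
∑< (suc n) f = ∑< n f ℚ.+ f n

-- The argument is the index read from right to left, so that the head is
-- the exponent of the largest summation variable, here n + 1 ≤ N.
ζʳ≤ : Index → ℕ → ℚ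
ζʳ≤ []       N = 1ℚ
ζʳ≤ (k ∷ ks) N = ∑< N (λ n → ζʳ≤ ks n ℚ.* (+ 1 / suc n) ^ val k)

-- ζ≤ k N = ∑_{1 ≤ n₁ < ⋯ < nᵣ ≤ N} n₁^{-k₁} ⋯ nᵣ^{-kᵣ}
ζ≤ : Index → ℕ → ℚ
ζ≤ k = ζʳ≤ (reverse k)

------------------------------------------------------------------------
-- Convergence for admissible indices

module Convergence where

  u : ℕ → ℚ
  u n = + 1 / suc n

  *-nonneg : ∀ {p q} → 0ℚ ≤ p → 0ℚ ≤ q → 0ℚ ≤ p ℚ.* q
  *-nonneg {p} {q} 0≤p 0≤q =
    ℚ.nonNegative⁻¹ (p ℚ.* q)
      {{ℚ.nonNeg*nonNeg⇒nonNeg p {{ℚ.nonNegative 0≤p}} q {{ℚ.nonNegative 0≤q}}}}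

  *-mono-nonneg : ∀ {p q r s} → 0ℚ ≤ r → 0ℚ ≤ q → p ≤ q → r ≤ s → p ℚ.* r ≤ q ℚ.* s
  *-mono-nonneg {p} {q} {r} {s} 0≤r 0≤q p≤q r≤s =
    ℚ.≤-trans (ℚ.*-monoʳ-≤-nonNeg r {{ℚ.nonNegative 0≤r}} p≤q)
              (ℚ.*-monoˡ-≤-nonNeg q {{ℚ.nonNegative 0≤q}} r≤s)

  ≤-+ʳ : ∀ {p q} → 0ℚ ≤ q → p ≤ p ℚ.+ q
  ≤-+ʳ {p} {q} 0≤q = subst (_≤ p ℚ.+ q) (ℚ.+-identityʳ p) (ℚ.+-monoʳ-≤ p 0≤q)

  ∑<-mono : ∀ {f g} → (∀ n → f n ≤ g n) → ∀ N → ∑< N f ≤ ∑< N g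
  ∑<-mono f≤g zero    = ℚ.≤-refl
  ∑<-mono f≤g (suc N) = ℚ.+-mono-≤ (∑<-mono f≤g N) (f≤g N)

  ∑<-nonneg : ∀ {f} → (∀ n → 0ℚ ≤ f n) → ∀ N → 0ℚ ≤ ∑< N f
  ∑<-nonneg 0≤f zero    = ℚ.≤-refl
  ∑<-nonneg 0≤f (suc N) = ℚ.+-mono-≤ (∑<-nonneg 0≤f N) (0≤f N)

  u-pos : ∀ n → 0ℚ < u n
  u-pos n = ℚ.positive⁻¹ (u n) {{ℚ.normalize-pos 1 (suc n)}}

  0≤u : ∀ n → 0ℚ ≤ u n
  0≤u n = ℚ.<⇒≤ (u-pos n)

  toℚᵘ-u : ∀ n → ℚ.toℚᵘ (u n) ℚᵘ.≃ ℚᵘ.mkℚᵘ (+ 1) n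
  toℚᵘ-u n = ℚ.toℚᵘ-fromℚᵘ (ℚᵘ.mkℚᵘ (+ 1) n)

  u-step : ∀ n → u n ≡ u (suc n) ℚ.+ u n ℚ.* u (suc n)
  u-step n = ℚ.toℚᵘ-injective (begin
    ℚ.toℚᵘ (u n)
      ≈⟨ toℚᵘ-u n ⟩
    a
      ≈⟨ ℚᵘ.*≡* (cong +_ (arith n)) ⟩
    b ℚᵘ.+ a ℚᵘ.* b
      ≈⟨ ℚᵘ.+-cong (toℚᵘ-u (suc n)) (ℚᵘ.*-cong (toℚᵘ-u n) (toℚᵘ-u (suc n))) ⟨
    ℚ.toℚᵘ (u (suc n)) ℚᵘ.+ ℚ.toℚᵘ (u n) ℚᵘ.* ℚ.toℚᵘ (u (suc n))
      ≈⟨ ℚᵘ.+-congʳ (ℚ.toℚᵘ (u (suc n))) (ℚ.toℚᵘ-homo-* (u n) (u (suc n))) ⟨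
    ℚ.toℚᵘ (u (suc n)) ℚᵘ.+ ℚ.toℚᵘ (u n ℚ.* u (suc n))
      ≈⟨ ℚ.toℚᵘ-homo-+ (u (suc n)) (u n ℚ.* u (suc n)) ⟨
    ℚ.toℚᵘ (u (suc n) ℚ.+ u n ℚ.* u (suc n)) ∎)
    where
    open ℚᵘ.≃-Reasoning
    a = ℚᵘ.mkℚᵘ (+ 1) n
    b = ℚᵘ.mkℚᵘ (+ 1) (suc n)
    arith : ∀ n → 1 ℕ.* (suc (suc n) ℕ.* (suc n ℕ.* suc (suc n)))
                ≡ (1 ℕ.* (suc n ℕ.* suc (suc n)) ℕ.+ 1 ℕ.* suc (suc n)) ℕ.* suc n
    arith = solve 1 (λ n → con 1 :* ((con 2 :+ n) :* ((con 1 :+ n) :* (con 2 :+ n)))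
                        := (con 1 :* ((con 1 :+ n) :* (con 2 :+ n)) :+ con 1 :* (con 2 :+ n)) :* (con 1 :+ n)) refl
      where open ℕSolver

  u-anti : ∀ n → u (suc n) ≤ u n
  u-anti n = subst (u (suc n) ≤_) (sym (u-step n)) (≤-+ʳ (*-nonneg (0≤u n) (0≤u (suc n))))

  u≤1 : ∀ n → u n ≤ 1ℚ
  u≤1 zero    = ℚ.≤-refl
  u≤1 (suc n) = ℚ.≤-trans (u-anti n) (u≤1 n)

  u≤2u : ∀ n → u n ≤ u (suc n) ℚ.+ u (suc n)
  u≤2u n = begin
    u n                              ≡⟨ u-step n ⟩
    u (suc n) ℚ.+ u n ℚ.* u (suc n)  ≤⟨ ℚ.+-monoʳ-≤ (u (suc n))
                                          (*-mono-nonneg (0≤u (suc n)) (ℚ.<⇒≤ (ℚ.positive⁻¹ 1ℚ)) (u≤1 n) ℚ.≤-refl) ⟩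
    u (suc n) ℚ.+ 1ℚ ℚ.* u (suc n)   ≡⟨ cong (u (suc n) ℚ.+_) (ℚ.*-identityˡ (u (suc n))) ⟩
    u (suc n) ℚ.+ u (suc n)          ∎
    where open ℚ.≤-Reasoning

  Vanishing : (ℕ → ℚ) → Set
  Vanishing s = ∀ δ → 0ℚ < δ → ∃ λ M → ∀ n → M ℕ.≤ n → s n ≤ δ

  u-vanishing : Vanishing u
  u-vanishing δ 0<δ = go δ {{ℚ.positive 0<δ}}
    where
    go : ∀ δ {{_ : ℚ.Positive δ}} → ∃ λ M → ∀ n → M ℕ.≤ n → u n ≤ δ
    go δ@(ℚ.mkℚ (+ suc p) q _) = q , λ n q≤n → ℚ.toℚᵘ-cancel-≤
      (ℚᵘ.≤-respˡ-≃ (ℚᵘ.≃-sym (toℚᵘ-u n)) (ℚᵘ.*≤* (ℤ.+≤+ (bound n q≤n))))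
      where
      bound : ∀ n → q ℕ.≤ n → 1 ℕ.* suc q ℕ.≤ suc p ℕ.* suc n
      bound n q≤n = ℕ.*-mono-≤ {1} {suc p} (ℕ.s≤s ℕ.z≤n) (ℕ.s≤s q≤n)

  vanishing-+ : ∀ {s t} → Vanishing s → Vanishing t → Vanishing (λ n → s n ℚ.+ t n)
  vanishing-+ {s} {t} vs vt δ 0<δ = M ℕ.⊔ N , λ n ≤n →
    subst (s n ℚ.+ t n ≤_) (halves δ)
      (ℚ.+-mono-≤ (proj₂ (vs _ (halve-pos 0<δ)) n (ℕ.m⊔n≤o⇒m≤o M N ≤n))
                  (proj₂ (vt _ (halve-pos 0<δ)) n (ℕ.m⊔n≤o⇒n≤o M N ≤n)))
    where
    M = proj₁ (vs _ (halve-pos 0<δ))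
    N = proj₁ (vt _ (halve-pos 0<δ))

  vanishing-scale : ∀ {s} C → 0ℚ ≤ C → (∀ n → 0ℚ ≤ s n) → Vanishing s → Vanishing (λ n → C ℚ.* s n)
  vanishing-scale {s} C 0≤C 0≤s vs δ 0<δ = proj₁ (vs δ′ 0<δ′) , bound
    where
    D = 1ℚ ℚ.+ C
    instance
      D-pos : ℚ.Positive D
      D-pos = ℚ.positive (ℚ.+-mono-<-≤ (ℚ.positive⁻¹ 1ℚ) 0≤C)
      D-nonZero : ℚ.NonZero D
      D-nonZero = ℚ.pos⇒nonZero D
      D⁻¹-pos : ℚ.Positive (ℚ.1/ D)
      D⁻¹-pos = ℚ.1/pos⇒pos D
    δ′ = ℚ.1/ D ℚ.* δ
    0<δ′ : 0ℚ < δ′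
    0<δ′ = subst (_< δ′) (ℚ.*-zeroʳ (ℚ.1/ D)) (ℚ.*-monoʳ-<-pos (ℚ.1/ D) 0<δ)
    Dδ′ : D ℚ.* δ′ ≡ δ
    Dδ′ = trans (sym (ℚ.*-assoc D (ℚ.1/ D) δ))
            (trans (cong (ℚ._* δ) (ℚ.*-inverseʳ D)) (ℚ.*-identityˡ δ))
    C≤D : C ≤ D
    C≤D = subst (C ≤_) (ℚ.+-comm C 1ℚ) (≤-+ʳ (ℚ.<⇒≤ (ℚ.positive⁻¹ 1ℚ)))
    bound : ∀ n → proj₁ (vs δ′ 0<δ′) ℕ.≤ n → C ℚ.* s n ≤ δ
    bound n ≤n = subst (C ℚ.* s n ≤_) Dδ′
      (*-mono-nonneg (0≤s n) (ℚ.<⇒≤ (ℚ.positive⁻¹ D)) C≤D (proj₂ (vs δ′ 0<δ′) n ≤n))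

  -- Cesàro: the averages of a vanishing sequence vanish.
  vanishing-mean : ∀ {a} → (∀ n → 0ℚ ≤ a n) → Vanishing a → Vanishing (λ n → ∑< n a ℚ.* u n)
  vanishing-mean {a} 0≤a va δ 0<δ = M ℕ.⊔ L , bound
    where
    η = ½ ℚ.* δ
    0<η = halve-pos 0<δ
    M = proj₁ (va η 0<η)
    C = ∑< M a
    0≤C = ∑<-nonneg 0≤a M
    vu = vanishing-scale C 0≤C 0≤u u-vanishing η 0<η
    L = proj₁ vu
    open ℚ.≤-Reasoning
    step : ∀ S w v b → w ≡ v ℚ.+ w ℚ.* v → 0ℚ ≤ v → v ≤ 1ℚ →
           S ℚ.* w ≤ C ℚ.* w ℚ.+ η → b ≤ η →
           (S ℚ.+ b) ℚ.* v ≤ C ℚ.* v ℚ.+ η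
    step S w v b w≡ 0≤v v≤1 ih b≤η = begin
      (S ℚ.+ b) ℚ.* v
        ≡⟨ ℚ.*-distribʳ-+ v S b ⟩
      S ℚ.* v ℚ.+ b ℚ.* v
        ≡⟨ cong (λ z → S ℚ.* z ℚ.+ b ℚ.* v) v≡ ⟩
      S ℚ.* (w ℚ.* (1ℚ ℚ.- v)) ℚ.+ b ℚ.* v
        ≡⟨ cong (ℚ._+ b ℚ.* v) (sym (ℚ.*-assoc S w (1ℚ ℚ.- v))) ⟩
      S ℚ.* w ℚ.* (1ℚ ℚ.- v) ℚ.+ b ℚ.* v
        ≤⟨ ℚ.+-mono-≤ (ℚ.*-monoʳ-≤-nonNeg (1ℚ ℚ.- v) {{ℚ.nonNegative 0≤1-v}} ih)
                      (ℚ.*-monoʳ-≤-nonNeg v {{ℚ.nonNegative 0≤v}} b≤η) ⟩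
      (C ℚ.* w ℚ.+ η) ℚ.* (1ℚ ℚ.- v) ℚ.+ η ℚ.* v
        ≡⟨ regroup C w v η ⟩
      C ℚ.* (w ℚ.* (1ℚ ℚ.- v)) ℚ.+ η
        ≡⟨ cong (λ z → C ℚ.* z ℚ.+ η) (sym v≡) ⟩
      C ℚ.* v ℚ.+ η ∎
      where
      open +-*-Solver
      0≤1-v : 0ℚ ≤ 1ℚ ℚ.- v
      0≤1-v = subst (_≤ 1ℚ ℚ.- v) (ℚ.+-inverseʳ v) (ℚ.+-monoˡ-≤ (ℚ.- v) v≤1)
      v≡ : v ≡ w ℚ.* (1ℚ ℚ.- v)
      v≡ = trans (solve 2 (λ v w → v := (v :+ w :* v) :- w :* v) refl v w)
             (trans (cong (ℚ._- w ℚ.* v) (sym w≡))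
               (solve 2 (λ v w → w :- w :* v := w :* (con 1ℚ :- v)) refl v w))
      regroup : ∀ C w v η → (C ℚ.* w ℚ.+ η) ℚ.* (1ℚ ℚ.- v) ℚ.+ η ℚ.* v ≡ C ℚ.* (w ℚ.* (1ℚ ℚ.- v)) ℚ.+ η
      regroup = solve 4 (λ C w v η → (C :* w :+ η) :* (con 1ℚ :- v) :+ η :* v := C :* (w :* (con 1ℚ :- v)) :+ η) refl
    from-M : ∀ p → ∑< (p ℕ.+ M) a ℚ.* u (p ℕ.+ M) ≤ C ℚ.* u (p ℕ.+ M) ℚ.+ η
    from-M zero    = ≤-+ʳ (ℚ.<⇒≤ 0<η)
    from-M (suc p) = step (∑< (p ℕ.+ M) a) (u (p ℕ.+ M)) (u (suc p ℕ.+ M)) (a (p ℕ.+ M))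
      (u-step (p ℕ.+ M)) (0≤u (suc p ℕ.+ M)) (u≤1 (suc p ℕ.+ M)) (from-M p)
      (proj₂ (va η 0<η) (p ℕ.+ M) (ℕ.m≤n+m M p))
    bound : ∀ n → M ℕ.⊔ L ℕ.≤ n → ∑< n a ℚ.* u n ≤ δ
    bound n ≤n = begin
      ∑< n a ℚ.* u n     ≤⟨ subst (λ m → ∑< m a ℚ.* u m ≤ C ℚ.* u m ℚ.+ η)
                                  (ℕ.m∸n+n≡m (ℕ.m⊔n≤o⇒m≤o M L ≤n)) (from-M (n ℕ.∸ M)) ⟩
      C ℚ.* u n ℚ.+ η    ≤⟨ ℚ.+-monoˡ-≤ η (proj₂ vu n (ℕ.m⊔n≤o⇒n≤o M L ≤n)) ⟩
      η ℚ.+ η            ≡⟨ halves δ ⟩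
      δ                  ∎

  pow-nonneg : ∀ n a → 0ℚ ≤ u n ^ a
  pow-nonneg n zero    = ℚ.<⇒≤ (ℚ.positive⁻¹ 1ℚ)
  pow-nonneg n (suc a) = *-nonneg (0≤u n) (pow-nonneg n a)

  pow≤1 : ∀ n a → u n ^ a ≤ 1ℚ
  pow≤1 n zero    = ℚ.≤-refl
  pow≤1 n (suc a) = *-mono-nonneg (pow-nonneg n a) (ℚ.<⇒≤ (ℚ.positive⁻¹ 1ℚ)) (u≤1 n) (pow≤1 n a)

  pow≤u : ∀ n a → u n ^ suc a ≤ u n
  pow≤u n a = subst (u n ^ suc a ≤_) (ℚ.*-identityʳ (u n))
                (*-mono-nonneg (pow-nonneg n a) (0≤u n) ℚ.≤-refl (pow≤1 n a))

  ζʳ≤-nonneg : ∀ ks N → 0ℚ ≤ ζʳ≤ ks N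
  ζʳ≤-nonneg []       N = ℚ.<⇒≤ (ℚ.positive⁻¹ 1ℚ)
  ζʳ≤-nonneg (k ∷ ks) N = ∑<-nonneg (λ n → *-nonneg (ζʳ≤-nonneg ks n) (pow-nonneg n (val k))) N

  e : ℕ → ℕ → ℚ
  e zero    N = 1ℚ
  e (suc s) N = ∑< N (λ n → e s n ℚ.* u n)

  e-nonneg : ∀ s N → 0ℚ ≤ e s N
  e-nonneg zero    N = ℚ.<⇒≤ (ℚ.positive⁻¹ 1ℚ)
  e-nonneg (suc s) N = ∑<-nonneg (λ n → *-nonneg (e-nonneg s n) (0≤u n)) N

  ζʳ≤-bound : ∀ ks N → ζʳ≤ ks N ≤ e (length ks) N
  ζʳ≤-bound []              N = ℚ.≤-refl
  ζʳ≤-bound ((1+ a) ∷ ks) N = ∑<-mono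
    (λ n → *-mono-nonneg (pow-nonneg n (suc a)) (e-nonneg (length ks) n) (ζʳ≤-bound ks n) (pow≤u n a)) N

  e-vanishing : ∀ s → Vanishing (λ n → e s n ℚ.* u n)
  e-vanishing zero δ 0<δ = proj₁ (u-vanishing δ 0<δ) , λ n ≤n →
    subst (_≤ δ) (sym (ℚ.*-identityˡ (u n))) (proj₂ (u-vanishing δ 0<δ) n ≤n)
  e-vanishing (suc s) = vanishing-mean (λ n → *-nonneg (e-nonneg s n) (0≤u n)) (e-vanishing s)

  g : ℕ → ℕ → ℚ
  g zero    n = e zero n ℚ.* u n
  g (suc s) n = g s n ℚ.+ e (suc s) n ℚ.* u n

  g-nonneg : ∀ s n → 0ℚ ≤ g s n
  g-nonneg zero    n = *-nonneg (e-nonneg zero n) (0≤u n)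
  g-nonneg (suc s) n = ℚ.+-mono-≤ (g-nonneg s n) (*-nonneg (e-nonneg (suc s) n) (0≤u n))

  g-vanishing : ∀ s → Vanishing (g s)
  g-vanishing zero    = e-vanishing zero
  g-vanishing (suc s) = vanishing-+ (g-vanishing s) (e-vanishing (suc s))

  g-step : ∀ s n → g s n ≡ g s (suc n) ℚ.+ e s n ℚ.* (u n ℚ.* u (suc n))
  g-step zero n = trans (cong (1ℚ ℚ.*_) (u-step n)) (ℚ.*-distribˡ-+ 1ℚ (u (suc n)) (u n ℚ.* u (suc n)))
  g-step (suc s) n = trans (cong₂ ℚ._+_ (g-step s n) (cong (e (suc s) n ℚ.*_) (u-step n)))
    (solve 5 (λ G E F w v → (G :+ E :* (w :* v)) :+ F :* (v :+ w :* v)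
                         := (G :+ (F :+ E :* w) :* v) :+ F :* (w :* v)) refl
       (g s (suc n)) (e s n) (e (suc s) n) (u n) (u (suc n)))
    where open +-*-Solver

  monotone-cauchy : ∀ s (t : ℕ → ℚ) → (∀ n → s n ≤ s (suc n)) →
                    (∀ n → s (suc n) ℚ.+ t (suc n) ≤ s n ℚ.+ t n) →
                    (∀ n → 0ℚ ≤ t n) → Vanishing t → IsCauchy s
  monotone-cauchy s t s↑ s+t↓ 0≤t vt ε 0<ε = N , bound
    where
    η = ½ ℚ.* ε
    0<η = halve-pos 0<ε
    N = proj₁ (vt η 0<η)
    η<ε : η < ε
    η<ε = subst₂ _<_ (ℚ.+-identityʳ η) (halves ε) (ℚ.+-monoʳ-< η 0<η)
    up : ∀ p n → s n ≤ s (p ℕ.+ n)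
    up zero    n = ℚ.≤-refl
    up (suc p) n = ℚ.≤-trans (up p n) (s↑ (p ℕ.+ n))
    down : ∀ p n → s (p ℕ.+ n) ℚ.+ t (p ℕ.+ n) ≤ s n ℚ.+ t n
    down zero    n = ℚ.≤-refl
    down (suc p) n = ℚ.≤-trans (s+t↓ (p ℕ.+ n)) (down p n)
    open ℚ.≤-Reasoning
    open +-*-Solver
    ordered : ∀ p n → N ℕ.≤ n → ∣ s (p ℕ.+ n) ℚ.- s n ∣ < ε
    ordered p n N≤n = begin-strict
      ∣ s (p ℕ.+ n) ℚ.- s n ∣
        ≡⟨ ℚ.0≤p⇒∣p∣≡p (subst (_≤ s (p ℕ.+ n) ℚ.- s n) (ℚ.+-inverseʳ (s n)) (ℚ.+-monoˡ-≤ (ℚ.- s n) (up p n))) ⟩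
      s (p ℕ.+ n) ℚ.- s n
        ≤⟨ ℚ.+-monoˡ-≤ (ℚ.- s n) (ℚ.≤-trans (≤-+ʳ {s (p ℕ.+ n)} (0≤t (p ℕ.+ n))) (down p n)) ⟩
      (s n ℚ.+ t n) ℚ.- s n
        ≡⟨ solve 2 (λ a b → (a :+ b) :- a := b) refl (s n) (t n) ⟩
      t n
        ≤⟨ proj₂ (vt η 0<η) n N≤n ⟩
      η
        <⟨ η<ε ⟩
      ε ∎
    ordered′ : ∀ m n → N ℕ.≤ n → n ℕ.≤ m → ∣ s m ℚ.- s n ∣ < ε
    ordered′ m n N≤n n≤m = subst (λ m → ∣ s m ℚ.- s n ∣ < ε) (ℕ.m∸n+n≡m n≤m) (ordered (m ℕ.∸ n) n N≤n)
    bound : ∀ m n → N ℕ.≤ m → N ℕ.≤ n → ∣ s m ℚ.- s n ∣ < ε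
    bound m n N≤m N≤n with ℕ.≤-total n m
    ... | inj₁ n≤m = ordered′ m n N≤n n≤m
    ... | inj₂ m≤n = subst (_< ε)
      (trans (sym (ℚ.∣-p∣≡∣p∣ (s n ℚ.- s m)))
        (cong ∣_∣ (solve 2 (λ a b → :- (a :- b) := b :- a) refl (s n) (s m))))
      (ordered′ n m N≤m m≤n)

  ζʳ≤-cauchy : ∀ l ks → 2 ℕ.≤ val l → IsCauchy (ζʳ≤ (l ∷ ks))
  ζʳ≤-cauchy (1+ suc a) ks _ = monotone-cauchy (ζʳ≤ ((1+ suc a) ∷ ks)) t s↑ s+t↓
    (λ n → ℚ.+-mono-≤ (g-nonneg s n) (g-nonneg s n))
    (vanishing-+ (g-vanishing s) (g-vanishing s))
    where
    s = length ks
    t : ℕ → ℚ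
    t n = g s n ℚ.+ g s n
    term : ℕ → ℚ
    term n = ζʳ≤ ks n ℚ.* u n ^ suc (suc a)
    s↑ : ∀ n → ∑< n term ≤ ∑< (suc n) term
    s↑ n = ≤-+ʳ (*-nonneg (ζʳ≤-nonneg ks n) (pow-nonneg n (suc (suc a))))
    open ℚ.≤-Reasoning
    open +-*-Solver
    term≤ : ∀ n → term n ≤ e s n ℚ.* (u n ℚ.* (u (suc n) ℚ.+ u (suc n)))
    term≤ n = *-mono-nonneg (pow-nonneg n (suc (suc a))) (e-nonneg s n) (ζʳ≤-bound ks n)
      (*-mono-nonneg (pow-nonneg n (suc a)) (0≤u n) ℚ.≤-refl (ℚ.≤-trans (pow≤u n a) (u≤2u n)))
    s+t↓ : ∀ n → ∑< (suc n) term ℚ.+ t (suc n) ≤ ∑< n term ℚ.+ t n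
    s+t↓ n = begin
      (S ℚ.+ term n) ℚ.+ (G ℚ.+ G)
        ≤⟨ ℚ.+-monoˡ-≤ (G ℚ.+ G) (ℚ.+-monoʳ-≤ S (term≤ n)) ⟩
      (S ℚ.+ e s n ℚ.* (u n ℚ.* (u (suc n) ℚ.+ u (suc n)))) ℚ.+ (G ℚ.+ G)
        ≡⟨ solve 5 (λ S E w v G → (S :+ E :* (w :* (v :+ v))) :+ (G :+ G)
                              := S :+ ((G :+ E :* (w :* v)) :+ (G :+ E :* (w :* v)))) refl
             S (e s n) (u n) (u (suc n)) G ⟩
      S ℚ.+ ((G ℚ.+ e s n ℚ.* (u n ℚ.* u (suc n))) ℚ.+ (G ℚ.+ e s n ℚ.* (u n ℚ.* u (suc n))))
        ≡⟨ cong (λ z → S ℚ.+ (z ℚ.+ z)) (sym (g-step s n)) ⟩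
      S ℚ.+ (g s n ℚ.+ g s n) ∎
      where
      S = ∑< n term
      G = g s (suc n)
  ζʳ≤-cauchy (1+ zero) ks (ℕ.s≤s ())

  ζ≤-cauchy : ∀ {k} → Admissible k → IsCauchy (ζ≤ k)
  ζ≤-cauchy empty          = cauchy-const 1ℚ
  ζ≤-cauchy (last≥2 k l 2≤l) =
    subst (λ r → IsCauchy (ζʳ≤ r)) (sym (reverse-++ k (l ∷ []))) (ζʳ≤-cauchy l (reverse k) 2≤l)

ζ : ∀ {k} → Admissible k → ℝ
ζ {k} a = mkℝ (ζ≤ k) (Convergence.ζ≤-cauchy a)

------------------------------------------------------------------------
-- ℚ-linear combinations and the spaces 𝓗⁰ ⊂ 𝓗¹

-- Formal ℚ-linear combinations of elements of A.
Lin : Set → Set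
Lin A = List (ℚ × A)

-- Bilinear extension of a product that sends a pair of basis elements to
-- a sum of basis elements (listed with multiplicity).
bilinear : {A : Set} → (A → A → List A) → Lin A → Lin A → Lin A
bilinear _⋆_ p q = concatMap (λ (c , a) → concatMap (λ (d , b) → map (c ℚ.* d ,_) (a ⋆ b)) q) p

linear : {A : Set} → (A → ℝ) → Lin A → ℝ
linear f p = ∑[ ca ∈ p ] fromℚ (proj₁ ca) * f (proj₂ ca)

-- The words z_k form a basis of 𝓗¹, those with k admissible a basis of 𝓗⁰.
𝓗¹ 𝓗⁰ : Set
𝓗¹ = Lin Index
𝓗⁰ = Lin (∃ Admissible)

Z : 𝓗⁰ → ℝ
Z = linear (λ (_ , a) → ζ a)

_∈𝒵 : ℝ → Set
x ∈𝒵 = ∃ λ (w : 𝓗⁰) → x ≈ Z w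

------------------------------------------------------------------------
-- The harmonic and shuffle products on 𝓗¹

-- Both recursions peel off the last letter; as with ζʳ≤ they are carried
-- out on reversed lists.

harmonicʳ : Index → Index → List Index
harmonicʳ []      l       = l ∷ []
harmonicʳ (a ∷ k) []      = (a ∷ k) ∷ []
harmonicʳ (a ∷ k) (b ∷ l) =
  map (a ∷_) (harmonicʳ k (b ∷ l)) ++
  map (b ∷_) (harmonicʳ (a ∷ k) l) ++
  map (a ⊕⁺ b ∷_) (harmonicʳ k l)

harmonic : Index → Index → List Index
harmonic k l = map reverse (harmonicʳ (reverse k) (reverse l))

data Letter : Set where
  𝔵 𝔶 : Letter

Word : Set
Word = List Letter

shuffleʳ : Word → Word → List Word
shuffleʳ []      v       = v ∷ []
shuffleʳ (a ∷ w) []      = (a ∷ w) ∷ []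
shuffleʳ (a ∷ w) (b ∷ v) =
  map (a ∷_) (shuffleʳ w (b ∷ v)) ++
  map (b ∷_) (shuffleʳ (a ∷ w) v)

shuffleWord : Word → Word → List Word
shuffleWord w v = map reverse (shuffleʳ (reverse w) (reverse v))

z : Index → Word
z = concatMap (λ { (1+ n) → 𝔶 ∷ replicate n 𝔵 })

-- Inverse of z on words that are empty or begin with 𝔶.  A shuffle of two
-- such words is a sum of such words, so the last clause of z⁻¹ is never
-- reached below.
blocks : ℕ → Word → Index
blocks n []      = 1+ n ∷ []
blocks n (𝔵 ∷ w) = blocks (suc n) w
blocks n (𝔶 ∷ w) = 1+ n ∷ blocks 0 w

z⁻¹ : Word → Index
z⁻¹ []      = []
z⁻¹ (𝔶 ∷ w) = blocks 0 w
z⁻¹ (𝔵 ∷ w) = []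

z-z⁻¹ : ∀ w → z (z⁻¹ (𝔶 ∷ w)) ≡ 𝔶 ∷ w
z-z⁻¹ = go 0
  where
  snoc : ∀ n w → replicate n 𝔵 ++ 𝔵 ∷ w ≡ 𝔵 ∷ replicate n 𝔵 ++ w
  snoc zero    w = refl
  snoc (suc n) w = cong (𝔵 ∷_) (snoc n w)
  go : ∀ n w → z (blocks n w) ≡ 𝔶 ∷ replicate n 𝔵 ++ w
  go n []      = refl
  go n (𝔵 ∷ w) = trans (go (suc n) w) (cong (𝔶 ∷_) (sym (snoc n w)))
  go n (𝔶 ∷ w) = cong (λ v → 𝔶 ∷ replicate n 𝔵 ++ v) (go 0 w)

z⁻¹-z : ∀ k → z⁻¹ (z k) ≡ k
z⁻¹-z []             = refl
z⁻¹-z ((1+ n) ∷ k) = trans (go 0 n k) (cong (λ j → 1+ j ∷ k) (ℕ.+-identityʳ n))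
  where
  go : ∀ m n k → blocks m (replicate n 𝔵 ++ z k) ≡ 1+ (n ℕ.+ m) ∷ k
  go m zero    []             = refl
  go m zero    ((1+ n) ∷ k) = cong (1+ m ∷_) (z⁻¹-z ((1+ n) ∷ k))
  go m (suc n) k              = trans (go (suc m) n k) (cong (λ j → 1+ j ∷ k) (ℕ.+-suc n m))

data Product : Set where
  ∗ sh : Product

basisProduct : Product → Index → Index → List Index
basisProduct ∗  k l = harmonic k l
basisProduct sh k l = map z⁻¹ (shuffleWord (z k) (z l))

_⟨_⟩_ : 𝓗¹ → Product → 𝓗¹ → 𝓗¹
p ⟨ • ⟩ q = bilinear (basisProduct •) p q

------------------------------------------------------------------------
-- Polynomials over ℝ and regularization

-- Coefficients from the constant term upwards; trailing zeros are allowed.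
ℝ[T] : Set
ℝ[T] = List ℝ

coeff : ℝ[T] → ℕ → ℝ
coeff []      n       = 0ℝ
coeff (a ∷ p) zero    = a
coeff (a ∷ p) (suc n) = coeff p n

infix 4 _≈ₚ_
_≈ₚ_ : ℝ[T] → ℝ[T] → Set
p ≈ₚ q = ∀ n → coeff p n ≈ coeff q n

infixl 6 _+ₚ_
infixl 7 _*ₚ_ _·ₚ_

_+ₚ_ : ℝ[T] → ℝ[T] → ℝ[T]
[]      +ₚ q       = q
(a ∷ p) +ₚ []      = a ∷ p
(a ∷ p) +ₚ (b ∷ q) = a + b ∷ p +ₚ q

_·ₚ_ : ℝ → ℝ[T] → ℝ[T]
c ·ₚ p = map (c *_) p

_*ₚ_ : ℝ[T] → ℝ[T] → ℝ[T]
[]      *ₚ q = []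
(a ∷ p) *ₚ q = a ·ₚ q +ₚ (0ℝ ∷ p *ₚ q)

const : ℝ → ℝ[T]
const a = a ∷ []

T : ℝ[T]
T = 0ℝ ∷ fromℚ 1ℚ ∷ []

linearₚ : {A : Set} → (A → ℝ[T]) → Lin A → ℝ[T]
linearₚ f = foldr (λ (c , a) s → fromℚ c ·ₚ f a +ₚ s) []

-- A ℚ-linear map 𝓗¹ → ℝ[T] is given by its values Z• k on the basis z_k.
-- The conditions say that it is the ℚ-algebra homomorphism
-- (𝓗¹ , •) → ℝ[T] which extends Z and sends 𝔶 = z_1 to T.
IsRegularization : Product → (Index → ℝ[T]) → Set
IsRegularization • Z• =
  (∀ {k} (a : Admissible k) → Z• k ≈ₚ const (ζ a)) ×
  (Z• (1+ 0 ∷ []) ≈ₚ T) ×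
  (∀ p q → linearₚ Z• (p ⟨ • ⟩ q) ≈ₚ linearₚ Z• p *ₚ linearₚ Z• q)

------------------------------------------------------------------------
-- Power series in t and symmetric multiple zeta values

ℝ[[t]] : Set
ℝ[[t]] = ℕ → ℝ

infixl 6 _+ₜ_
_+ₜ_ : ℝ[[t]] → ℝ[[t]] → ℝ[[t]]
(f +ₜ h) n = f n + h n

infix 5 ∑ₜ ∑∞
∑ₜ : {A : Set} → List A → (A → ℝ[[t]]) → ℝ[[t]]
∑ₜ xs f n = ∑[ a ∈ xs ] f a n

syntax ∑ₜ xs (λ a → f) = ∑ₜ[ a ∈ xs ] f

-- The formal infinite sum ∑_{j ≥ 0} f j · t^j.
∑∞ : (ℕ → ℝ[[t]]) → ℝ[[t]]
∑∞ f n = ∑[ j ∈ upTo (suc n) ] f j (n ℕ.∸ j)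

syntax ∑∞ (λ j → f) = ∑∞[ j ] f ·tʲ

two-admissible : Admissible (1+ 1 ∷ [])
two-admissible = last≥2 [] (1+ 1) ℕ.≤-refl

-- Equality of the classes of f and h in (𝒵/ζ(2)𝒵)[[t]].
infix 4 _≡_[modζ2]
_≡_[modζ2] : ℝ[[t]] → ℝ[[t]] → Set
f ≡ h [modζ2] = ∀ n → ∃ λ c → c ∈𝒵 × f n - h n ≈ ζ two-admissible * c

-- All (l₁ , … , l_m) ∈ ℕ^m with l₁ + ⋯ + l_m = n.
compositions : ℕ → ℕ → List (List ℕ)
compositions zero    zero    = [] ∷ []
compositions zero    (suc n) = []
compositions (suc m) n       = concatMap (λ l → map (l ∷_) (compositions m (n ℕ.∸ l))) (upTo (suc n))

fromℕ : ℕ → ℝ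
fromℕ n = fromℚ (+ n / 1)

module Symmetric (Z• : Index → ℝ[T]) where

  ζ• : Index → ℝ
  ζ• k = coeff (Z• k) 0

  -- The sum over l_{i+1}, …, l_r, for the string s = (k_{i+1}, …, k_r).
  tail-series : Index → ℝ[[t]]
  tail-series s n =
    ∑[ l ∈ compositions (length s) n ]
      fromℕ (product (zipWith (λ k l → (val k ℕ.+ l ℕ.∸ 1) choose l) s l)) * ζ• (reverse (zipWith _⊕_ s l))

  -- Modulo ζ(2)𝒵 this does not depend on the product • regularized by Z•.
  ζŜ : Index → ℝ[[t]]
  ζŜ k n =
    ∑[ i ∈ upTo (suc (length k)) ]
      fromℚ ((ℚ.- 1ℚ) ^ sum (map val (drop i k))) * ζ• (take i k) * tail-series (drop i k) n

-- For i the 0-based position of k_i: (k_{i+1}, …, k_r, k_1, …, k_{i-1}).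
cyclic-rest : (k : Index) → Fin (length k) → Index
cyclic-rest k i = drop (suc (toℕ i)) k ++ take (toℕ i) k

{-# OPTIONS --safe #-}
module Submission where

-- Let S_N(k) be the sum of n₁^{-k₁} ⋯ nᵣ^{-kᵣ} over n₁ ≺ ⋯ ≺ nᵣ in the ordered set 1 ≺ ⋯ ≺ N ≺ t - N ≺ ⋯ ≺ t - 1.
-- Partial fractions, summed over all ways of splitting an exponent, turn the two sides of the formula for S_N into
-- sums over the same chains, weighted by sums of 1/(b - a) that telescope.  This yields the cyclic sum formula for
-- S_N in ℚ[[t]] up to explicit error terms.  They vanish as N → ∞, except for the constant term at k = (1 , … , 1),
-- which lies in ζ(2) 𝒵 because all even zeta values do.
--
-- Cutting n₁ ≺ ⋯ ≺ nᵣ between N and t - N shows that S_N is ζŜ with the truncated sums ζ_N in place of ζ•.  Let ∂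
-- delete an exponent 1 of the largest variable, and vanish on all other indices.  Then ζ_N = P_N(∂) φ_N with φ_N → ζ•,
-- where P_N is exp(t ∑_{n ≤ N} 1/n) for the harmonic and ∏_{n ≤ N} (1 + t/n) for the shuffle regularization, as φ_N
-- annihilates y • w in the limit.  Moving a 1 across the cut changes the sign, so passing from ζ• to ζ_N in ζŜ amounts
-- to inserting P_N(-∂) P_N(∂).  This is 1 for ∗ and comes from ∏ (1 - t²/n²) for sh, so it is 1 modulo ζ(2) 𝒵.

open import Algebra.Bundles using (CommutativeRing)
import Algebra.Definitions.RawSemiring as RawSemiring
import Algebra.Properties.Group as GroupProperties
import Algebra.Properties.Ring as RingProperties
import Algebra.Properties.Semiring.Exp as Exp
import Algebra.Solver.Ring.NaturalCoefficients.Default as SemiringSolver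
open import Data.Empty using (⊥)
open import Data.Fin.Base using (Fin; toℕ) renaming (zero to fzero; suc to fsuc)
import Data.Integer.Base as ℤ
import Data.Integer.Properties as ℤ
open import Data.List.Base
  using (List; []; _∷_; _∷ʳ_; _++_; map; concatMap; reverse; reverseAcc; length; replicate; take; drop; upTo; applyUpTo;
         lookup; tabulate; allFin; zipWith)
open import Data.List.Properties
  using (reverse-++; reverse-involutive; unfold-reverse; ++-assoc; ++-identityʳ; concatMap-++; length-reverse)
open import Data.List.Relation.Unary.All as All using (All; []; _∷_)
import Data.List.Relation.Unary.All.Properties as All
open import Data.List.Relation.Unary.Any using (Any; here; there)
import Data.List.Relation.Unary.Any.Properties as Any
open import Data.Nat.Base as ℕ using (ℕ; zero; suc; _∸_)
open import Data.Nat.Combinatorics using (nCk+nC[k+1]≡[n+1]C[k+1]; k>n⇒nCk≡0) renaming (_C_ to _choose_)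
open import Data.Nat.Induction using (<-rec)
open import Data.Nat.ListAction using (sum; product)
import Data.Nat.Properties as ℕ
open import Data.Product.Base using (∃; _×_; _,_; proj₁; proj₂)
open import Data.Rational.Base as ℚ using (ℚ; 0ℚ; 1ℚ; ½; _/_)
import Data.Rational.Properties as ℚ
open import Data.Rational.Solver using () renaming (module +-*-Solver to ℚSolver)
import Data.Rational.Unnormalised.Base as ℚᵘ
import Data.Rational.Unnormalised.Properties as ℚᵘ
open import Data.Sum.Base using (_⊎_; inj₁; inj₂)
open import Data.Unit.Base using (⊤; tt)
open import Defs hiding (_+_; _*_; _-_; _≈_)
open import Function.Base using (id; _∘_)
open import Level using (0ℓ)
open import Relation.Binary.PropositionalEquality as ≡ using (_≡_)

-- Splitting an exponent k adds a variable to the chain, and telescoping removes it again: with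
-- weight 1/(b - a) it is left either beyond the last variable for the index (k , ks) or before the
-- first variable for (ks , k). These are two rotations of the same index, so it takes the sum over
-- all rotations to compare the two weights pointwise.
--
-- Subtracting t exchanges the two halves of the ordered set up to sign, and this makes the weights
-- of the two sides cancel up to terms near the bound N.
--
-- Truncated sums of non-admissible indices diverge like powers of the harmonic number 𝓗 N, so every
-- estimate has to beat such powers: an error is negligible if it is at most a power of 𝓗 N times
-- 1/N. The formula at the index (2n - 1) has negligible errors, and in it the divergent sum ζ_N(1)
-- has coefficient 0. Hence it proves Euler's theorem on even zeta values, which in turn settles the
-- remaining error at (1 , ... , 1) and the product ∏ (1 - t²/n²).

-- Finite sums in a commutative ring

module Sums
  (R : CommutativeRing 0ℓ 0ℓ)
  (Σ< : ℕ → (ℕ → CommutativeRing.Carrier R) → CommutativeRing.Carrier R)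
  (Σ<-zero : ∀ f → CommutativeRing._≈_ R (Σ< 0 f) (CommutativeRing.0# R))
  (Σ<-suc : ∀ n f → CommutativeRing._≈_ R (Σ< (suc n) f) (CommutativeRing._+_ R (Σ< n f) (f n)))
  where

  open CommutativeRing R
  open import Relation.Binary.Reasoning.Setoid setoid

  +-exchange : ∀ a b c d → (a + b) + (c + d) ≈ (a + c) + (b + d)
  +-exchange = solve 4 (λ a b c d → (a :+ b) :+ (c :+ d) := (a :+ c) :+ (b :+ d)) refl
    where open SemiringSolver commutativeSemiring

  Σ-cong : ∀ n {f g} → (∀ i → i ℕ.< n → f i ≈ g i) → Σ< n f ≈ Σ< n g
  Σ-cong zero    {f} {g} f≈g = trans (Σ<-zero f) (sym (Σ<-zero g))
  Σ-cong (suc n) {f} {g} f≈g = begin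
    Σ< (suc n) f  ≈⟨ Σ<-suc n f ⟩
    Σ< n f + f n  ≈⟨ +-cong (Σ-cong n (λ i i<n → f≈g i (ℕ.m<n⇒m<1+n i<n))) (f≈g n ℕ.≤-refl) ⟩
    Σ< n g + g n  ≈⟨ Σ<-suc n g ⟨
    Σ< (suc n) g  ∎

  Σ-cong′ : ∀ n {f g} → (∀ i → f i ≈ g i) → Σ< n f ≈ Σ< n g
  Σ-cong′ n f≈g = Σ-cong n (λ i _ → f≈g i)

  Σ-0 : ∀ n → Σ< n (λ _ → 0#) ≈ 0#
  Σ-0 zero    = Σ<-zero _
  Σ-0 (suc n) = trans (Σ<-suc n _) (trans (+-identityʳ _) (Σ-0 n))

  Σ-+ : ∀ n f g → Σ< n (λ i → f i + g i) ≈ Σ< n f + Σ< n g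
  Σ-+ zero    f g = trans (Σ<-zero _) (sym (trans (+-cong (Σ<-zero f) (Σ<-zero g)) (+-identityʳ 0#)))
  Σ-+ (suc n) f g = begin
    Σ< (suc n) (λ i → f i + g i)           ≈⟨ Σ<-suc n _ ⟩
    Σ< n (λ i → f i + g i) + (f n + g n)   ≈⟨ +-congʳ (Σ-+ n f g) ⟩
    (Σ< n f + Σ< n g) + (f n + g n)        ≈⟨ +-exchange _ _ _ _ ⟩
    (Σ< n f + f n) + (Σ< n g + g n)        ≈⟨ +-cong (Σ<-suc n f) (Σ<-suc n g) ⟨
    Σ< (suc n) f + Σ< (suc n) g            ∎

  Σ-*ˡ : ∀ n c f → Σ< n (λ i → c * f i) ≈ c * Σ< n f
  Σ-*ˡ zero    c f = trans (Σ<-zero _) (sym (trans (*-congˡ (Σ<-zero f)) (zeroʳ c)))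
  Σ-*ˡ (suc n) c f = begin
    Σ< (suc n) (λ i → c * f i)      ≈⟨ Σ<-suc n _ ⟩
    Σ< n (λ i → c * f i) + c * f n  ≈⟨ +-congʳ (Σ-*ˡ n c f) ⟩
    c * Σ< n f + c * f n            ≈⟨ distribˡ c _ _ ⟨
    c * (Σ< n f + f n)              ≈⟨ *-congˡ (Σ<-suc n f) ⟨
    c * Σ< (suc n) f                ∎

  Σ-*ʳ : ∀ n c f → Σ< n (λ i → f i * c) ≈ Σ< n f * c
  Σ-*ʳ n c f = trans (Σ-cong′ n (λ i → *-comm (f i) c)) (trans (Σ-*ˡ n c f) (*-comm c _))

  Σ-swap : ∀ m n (f : ℕ → ℕ → Carrier) → Σ< m (λ i → Σ< n (f i)) ≈ Σ< n (λ j → Σ< m (λ i → f i j))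
  Σ-swap zero    n f = trans (Σ<-zero _) (sym (trans (Σ-cong′ n (λ _ → Σ<-zero _)) (Σ-0 n)))
  Σ-swap (suc m) n f = begin
    Σ< (suc m) (λ i → Σ< n (f i))                        ≈⟨ Σ<-suc m _ ⟩
    Σ< m (λ i → Σ< n (f i)) + Σ< n (f m)                 ≈⟨ +-congʳ (Σ-swap m n f) ⟩
    Σ< n (λ j → Σ< m (λ i → f i j)) + Σ< n (f m)         ≈⟨ Σ-+ n _ _ ⟨
    Σ< n (λ j → Σ< m (λ i → f i j) + f m j)              ≈⟨ Σ-cong′ n (λ j → Σ<-suc m _) ⟨
    Σ< n (λ j → Σ< (suc m) (λ i → f i j))                ∎

  Σ-split : ∀ m n f → Σ< (m ℕ.+ n) f ≈ Σ< m f + Σ< n (λ i → f (m ℕ.+ i))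
  Σ-split m zero f = begin
    Σ< (m ℕ.+ 0) f                        ≡⟨ ≡.cong (λ k → Σ< k f) (ℕ.+-identityʳ m) ⟩
    Σ< m f                                ≈⟨ +-identityʳ _ ⟨
    Σ< m f + 0#                           ≈⟨ +-congˡ (Σ<-zero _) ⟨
    Σ< m f + Σ< 0 (λ i → f (m ℕ.+ i))     ∎
  Σ-split m (suc n) f = begin
    Σ< (m ℕ.+ suc n) f                                      ≡⟨ ≡.cong (λ k → Σ< k f) (ℕ.+-suc m n) ⟩
    Σ< (suc (m ℕ.+ n)) f                                    ≈⟨ Σ<-suc _ f ⟩
    Σ< (m ℕ.+ n) f + f (m ℕ.+ n)                            ≈⟨ +-congʳ (Σ-split m n f) ⟩
    (Σ< m f + Σ< n (λ i → f (m ℕ.+ i))) + f (m ℕ.+ n)       ≈⟨ +-assoc _ _ _ ⟩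
    Σ< m f + (Σ< n (λ i → f (m ℕ.+ i)) + f (m ℕ.+ n))       ≈⟨ +-congˡ (Σ<-suc n _) ⟨
    Σ< m f + Σ< (suc n) (λ i → f (m ℕ.+ i))                 ∎

  Σ-front : ∀ n f → Σ< (suc n) f ≈ f 0 + Σ< n (λ i → f (suc i))
  Σ-front n f = trans (Σ-split 1 n f)
    (+-congʳ (trans (Σ<-suc 0 f) (trans (+-congʳ (Σ<-zero f)) (+-identityˡ _))))

  -- The last `a` terms appear backwards because they arise from the differences `b - m` of a
  -- variable `m` that ascends.
  Σ-rev : ∀ a b f → a ℕ.≤ b → Σ< (b ℕ.∸ a) f + Σ< a (λ i → f (b ℕ.∸ suc i)) ≈ Σ< b f
  Σ-rev zero    b f _   = trans (+-congˡ (Σ<-zero _)) (+-identityʳ _)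
  Σ-rev (suc a) b f a<b = begin
    Σ< (b ℕ.∸ suc a) f + Σ< (suc a) (λ i → f (b ℕ.∸ suc i))
      ≈⟨ +-congˡ (trans (Σ<-suc a _) (+-comm _ _)) ⟩
    Σ< (b ℕ.∸ suc a) f + (f (b ℕ.∸ suc a) + Σ< a (λ i → f (b ℕ.∸ suc i)))
      ≈⟨ +-assoc _ _ _ ⟨
    (Σ< (b ℕ.∸ suc a) f + f (b ℕ.∸ suc a)) + Σ< a (λ i → f (b ℕ.∸ suc i))
      ≈⟨ +-congʳ (Σ<-suc _ f) ⟨
    Σ< (suc (b ℕ.∸ suc a)) f + Σ< a (λ i → f (b ℕ.∸ suc i))
      ≡⟨ ≡.cong (λ k → Σ< k f + Σ< a (λ i → f (b ℕ.∸ suc i))) (≡.sym (ℕ.+-∸-assoc 1 a<b)) ⟩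
    Σ< (b ℕ.∸ a) f + Σ< a (λ i → f (b ℕ.∸ suc i))
      ≈⟨ Σ-rev a b f (ℕ.<⇒≤ a<b) ⟩
    Σ< b f ∎

  Σ-neg : ∀ n f → Σ< n (λ i → - f i) + Σ< n f ≈ 0#
  Σ-neg n f = trans (sym (Σ-+ n _ _)) (trans (Σ-cong′ n (λ i → -‿inverseˡ (f i))) (Σ-0 n))

  Σ> : ℕ → ℕ → (ℕ → Carrier) → Carrier
  Σ> N a f = Σ< (N ℕ.∸ suc a) (λ i → f (suc a ℕ.+ i))

  Σ>-split : ∀ N a f → a ℕ.< N → Σ< N f ≈ Σ< (suc a) f + Σ> N a f
  Σ>-split N a f a<N = trans (reflexive (≡.cong (λ k → Σ< k f) (≡.sym (ℕ.m+[n∸m]≡n a<N))))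
    (Σ-split (suc a) (N ℕ.∸ suc a) f)

  Σ>-cong : ∀ N a {f g} → (∀ i → a ℕ.< i → i ℕ.< N → f i ≈ g i) → Σ> N a f ≈ Σ> N a g
  Σ>-cong N a f≈g = Σ-cong (N ℕ.∸ suc a) (λ i i< → f≈g (suc a ℕ.+ i) (ℕ.m≤m+n (suc a) i)
    (ℕ.<-≤-trans (ℕ.+-monoʳ-< (suc a) i<) (ℕ.≤-reflexive (ℕ.m+[n∸m]≡n (suc-a≤N i<)))))
    where
    suc-a≤N : ∀ {i} → i ℕ.< N ℕ.∸ suc a → suc a ℕ.≤ N
    suc-a≤N i< = ℕ.≰⇒≥ (λ N≤ → ℕ.<⇒≱ i< (ℕ.≤-trans (ℕ.≤-reflexive (ℕ.m≤n⇒m∸n≡0 N≤)) ℕ.z≤n))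

  Σ>-suc : ∀ N a f → a ℕ.< N → Σ> (suc N) a f ≈ Σ> N a f + f N
  Σ>-suc N a f a<N = begin
    Σ< (suc N ℕ.∸ suc a) (λ i → f (suc a ℕ.+ i))      ≡⟨ ≡.cong (λ k → Σ< k (λ i → f (suc a ℕ.+ i))) (ℕ.+-∸-assoc 1 a<N) ⟩
    Σ< (suc (N ℕ.∸ suc a)) (λ i → f (suc a ℕ.+ i))    ≈⟨ Σ<-suc _ _ ⟩
    Σ> N a f + f (suc a ℕ.+ (N ℕ.∸ suc a))            ≡⟨ ≡.cong (λ k → Σ> N a f + f k) (ℕ.m+[n∸m]≡n a<N) ⟩
    Σ> N a f + f N                                    ∎

  Σ>-last : ∀ N f → Σ> (suc N) N f ≈ 0#
  Σ>-last N f = trans (reflexive (≡.cong (λ k → Σ< k (λ i → f (suc N ℕ.+ i))) (ℕ.n∸n≡0 N))) (Σ<-zero _)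

  Σ-triangle : ∀ N (F : ℕ → ℕ → Carrier) →
    Σ< N (λ a → Σ> N a (F a)) ≈ Σ< N (λ b → Σ< b (λ a → F a b))
  Σ-triangle zero    F = trans (Σ<-zero _) (sym (Σ<-zero _))
  Σ-triangle (suc N) F = begin
    Σ< (suc N) (λ a → Σ> (suc N) a (F a))                               ≈⟨ Σ<-suc N _ ⟩
    Σ< N (λ a → Σ> (suc N) a (F a)) + Σ> (suc N) N (F N)                ≈⟨ +-cong (Σ-cong N (λ a → Σ>-suc N a (F a))) (Σ>-last N (F N)) ⟩
    Σ< N (λ a → Σ> N a (F a) + F a N) + 0#                              ≈⟨ +-identityʳ _ ⟩
    Σ< N (λ a → Σ> N a (F a) + F a N)                                   ≈⟨ Σ-+ N _ _ ⟩
    Σ< N (λ a → Σ> N a (F a)) + Σ< N (λ a → F a N)                      ≈⟨ +-congʳ (Σ-triangle N F) ⟩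
    Σ< N (λ b → Σ< b (λ a → F a b)) + Σ< N (λ a → F a N)                ≈⟨ Σ<-suc N _ ⟨
    Σ< (suc N) (λ b → Σ< b (λ a → F a b))                               ∎

-- Sums over chains in the two-sided ordered set

-- pos a and neg a stand for the values a + 1 and t - (a + 1) of a summation variable.
data Place : Set where
  pos neg : ℕ → Place

infix 4 _≺_
_≺_ : Place → Place → Set
pos a ≺ pos b = a ℕ.< b
pos a ≺ neg b = ⊤
neg a ≺ pos b = ⊥
neg a ≺ neg b = b ℕ.< a

≺-trans : ∀ a b c → a ≺ b → b ≺ c → a ≺ c
≺-trans (pos _) (pos _) (pos _) p q = ℕ.<-trans p q
≺-trans (pos _) (pos _) (neg _) p q = tt
≺-trans (pos _) (neg _) (neg _) p q = tt
≺-trans (neg _) (neg _) (neg _) p q = ℕ.<-trans q p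

∣_∣ₚ : Place → ℕ
∣ pos a ∣ₚ = a
∣ neg a ∣ₚ = a

-- `ι a`, `h a` and `s a` stand for a + 1, 1/(a + 1) and 1/(a + 1 - t). The equations between them
-- are imposed in `CyclicSum`; here the sums are only rearranged.
module Cyclic
  (R : CommutativeRing 0ℓ 0ℓ)
  (ι h s : ℕ → CommutativeRing.Carrier R)
  (t : CommutativeRing.Carrier R)
  (N : ℕ)
  where

  open CommutativeRing R
  open Exp semiring using (_^_; ^-homo-*)
  open import Relation.Binary.Reasoning.Setoid setoid

  Σ< : ℕ → (ℕ → Carrier) → Carrier
  Σ< zero    f = 0#
  Σ< (suc n) f = Σ< n f + f n

  open Sums R Σ< (λ _ → refl) (λ _ _ → refl) public

  Series : Set
  Series = Place → Carrier

  opaque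
    ΣP : Series → Carrier
    ΣP g = Σ< N (λ a → g (pos a)) + Σ< N (λ a → g (neg a))

    ΣP-def : ∀ g → ΣP g ≈ Σ< N (λ a → g (pos a)) + Σ< N (λ a → g (neg a))
    ΣP-def g = refl

  -- Sums over the places above and below a given one. On the `neg` half the order is reversed,
  -- hence the exchanged ranges. Thus `op ks g a` runs over the chains that ascend from `a`, with
  -- `g` evaluated at their last place.
  U L : Series → Series
  U g (pos a) = Σ> N a (λ b → g (pos b)) + Σ< N (λ b → g (neg b))
  U g (neg a) = Σ< a (λ b → g (neg b))
  L g (pos a) = Σ< a (λ b → g (pos b))
  L g (neg a) = Σ< N (λ b → g (pos b)) + Σ> N a (λ b → g (neg b))

  f : Series
  f (pos a) = h a
  f (neg a) = - s a

  op : Index → Series → Series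
  op []       g = g
  op (k ∷ ks) g = U (λ b → f b ^ val k * op ks g b)

  𝟙 : Series
  𝟙 _ = 1#

  -- The truncated sum over n₁ ≺ ⋯ ≺ nᵣ whose limit is the symmetric multiple zeta value.
  S : Index → Carrier
  S []       = 1#
  S (k ∷ ks) = ΣP (λ a → f a ^ val k * op ks 𝟙 a)

  -- The same sum weighted by a function of the first and the last variable.
  CE : Index → (Place → Series) → Carrier
  CE []       g = 0#
  CE (k ∷ ks) g = ΣP (λ a → f a ^ val k * op ks (g a) a)

  opaque
    unfolding ΣP

    ΣP-cong : ∀ {g g′} → (∀ a → ∣ a ∣ₚ ℕ.< N → g a ≈ g′ a) → ΣP g ≈ ΣP g′
    ΣP-cong e = +-cong (Σ-cong N (λ a → e (pos a))) (Σ-cong N (λ a → e (neg a)))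

    ΣP-cong′ : ∀ {g g′} → (∀ a → g a ≈ g′ a) → ΣP g ≈ ΣP g′
    ΣP-cong′ e = ΣP-cong (λ a _ → e a)

    ΣP-+ : ∀ g g′ → ΣP (λ a → g a + g′ a) ≈ ΣP g + ΣP g′
    ΣP-+ g g′ = trans (+-cong (Σ-+ N _ _) (Σ-+ N _ _)) (+-exchange _ _ _ _)

    ΣP-Σ : ∀ m (g : ℕ → Series) → ΣP (λ a → Σ< m (λ i → g i a)) ≈ Σ< m (λ i → ΣP (g i))
    ΣP-Σ m g = trans (+-cong (Σ-swap N m _) (Σ-swap N m _)) (sym (Σ-+ m _ _))

    ΣP-*ˡ : ∀ c g → ΣP (λ a → c * g a) ≈ c * ΣP g
    ΣP-*ˡ c g = trans (+-cong (Σ-*ˡ N c _) (Σ-*ˡ N c _)) (sym (distribˡ c _ _))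

  U-cong : ∀ a {g g′} → ∣ a ∣ₚ ℕ.< N → (∀ b → a ≺ b → ∣ b ∣ₚ ℕ.< N → g b ≈ g′ b) → U g a ≈ U g′ a
  U-cong (pos a) a<N e = +-cong (Σ>-cong N a (λ b a<b b<N → e (pos b) a<b b<N)) (Σ-cong N (λ b → e (neg b) tt))
  U-cong (neg a) a<N e = Σ-cong a (λ b b<a → e (neg b) b<a (ℕ.<-trans b<a a<N))

  U-cong′ : ∀ a {g g′} → (∀ b → g b ≈ g′ b) → U g a ≈ U g′ a
  U-cong′ (pos a) e = +-cong (Σ-cong′ (N ℕ.∸ suc a) (λ b → e _)) (Σ-cong′ N (λ b → e (neg b)))
  U-cong′ (neg a) e = Σ-cong′ a (λ b → e (neg b))

  L-cong′ : ∀ a {g g′} → (∀ b → g b ≈ g′ b) → L g a ≈ L g′ a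
  L-cong′ (pos a) e = Σ-cong′ a (λ b → e (pos b))
  L-cong′ (neg a) e = +-cong (Σ-cong′ N (λ b → e (pos b))) (Σ-cong′ (N ℕ.∸ suc a) (λ b → e _))

  U-+ : ∀ a g g′ → U (λ b → g b + g′ b) a ≈ U g a + U g′ a
  U-+ (pos a) g g′ = trans (+-cong (Σ-+ (N ℕ.∸ suc a) _ _) (Σ-+ N _ _)) (+-exchange _ _ _ _)
  U-+ (neg a) g g′ = Σ-+ a _ _

  U-Σ : ∀ a m (g : ℕ → Series) → U (λ b → Σ< m (λ i → g i b)) a ≈ Σ< m (λ i → U (g i) a)
  U-Σ (pos a) m g = trans (+-cong (Σ-swap (N ℕ.∸ suc a) m _) (Σ-swap N m _)) (sym (Σ-+ m _ _))
  U-Σ (neg a) m g = Σ-swap a m _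

  U-*ˡ : ∀ a c g → U (λ b → c * g b) a ≈ c * U g a
  U-*ˡ (pos a) c g = trans (+-cong (Σ-*ˡ (N ℕ.∸ suc a) c _) (Σ-*ˡ N c _)) (sym (distribˡ c _ _))
  U-*ˡ (neg a) c g = Σ-*ˡ a c _

  L-*ˡ : ∀ a c g → L (λ b → c * g b) a ≈ c * L g a
  L-*ˡ (pos a) c g = Σ-*ˡ a c _
  L-*ˡ (neg a) c g = trans (+-cong (Σ-*ˡ N c _) (Σ-*ˡ (N ℕ.∸ suc a) c _)) (sym (distribˡ c _ _))

  L-Σ : ∀ a m (g : ℕ → Series) → L (λ b → Σ< m (λ i → g i b)) a ≈ Σ< m (λ i → L (g i) a)
  L-Σ (pos a) m g = Σ-swap a m _
  L-Σ (neg a) m g = trans (+-cong (Σ-swap N m _) (Σ-swap (N ℕ.∸ suc a) m _)) (sym (Σ-+ m _ _))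

  opaque
    unfolding ΣP

    -- Fubini for the pairs `a ≺ b`; each combination of signs is a triangle or a full square.
    UL : ∀ (F : Place → Series) → ΣP (λ a → U (F a) a) ≈ ΣP (λ b → L (λ a → F a b) b)
    UL F = begin
      Σ< N (λ a → Σ> N a (λ b → F (pos a) (pos b)) + Σ< N (λ b → F (pos a) (neg b)))
        + Σ< N (λ a → Σ< a (λ b → F (neg a) (neg b)))
        ≈⟨ +-cong (Σ-+ N _ _) (sym (Σ-triangle N (λ b a → F (neg a) (neg b)))) ⟩
      (Σ< N (λ a → Σ> N a (λ b → F (pos a) (pos b))) + Σ< N (λ a → Σ< N (λ b → F (pos a) (neg b))))
        + Σ< N (λ b → Σ> N b (λ a → F (neg a) (neg b)))
        ≈⟨ +-congʳ (+-cong (Σ-triangle N (λ a b → F (pos a) (pos b))) (Σ-swap N N _)) ⟩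
      (Σ< N (λ b → Σ< b (λ a → F (pos a) (pos b))) + Σ< N (λ b → Σ< N (λ a → F (pos a) (neg b))))
        + Σ< N (λ b → Σ> N b (λ a → F (neg a) (neg b)))
        ≈⟨ trans (+-assoc _ _ _) (+-congˡ (sym (Σ-+ N _ _))) ⟩
      ΣP (λ b → L (λ a → F a b) b) ∎

  op-cong′ : ∀ ks a {g g′} → (∀ b → g b ≈ g′ b) → op ks g a ≈ op ks g′ a
  op-cong′ []       a e = e a
  op-cong′ (k ∷ ks) a e = U-cong′ a (λ b → *-congˡ (op-cong′ ks b e))

  op-cong : ∀ ks a {g g′} → ∣ a ∣ₚ ℕ.< N → (∀ b → a ≡ b ⊎ a ≺ b → ∣ b ∣ₚ ℕ.< N → g b ≈ g′ b) → op ks g a ≈ op ks g′ a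
  op-cong []       a a<N e = e a (inj₁ ≡.refl) a<N
  op-cong (k ∷ ks) a a<N e = U-cong a a<N (λ b a≺b b<N → *-congˡ (op-cong ks b b<N
    (λ { c (inj₁ ≡.refl) → e c (inj₂ a≺b) ; c (inj₂ b≺c) → e c (inj₂ (≺-trans a b c a≺b b≺c)) })))

  opU-cong : ∀ ks a {g g′} → ∣ a ∣ₚ ℕ.< N → (∀ b → a ≺ b → ∣ b ∣ₚ ℕ.< N → g b ≈ g′ b) → op ks (U g) a ≈ op ks (U g′) a
  opU-cong ks a a<N e = op-cong ks a a<N
    (λ { b (inj₁ ≡.refl) b<N → U-cong a a<N e
       ; b (inj₂ a≺b) b<N → U-cong b b<N (λ c b≺c → e c (≺-trans a b c a≺b b≺c)) })

  op-+ : ∀ ks a g g′ → op ks (λ b → g b + g′ b) a ≈ op ks g a + op ks g′ a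
  op-+ []       a g g′ = refl
  op-+ (k ∷ ks) a g g′ = trans (U-cong′ a (λ b → trans (*-congˡ (op-+ ks b g g′)) (distribˡ _ _ _))) (U-+ a _ _)

  op-Σ : ∀ ks a m (g : ℕ → Series) → op ks (λ b → Σ< m (λ i → g i b)) a ≈ Σ< m (λ i → op ks (g i) a)
  op-Σ []       a m g = refl
  op-Σ (k ∷ ks) a m g = trans (U-cong′ a (λ b → trans (*-congˡ (op-Σ ks b m g)) (sym (Σ-*ˡ m _ _)))) (U-Σ a m _)

  *-swap : ∀ x y z → x * (y * z) ≈ y * (x * z)
  *-swap = solve 3 (λ x y z → x :* (y :* z) := y :* (x :* z)) refl
    where open SemiringSolver commutativeSemiring

  op-*ˡ : ∀ ks a c g → op ks (λ b → c * g b) a ≈ c * op ks g a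
  op-*ˡ []       a c g = refl
  op-*ˡ (k ∷ ks) a c g = trans (U-cong′ a (λ b → trans (*-congˡ (op-*ˡ ks b c g)) (*-swap _ _ _))) (U-*ˡ a c _)

  op-++ : ∀ ks ls a g → op (ks ++ ls) g a ≈ op ks (op ls g) a
  op-++ []       ls a g = refl
  op-++ (k ∷ ks) ls a g = U-cong′ a (λ b → *-congˡ (op-++ ks ls b g))

  op-L : ∀ ks a c (G : Place → Series) → op ks (λ b → L (λ m → G m b) c) a ≈ L (λ m → op ks (G m) a) c
  op-L ks a (pos c) G = op-Σ ks a c _
  op-L ks a (neg c) G = trans (op-+ ks a _ _) (+-cong (op-Σ ks a N _) (op-Σ ks a (N ℕ.∸ suc c) _))

  CE-cong : ∀ κ {g g′} → (∀ a b → ∣ a ∣ₚ ℕ.< N → a ≡ b ⊎ a ≺ b → ∣ b ∣ₚ ℕ.< N → g a b ≈ g′ a b) → CE κ g ≈ CE κ g′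
  CE-cong []       e = refl
  CE-cong (k ∷ ks) e = ΣP-cong (λ a a<N → *-congˡ (op-cong ks a a<N (λ b → e a b a<N)))

  CE-+ : ∀ κ g g′ → CE κ (λ a b → g a b + g′ a b) ≈ CE κ g + CE κ g′
  CE-+ []       g g′ = sym (+-identityʳ 0#)
  CE-+ (k ∷ ks) g g′ = trans (ΣP-cong′ (λ a → trans (*-congˡ (op-+ ks a _ _)) (distribˡ _ _ _))) (ΣP-+ _ _)

  CE-Σ : ∀ κ m (g : ℕ → Place → Series) → CE κ (λ a b → Σ< m (λ i → g i a b)) ≈ Σ< m (λ i → CE κ (g i))
  CE-Σ []       m g = sym (Σ-0 m)
  CE-Σ (k ∷ ks) m g = trans (ΣP-cong′ (λ a → trans (*-congˡ (op-Σ ks a m _)) (sym (Σ-*ˡ m _ _)))) (ΣP-Σ m _)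

  CE-*ˡ : ∀ κ c g → CE κ (λ a b → c * g a b) ≈ c * CE κ g
  CE-*ˡ []       c g = sym (zeroʳ c)
  CE-*ˡ (k ∷ ks) c g = trans (ΣP-cong′ (λ a → trans (*-congˡ (op-*ˡ ks a c _)) (*-swap _ _ _))) (ΣP-*ˡ c _)

  -- The new variable lies below the old first one and is constrained by nothing else, so it is
  -- summed out into a weight at the first place.
  S-cons : ∀ k κ → κ ≡.≢ [] → S (k ∷ κ) ≈ CE κ (λ a _ → L (λ y → f y ^ val k) a)
  S-cons k []       κ≢[] with () ← κ≢[] ≡.refl
  S-cons k (l ∷ ls) _    = begin
    ΣP (λ y → f y ^ val k * U (λ a → f a ^ val l * op ls 𝟙 a) y)
      ≈⟨ ΣP-cong′ (λ y → sym (U-*ˡ y _ _)) ⟩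
    ΣP (λ y → U (λ a → f y ^ val k * (f a ^ val l * op ls 𝟙 a)) y)
      ≈⟨ UL _ ⟩
    ΣP (λ a → L (λ y → f y ^ val k * (f a ^ val l * op ls 𝟙 a)) a)
      ≈⟨ ΣP-cong′ (λ a → L-cong′ a (λ y → trans (*-comm _ _) (trans (*-assoc _ _ _) (*-congˡ (trans (*-comm _ _) (sym (op-*ˡ ls a _ _))))))) ⟩
    ΣP (λ a → L (λ y → f a ^ val l * op ls (λ b → f y ^ val k * 1#) a) a)
      ≈⟨ ΣP-cong′ (λ a → trans (L-*ˡ a _ _) (*-congˡ (sym (op-L ls a a _)))) ⟩
    ΣP (λ a → f a ^ val l * op ls (λ b → L (λ y → f y ^ val k * 1#) a) a)
      ≈⟨ ΣP-cong′ (λ a → *-congˡ (op-cong′ ls a (λ b → L-cong′ a (λ y → *-identityʳ _)))) ⟩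
    CE (l ∷ ls) (λ a _ → L (λ y → f y ^ val k) a) ∎

  S-snoc : ∀ k ks m → S (k ∷ ks ∷ʳ m) ≈ CE (k ∷ ks) (λ _ → U (λ b → f b ^ val m))
  S-snoc k ks m = ΣP-cong′ (λ a → *-congˡ (trans (op-++ ks (m ∷ []) a 𝟙)
    (op-cong′ ks a (λ b → U-cong′ b (λ c → *-identityʳ _)))))

  S-bump-first : ∀ k ks j → S ((k ⊕ j ⊕ 1) ∷ ks) ≈ CE (k ∷ ks) (λ a _ → f a ^ suc j)
  S-bump-first (1+ k) ks j = ΣP-cong′ (λ a → begin
    f a ^ val ((1+ k) ⊕ j ⊕ 1) * op ks 𝟙 a     ≡⟨ ≡.cong (λ m → f a ^ suc m * op ks 𝟙 a) (≡.trans (ℕ.+-comm (k ℕ.+ j) 1) (≡.sym (ℕ.+-suc k j))) ⟩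
    f a ^ (suc k ℕ.+ suc j) * op ks 𝟙 a        ≈⟨ *-congʳ (^-homo-* (f a) (suc k) (suc j)) ⟩
    f a ^ suc k * f a ^ suc j * op ks 𝟙 a      ≈⟨ *-assoc _ _ _ ⟩
    f a ^ suc k * (f a ^ suc j * op ks 𝟙 a)    ≈⟨ *-congˡ (trans (sym (op-*ˡ ks a _ _)) (op-cong′ ks a (λ _ → *-identityʳ _))) ⟩
    f a ^ suc k * op ks (λ _ → f a ^ suc j) a  ∎)

  S-bump-last : ∀ ks k → S (ks ∷ʳ (k ⊕ 1)) ≈ CE (ks ∷ʳ k) (λ _ → f)
  S-bump-last []       (1+ k) = ΣP-cong′ (λ a → trans (*-identityʳ _)
    (trans (reflexive (≡.cong (λ m → f a ^ suc m) (ℕ.+-comm k 1))) (*-comm _ _)))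
  S-bump-last (l ∷ ks) (1+ k) = ΣP-cong′ (λ a → *-congˡ (begin
    op (ks ∷ʳ (1+ (k ℕ.+ 1))) 𝟙 a                  ≈⟨ op-++ ks _ a 𝟙 ⟩
    op ks (U (λ b → f b ^ suc (k ℕ.+ 1) * 1#)) a   ≈⟨ op-cong′ ks a (λ b → U-cong′ b (λ c → trans (*-identityʳ _)
                                                        (trans (reflexive (≡.cong (λ m → f c ^ suc m) (ℕ.+-comm k 1))) (*-comm _ _)))) ⟩
    op ks (U (λ b → f b ^ suc k * f b)) a          ≈⟨ op-++ ks _ a f ⟨
    op (ks ∷ʳ (1+ k)) f a                          ∎))

  -- For p = 1/a, q = 1/b and D = 1/(b - a) the hypothesis is the partial fraction p q = D (p - q),
  -- written without subtraction; the summands are then differences of consecutive terms D p^i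
  -- q^{k-i}.
  telescope : ∀ p q D → p * q + D * q ≈ D * p → ∀ k →
    Σ< k (λ j → p ^ suc j * q ^ (k ℕ.∸ j)) + D * q ^ k ≈ D * p ^ k
  telescope p q D e zero    = +-identityˡ _
  telescope p q D e (suc k) = begin
    (Σ< k (λ j → p ^ suc j * q ^ (suc k ℕ.∸ j)) + p ^ suc k * q ^ (suc k ℕ.∸ k)) + D * q ^ suc k
      ≈⟨ +-congʳ (+-cong (Σ-cong k (λ j j<k → trans
           (*-congˡ (reflexive (≡.cong (q ^_) (ℕ.+-∸-assoc 1 (ℕ.<⇒≤ j<k))))) (*-swap _ _ _)))
           (*-congˡ (trans (reflexive (≡.cong (q ^_) (≡.trans (ℕ.+-∸-assoc 1 (ℕ.≤-refl {k})) (≡.cong suc (ℕ.n∸n≡0 k))))) (*-identityʳ q)))) ⟩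
    (Σ< k (λ j → q * (p ^ suc j * q ^ (k ℕ.∸ j))) + p ^ suc k * q) + D * q ^ suc k
      ≈⟨ +-congʳ (+-congʳ (Σ-*ˡ k q _)) ⟩
    (q * X + p * p ^ k * q) + D * (q * q ^ k)
      ≈⟨ solve 6 (λ p q pk qk D X → (q :* X :+ p :* pk :* q) :+ D :* (q :* qk)
                                 := q :* (X :+ D :* qk) :+ p :* pk :* q) refl p q (p ^ k) (q ^ k) D X ⟩
    q * (X + D * q ^ k) + p * p ^ k * q
      ≈⟨ +-congʳ (*-congˡ (telescope p q D e k)) ⟩
    q * (D * p ^ k) + p * p ^ k * q
      ≈⟨ solve 4 (λ p q pk D → q :* (D :* pk) :+ p :* pk :* q := pk :* (p :* q :+ D :* q)) refl p q (p ^ k) D ⟩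
    p ^ k * (p * q + D * q)
      ≈⟨ *-congˡ e ⟩
    p ^ k * (D * p)
      ≈⟨ trans (*-swap _ _ _) (*-congˡ (*-comm _ _)) ⟩
    D * (p * p ^ k) ∎
    where
    open SemiringSolver commutativeSemiring
    X = Σ< k (λ j → p ^ suc j * q ^ (k ℕ.∸ j))

  -- The variables run through a₁ > a₂ > ⋯; the weight is evaluated at the last of them.
  W : (ℕ → Carrier) → Index → ℕ → (ℕ → Carrier) → Carrier
  W φ []       M w = w M
  W φ (k ∷ ks) M w = Σ< M (λ a → φ a ^ val k * W φ ks a w)

  f⁻ : ℕ → Carrier
  f⁻ a = - s a

  op-neg : ∀ ks g a → op ks g (neg a) ≈ W f⁻ ks a (λ b → g (neg b))
  op-neg []       g a = refl
  op-neg (k ∷ ks) g a = Σ-cong′ a (λ b → *-congˡ (op-neg ks g b))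

  op-0 : ∀ ks a {g} → (∀ b → g b ≈ 0#) → op ks g a ≈ 0#
  op-0 ks a e = trans (op-cong′ ks a (λ b → trans (e b) (sym (zeroˡ 0#)))) (trans (op-*ˡ ks a 0# (λ _ → 0#)) (zeroˡ _))

  -- Ascending chains in the `neg` half have descending numbers, which is the direction of `W`; the
  -- index keeps its order and the weight sits at the last variable.
  CE-neg : ∀ k ks g w → (∀ a b → g (pos a) b ≈ 0#) → (∀ a b → g (neg a) (neg b) ≈ w b) →
    CE (k ∷ ks) g ≈ W f⁻ (k ∷ ks) N w
  CE-neg k ks g w e₀ e = begin
    CE (k ∷ ks) g
      ≈⟨ ΣP-def _ ⟩
    Σ< N (λ a → f (pos a) ^ val k * op ks (g (pos a)) (pos a)) + Σ< N (λ a → f (neg a) ^ val k * op ks (g (neg a)) (neg a))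
      ≈⟨ +-cong (trans (Σ-cong′ N (λ a → trans (*-congˡ (op-0 ks (pos a) (e₀ a))) (zeroʳ _))) (Σ-0 N))
           (Σ-cong′ N (λ a → *-congˡ (trans (op-neg ks (g (neg a)) a) (W-cong ks a (e a))))) ⟩
    0# + W f⁻ (k ∷ ks) N w
      ≈⟨ +-identityˡ _ ⟩
    W f⁻ (k ∷ ks) N w ∎
    where
    W-cong : ∀ ks M {w w′} → (∀ a → w a ≈ w′ a) → W f⁻ ks M w ≈ W f⁻ ks M w′
    W-cong []       M e = e M
    W-cong (k ∷ ks) M e = Σ-cong′ M (λ a → *-congˡ (W-cong ks a e))

  chain-triangle : ∀ (x : ℕ → Carrier) (φ : ℕ → Carrier) →
    Σ< N (λ a → x a * Σ> N a φ) ≈ Σ< N (λ b → Σ< b x * φ b)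
  chain-triangle x φ = begin
    Σ< N (λ a → x a * Σ> N a φ)              ≈⟨ Σ-cong′ N (λ a → sym (Σ-*ˡ (N ℕ.∸ suc a) (x a) _)) ⟩
    Σ< N (λ a → Σ> N a (λ b → x a * φ b))    ≈⟨ Σ-triangle N (λ a b → x a * φ b) ⟩
    Σ< N (λ b → Σ< b (λ a → x a * φ b))      ≈⟨ Σ-cong′ N (λ b → Σ-*ʳ b (φ b) x) ⟩
    Σ< N (λ b → Σ< b x * φ b)                ∎

  W-step : ∀ k p w M → Σ< M (λ a → W h p a w * h a ^ val k) ≈ W h (k ∷ p) M w
  W-step k p w M = Σ-cong′ M (λ a → *-comm _ _)

  -- In the `pos` half the numbers ascend while `W` descends. The index is therefore reversed, and
  -- the first variable, on which the weight depends, becomes the last one of `W`.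
  CE-pos : ∀ k ks g w → (∀ a b → g (neg a) b ≈ 0#) → (∀ a b → g (pos a) (neg b) ≈ 0#) → (∀ a b → g (pos a) (pos b) ≈ w a) →
    CE (k ∷ ks) g ≈ W h (reverse (k ∷ ks)) N w
  CE-pos k ks g w e₋ e₀ e = begin
    CE (k ∷ ks) g
      ≈⟨ ΣP-def _ ⟩
    Σ< N (λ a → h a ^ val k * op ks (g (pos a)) (pos a)) + Σ< N (λ a → f (neg a) ^ val k * op ks (g (neg a)) (neg a))
      ≈⟨ +-cong (Σ-cong′ N (λ a → trans (*-congˡ (op-c ks (e₀ a) (e a) a)) (trans (sym (*-assoc _ _ _)) (*-congʳ (*-comm _ _)))))
           (trans (Σ-cong′ N (λ a → trans (*-congˡ (op-0 ks (neg a) (e₋ a))) (zeroʳ _))) (Σ-0 N)) ⟩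
    Σ< N (λ a → (W h [] a w * h a ^ val k) * c ks a) + 0#
      ≈⟨ trans (+-identityʳ _) (go [] k ks) ⟩
    W h (reverse (k ∷ ks)) N w ∎
    where
    c : Index → ℕ → Carrier
    c []       a = 1#
    c (k ∷ ks) a = Σ> N a (λ b → h b ^ val k * c ks b)
    op-c : ∀ ks {g x} → (∀ b → g (neg b) ≈ 0#) → (∀ b → g (pos b) ≈ x) → ∀ a → op ks g (pos a) ≈ x * c ks a
    op-c []       e₀ e a = trans (e a) (sym (*-identityʳ _))
    op-c (k ∷ ks) {g} {x} e₀ e a = begin
      Σ> N a (λ b → h b ^ val k * op ks g (pos b)) + Σ< N (λ b → f⁻ b ^ val k * op ks g (neg b))
        ≈⟨ +-cong (Σ-cong′ (N ℕ.∸ suc a) (λ b → trans (*-congˡ (op-c ks e₀ e _)) (*-swap _ _ _)))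
             (trans (Σ-cong′ N (λ b → trans (*-congˡ (trans (op-neg ks g b) (W-0 ks b e₀))) (zeroʳ _))) (Σ-0 N)) ⟩
      Σ> N a (λ b → x * (h b ^ val k * c ks b)) + 0#
        ≈⟨ trans (+-identityʳ _) (Σ-*ˡ (N ℕ.∸ suc a) x _) ⟩
      x * c (k ∷ ks) a ∎
      where
      W-0 : ∀ ks M {w} → (∀ a → w a ≈ 0#) → W f⁻ ks M w ≈ 0#
      W-0 []       M e = e M
      W-0 (k ∷ ks) M e = trans (Σ-cong′ M (λ a → trans (*-congˡ (W-0 ks a e)) (zeroʳ _))) (Σ-0 M)
    -- `p` holds the entries already absorbed into `W`, in reverse order; interchanging two sums
    -- moves one more entry across.
    go : ∀ p k ks → Σ< N (λ a → (W h p a w * h a ^ val k) * c ks a) ≈ W h (reverseAcc (k ∷ p) ks) N w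
    go p k []       = trans (Σ-cong′ N (λ a → *-identityʳ _)) (W-step k p w N)
    go p k (l ∷ ks) = begin
      Σ< N (λ a → (W h p a w * h a ^ val k) * c (l ∷ ks) a)
        ≈⟨ chain-triangle _ _ ⟩
      Σ< N (λ b → Σ< b (λ a → W h p a w * h a ^ val k) * (h b ^ val l * c ks b))
        ≈⟨ Σ-cong′ N (λ b → trans (*-congʳ (W-step k p w b)) (sym (*-assoc _ _ _))) ⟩
      Σ< N (λ b → (W h (k ∷ p) b w * h b ^ val l) * c ks b)
        ≈⟨ go (k ∷ p) l ks ⟩
      W h (reverseAcc (l ∷ k ∷ p) ks) N w ∎

  -- ∑ over all ways of cutting the list reverse p ++ q at a place inside q;
  -- the front part is passed in reverse order.
  cuts : (Index → Index → Carrier) → Index → Index → Carrier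
  cuts F p []      = F p []
  cuts F p (k ∷ q) = F p (k ∷ q) + cuts F (k ∷ p) q

  𝟏 : ℕ → Carrier
  𝟏 _ = 1#

  S-cuts : ∀ κ → S κ ≈ cuts (λ p q → W h p N 𝟏 * W f⁻ q N 𝟏) [] κ
  S-cuts []       = sym (*-identityʳ 1#)
  S-cuts (k ∷ ks) = begin
    S (k ∷ ks)
      ≈⟨ trans (ΣP-def _) (+-comm _ _) ⟩
    Σ< N (λ a → f (neg a) ^ val k * op ks 𝟙 (neg a)) + Σ< N (λ a → h a ^ val k * op ks 𝟙 (pos a))
      ≈⟨ +-cong (trans (Σ-cong′ N (λ a → *-congˡ (op-neg ks 𝟙 a))) (sym (*-identityˡ _)))
           (trans (Σ-cong′ N (λ a → *-congʳ (sym (*-identityˡ _)))) (go [] k ks)) ⟩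
    cuts _ [] (k ∷ ks) ∎
    where
    go : ∀ p k ks → Σ< N (λ a → (W h p a 𝟏 * h a ^ val k) * op ks 𝟙 (pos a)) ≈ cuts (λ p q → W h p N 𝟏 * W f⁻ q N 𝟏) (k ∷ p) ks
    go p k []       = trans (Σ-cong′ N (λ a → *-identityʳ _)) (trans (W-step k p 𝟏 N) (sym (*-identityʳ _)))
    go p k (l ∷ ks) = begin
      Σ< N (λ a → (W h p a 𝟏 * h a ^ val k) * (Σ> N a φ + Σ< N (λ b → f⁻ b ^ val l * op ks 𝟙 (neg b))))
        ≈⟨ trans (Σ-cong′ N (λ a → distribˡ _ _ _)) (trans (Σ-+ N _ _) (+-comm _ _)) ⟩
      Σ< N (λ a → (W h p a 𝟏 * h a ^ val k) * Σ< N (λ b → f⁻ b ^ val l * op ks 𝟙 (neg b)))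
        + Σ< N (λ a → (W h p a 𝟏 * h a ^ val k) * Σ> N a φ)
        ≈⟨ +-cong (trans (Σ-*ʳ N _ _) (*-cong (W-step k p 𝟏 N) (Σ-cong′ N (λ b → *-congˡ (op-neg ks 𝟙 b)))))
             (trans (chain-triangle _ φ) (Σ-cong′ N (λ b → trans (*-congʳ (W-step k p 𝟏 b)) (sym (*-assoc _ _ _))))) ⟩
      W h (k ∷ p) N 𝟏 * W f⁻ (l ∷ ks) N 𝟏 + Σ< N (λ b → (W h (k ∷ p) b 𝟏 * h b ^ val l) * op ks 𝟙 (pos b))
        ≈⟨ +-congˡ (go (k ∷ p) l ks) ⟩
      cuts _ (k ∷ p) (l ∷ ks) ∎
      where
      φ : ℕ → Carrier
      φ b = h b ^ val l * op ks 𝟙 (pos b)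

∷ʳ≢[] : ∀ (ks : Index) k → ks ∷ʳ k ≡.≢ []
∷ʳ≢[] []       k ()
∷ʳ≢[] (_ ∷ ks) k ()

-- The cyclic sum formula at a finite level N

module CyclicSum
  (R : CommutativeRing 0ℓ 0ℓ)
  (ι h s : ℕ → CommutativeRing.Carrier R)
  (t : CommutativeRing.Carrier R)
  (N n : ℕ)
  (ι-+ : ∀ a b → CommutativeRing._≈_ R (ι (suc (a ℕ.+ b))) (CommutativeRing._+_ R (ι a) (ι b)))
  (ιh≈1 : ∀ a → CommutativeRing._≈_ R (CommutativeRing._*_ R (ι a) (h a)) (CommutativeRing.1# R))
  (ιs≈1+ts : ∀ a → CommutativeRing._≈_ R (CommutativeRing._*_ R (ι a) (s a))
    (CommutativeRing._+_ R (CommutativeRing.1# R) (CommutativeRing._*_ R t (s a))))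
  (t^1+n≈0 : CommutativeRing._≈_ R (Exp._^_ (CommutativeRing.semiring R) t (suc n)) (CommutativeRing.0# R))
  where

  open CommutativeRing R
  open RingProperties ring using (-‿distribˡ-*; -‿distribʳ-*; -‿involutive; +-cancelʳ; -‿+-comm)
  open Exp semiring using (_^_; ^-homo-*)
  open import Relation.Binary.Reasoning.Setoid setoid
  open Cyclic R ι h s t N public

  -- Identities between differences are proved with one quantity, written as `l` on one side and as
  -- `r` on the other, added to both, so that only sums have to be rearranged.
  cancel : ∀ {x y l r} → l ≈ r → x + l ≈ y + r → x ≈ y
  cancel {x} {y} {l} {r} l≈r e = +-cancelʳ r x y (trans (+-congˡ (sym l≈r)) e)

  -- For `a ≺ b` this is 1/(v b - v a). The offsets come from `h i` being 1/(i + 1): for instance (b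
  -- + 1) - (a + 1) = (b - a - 1) + 1.
  D : Place → Series
  D (pos a) (pos b) = h (b ℕ.∸ suc a)
  D (pos a) (neg b) = - s (suc (a ℕ.+ b))
  D (neg a) (pos b) = 0#
  D (neg a) (neg b) = h (a ℕ.∸ suc b)

  v : Series
  v (pos a) = ι a
  v (neg a) = - ι a + t

  vs≈1 : ∀ a → (- ι a + t) * (- s a) ≈ 1#
  vs≈1 a = begin
    (- ι a + t) * (- s a)          ≈⟨ distribʳ _ _ _ ⟩
    - ι a * - s a + t * - s a      ≈⟨ +-cong (trans (sym (-‿distribˡ-* _ _)) (trans (-‿cong (sym (-‿distribʳ-* _ _))) (-‿involutive _))) (sym (-‿distribʳ-* _ _)) ⟩
    ι a * s a + - (t * s a)        ≈⟨ +-congʳ (ιs≈1+ts a) ⟩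
    (1# + t * s a) + - (t * s a)   ≈⟨ +-assoc _ _ _ ⟩
    1# + (t * s a + - (t * s a))   ≈⟨ trans (+-congˡ (-‿inverseʳ _)) (+-identityʳ 1#) ⟩
    1# ∎

  vf≈1 : ∀ a → v a * f a ≈ 1#
  vf≈1 (pos a) = ιh≈1 a
  vf≈1 (neg a) = vs≈1 a

  partial-fraction : ∀ {va vb w pa pb pw} → va * pa ≈ 1# → vb * pb ≈ 1# → w * pw ≈ 1# → vb ≈ va + w →
    pa * pb + pw * pb ≈ pw * pa
  partial-fraction {va} {vb} {w} {pa} {pb} {pw} ea eb ew e = begin
    pa * pb + pw * pb                              ≈⟨ +-cong (*-identityˡ _) (*-identityˡ _) ⟨
    1# * (pa * pb) + 1# * (pw * pb)                ≈⟨ +-cong (*-congʳ ew) (*-congʳ ea) ⟨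
    (w * pw) * (pa * pb) + (va * pa) * (pw * pb)   ≈⟨ solve 5 (λ va w pa pb pw → (w :* pw) :* (pa :* pb) :+ (va :* pa) :* (pw :* pb)
                                                           := ((va :+ w) :* pb) :* (pw :* pa)) refl va w pa pb pw ⟩
    ((va + w) * pb) * (pw * pa)                    ≈⟨ *-congʳ (trans (*-congʳ (sym e)) eb) ⟩
    1# * (pw * pa)                                 ≈⟨ *-identityˡ _ ⟩
    pw * pa                                        ∎
    where open SemiringSolver commutativeSemiring

  ι-∸ : ∀ {a b} → a ℕ.< b → ι b ≈ ι a + ι (b ℕ.∸ suc a)
  ι-∸ {a} {b} a<b = trans (reflexive (≡.cong ι (≡.sym (ℕ.m+[n∸m]≡n a<b)))) (ι-+ a (b ℕ.∸ suc a))

  D-law : ∀ a b → a ≺ b → f a * f b + D a b * f b ≈ D a b * f a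
  D-law (pos a) (pos b) a<b = partial-fraction (ιh≈1 a) (ιh≈1 b) (ιh≈1 (b ℕ.∸ suc a)) (ι-∸ a<b)
  D-law (pos a) (neg b) _   = partial-fraction (ιh≈1 a) (vs≈1 b) (vs≈1 (suc (a ℕ.+ b))) (begin
    - ι b + t                          ≈⟨ +-identityˡ _ ⟨
    0# + (- ι b + t)                   ≈⟨ +-congʳ (-‿inverseʳ (ι a)) ⟨
    (ι a + - ι a) + (- ι b + t)        ≈⟨ solve 4 (λ a a′ b t → (a :+ a′) :+ (b :+ t) := a :+ ((a′ :+ b) :+ t)) refl (ι a) (- ι a) (- ι b) t ⟩
    ι a + ((- ι a + - ι b) + t)        ≈⟨ +-congˡ (+-congʳ (trans (-‿+-comm _ _) (-‿cong (sym (ι-+ a b))))) ⟩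
    ι a + (- ι (suc (a ℕ.+ b)) + t)    ∎)
    where open SemiringSolver commutativeSemiring
  D-law (neg a) (neg b) b<a = partial-fraction (vs≈1 a) (vs≈1 b) (ιh≈1 (a ℕ.∸ suc b)) (begin
    - ι b + t                          ≈⟨ +-identityˡ _ ⟨
    0# + (- ι b + t)                   ≈⟨ +-congʳ (-‿inverseˡ (ι (a ℕ.∸ suc b))) ⟨
    (- d + d) + (- ι b + t)            ≈⟨ solve 4 (λ d′ d b t → (d′ :+ d) :+ (b :+ t) := ((b :+ d′) :+ t) :+ d) refl (- d) d (- ι b) t ⟩
    ((- ι b + - d) + t) + d            ≈⟨ +-congʳ (+-congʳ (trans (-‿+-comm _ _) (-‿cong (sym (ι-∸ b<a))))) ⟩
    (- ι a + t) + d                    ∎)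
    where
    open SemiringSolver commutativeSemiring
    d = ι (a ℕ.∸ suc b)

  -- The weights that telescoping leaves: the extra variable lies above the last place `b` in `gA`
  -- and below the first place `a` in `gB`.
  gA gB : Place → Series
  gA a b = U (D a) b
  gB a b = L (λ m → D m b) a

  CE-gB : ∀ ks k → ΣP (λ m → op (ks ∷ʳ k) (D m) m) ≈ CE (ks ∷ʳ k) gB
  CE-gB ks k = go (ks ∷ʳ k) (∷ʳ≢[] ks k)
    where
    go : ∀ κ → κ ≡.≢ [] → ΣP (λ m → op κ (D m) m) ≈ CE κ gB
    go []       κ≢[] with () ← κ≢[] ≡.refl
    go (l ∷ ls) _    = trans (UL _) (ΣP-cong′ (λ a → trans (L-*ˡ a _ _) (*-congˡ (sym (op-L ls a a _)))))

  LHS : ℕ⁺ → Index → Carrier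
  LHS k ks = Σ< (val k ℕ.∸ 1) (λ j → S ((1+ j) ∷ ks ∷ʳ (k ⊖ j)))

  -- Summing the partial fraction identity over all ways of splitting the exponent k + 1.
  split-sum : ∀ k ks → Σ< (val k) (λ j → S ((1+ j) ∷ ks ∷ʳ (k ⊖ j))) + CE (ks ∷ʳ k) gB ≈ CE (k ∷ ks) gA
  split-sum (1+ m) ks = begin
    Σ< k (λ j → S ((1+ j) ∷ ks ∷ʳ (1+ (m ℕ.∸ j)))) + CE (ks ∷ʳ (1+ m)) gB
      ≈⟨ +-cong (Σ-cong k term) (trans (sym (CE-gB ks (1+ m))) (ΣP-cong′ (λ a → op-++ ks _ a (D a)))) ⟩
    Σ< k (λ j → ΣP (λ a → op ks (U (λ b → f a ^ suc j * f b ^ (k ℕ.∸ j))) a))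
      + ΣP (λ a → op ks (U (λ b → f b ^ k * D a b)) a)
      ≈⟨ trans (+-congʳ (sym (ΣP-Σ k _))) (sym (ΣP-+ _ _)) ⟩
    ΣP (λ a → Σ< k (λ j → op ks (U (λ b → f a ^ suc j * f b ^ (k ℕ.∸ j))) a) + op ks (U (λ b → f b ^ k * D a b)) a)
      ≈⟨ ΣP-cong inner ⟩
    CE ((1+ m) ∷ ks) gA ∎
    where
    k = suc m
    term : ∀ j → j ℕ.< k → S ((1+ j) ∷ ks ∷ʳ (1+ (m ℕ.∸ j))) ≈ ΣP (λ a → op ks (U (λ b → f a ^ suc j * f b ^ (k ℕ.∸ j))) a)
    term j (ℕ.s≤s j≤m) = ΣP-cong′ (λ a → begin
      f a ^ suc j * op (ks ∷ʳ (1+ (m ℕ.∸ j))) 𝟙 a               ≈⟨ *-congˡ (op-++ ks _ a 𝟙) ⟩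
      f a ^ suc j * op ks (U (λ b → f b ^ suc (m ℕ.∸ j) * 1#)) a ≈⟨ op-*ˡ ks a _ _ ⟨
      op ks (λ c → f a ^ suc j * U (λ b → f b ^ suc (m ℕ.∸ j) * 1#) c) a
        ≈⟨ op-cong′ ks a (λ c → trans (sym (U-*ˡ c _ _)) (U-cong′ c (λ b → *-congˡ (trans (*-identityʳ _)
             (reflexive (≡.cong (f b ^_) (≡.sym (ℕ.+-∸-assoc 1 j≤m)))))))) ⟩
      op ks (U (λ b → f a ^ suc j * f b ^ (k ℕ.∸ j))) a ∎)
    inner : ∀ a → ∣ a ∣ₚ ℕ.< N →
      Σ< k (λ j → op ks (U (λ b → f a ^ suc j * f b ^ (k ℕ.∸ j))) a) + op ks (U (λ b → f b ^ k * D a b)) a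
        ≈ f a ^ k * op ks (U (D a)) a
    inner a a<N = begin
      Σ< k (λ j → op ks (U (λ b → f a ^ suc j * f b ^ (k ℕ.∸ j))) a) + op ks (U (λ b → f b ^ k * D a b)) a
        ≈⟨ +-congʳ (trans (sym (op-Σ ks a k _)) (op-cong′ ks a (λ c → sym (U-Σ c k _)))) ⟩
      op ks (U (λ b → Σ< k (λ j → f a ^ suc j * f b ^ (k ℕ.∸ j)))) a + op ks (U (λ b → f b ^ k * D a b)) a
        ≈⟨ trans (sym (op-+ ks a _ _)) (op-cong′ ks a (λ c → sym (U-+ c _ _))) ⟩
      op ks (U (λ b → Σ< k (λ j → f a ^ suc j * f b ^ (k ℕ.∸ j)) + f b ^ k * D a b)) a
        ≈⟨ opU-cong ks a a<N (λ b a≺b _ → trans (+-congˡ (*-comm _ _))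
             (trans (telescope (f a) (f b) (D a b) (D-law a b a≺b) k) (*-comm _ _))) ⟩
      op ks (U (λ b → f a ^ k * D a b)) a
        ≈⟨ trans (op-cong′ ks a (λ c → U-*ˡ c _ _)) (op-*ˡ ks a _ _) ⟩
      f a ^ k * op ks (U (D a)) a ∎

  Uf : Place → Series
  Uf _ = U f

  LHS-sum : ∀ k ks → LHS k ks + (CE (k ∷ ks) Uf + CE (ks ∷ʳ k) gB) ≈ CE (k ∷ ks) gA
  LHS-sum k@(1+ m) ks = begin
    LHS k ks + (CE (k ∷ ks) Uf + CE (ks ∷ʳ k) gB)                    ≈⟨ +-assoc _ _ _ ⟨
    LHS k ks + CE (k ∷ ks) Uf + CE (ks ∷ʳ k) gB                      ≈⟨ +-congʳ (+-congˡ last) ⟨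
    Σ< (suc m) (λ j → S ((1+ j) ∷ ks ∷ʳ (k ⊖ j))) + CE (ks ∷ʳ k) gB  ≈⟨ split-sum k ks ⟩
    CE (k ∷ ks) gA                                                   ∎
    where
    -- The summand j = k - 1 of `split-sum`, whose last exponent is 1, is not part of `LHS` and is
    -- accounted for by `Uf`.
    last : S ((1+ m) ∷ ks ∷ʳ (1+ (m ℕ.∸ m))) ≈ CE (k ∷ ks) Uf
    last = begin
      S ((1+ m) ∷ ks ∷ʳ (1+ (m ℕ.∸ m)))     ≡⟨ ≡.cong (λ i → S ((1+ m) ∷ ks ∷ʳ (1+ i))) (ℕ.n∸n≡0 m) ⟩
      S ((1+ m) ∷ ks ∷ʳ (1+ 0))             ≈⟨ S-snoc (1+ m) ks (1+ 0) ⟩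
      CE (k ∷ ks) (λ _ → U (λ b → f b ^ 1)) ≈⟨ CE-cong (k ∷ ks) (λ _ b _ _ _ → U-cong′ b (λ c → *-identityʳ _)) ⟩
      CE (k ∷ ks) Uf                        ∎

  -- 1 / (v - t), as the geometric series ∑ tʲ f^{j+1}.
  f′ : Series
  f′ y = Σ< (suc n) (λ j → t ^ j * f y ^ suc j)

  f′-fix : ∀ y → f′ y ≈ f y + t * f y * f′ y
  f′-fix y = begin
    f′ y
      ≈⟨ Σ-front n _ ⟩
    t ^ 0 * f y ^ 1 + Σ< n (λ j → t ^ suc j * f y ^ suc (suc j))
      ≈⟨ +-cong (trans (*-identityˡ _) (*-identityʳ _)) (trans (Σ-cong′ n (λ j → step (t ^ j) (f y ^ suc j))) (Σ-*ˡ n _ _)) ⟩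
    f y + t * f y * Σ< n (λ j → t ^ j * f y ^ suc j)
      ≈⟨ +-congˡ (+-identityʳ _) ⟨
    f y + (t * f y * Σ< n (λ j → t ^ j * f y ^ suc j) + 0#)
      ≈⟨ +-congˡ (+-congˡ zero-term) ⟨
    f y + (t * f y * Σ< n (λ j → t ^ j * f y ^ suc j) + t * f y * (t ^ n * f y ^ suc n))
      ≈⟨ +-congˡ (distribˡ _ _ _) ⟨
    f y + t * f y * f′ y ∎
    where
    step : ∀ a b → (t * a) * (f y * b) ≈ t * f y * (a * b)
    step a b = solve 4 (λ t f a b → (t :* a) :* (f :* b) := t :* f :* (a :* b)) refl t (f y) a b
      where open SemiringSolver commutativeSemiring
    zero-term : t * f y * (t ^ n * f y ^ suc n) ≈ 0#
    zero-term = trans (sym (step (t ^ n) (f y ^ suc n))) (trans (*-congʳ t^1+n≈0) (zeroˡ _))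

  vf′ : ∀ y → v y * f′ y ≈ 1# + t * f′ y
  vf′ y = begin
    v y * f′ y                            ≈⟨ *-congˡ (f′-fix y) ⟩
    v y * (f y + t * f y * f′ y)          ≈⟨ solve 4 (λ v f t g → v :* (f :+ t :* f :* g) := (v :* f) :* (con 1 :+ t :* g)) refl (v y) (f y) t (f′ y) ⟩
    (v y * f y) * (1# + t * f′ y)         ≈⟨ trans (*-congʳ (vf≈1 y)) (*-identityˡ _) ⟩
    1# + t * f′ y                         ∎
    where open SemiringSolver commutativeSemiring

  -- Subtracting t turns t - (a + 1) into - (a + 1), and a + 1 into - (t - (a + 1)). So `f′` is
  -- minus `f` at the opposite place, in this lemma and in `f′-neg`.
  f′-pos : ∀ a → f′ (pos a) ≈ s a
  f′-pos a = cancel refl (begin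
    f′ (pos a) + t * (f′ (pos a) * s a)   ≈⟨ solve 3 (λ t x y → x :+ t :* (x :* y) := x :* (con 1 :+ t :* y)) refl t (f′ (pos a)) (s a) ⟩
    f′ (pos a) * (1# + t * s a)           ≈⟨ *-congˡ (ιs≈1+ts a) ⟨
    f′ (pos a) * (ι a * s a)              ≈⟨ solve 3 (λ i x y → x :* (i :* y) := (i :* x) :* y) refl (ι a) (f′ (pos a)) (s a) ⟩
    (ι a * f′ (pos a)) * s a              ≈⟨ *-congʳ (vf′ (pos a)) ⟩
    (1# + t * f′ (pos a)) * s a           ≈⟨ solve 3 (λ t x y → (con 1 :+ t :* x) :* y := y :+ t :* (x :* y)) refl t (f′ (pos a)) (s a) ⟩
    s a + t * (f′ (pos a) * s a)          ∎)
    where open SemiringSolver commutativeSemiring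

  f′-neg : ∀ a → f′ (neg a) ≈ - h a
  f′-neg a = cancel (-‿inverseˡ (h a)) (begin
    y + (- h a + h a)          ≈⟨ +-cong (trans (sym (*-identityˡ y)) (*-congʳ (sym (ιh≈1 a)))) refl ⟩
    ι a * h a * y + (- h a + h a)
      ≈⟨ solve 4 (λ i h y m → i :* h :* y :+ (m :+ h) := m :+ h :* (i :* y :+ con 1)) refl (ι a) (h a) y (- h a) ⟩
    - h a + h a * (ι a * y + 1#)
      ≈⟨ +-congˡ (trans (*-congˡ ιy+1≈0) (zeroʳ _)) ⟩
    - h a + 0#                 ∎)
    where
    open SemiringSolver commutativeSemiring
    y = f′ (neg a)
    ιy+1≈0 : ι a * y + 1# ≈ 0#
    ιy+1≈0 = cancel {l = - ι a * y + t * y} {r = 1# + t * y} (trans (sym (distribʳ _ _ _)) (vf′ (neg a))) (begin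
      (ι a * y + 1#) + (- ι a * y + t * y)    ≈⟨ solve 4 (λ i m y x → (i :* y :+ con 1) :+ (m :* y :+ x) := (i :+ m) :* y :+ (con 1 :+ x)) refl (ι a) (- ι a) y (t * y) ⟩
      (ι a + - ι a) * y + (1# + t * y)        ≈⟨ +-congʳ (trans (*-congʳ (-‿inverseʳ _)) (zeroˡ y)) ⟩
      0# + (1# + t * y)                       ∎)

  RHS : ℕ⁺ → Index → Carrier
  RHS k ks = Σ< (suc n) (λ j → t ^ j * (S ((k ⊕ j ⊕ 1) ∷ ks) + S ((1+ j) ∷ ks ∷ʳ k))) + S (ks ∷ʳ (k ⊕ 1))

  f′₁ Lf′ f₂ : Place → Series
  f′₁ a _ = f′ a
  Lf′ a _ = L f′ a
  f₂ _ b  = f b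

  RHS-sum : ∀ k ks → RHS k ks ≈ (CE (k ∷ ks) f′₁ + CE (ks ∷ʳ k) Lf′) + CE (ks ∷ʳ k) f₂
  RHS-sum k ks = +-cong (begin
    Σ< (suc n) (λ j → t ^ j * (S ((k ⊕ j ⊕ 1) ∷ ks) + S ((1+ j) ∷ ks ∷ʳ k)))
      ≈⟨ trans (Σ-cong′ (suc n) (λ j → distribˡ _ _ _)) (Σ-+ (suc n) _ _) ⟩
    Σ< (suc n) (λ j → t ^ j * S ((k ⊕ j ⊕ 1) ∷ ks)) + Σ< (suc n) (λ j → t ^ j * S ((1+ j) ∷ ks ∷ʳ k))
      ≈⟨ +-cong
          (trans (Σ-cong′ (suc n) (λ j → trans (*-congˡ (S-bump-first k ks j)) (sym (CE-*ˡ (k ∷ ks) _ _)))) (sym (CE-Σ (k ∷ ks) (suc n) _)))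
          (trans (Σ-cong′ (suc n) (λ j → trans (*-congˡ (S-cons (1+ j) (ks ∷ʳ k) (∷ʳ≢[] ks k))) (sym (CE-*ˡ (ks ∷ʳ k) _ _)))) (sym (CE-Σ (ks ∷ʳ k) (suc n) _))) ⟩
    CE (k ∷ ks) f′₁ + CE (ks ∷ʳ k) (λ a _ → Σ< (suc n) (λ j → t ^ j * L (λ y → f y ^ suc j) a))
      ≈⟨ +-congˡ (CE-cong (ks ∷ʳ k) (λ a _ _ _ _ → trans (Σ-cong′ (suc n) (λ j → sym (L-*ˡ a _ _))) (sym (L-Σ a (suc n) _)))) ⟩
    CE (k ∷ ks) f′₁ + CE (ks ∷ʳ k) Lf′ ∎)
    (S-bump-last ks k)

  -- The weights of the right side together with `Uf`, once all summands refer to the same rotation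
  -- of the index.
  V : Place → Series
  V a b = ((f′ a + L f′ a) + f b) + U f b

  -- The reciprocals just below and just above the bound N that remain because the ranges of the
  -- telescoping sums are shifted against each other by `x`.
  ε : ℕ → Carrier
  ε x = Σ< x (λ i → h (N ℕ.∸ suc i)) + Σ< x (λ i → s (N ℕ.+ i))

  e⁺ e⁻ : Place → Series
  e⁺ (pos a) (pos b) = ε (suc a)
  e⁺ (pos a) (neg b) = 0#
  e⁺ (neg a) b       = 0#
  e⁻ (pos a) b       = 0#
  e⁻ (neg a) (pos b) = 0#
  e⁻ (neg a) (neg b) = ε (suc b)

  H G : ℕ → Carrier
  H n = Σ< n h
  G n = Σ< n s

  -s : ℕ → Carrier
  -s i = - s i

  f′-sum : ∀ a → f′ (pos a) + Σ< a (λ i → f′ (pos i)) ≈ G (suc a)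
  f′-sum a = trans (+-comm _ _) (Σ-cong′ (suc a) f′-pos)

  -- Every term is a sum of `h` or `s` over an interval. The equations `r₁` to `r₇` complete the
  -- intervals to initial sums `H` and `G`, after which both sides contain the same terms. The error
  -- arises in `r₂` and `r₇`, where the completed range meets the bound N.
  pos-pos : ∀ a b → a ℕ.≤ b → b ℕ.< N →
    gA (pos a) (pos b) + ε (suc a) ≈ (gB (pos a) (pos b) + V (pos a) (pos b)) + 0#
  pos-pos a b a≤b b<N = cancel
    (+-cong (sym r₁) (+-cong (sym r₂) (+-cong r₃ (+-cong r₄ (+-cong (sym r₅) (+-cong r₆ r₇))))))
    (trans (solve 16 (λ Y X⁻ E₁ E₂ Hx HN Hd Z Hb hb T n⁻ GN Gx X o →
        ((Y :+ X⁻) :+ (E₁ :+ E₂)) :+ (Hx :+ (HN :+ ((Hd :+ Z) :+ (((Hb :+ hb) :+ T) :+ (o :+ ((n⁻ :+ GN) :+ (Gx :+ X)))))))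
        := ((Z :+ ((Gx :+ hb) :+ (T :+ n⁻))) :+ o) :+ ((Hd :+ Y) :+ ((Hx :+ E₁) :+ (Hb :+ (HN :+ ((X⁻ :+ X) :+ (con 0 :+ (GN :+ E₂))))))))
      refl Y X⁻ E₁ E₂ (H (N ℕ.∸ suc a)) (H N) (H (b ℕ.∸ a)) Zb (H b) (h b) (Σ> N b h) (Σ< N -s) (G N) (G (suc a)) X 0#)
      (+-congʳ (+-congʳ (+-congˡ (+-congʳ (+-congʳ (sym (f′-sum a))))))))
    where
    open SemiringSolver commutativeSemiring
    Y = Σ> N b (λ c → h (c ℕ.∸ suc a))
    X⁻ = Σ< N (λ i → - s (suc (a ℕ.+ i)))
    X = Σ< N (λ i → s (suc (a ℕ.+ i)))
    E₁ = Σ< (suc a) (λ i → h (N ℕ.∸ suc i))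
    E₂ = Σ< (suc a) (λ i → s (N ℕ.+ i))
    Zb = Σ< a (λ m → h (b ℕ.∸ suc m))
    r₁ : H (b ℕ.∸ a) + Y ≈ H (N ℕ.∸ suc a)
    r₁ = begin
      H (b ℕ.∸ a) + Y
        ≈⟨ +-congˡ (Σ-cong′ (N ℕ.∸ suc b) (λ i → reflexive (≡.cong h (ℕ.+-∸-comm i a≤b)))) ⟩
      H (b ℕ.∸ a) + Σ< (N ℕ.∸ suc b) (λ i → h ((b ℕ.∸ a) ℕ.+ i))
        ≈⟨ Σ-split (b ℕ.∸ a) (N ℕ.∸ suc b) h ⟨
      H ((b ℕ.∸ a) ℕ.+ (N ℕ.∸ suc b))
        ≡⟨ ≡.cong H (≡.trans (≡.sym (ℕ.+-∸-comm (N ℕ.∸ suc b) a≤b)) (≡.cong (ℕ._∸ suc a) (ℕ.m+[n∸m]≡n b<N))) ⟩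
      H (N ℕ.∸ suc a) ∎
    r₂ = Σ-rev (suc a) N h (ℕ.<-≤-trans (ℕ.s≤s a≤b) b<N)
    r₃ = Σ-rev a b h a≤b
    r₄ = sym (Σ>-split N b h b<N)
    r₅ = Σ-neg N (λ i → s (suc (a ℕ.+ i)))
    r₆ = Σ-neg N s
    r₇ : G (suc a) + X ≈ G N + E₂
    r₇ = trans (sym (Σ-split (suc a) N s)) (trans (reflexive (≡.cong G (ℕ.+-comm (suc a) N))) (Σ-split N (suc a) s))

  pos-neg : ∀ a b → gA (pos a) (neg b) + 0# ≈ (gB (pos a) (neg b) + V (pos a) (neg b)) + 0#
  pos-neg a b = cancel
    (+-cong (sym r₁) (+-cong r₂ (+-cong r₃ r₄)))
    (trans (solve 9 (λ X₁⁻ X₁ X₂⁻ X₂ Ga Gb sb nb o →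
        (X₁⁻ :+ o) :+ (o :+ ((X₂⁻ :+ X₂) :+ ((Ga :+ X₁) :+ ((nb :+ sb) :+ Gb))))
        := ((X₂⁻ :+ ((Ga :+ sb) :+ nb)) :+ o) :+ ((X₁⁻ :+ X₁) :+ (con 0 :+ ((Gb :+ X₂) :+ o))))
      refl X₁⁻ X₁ X₂⁻ X₂ (G (suc a)) (G (suc b)) (- s b) (Σ< b -s) 0#)
      (+-congʳ (+-congʳ (+-congˡ (+-congʳ (+-congʳ (sym (f′-sum a))))))))
    where
    open SemiringSolver commutativeSemiring
    X₁⁻ = Σ< b (λ i → - s (suc (a ℕ.+ i)))
    X₁  = Σ< b (λ i → s (suc (a ℕ.+ i)))
    X₂⁻ = Σ< a (λ i → - s (suc (i ℕ.+ b)))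
    X₂  = Σ< a (λ i → s (suc (i ℕ.+ b)))
    r₁ = Σ-neg b (λ i → s (suc (a ℕ.+ i)))
    r₂ = Σ-neg a (λ i → s (suc (i ℕ.+ b)))
    r₃ : G (suc a) + X₁ ≈ G (suc b) + X₂
    r₃ = begin
      G (suc a) + X₁                                  ≈⟨ Σ-split (suc a) b s ⟨
      G (suc a ℕ.+ b)                                 ≡⟨ ≡.cong (λ m → G (suc m)) (ℕ.+-comm a b) ⟩
      G (suc b ℕ.+ a)                                 ≈⟨ Σ-split (suc b) a s ⟩
      G (suc b) + Σ< a (λ i → s (suc (b ℕ.+ i)))      ≈⟨ +-congˡ (Σ-cong′ a (λ i → reflexive (≡.cong (λ m → s (suc m)) (ℕ.+-comm b i)))) ⟩
      G (suc b) + X₂                                  ∎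
    r₄ : (Σ< b -s + - s b) + G (suc b) ≈ 0#
    r₄ = Σ-neg (suc b) s

  neg-neg : ∀ a b → b ℕ.≤ a → a ℕ.< N →
    gA (neg a) (neg b) + 0# ≈ (gB (neg a) (neg b) + V (neg a) (neg b)) + ε (suc b)
  neg-neg a b b≤a a<N = cancel
    (+-cong (sym r₁) (+-cong r₂ (+-cong r₃ (+-cong r₄ (+-cong (sym r₅) (+-cong r₆ (+-cong (sym r₇) r₈)))))))
    (trans (solve 19 (λ A Ha Hd M Hx E₁ X₂⁻ X₂ GN E₂ sb nb Gb HN T⁻ T na ha o →
        (A :+ o) :+ (Ha :+ ((Hd :+ M) :+ ((Hx :+ E₁) :+ ((X₂⁻ :+ X₂) :+ ((GN :+ E₂) :+ (((nb :+ sb) :+ Gb) :+ (HN :+ ((T⁻ :+ T) :+ (na :+ ha)))))))))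
        := ((X₂⁻ :+ M) :+ (((na :+ (GN :+ T⁻)) :+ sb) :+ nb)) :+ (E₁ :+ E₂)
           :+ ((Hd :+ A) :+ (Hx :+ (HN :+ (con 0 :+ ((Gb :+ X₂) :+ (con 0 :+ (((Ha :+ ha) :+ T) :+ o))))))))
      refl A (H a) (H (a ℕ.∸ b)) M (H (N ℕ.∸ suc b)) E₁ X₂⁻ X₂ (G N) E₂ (- s b) (Σ< b -s) (G (suc b)) (H N)
        (Σ> N a (λ i → - h i)) (Σ> N a h) (- h a) (h a) 0#)
      (+-congʳ (+-congʳ (+-congˡ (+-congʳ (+-congʳ (+-cong (sym (f′-neg a))
        (+-cong (Σ-cong′ N (λ i → sym (f′-pos i))) (Σ-cong′ (N ℕ.∸ suc a) (λ i → sym (f′-neg _)))))))))))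
    where
    open SemiringSolver commutativeSemiring
    A = Σ< b (λ i → h (a ℕ.∸ suc i))
    M = Σ> N a (λ m → h (m ℕ.∸ suc b))
    X₂⁻ = Σ< N (λ i → - s (suc (i ℕ.+ b)))
    X₂  = Σ< N (λ i → s (suc (i ℕ.+ b)))
    E₁ = Σ< (suc b) (λ i → h (N ℕ.∸ suc i))
    E₂ = Σ< (suc b) (λ i → s (N ℕ.+ i))
    r₁ = Σ-rev b a h b≤a
    r₂ : H (a ℕ.∸ b) + M ≈ H (N ℕ.∸ suc b)
    r₂ = begin
      H (a ℕ.∸ b) + M
        ≈⟨ +-congˡ (Σ-cong′ (N ℕ.∸ suc a) (λ i → reflexive (≡.cong h (ℕ.+-∸-comm i b≤a)))) ⟩
      H (a ℕ.∸ b) + Σ< (N ℕ.∸ suc a) (λ i → h ((a ℕ.∸ b) ℕ.+ i))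
        ≈⟨ Σ-split (a ℕ.∸ b) (N ℕ.∸ suc a) h ⟨
      H ((a ℕ.∸ b) ℕ.+ (N ℕ.∸ suc a))
        ≡⟨ ≡.cong H (≡.trans (≡.sym (ℕ.+-∸-comm (N ℕ.∸ suc a) b≤a)) (≡.cong (ℕ._∸ suc b) (ℕ.m+[n∸m]≡n a<N))) ⟩
      H (N ℕ.∸ suc b) ∎
    r₃ = Σ-rev (suc b) N h (ℕ.<-≤-trans (ℕ.s≤s b≤a) a<N)
    r₄ = Σ-neg N (λ i → s (suc (i ℕ.+ b)))
    r₅ : G (suc b) + X₂ ≈ G N + E₂
    r₅ = begin
      G (suc b) + X₂                                ≈⟨ +-congˡ (Σ-cong′ N (λ i → reflexive (≡.cong (λ m → s (suc m)) (ℕ.+-comm i b)))) ⟩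
      G (suc b) + Σ< N (λ i → s (suc b ℕ.+ i))      ≈⟨ Σ-split (suc b) N s ⟨
      G (suc b ℕ.+ N)                               ≡⟨ ≡.cong G (ℕ.+-comm (suc b) N) ⟩
      G (N ℕ.+ suc b)                               ≈⟨ Σ-split N (suc b) s ⟩
      G N + E₂                                      ∎
    r₆ : (Σ< b -s + - s b) + G (suc b) ≈ 0#
    r₆ = Σ-neg (suc b) s
    r₇ = sym (Σ>-split N a h a<N)
    r₈ : (Σ> N a (λ i → - h i) + Σ> N a h) + (- h a + h a) ≈ 0#
    r₈ = trans (+-cong (Σ-neg (N ℕ.∸ suc a) _) (-‿inverseˡ _)) (+-identityʳ 0#)

  -- The case `a ≡ b` belongs to indices of length one, where the first and the last variable
  -- coincide.
  gA-gB : ∀ a b → ∣ a ∣ₚ ℕ.< N → a ≡ b ⊎ a ≺ b → ∣ b ∣ₚ ℕ.< N →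
    gA a b + e⁺ a b ≈ (gB a b + V a b) + e⁻ a b
  gA-gB (pos a) (pos b)  a<N (inj₂ a<b)    b<N = pos-pos a b (ℕ.<⇒≤ a<b) b<N
  gA-gB (pos a) .(pos a) a<N (inj₁ ≡.refl) b<N = pos-pos a a ℕ.≤-refl b<N
  gA-gB (pos a) (neg b)  a<N (inj₂ _)      b<N = pos-neg a b
  gA-gB (neg a) (neg b)  a<N (inj₂ b<a)    b<N = neg-neg a b (ℕ.<⇒≤ b<a) a<N
  gA-gB (neg a) .(neg a) a<N (inj₁ ≡.refl) b<N = neg-neg a a ℕ.≤-refl a<N

  -- ∑ over the rotations of p ++ q that start in q.
  rot : (ℕ⁺ → Index → Carrier) → Index → Index → Carrier
  rot G p []      = 0#
  rot G p (k ∷ q) = G k (q ++ p) + rot G (p ∷ʳ k) q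

  rot-cong : ∀ {G G′} → (∀ k ks → G k ks ≈ G′ k ks) → ∀ p q → rot G p q ≈ rot G′ p q
  rot-cong e p []      = refl
  rot-cong e p (k ∷ q) = +-cong (e k (q ++ p)) (rot-cong e (p ∷ʳ k) q)

  rot-+ : ∀ G G′ p q → rot (λ k ks → G k ks + G′ k ks) p q ≈ rot G p q + rot G′ p q
  rot-+ G G′ p []      = sym (+-identityʳ 0#)
  rot-+ G G′ p (k ∷ q) = trans (+-congˡ (rot-+ G G′ (p ∷ʳ k) q)) (+-exchange _ _ _ _)

  -- Both sides run over all rotations, one of them a step ahead. In `go` the difference is a
  -- boundary term at either end, and after a full turn both boundary terms are `F k`.
  rot-shift : ∀ (F : Index → Carrier) k → rot (λ k ks → F (ks ∷ʳ k)) [] k ≈ rot (λ k ks → F (k ∷ ks)) [] k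
  rot-shift F k = cancel (reflexive (≡.cong F (++-identityʳ k))) (go [] k)
    where
    go : ∀ p q → rot (λ k ks → F (ks ∷ʳ k)) p q + F (q ++ p) ≈ rot (λ k ks → F (k ∷ ks)) p q + F (p ++ q)
    go p []      = +-congˡ (reflexive (≡.cong F (≡.sym (++-identityʳ p))))
    go p (k ∷ q) = begin
      (F ((q ++ p) ∷ʳ k) + rot _ (p ∷ʳ k) q) + F (k ∷ q ++ p)
        ≈⟨ solve 3 (λ x y z → (x :+ y) :+ z := z :+ (y :+ x)) refl _ _ _ ⟩
      F (k ∷ q ++ p) + (rot _ (p ∷ʳ k) q + F ((q ++ p) ∷ʳ k))
        ≈⟨ +-congˡ (trans (+-congˡ (reflexive (≡.cong F (++-assoc q p (k ∷ []))))) (go (p ∷ʳ k) q)) ⟩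
      F (k ∷ q ++ p) + (rot _ (p ∷ʳ k) q + F ((p ∷ʳ k) ++ q))
        ≈⟨ trans (sym (+-assoc _ _ _)) (+-congˡ (reflexive (≡.cong F (++-assoc p (k ∷ []) q)))) ⟩
      (F (k ∷ q ++ p) + rot _ (p ∷ʳ k) q) + F (p ++ k ∷ q) ∎
      where open SemiringSolver commutativeSemiring

  -- `LHS-sum` has `gA` at `k ∷ ks` but `gB` at `ks ∷ʳ k`. Summing over rotations allows `rot-shift`
  -- to move all weights to `k ∷ ks`, where `gA-gB` compares them.
  cyclic-sum : ∀ k → rot LHS [] k + rot (λ k ks → CE (k ∷ ks) e⁺) [] k ≈ rot RHS [] k + rot (λ k ks → CE (k ∷ ks) e⁻) [] k
  cyclic-sum κ = cancel refl (begin
    (rot LHS [] κ + C e⁺) + (C Uf + C gB)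
      ≈⟨ solve 4 (λ l e u g → (l :+ e) :+ (u :+ g) := (l :+ (u :+ g)) :+ e) refl (rot LHS [] κ) (C e⁺) (C Uf) (C gB) ⟩
    (rot LHS [] κ + (C Uf + C gB)) + C e⁺
      ≈⟨ +-congʳ (trans (+-congˡ (trans (+-congˡ (sym (rot-shift (λ κ → CE κ gB) κ))) (sym (rot-+ _ _ [] κ)))) (sym (rot-+ _ _ [] κ))) ⟩
    rot (λ k ks → LHS k ks + (CE (k ∷ ks) Uf + CE (ks ∷ʳ k) gB)) [] κ + C e⁺
      ≈⟨ +-congʳ (rot-cong LHS-sum [] κ) ⟩
    C gA + C e⁺
      ≈⟨ rot-+ _ _ [] κ ⟨
    rot (λ k ks → CE (k ∷ ks) gA + CE (k ∷ ks) e⁺) [] κ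
      ≈⟨ rot-cong (λ k ks → begin
           CE (k ∷ ks) gA + CE (k ∷ ks) e⁺                                ≈⟨ CE-+ (k ∷ ks) gA e⁺ ⟨
           CE (k ∷ ks) (λ a b → gA a b + e⁺ a b)                          ≈⟨ CE-cong (k ∷ ks) gA-gB ⟩
           CE (k ∷ ks) (λ a b → (gB a b + V a b) + e⁻ a b)                ≈⟨ trans (CE-+ (k ∷ ks) _ e⁻) (+-congʳ (CE-+ (k ∷ ks) gB V)) ⟩
           (CE (k ∷ ks) gB + CE (k ∷ ks) V) + CE (k ∷ ks) e⁻              ≈⟨ +-congʳ (+-congˡ (trans (CE-+ (k ∷ ks) _ Uf)
                                                                              (+-congʳ (trans (CE-+ (k ∷ ks) _ f₂) (+-congʳ (CE-+ (k ∷ ks) f′₁ Lf′)))))) ⟩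
           (CE (k ∷ ks) gB + (((CE (k ∷ ks) f′₁ + CE (k ∷ ks) Lf′) + CE (k ∷ ks) f₂) + CE (k ∷ ks) Uf)) + CE (k ∷ ks) e⁻ ∎) [] κ ⟩
    rot (λ k ks → (CE (k ∷ ks) gB + (((CE (k ∷ ks) f′₁ + CE (k ∷ ks) Lf′) + CE (k ∷ ks) f₂) + CE (k ∷ ks) Uf)) + CE (k ∷ ks) e⁻) [] κ
      ≈⟨ trans (rot-+ _ _ [] κ) (+-congʳ (trans (rot-+ _ _ [] κ) (+-congˡ (trans (rot-+ _ _ [] κ) (+-congʳ
           (trans (rot-+ _ _ [] κ) (+-congʳ (rot-+ _ _ [] κ)))))))) ⟩
    (C gB + (((C f′₁ + C Lf′) + C f₂) + C Uf)) + C e⁻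
      ≈⟨ solve 4 (λ g r u e → (g :+ (r :+ u)) :+ e := (r :+ e) :+ (u :+ g)) refl (C gB) ((C f′₁ + C Lf′) + C f₂) (C Uf) (C e⁻) ⟩
    (((C f′₁ + C Lf′) + C f₂) + C e⁻) + (C Uf + C gB)
      ≈⟨ +-congʳ (+-congʳ rot-RHS) ⟨
    (rot RHS [] κ + C e⁻) + (C Uf + C gB) ∎)
    where
    open SemiringSolver commutativeSemiring
    C : (Place → Series) → Carrier
    C g = rot (λ k ks → CE (k ∷ ks) g) [] κ
    rot-RHS : rot RHS [] κ ≈ (C f′₁ + C Lf′) + C f₂
    rot-RHS = begin
      rot RHS [] κ
        ≈⟨ rot-cong RHS-sum [] κ ⟩
      rot (λ k ks → (CE (k ∷ ks) f′₁ + CE (ks ∷ʳ k) Lf′) + CE (ks ∷ʳ k) f₂) [] κ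
        ≈⟨ trans (rot-+ _ _ [] κ) (+-congʳ (rot-+ _ _ [] κ)) ⟩
      (C f′₁ + rot (λ k ks → CE (ks ∷ʳ k) Lf′) [] κ) + rot (λ k ks → CE (ks ∷ʳ k) f₂) [] κ
        ≈⟨ +-cong (+-congˡ (rot-shift (λ κ → CE κ Lf′) κ)) (rot-shift (λ κ → CE κ f₂) κ) ⟩
      (C f′₁ + C Lf′) + C f₂ ∎

open import Data.Rational.Base using (_+_; _*_; _-_; -_; _≤_; _<_; ∣_∣)
open import Relation.Binary.PropositionalEquality using (_≢_; refl; sym; trans; cong; cong₂; subst; subst₂; module ≡-Reasoning)
open RawSemiring ℚ.+-*-rawSemiring using (_^_)
open Exp (CommutativeRing.semiring ℚ.+-*-commutativeRing) using (^-homo-*)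
open GroupProperties ℚ.+-0-group using () renaming (∙-cancelˡ to +-cancelˡ)
open Convergence
  using (u; 0≤u; u-step; toℚᵘ-u; Vanishing; vanishing-+; vanishing-scale; vanishing-mean; u-vanishing; u-anti; u≤1; u≤2u;
         *-nonneg; *-mono-nonneg; ≤-+ʳ; ∑<-nonneg; pow-nonneg; pow≤u; pow≤1)
open Sums ℚ.+-*-commutativeRing ∑< (λ _ → refl) (λ _ _ → refl)

-- Sums over the antidiagonal i + j = n

anti : (ℕ → ℕ → ℚ) → ℕ → ℚ
anti F zero    = F 0 0
anti F (suc n) = F 0 (suc n) + anti (λ i → F (suc i)) n

anti-cong : ∀ n {F G} → (∀ i j → i ℕ.+ j ≡ n → F i j ≡ G i j) → anti F n ≡ anti G n
anti-cong zero    e = e 0 0 refl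
anti-cong (suc n) e = cong₂ _+_ (e 0 (suc n) refl) (anti-cong n (λ i j i+j → e (suc i) j (cong suc i+j)))

anti-cong′ : ∀ n {F G} → (∀ i j → F i j ≡ G i j) → anti F n ≡ anti G n
anti-cong′ n e = anti-cong n (λ i j _ → e i j)

anti-0 : ∀ n → anti (λ _ _ → 0ℚ) n ≡ 0ℚ
anti-0 zero    = refl
anti-0 (suc n) = trans (ℚ.+-identityˡ _) (anti-0 n)

anti-+ : ∀ n F G → anti (λ i j → F i j + G i j) n ≡ anti F n + anti G n
anti-+ zero    F G = refl
anti-+ (suc n) F G = trans (cong (F 0 (suc n) + G 0 (suc n) +_) (anti-+ n (λ i → F (suc i)) (λ i → G (suc i))))
  (+-exchange (F 0 (suc n)) (G 0 (suc n)) _ _)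

anti-*ˡ : ∀ n c F → anti (λ i j → c * F i j) n ≡ c * anti F n
anti-*ˡ zero    c F = refl
anti-*ˡ (suc n) c F = trans (cong (c * F 0 (suc n) +_) (anti-*ˡ n c _)) (sym (ℚ.*-distribˡ-+ c _ _))

anti-*ʳ : ∀ n c F → anti (λ i j → F i j * c) n ≡ anti F n * c
anti-*ʳ n c F = trans (anti-cong′ n (λ i j → ℚ.*-comm (F i j) c)) (trans (anti-*ˡ n c F) (ℚ.*-comm c _))

anti-∑ : ∀ n m (F : ℕ → ℕ → ℕ → ℚ) → anti (λ i j → ∑< m (λ a → F a i j)) n ≡ ∑< m (λ a → anti (F a) n)
anti-∑ n zero    F = anti-0 n
anti-∑ n (suc m) F = trans (anti-+ n _ _) (cong (_+ anti (F m) n) (anti-∑ n m F))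

anti-last : ∀ n F → anti F (suc n) ≡ anti (λ i j → F i (suc j)) n + F (suc n) 0
anti-last zero    F = refl
anti-last (suc n) F = trans (cong (F 0 (suc (suc n)) +_) (anti-last n (λ i → F (suc i))))
  (sym (ℚ.+-assoc (F 0 (suc (suc n))) _ (F (suc (suc n)) 0)))

anti-comm : ∀ n F → anti F n ≡ anti (λ i j → F j i) n
anti-comm zero    F = refl
anti-comm (suc n) F = trans (anti-last n F)
  (trans (ℚ.+-comm _ (F (suc n) 0)) (cong (F (suc n) 0 +_) (anti-comm n (λ i j → F i (suc j)))))

anti-assoc : ∀ n (F : ℕ → ℕ → ℕ → ℚ) →
  anti (λ m l → anti (λ i j → F i j l) m) n ≡ anti (λ i m → anti (λ j l → F i j l) m) n
anti-assoc zero    F = refl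
anti-assoc (suc n) F = begin
  F 0 0 (suc n) + anti (λ m l → F 0 (suc m) l + anti (λ i j → F (suc i) j l) m) n
    ≡⟨ cong (F 0 0 (suc n) +_) (trans (anti-+ n _ _) (cong (anti (λ m l → F 0 (suc m) l) n +_) (anti-assoc n (λ i → F (suc i))))) ⟩
  F 0 0 (suc n) + (anti (λ m l → F 0 (suc m) l) n + anti (λ i m → anti (λ j l → F (suc i) j l) m) n)
    ≡⟨ ℚ.+-assoc (F 0 0 (suc n)) _ _ ⟨
  anti (λ j l → F 0 j l) (suc n) + anti (λ i m → anti (λ j l → F (suc i) j l) m) n ∎
  where open ≡-Reasoning

anti-as-∑ : ∀ n F → anti F n ≡ ∑< (suc n) (λ i → F i (n ℕ.∸ i))
anti-as-∑ zero    F = sym (ℚ.+-identityˡ _)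
anti-as-∑ (suc n) F = trans (cong (F 0 (suc n) +_) (anti-as-∑ n (λ i → F (suc i)))) (sym (Σ-front (suc n) _))

∑-anti : ∀ n F → ∑< (suc n) (anti F) ≡ ∑< (suc n) (λ i → ∑< (suc (n ℕ.∸ i)) (F i))
∑-anti zero    F = cong (0ℚ +_) (sym (ℚ.+-identityˡ (F 0 0)))
∑-anti (suc n) F = begin
  ∑< (suc (suc n)) (anti F)
    ≡⟨ Σ-front (suc n) (anti F) ⟩
  F 0 0 + ∑< (suc n) (λ m → F 0 (suc m) + anti (λ i → F (suc i)) m)
    ≡⟨ cong (F 0 0 +_) (Σ-+ (suc n) _ _) ⟩
  F 0 0 + (∑< (suc n) (λ m → F 0 (suc m)) + ∑< (suc n) (anti (λ i → F (suc i))))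
    ≡⟨ ℚ.+-assoc (F 0 0) _ _ ⟨
  F 0 0 + ∑< (suc n) (λ m → F 0 (suc m)) + ∑< (suc n) (anti (λ i → F (suc i)))
    ≡⟨ cong₂ _+_ (sym (Σ-front (suc n) (F 0))) (∑-anti n (λ i → F (suc i))) ⟩
  ∑< (suc (suc n)) (F 0) + ∑< (suc n) (λ i → ∑< (suc (n ℕ.∸ i)) (F (suc i)))
    ≡⟨ Σ-front (suc n) _ ⟨
  ∑< (suc (suc n)) (λ i → ∑< (suc (suc n ℕ.∸ i)) (F i)) ∎
  where open ≡-Reasoning

-- Formal power series over ℚ

ℚ[[t]] : Set
ℚ[[t]] = ℕ → ℚ

infixl 7 _⋆_
_⋆_ : ℚ[[t]] → ℚ[[t]] → ℚ[[t]]
f ⋆ g = anti (λ i j → f i * g j)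

δ₀ : ℚ[[t]]
δ₀ zero    = 1ℚ
δ₀ (suc _) = 0ℚ

⋆-comm : ∀ f g n → (f ⋆ g) n ≡ (g ⋆ f) n
⋆-comm f g n = trans (anti-comm n _) (anti-cong′ n (λ i j → ℚ.*-comm (f j) (g i)))

⋆-assoc : ∀ f g k n → (f ⋆ g ⋆ k) n ≡ (f ⋆ (g ⋆ k)) n
⋆-assoc f g k n = begin
  anti (λ m l → anti (λ i j → f i * g j) m * k l) n     ≡⟨ anti-cong′ n (λ m l → sym (anti-*ʳ m (k l) _)) ⟩
  anti (λ m l → anti (λ i j → f i * g j * k l) m) n     ≡⟨ anti-assoc n (λ i j l → f i * g j * k l) ⟩
  anti (λ i m → anti (λ j l → f i * g j * k l) m) n     ≡⟨ anti-cong′ n (λ i m → trans (anti-cong′ m (λ j l → ℚ.*-assoc (f i) (g j) (k l))) (anti-*ˡ m (f i) _)) ⟩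
  anti (λ i m → f i * anti (λ j l → g j * k l) m) n     ∎
  where open ≡-Reasoning

⋆-distribˡ : ∀ f g k n → (f ⋆ (λ i → g i + k i)) n ≡ (f ⋆ g) n + (f ⋆ k) n
⋆-distribˡ f g k n = trans (anti-cong′ n (λ i j → ℚ.*-distribˡ-+ (f i) (g j) (k j))) (anti-+ n _ _)

⋆-distribʳ : ∀ f g k n → ((λ i → g i + k i) ⋆ f) n ≡ (g ⋆ f) n + (k ⋆ f) n
⋆-distribʳ f g k n = trans (anti-cong′ n (λ i j → ℚ.*-distribʳ-+ (f j) (g i) (k i))) (anti-+ n _ _)

⋆-scalar : ∀ f g → (∀ i → f (suc i) ≡ 0ℚ) → ∀ n → (f ⋆ g) n ≡ f 0 * g n
⋆-scalar f g e zero    = refl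
⋆-scalar f g e (suc n) = trans (cong (f 0 * g (suc n) +_)
  (trans (anti-cong′ n (λ i j → trans (cong (_* g j) (e i)) (ℚ.*-zeroˡ (g j)))) (anti-0 n))) (ℚ.+-identityʳ _)

⋆-identityˡ : ∀ f n → (δ₀ ⋆ f) n ≡ f n
⋆-identityˡ f n = trans (⋆-scalar δ₀ f (λ _ → refl) n) (ℚ.*-identityˡ (f n))

-- The ring ℚ[[t]]/(t^{n+1}): equality sees the coefficients up to `n` only. This makes `τ`
-- nilpotent, so that the infinite sum over j ends at `n`.
module Truncated (n : ℕ) where

  infix 4 _≈_
  _≈_ : ℚ[[t]] → ℚ[[t]] → Set
  f ≈ g = ∀ i → i ℕ.≤ n → f i ≡ g i

  ring : CommutativeRing 0ℓ 0ℓ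
  ring = record
    { Carrier = ℚ[[t]]
    ; _≈_ = _≈_
    ; _+_ = λ f g i → f i + g i
    ; _*_ = _⋆_
    ; -_ = λ f i → - f i
    ; 0# = λ _ → 0ℚ
    ; 1# = δ₀
    ; isCommutativeRing = record
      { isRing = record
        { +-isAbelianGroup = record
          { isGroup = record
            { isMonoid = record
              { isSemigroup = record
                { isMagma = record
                  { isEquivalence = record
                    { refl = λ _ _ → refl
                    ; sym = λ e i i≤n → sym (e i i≤n)
                    ; trans = λ e e′ i i≤n → trans (e i i≤n) (e′ i i≤n) }
                  ; ∙-cong = λ e e′ i i≤n → cong₂ _+_ (e i i≤n) (e′ i i≤n) }
                ; assoc = λ f g k i _ → ℚ.+-assoc (f i) (g i) (k i) }
              ; identity = (λ f i _ → ℚ.+-identityˡ (f i)) , (λ f i _ → ℚ.+-identityʳ (f i)) }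
            ; inverse = (λ f i _ → ℚ.+-inverseˡ (f i)) , (λ f i _ → ℚ.+-inverseʳ (f i))
            ; ⁻¹-cong = λ e i i≤n → cong -_ (e i i≤n) }
          ; comm = λ f g i _ → ℚ.+-comm (f i) (g i) }
        ; *-cong = λ e e′ i i≤n → anti-cong i (λ a b a+b≡i → cong₂ _*_
            (e a (ℕ.≤-trans (ℕ.m+n≤o⇒m≤o a (ℕ.≤-reflexive a+b≡i)) i≤n))
            (e′ b (ℕ.≤-trans (ℕ.m+n≤o⇒n≤o a (ℕ.≤-reflexive a+b≡i)) i≤n)))
        ; *-assoc = λ f g k i _ → ⋆-assoc f g k i
        ; *-identity = (λ f i _ → ⋆-identityˡ f i) , (λ f i _ → trans (⋆-comm f δ₀ i) (⋆-identityˡ f i))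
        ; distrib = (λ f g k i _ → ⋆-distribˡ f g k i) , (λ f g k i _ → ⋆-distribʳ f g k i) }
      ; *-comm = λ f g i _ → ⋆-comm f g i } }

-- Rational power series for the summands

ν : ℕ → ℚ
ν n = (ℤ.+ n) / 1

toℚᵘ-ν : ∀ n → ℚ.toℚᵘ (ν n) ℚᵘ.≃ ℚᵘ.mkℚᵘ (ℤ.+ n) 0
toℚᵘ-ν n = ℚ.toℚᵘ-fromℚᵘ (ℚᵘ.mkℚᵘ (ℤ.+ n) 0)

ν-+ : ∀ m n → ν (m ℕ.+ n) ≡ ν m + ν n
ν-+ m n = ℚ.toℚᵘ-injective (begin
  ℚ.toℚᵘ (ν (m ℕ.+ n))                        ≈⟨ toℚᵘ-ν (m ℕ.+ n) ⟩
  ℚᵘ.mkℚᵘ (ℤ.+ (m ℕ.+ n)) 0                     ≈⟨ ℚᵘ.*≡* (cong (ℤ._* (ℤ.+ 1)) (cong₂ ℤ._+_ (sym (ℤ.*-identityʳ (ℤ.+ m))) (sym (ℤ.*-identityʳ (ℤ.+ n))))) ⟩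
  ℚᵘ.mkℚᵘ (ℤ.+ m) 0 ℚᵘ.+ ℚᵘ.mkℚᵘ (ℤ.+ n) 0        ≈⟨ ℚᵘ.+-cong (toℚᵘ-ν m) (toℚᵘ-ν n) ⟨
  ℚ.toℚᵘ (ν m) ℚᵘ.+ ℚ.toℚᵘ (ν n)              ≈⟨ ℚ.toℚᵘ-homo-+ (ν m) (ν n) ⟨
  ℚ.toℚᵘ (ν m + ν n)                          ∎)
  where open ℚᵘ.≃-Reasoning

νu≡1 : ∀ a → ν (suc a) * u a ≡ 1ℚ
νu≡1 a = ℚ.toℚᵘ-injective (begin
  ℚ.toℚᵘ (ν (suc a) * u a)                          ≈⟨ ℚ.toℚᵘ-homo-* (ν (suc a)) (u a) ⟩
  ℚ.toℚᵘ (ν (suc a)) ℚᵘ.* ℚ.toℚᵘ (u a)              ≈⟨ ℚᵘ.*-cong (toℚᵘ-ν (suc a)) (toℚᵘ-u a) ⟩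
  ℚᵘ.mkℚᵘ (ℤ.+ suc a) 0 ℚᵘ.* ℚᵘ.mkℚᵘ (ℤ.+ 1) a          ≈⟨ ℚᵘ.*≡* (cong ℤ.+_ (trans (ℕ.*-identityʳ _) (trans (ℕ.*-identityʳ (suc a)) (sym (trans (ℕ.*-identityˡ _) (ℕ.*-identityˡ (suc a))))))) ⟩
  ℚᵘ.1ℚᵘ                                            ∎)
  where open ℚᵘ.≃-Reasoning

scalar : ℚ → ℚ[[t]]
scalar c zero    = c
scalar c (suc _) = 0ℚ

τ : ℚ[[t]]
τ zero    = 0ℚ
τ (suc n) = δ₀ n

τ⋆-suc : ∀ f n → (τ ⋆ f) (suc n) ≡ f n
τ⋆-suc f n = trans (cong (_+ (δ₀ ⋆ f) n) (ℚ.*-zeroˡ (f (suc n)))) (trans (ℚ.+-identityˡ _) (⋆-identityˡ f n))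

-- `sₜ a` is the geometric series of 1/(a + 1 - t).
ιₜ hₜ sₜ : ℕ → ℚ[[t]]
ιₜ a = scalar (ν (suc a))
hₜ a = scalar (u a)
sₜ a i = u a ^ suc i

module _ (N n : ℕ) where

  open CommutativeRing (Truncated.ring n) using (_≈_; semiring; 0#; 1#) renaming (_+_ to _+ₛ_)
  open Exp semiring using () renaming (_^_ to _^ₛ_)

  ιₜ-+ : ∀ a b → ιₜ (suc (a ℕ.+ b)) ≈ (λ i → ιₜ a i + ιₜ b i)
  ιₜ-+ a b zero    _ = trans (cong ν (sym (ℕ.+-suc (suc a) b))) (ν-+ (suc a) (suc b))
  ιₜ-+ a b (suc i) _ = refl

  ιh≈1 : ∀ a → ιₜ a ⋆ hₜ a ≈ δ₀
  ιh≈1 a zero    _ = νu≡1 a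
  ιh≈1 a (suc i) _ = trans (⋆-scalar (ιₜ a) (hₜ a) (λ _ → refl) (suc i)) (ℚ.*-zeroʳ (ν (suc a)))

  ιs≈1+ts : ∀ a → ιₜ a ⋆ sₜ a ≈ (λ i → δ₀ i + (τ ⋆ sₜ a) i)
  ιs≈1+ts a zero    _ = trans (cong (ν (suc a) *_) (ℚ.*-identityʳ (u a)))
    (trans (νu≡1 a) (sym (trans (cong (1ℚ +_) (ℚ.*-zeroˡ (u a ^ 1))) (ℚ.+-identityʳ 1ℚ))))
  ιs≈1+ts a (suc i) _ = begin
    (ιₜ a ⋆ sₜ a) (suc i)                ≡⟨ ⋆-scalar (ιₜ a) (sₜ a) (λ _ → refl) (suc i) ⟩
    ν (suc a) * (u a * u a ^ suc i)      ≡⟨ ℚ.*-assoc (ν (suc a)) (u a) _ ⟨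
    ν (suc a) * u a * u a ^ suc i        ≡⟨ trans (cong (_* u a ^ suc i) (νu≡1 a)) (ℚ.*-identityˡ (u a ^ suc i)) ⟩
    u a ^ suc i                          ≡⟨ τ⋆-suc (sₜ a) i ⟨
    (τ ⋆ sₜ a) (suc i)                   ≡⟨ ℚ.+-identityˡ _ ⟨
    0ℚ + (τ ⋆ sₜ a) (suc i)              ∎
    where open ≡-Reasoning

  τ^-⋆ : ∀ j (f : ℚ[[t]]) m → ((τ ^ₛ j) ⋆ f) (j ℕ.+ m) ≡ f m
  τ^-⋆ zero    f m = ⋆-identityˡ f m
  τ^-⋆ (suc j) f m = trans (⋆-assoc τ (τ ^ₛ j) f (suc (j ℕ.+ m))) (trans (τ⋆-suc ((τ ^ₛ j) ⋆ f) (j ℕ.+ m)) (τ^-⋆ j f m))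

  τ^-0 : ∀ j i → i ℕ.< j → (τ ^ₛ j) i ≡ 0ℚ
  τ^-0 (suc j) zero    _           = ℚ.*-zeroˡ ((τ ^ₛ j) 0)
  τ^-0 (suc j) (suc i) (ℕ.s≤s i<j) = trans (τ⋆-suc (τ ^ₛ j) i) (τ^-0 j i i<j)

  module Cyc = CyclicSum (Truncated.ring n) ιₜ hₜ sₜ τ N n ιₜ-+ ιh≈1 ιs≈1+ts (λ i i≤n → τ^-0 (suc n) i (ℕ.s≤s i≤n))

  coeff-Σ : ∀ m F i → Cyc.Σ< m F i ≡ ∑< m (λ a → F a i)
  coeff-Σ zero    F i = refl
  coeff-Σ (suc m) F i = cong (_+ F m i) (coeff-Σ m F i)

-- Coefficients of the cyclic sum formula

W : Index → ℕ → (ℕ → ℚ) → ℚ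
W []       M w = w M
W (k ∷ ks) M w = ∑< M (λ a → u a ^ val k * W ks a w)

ζʳ≤≡W : ∀ ks N → ζʳ≤ ks N ≡ W ks N (λ _ → 1ℚ)
ζʳ≤≡W []       N = refl
ζʳ≤≡W (k ∷ ks) N = Σ-cong′ N (λ a → trans (cong (_* u a ^ val k) (ζʳ≤≡W ks a)) (ℚ.*-comm _ (u a ^ val k)))

binomial : ℕ → ℕ → ℚ
binomial k l = ν ((k ℕ.+ l ℕ.∸ 1) choose l)

binomial-suc : ∀ k l → binomial (suc k) (suc l) ≡ binomial k (suc l) + binomial (suc k) l
binomial-suc k l = begin
  ν ((k ℕ.+ suc l) choose suc l)                     ≡⟨ cong (λ m → ν (m choose suc l)) (ℕ.+-suc k l) ⟩
  ν (suc (k ℕ.+ l) choose suc l)                     ≡⟨ cong ν (trans (sym (nCk+nC[k+1]≡[n+1]C[k+1] (k ℕ.+ l) l)) (ℕ.+-comm ((k ℕ.+ l) choose l) _)) ⟩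
  ν ((k ℕ.+ l) choose suc l ℕ.+ (k ℕ.+ l) choose l)  ≡⟨ ν-+ ((k ℕ.+ l) choose suc l) ((k ℕ.+ l) choose l) ⟩
  ν ((k ℕ.+ l) choose suc l) + binomial (suc k) l    ≡⟨ cong (λ m → ν ((m ℕ.∸ 1) choose suc l) + binomial (suc k) l) (sym (ℕ.+-suc k l)) ⟩
  binomial k (suc l) + binomial (suc k) l            ∎
  where open ≡-Reasoning

-- The coefficients of the power series (1/u - t)^{-k}.
negative-binomial : ∀ u k j → anti (λ l m → u ^ suc l * (binomial k m * u ^ (k ℕ.+ m))) j ≡ binomial (suc k) j * u ^ (suc k ℕ.+ j)
negative-binomial u k zero = solve 2 (λ u x → u :* con 1ℚ :* (con 1ℚ :* x) := con 1ℚ :* (u :* x)) refl u (u ^ (k ℕ.+ 0))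
  where open ℚSolver
negative-binomial u k (suc j) = begin
  u * 1ℚ * (binomial k (suc j) * u ^ (k ℕ.+ suc j)) + anti (λ l m → u * u ^ suc l * (binomial k m * u ^ (k ℕ.+ m))) j
    ≡⟨ cong (u * 1ℚ * (binomial k (suc j) * u ^ (k ℕ.+ suc j)) +_)
         (trans (anti-cong′ j (λ l m → ℚ.*-assoc u (u ^ suc l) _)) (trans (anti-*ˡ j u _) (cong (u *_) (negative-binomial u k j)))) ⟩
  u * 1ℚ * (binomial k (suc j) * u ^ (k ℕ.+ suc j)) + u * (binomial (suc k) j * u ^ (suc k ℕ.+ j))
    ≡⟨ cong (λ m → u * 1ℚ * (binomial k (suc j) * u ^ (k ℕ.+ suc j)) + u * (binomial (suc k) j * u ^ m)) (sym (ℕ.+-suc k j)) ⟩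
  u * 1ℚ * (binomial k (suc j) * u ^ (k ℕ.+ suc j)) + u * (binomial (suc k) j * u ^ (k ℕ.+ suc j))
    ≡⟨ solve 4 (λ u a b x → u :* con 1ℚ :* (a :* x) :+ u :* (b :* x) := (a :+ b) :* (u :* x)) refl u (binomial k (suc j)) (binomial (suc k) j) (u ^ (k ℕ.+ suc j)) ⟩
  (binomial k (suc j) + binomial (suc k) j) * (u * u ^ (k ℕ.+ suc j))
    ≡⟨ cong (_* (u * u ^ (k ℕ.+ suc j))) (binomial-suc k j) ⟨
  binomial (suc k) (suc j) * u ^ (suc k ℕ.+ suc j) ∎
  where
  open ≡-Reasoning
  open ℚSolver

-- ∑ over l₁ + ⋯ + l_r = n of ∏ binomial (k_i) (l_i) times φ (k₁ + l₁ , … , k_r + l_r)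
tailˢ : (Index → ℚ) → Index → ℚ[[t]]
tailˢ φ []       zero    = φ []
tailˢ φ []       (suc n) = 0ℚ
tailˢ φ (k ∷ ks) n       = anti (λ l m → binomial (val k) l * tailˢ (λ p → φ ((k ⊕ l) ∷ p)) ks m) n

tailˢ-cong : ∀ {φ ψ} κ n → (∀ p → φ p ≡ ψ p) → tailˢ φ κ n ≡ tailˢ ψ κ n
tailˢ-cong []       zero    e = e []
tailˢ-cong []       (suc n) e = refl
tailˢ-cong (k ∷ ks) n       e = anti-cong′ n (λ l m → cong (binomial (val k) l *_) (tailˢ-cong ks m (λ p → e _)))

tailˢ-*ˡ : ∀ c φ κ n → tailˢ (λ p → c * φ p) κ n ≡ c * tailˢ φ κ n
tailˢ-*ˡ c φ []       zero    = refl
tailˢ-*ˡ c φ []       (suc n) = sym (ℚ.*-zeroʳ c)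
tailˢ-*ˡ c φ (k ∷ ks) n       = trans (anti-cong′ n (λ l m → trans (cong (binomial (val k) l *_) (tailˢ-*ˡ c _ ks m))
  (solve 3 (λ a b c → a :* (b :* c) := b :* (a :* c)) refl (binomial (val k) l) c _))) (anti-*ˡ n c _)
  where open ℚSolver

tailˢ-+ : ∀ φ ψ κ n → tailˢ (λ p → φ p + ψ p) κ n ≡ tailˢ φ κ n + tailˢ ψ κ n
tailˢ-+ φ ψ []       zero    = refl
tailˢ-+ φ ψ []       (suc n) = refl
tailˢ-+ φ ψ (k ∷ ks) n       = trans (anti-cong′ n (λ l m → trans (cong (binomial (val k) l *_) (tailˢ-+ _ _ ks m))
  (ℚ.*-distribˡ-+ (binomial (val k) l) _ _))) (anti-+ n _ _)

tailˢ-0 : ∀ κ n → tailˢ (λ _ → 0ℚ) κ n ≡ 0ℚ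
tailˢ-0 κ n = trans (tailˢ-cong κ n (λ _ → sym (ℚ.*-zeroˡ 0ℚ))) (trans (tailˢ-*ˡ 0ℚ (λ _ → 0ℚ) κ n) (ℚ.*-zeroˡ (tailˢ (λ _ → 0ℚ) κ n)))

tailˢ-∑ : ∀ m (φ : ℕ → Index → ℚ) κ n → tailˢ (λ p → ∑< m (λ a → φ a p)) κ n ≡ ∑< m (λ a → tailˢ (φ a) κ n)
tailˢ-∑ zero    φ κ n = tailˢ-0 κ n
tailˢ-∑ (suc m) φ κ n = trans (tailˢ-+ _ (φ m) κ n) (cong (_+ tailˢ (φ m) κ n) (tailˢ-∑ m φ κ n))

sgn : Index → ℚ
sgn κ = (- 1ℚ) ^ sum (map val κ)

sgn-∷ : ∀ k ks → sgn (k ∷ ks) ≡ (- 1ℚ) ^ val k * sgn ks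
sgn-∷ k ks = ^-homo-* (- 1ℚ) (val k) (sum (map val ks))

cuts : (Index → Index → ℚ) → Index → Index → ℚ
cuts F p []      = F p []
cuts F p (k ∷ q) = F p (k ∷ q) + cuts F (k ∷ p) q

cuts-cong : ∀ {F G} → (∀ p q → F p q ≡ G p q) → ∀ p q → cuts F p q ≡ cuts G p q
cuts-cong e p []      = e p []
cuts-cong e p (k ∷ q) = cong₂ _+_ (e p (k ∷ q)) (cuts-cong e (k ∷ p) q)

rot : (ℕ⁺ → Index → ℚ) → Index → Index → ℚ
rot G p []      = 0ℚ
rot G p (k ∷ q) = G k (q ++ p) + rot G (p ∷ʳ k) q

rot-cong : ∀ {G G′} → (∀ k ks → G k ks ≡ G′ k ks) → ∀ p q → rot G p q ≡ rot G′ p q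
rot-cong e p []      = refl
rot-cong e p (k ∷ q) = cong₂ _+_ (e k (q ++ p)) (rot-cong e (p ∷ʳ k) q)

-- 𝒮 φ κ is ζŜ κ with ζ• (reverse p) replaced by φ p.
𝒮 : (Index → ℚ) → Index → ℚ[[t]]
𝒮 φ κ n = cuts (λ p q → sgn q * (φ p * tailˢ φ q n)) [] κ

-- The contribution of one rotation to the coefficient of tⁿ on either side of the theorem. The
-- parameter `φ` will be the truncated sums as well as the regularized values.
𝓛 𝓡 : (Index → ℚ) → ℕ → ℕ⁺ → Index → ℚ
𝓛 φ n k ks = ∑< (val k ℕ.∸ 1) (λ j → 𝒮 φ ((1+ j) ∷ ks ∷ʳ (k ⊖ j)) n)
𝓡 φ n k ks = anti (λ j m → 𝒮 φ ((k ⊕ j ⊕ 1) ∷ ks) m + 𝒮 φ ((1+ j) ∷ ks ∷ʳ k) m) n + 𝒮 φ (ks ∷ʳ (k ⊕ 1)) n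

W₁ : ℕ → Index → ℚ
W₁ N p = W p N (λ _ → 1ℚ)

W-0 : ∀ κ M → W κ M (λ _ → 0ℚ) ≡ 0ℚ
W-0 []       M = refl
W-0 (k ∷ ks) M = trans (Σ-cong′ M (λ a → trans (cong (u a ^ val k *_) (W-0 ks a)) (ℚ.*-zeroʳ (u a ^ val k)))) (Σ-0 M)

-- The coefficient of t^l in the error 1/N + ⋯ + 1/(N - a) + 1/(N + 1 - t) + ⋯ + 1/(N + a + 1 - t).
ε : ℕ → ℕ → ℕ → ℚ
ε N l a = ∑< (suc a) (λ i → scalar (u (N ℕ.∸ suc i)) l) + ∑< (suc a) (λ i → u (N ℕ.+ i) ^ suc l)

-- The coefficients of tⁿ in the errors `CE κ e⁺` and `CE κ e⁻`. Only on the `neg` half do the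
-- summands themselves depend on t, whence the tail sum in `𝓔⁻`.
𝓔⁺ 𝓔⁻ : ℕ → ℕ → Index → ℚ
𝓔⁺ N n κ = W (reverse κ) N (ε N n)
𝓔⁻ N n κ = sgn κ * anti (λ j l → tailˢ (λ p → W p N (ε N l)) κ j) n

anti-pick : ∀ n F → (∀ j l → F j (suc l) ≡ 0ℚ) → anti F n ≡ F n 0
anti-pick zero    F e = refl
anti-pick (suc n) F e = trans (anti-last n F)
  (trans (cong (_+ F (suc n) 0) (trans (anti-cong′ n e) (anti-0 n))) (ℚ.+-identityˡ _))

module _ (N n : ℕ) where

  open Cyc N n using () renaming (W to Wₜ; f⁻ to f⁻ₜ)
  open Exp (CommutativeRing.semiring (Truncated.ring n)) using () renaming (_^_ to _^ₛ_)

  hₜ^ : ∀ a k i → (hₜ a ^ₛ k) i ≡ scalar (u a ^ k) i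
  hₜ^ a zero    zero    = refl
  hₜ^ a zero    (suc i) = refl
  hₜ^ a (suc k) zero    = cong (u a *_) (hₜ^ a k 0)
  hₜ^ a (suc k) (suc i) = trans (⋆-scalar (hₜ a) (hₜ a ^ₛ k) (λ _ → refl) (suc i))
    (trans (cong (u a *_) (hₜ^ a k (suc i))) (ℚ.*-zeroʳ (u a)))

  coeff-W-h : ∀ κ M w i → Wₜ hₜ κ M w i ≡ W κ M (λ a → w a i)
  coeff-W-h []       M w i = refl
  coeff-W-h (k ∷ ks) M w i = trans (coeff-Σ N n M _ i) (Σ-cong′ M (λ a →
    trans (⋆-scalar (hₜ a ^ₛ val k) (Wₜ hₜ ks a w) (λ j → hₜ^ a (val k) (suc j)) i)
      (cong₂ _*_ (hₜ^ a (val k) 0) (coeff-W-h ks a w i))))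

  f⁻ₜ^ : ∀ a k j → (f⁻ₜ a ^ₛ k) j ≡ (- 1ℚ) ^ k * (binomial k j * u a ^ (k ℕ.+ j))
  f⁻ₜ^ a zero    zero    = refl
  f⁻ₜ^ a zero    (suc j) = sym (trans (ℚ.*-identityˡ _) (trans (cong (λ m → ν m * u a ^ suc j) (k>n⇒nCk≡0 (ℕ.n<1+n j))) (ℚ.*-zeroˡ (u a ^ suc j))))
  f⁻ₜ^ a (suc k) j       = begin
    anti (λ l m → - (u a ^ suc l) * (f⁻ₜ a ^ₛ k) m) j
      ≡⟨ anti-cong′ j (λ l m → trans (cong (- (u a ^ suc l) *_) (f⁻ₜ^ a k m))
           (solve 3 (λ x e y → :- x :* (e :* y) := (:- con 1ℚ :* e) :* (x :* y)) refl (u a ^ suc l) ((- 1ℚ) ^ k) (binomial k m * u a ^ (k ℕ.+ m)))) ⟩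
    anti (λ l m → (- 1ℚ) ^ suc k * (u a ^ suc l * (binomial k m * u a ^ (k ℕ.+ m)))) j
      ≡⟨ anti-*ˡ j ((- 1ℚ) ^ suc k) _ ⟩
    (- 1ℚ) ^ suc k * anti (λ l m → u a ^ suc l * (binomial k m * u a ^ (k ℕ.+ m))) j
      ≡⟨ cong ((- 1ℚ) ^ suc k *_) (negative-binomial (u a) k j) ⟩
    (- 1ℚ) ^ suc k * (binomial (suc k) j * u a ^ (suc k ℕ.+ j)) ∎
    where
    open ≡-Reasoning
    open ℚSolver

  coeff-W-f⁻ : ∀ κ M (w : ℕ → ℚ[[t]]) i → Wₜ f⁻ₜ κ M w i ≡ sgn κ * anti (λ j l → tailˢ (λ p → W p M (λ a → w a l)) κ j) i
  coeff-W-f⁻ []       M w zero    = sym (ℚ.*-identityˡ _)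
  coeff-W-f⁻ []       M w (suc i) = sym (trans (ℚ.*-identityˡ _)
    (trans (cong (w M (suc i) +_) (anti-0 i)) (ℚ.+-identityʳ _)))
  coeff-W-f⁻ (k ∷ ks) M w i = begin
    Wₜ f⁻ₜ (k ∷ ks) M w i
      ≡⟨ coeff-Σ N n M _ i ⟩
    ∑< M (λ a → anti (λ l m → (f⁻ₜ a ^ₛ val k) l * Wₜ f⁻ₜ ks a w m) i)
      ≡⟨ Σ-cong′ M (λ a → trans (anti-cong′ i (λ l m → trans (cong₂ _*_ (f⁻ₜ^ a (val k) l) (coeff-W-f⁻ ks a w m))
           (trans (rearrange ((- 1ℚ) ^ val k) (binomial (val k) l) (u a ^ (val k ℕ.+ l)) (sgn ks) (anti (λ j r → T′ a r j) m))
             (cong (_* (binomial (val k) l * (u a ^ (val k ℕ.+ l) * anti (λ j r → T′ a r j) m))) (sym (sgn-∷ k ks)))))) (anti-*ˡ i (sgn (k ∷ ks)) _)) ⟩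
    ∑< M (λ a → sgn (k ∷ ks) * anti (λ l m → binomial (val k) l * (u a ^ (val k ℕ.+ l) * anti (λ j r → T′ a r j) m)) i)
      ≡⟨ Σ-*ˡ M (sgn (k ∷ ks)) _ ⟩
    sgn (k ∷ ks) * ∑< M (λ a → anti (λ l m → binomial (val k) l * (u a ^ (val k ℕ.+ l) * anti (λ j r → T′ a r j) m)) i)
      ≡⟨ cong (sgn (k ∷ ks) *_) (begin
        ∑< M (λ a → anti (λ l m → binomial (val k) l * (u a ^ (val k ℕ.+ l) * anti (λ j r → T′ a r j) m)) i)
          ≡⟨ Σ-cong′ M (λ a → trans (anti-cong′ i (λ l m → sym (trans (anti-*ˡ m (binomial (val k) l) _) (cong (binomial (val k) l *_) (anti-*ˡ m (u a ^ (val k ℕ.+ l)) _)))))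
               (sym (anti-assoc i (λ l j r → binomial (val k) l * (u a ^ (val k ℕ.+ l) * T′ a r j))))) ⟩
        ∑< M (λ a → anti (λ m r → anti (λ l j → binomial (val k) l * (u a ^ (val k ℕ.+ l) * T′ a r j)) m) i)
          ≡⟨ trans (sym (anti-∑ i M _)) (anti-cong′ i (λ m r → sym (anti-∑ m M _))) ⟩
        anti (λ m r → anti (λ l j → ∑< M (λ a → binomial (val k) l * (u a ^ (val k ℕ.+ l) * T′ a r j))) m) i
          ≡⟨ anti-cong′ i (λ m r → anti-cong′ m (λ l j → trans (Σ-*ˡ M (binomial (val k) l) _) (cong (binomial (val k) l *_) (begin
               ∑< M (λ a → u a ^ (val k ℕ.+ l) * T′ a r j)
                 ≡⟨ Σ-cong′ M (λ a → sym (tailˢ-*ˡ (u a ^ (val k ℕ.+ l)) _ ks j)) ⟩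
               ∑< M (λ a → tailˢ (λ p → u a ^ (val k ℕ.+ l) * W p a (λ b → w b r)) ks j)
                 ≡⟨ sym (tailˢ-∑ M _ ks j) ⟩
               tailˢ (λ p → ∑< M (λ a → u a ^ (val k ℕ.+ l) * W p a (λ b → w b r))) ks j
                 ≡⟨ cong (λ e → tailˢ (λ p → ∑< M (λ a → u a ^ e * W p a (λ b → w b r))) ks j) (sym (val-⊕ k l)) ⟩
               tailˢ (λ p → W ((k ⊕ l) ∷ p) M (λ b → w b r)) ks j ∎)))) ⟩
        anti (λ m r → tailˢ (λ p → W p M (λ b → w b r)) (k ∷ ks) m) i ∎) ⟩
    sgn (k ∷ ks) * anti (λ m r → tailˢ (λ p → W p M (λ b → w b r)) (k ∷ ks) m) i ∎
    where
    open ≡-Reasoning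
    T′ : ℕ → ℕ → ℕ → ℚ
    T′ a r j = tailˢ (λ p → W p a (λ b → w b r)) ks j
    rearrange : ∀ e b x s y → e * (b * x) * (s * y) ≡ e * s * (b * (x * y))
    rearrange = solve 5 (λ e b x s y → e :* (b :* x) :* (s :* y) := e :* s :* (b :* (x :* y))) refl
      where open ℚSolver
    val-⊕ : ∀ k l → val (k ⊕ l) ≡ val k ℕ.+ l
    val-⊕ (1+ k) l = refl

  coeff-cuts : ∀ F p q i → Cyc.cuts N n F p q i ≡ cuts (λ p q → F p q i) p q
  coeff-cuts F p []      i = refl
  coeff-cuts F p (k ∷ q) i = cong (F p (k ∷ q) i +_) (coeff-cuts F (k ∷ p) q i)

  -- The `pos` part of a cut chain is constant in t, so the whole degree `i` falls to the `neg`
  -- part.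
  coeff-S : ∀ κ i → i ℕ.≤ n → Cyc.S N n κ i ≡ 𝒮 (W₁ N) κ i
  coeff-S κ i i≤n = trans (Cyc.S-cuts N n κ i i≤n) (trans (coeff-cuts _ [] κ i) (cuts-cong summand [] κ))
    where
    open ≡-Reasoning
    𝟏ₜ : ℕ → ℚ[[t]]
    𝟏ₜ _ = δ₀
    summand : ∀ p q → (Wₜ hₜ p N 𝟏ₜ ⋆ Wₜ f⁻ₜ q N 𝟏ₜ) i ≡ sgn q * (W₁ N p * tailˢ (W₁ N) q i)
    summand p q = begin
      (Wₜ hₜ p N 𝟏ₜ ⋆ Wₜ f⁻ₜ q N 𝟏ₜ) i
        ≡⟨ ⋆-scalar (Wₜ hₜ p N 𝟏ₜ) _ (λ j → trans (coeff-W-h p N 𝟏ₜ (suc j)) (W-0 p N)) i ⟩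
      Wₜ hₜ p N 𝟏ₜ 0 * Wₜ f⁻ₜ q N 𝟏ₜ i
        ≡⟨ cong₂ _*_ (coeff-W-h p N 𝟏ₜ 0) (trans (coeff-W-f⁻ q N 𝟏ₜ i) (cong (sgn q *_)
             (anti-pick i _ (λ j l → trans (tailˢ-cong q j (λ p → W-0 p N)) (tailˢ-0 q j))))) ⟩
      W₁ N p * (sgn q * tailˢ (W₁ N) q i)
        ≡⟨ solve 3 (λ w e x → w :* (e :* x) := e :* (w :* x)) refl (W₁ N p) (sgn q) (tailˢ (W₁ N) q i) ⟩
      sgn q * (W₁ N p * tailˢ (W₁ N) q i) ∎
      where open ℚSolver

  coeff-ε : ∀ l a → Cyc.ε N n (suc a) l ≡ ε N l a
  coeff-ε l a = cong₂ _+_ (coeff-Σ N n (suc a) (λ i → hₜ (N ℕ.∸ suc i)) l) (coeff-Σ N n (suc a) (λ i → sₜ (N ℕ.+ i)) l)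

  W-cong : ∀ κ M {w w′} → (∀ a → w a ≡ w′ a) → W κ M w ≡ W κ M w′
  W-cong []       M e = e M
  W-cong (k ∷ ks) M e = Σ-cong′ M (λ a → cong (u a ^ val k *_) (W-cong ks a e))

  coeff-e⁺ : ∀ k ks → Cyc.CE N n (k ∷ ks) (Cyc.e⁺ N n) n ≡ 𝓔⁺ N n (k ∷ ks)
  coeff-e⁺ k ks = trans
    (Cyc.CE-pos N n k ks (Cyc.e⁺ N n) (λ a → Cyc.ε N n (suc a)) (λ _ _ _ _ → refl) (λ _ _ _ _ → refl) (λ _ _ _ _ → refl) n ℕ.≤-refl)
    (trans (coeff-W-h (reverse (k ∷ ks)) N _ n) (W-cong (reverse (k ∷ ks)) N (coeff-ε n)))

  coeff-e⁻ : ∀ k ks → Cyc.CE N n (k ∷ ks) (Cyc.e⁻ N n) n ≡ 𝓔⁻ N n (k ∷ ks)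
  coeff-e⁻ k ks = trans
    (Cyc.CE-neg N n k ks (Cyc.e⁻ N n) (λ a → Cyc.ε N n (suc a)) (λ { _ (pos _) _ _ → refl ; _ (neg _) _ _ → refl }) (λ _ _ _ _ → refl) n ℕ.≤-refl)
    (trans (coeff-W-f⁻ (k ∷ ks) N _ n) (cong (sgn (k ∷ ks) *_) (anti-cong′ n (λ j l →
      tailˢ-cong (k ∷ ks) j (λ p → W-cong p N (coeff-ε l))))))

  coeff-rot : ∀ G p q → Cyc.rot N n G p q n ≡ rot (λ k ks → G k ks n) p q
  coeff-rot G p []      = refl
  coeff-rot G p (k ∷ q) = cong (G k (q ++ p) n +_) (coeff-rot G (p ∷ʳ k) q)

  coeff-L : ∀ k ks → Cyc.LHS N n k ks n ≡ 𝓛 (W₁ N) n k ks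
  coeff-L k ks = trans (coeff-Σ N n (val k ℕ.∸ 1) _ n) (Σ-cong′ (val k ℕ.∸ 1) (λ j → coeff-S ((1+ j) ∷ ks ∷ʳ (k ⊖ j)) n ℕ.≤-refl))

  coeff-R : ∀ k ks → Cyc.RHS N n k ks n ≡ 𝓡 (W₁ N) n k ks
  coeff-R k ks = cong₂ _+_ (begin
      Cyc.Σ< N n (suc n) (λ j → (τ ^ₛ j) ⋆ X j) n
        ≡⟨ coeff-Σ N n (suc n) _ n ⟩
      ∑< (suc n) (λ j → ((τ ^ₛ j) ⋆ X j) n)
        ≡⟨ Σ-cong (suc n) (λ { j (ℕ.s≤s j≤n) → trans (cong ((τ ^ₛ j) ⋆ X j) (sym (ℕ.m+[n∸m]≡n j≤n)))
             (trans (τ^-⋆ N n j (X j) (n ℕ.∸ j)) (cong₂ _+_ (coeff-S ((k ⊕ j ⊕ 1) ∷ ks) (n ℕ.∸ j) (ℕ.m∸n≤m n j)) (coeff-S ((1+ j) ∷ ks ∷ʳ k) (n ℕ.∸ j) (ℕ.m∸n≤m n j)))) }) ⟩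
      ∑< (suc n) (λ j → 𝒮 (W₁ N) ((k ⊕ j ⊕ 1) ∷ ks) (n ℕ.∸ j) + 𝒮 (W₁ N) ((1+ j) ∷ ks ∷ʳ k) (n ℕ.∸ j))
        ≡⟨ anti-as-∑ n _ ⟨
      anti (λ j m → 𝒮 (W₁ N) ((k ⊕ j ⊕ 1) ∷ ks) m + 𝒮 (W₁ N) ((1+ j) ∷ ks ∷ʳ k) m) n ∎)
    (coeff-S (ks ∷ʳ (k ⊕ 1)) n ℕ.≤-refl)
    where
    open ≡-Reasoning
    X : ℕ → ℚ[[t]]
    X j i = Cyc.S N n ((k ⊕ j ⊕ 1) ∷ ks) i + Cyc.S N n ((1+ j) ∷ ks ∷ʳ k) i

  truncated-cyclic-sum : ∀ κ → rot (𝓛 (W₁ N) n) [] κ + rot (λ k ks → 𝓔⁺ N n (k ∷ ks)) [] κ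
                             ≡ rot (𝓡 (W₁ N) n) [] κ + rot (λ k ks → 𝓔⁻ N n (k ∷ ks)) [] κ
  truncated-cyclic-sum κ = trans
    (sym (cong₂ _+_ (trans (coeff-rot _ [] κ) (rot-cong coeff-L [] κ)) (trans (coeff-rot _ [] κ) (rot-cong coeff-e⁺ [] κ))))
    (trans (Cyc.cyclic-sum N n κ n ℕ.≤-refl)
      (cong₂ _+_ (trans (coeff-rot _ [] κ) (rot-cong coeff-R [] κ)) (trans (coeff-rot _ [] κ) (rot-cong coeff-e⁻ [] κ))))

-- Powers of harmonic numbers over N

0≤1 : 0ℚ ≤ 1ℚ
0≤1 = ℚ.nonNegative⁻¹ 1ℚ

vanishing-mono : ∀ {s t} → (∀ n → s n ≤ t n) → Vanishing t → Vanishing s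
vanishing-mono s≤t vt δ 0<δ = proj₁ (vt δ 0<δ) , λ n M≤n → ℚ.≤-trans (s≤t n) (proj₂ (vt δ 0<δ) n M≤n)

+-mono-nonneg : ∀ {p q} → 0ℚ ≤ p → 0ℚ ≤ q → 0ℚ ≤ p + q
+-mono-nonneg 0≤p 0≤q = ℚ.+-mono-≤ 0≤p 0≤q

^-nonneg : ∀ {p} → 0ℚ ≤ p → ∀ m → 0ℚ ≤ p ^ m
^-nonneg 0≤p zero    = 0≤1
^-nonneg 0≤p (suc m) = *-nonneg 0≤p (^-nonneg 0≤p m)

^-mono : ∀ {p q} → 0ℚ ≤ p → p ≤ q → ∀ m → p ^ m ≤ q ^ m
^-mono         0≤p p≤q zero    = ℚ.≤-refl
^-mono {p} {q} 0≤p p≤q (suc m) = *-mono-nonneg (^-nonneg 0≤p m) (ℚ.≤-trans 0≤p p≤q) p≤q (^-mono 0≤p p≤q m)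

*-monoˡ : ∀ {p q} r → 0ℚ ≤ r → p ≤ q → r * p ≤ r * q
*-monoˡ r 0≤r = ℚ.*-monoˡ-≤-nonNeg r {{ℚ.nonNegative 0≤r}}

*-monoʳ : ∀ {p q} r → 0ℚ ≤ r → p ≤ q → p * r ≤ q * r
*-monoʳ r 0≤r = ℚ.*-monoʳ-≤-nonNeg r {{ℚ.nonNegative 0≤r}}

∑<-mono : ∀ n {f g} → (∀ i → i ℕ.< n → f i ≤ g i) → ∑< n f ≤ ∑< n g
∑<-mono zero    f≤g = ℚ.≤-refl
∑<-mono (suc n) f≤g = ℚ.+-mono-≤ (∑<-mono n (λ i i<n → f≤g i (ℕ.m<n⇒m<1+n i<n))) (f≤g n ℕ.≤-refl)

∑<-≤ : ∀ {f} → (∀ i → 0ℚ ≤ f i) → ∀ {m n} → m ℕ.≤ n → ∑< m f ≤ ∑< n f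
∑<-≤ {f} 0≤f {m} {n} m≤n = subst (∑< m f ≤_)
  (trans (sym (Σ-split m (n ℕ.∸ m) f)) (cong (λ k → ∑< k f) (ℕ.m+[n∸m]≡n m≤n)))
  (≤-+ʳ (∑<-nonneg (λ i → 0≤f (m ℕ.+ i)) (n ℕ.∸ m)))

u-antitone : ∀ {a b} → a ℕ.≤ b → u b ≤ u a
u-antitone {a} {b} a≤b = subst (λ c → u c ≤ u a) (ℕ.m∸n+n≡m a≤b) (go (b ℕ.∸ a))
  where
  go : ∀ d → u (d ℕ.+ a) ≤ u a
  go zero    = ℚ.≤-refl
  go (suc d) = ℚ.≤-trans (u-anti (d ℕ.+ a)) (go d)

u-mul : ∀ a b → u a * u b ≡ u (suc (a ℕ.+ b)) * (u a + u b)
u-mul a b = begin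
  u a * u b                                                                ≡⟨ solve 2 (λ a b → a :* b := con 1ℚ :* (a :* b)) refl (u a) (u b) ⟩
  1ℚ * (u a * u b)                                                         ≡⟨ cong (_* (u a * u b)) (νu≡1 (suc (a ℕ.+ b))) ⟨
  ν (suc (suc (a ℕ.+ b))) * w * (u a * u b)                                ≡⟨ cong (λ x → x * w * (u a * u b)) (trans (cong ν (sym (ℕ.+-suc (suc a) b))) (ν-+ (suc a) (suc b))) ⟩
  (ν (suc a) + ν (suc b)) * w * (u a * u b)                                ≡⟨ solve 5 (λ x y w a b → (x :+ y) :* w :* (a :* b) := w :* ((y :* b) :* a :+ (x :* a) :* b)) refl (ν (suc a)) (ν (suc b)) w (u a) (u b) ⟩
  w * ((ν (suc b) * u b) * u a + (ν (suc a) * u a) * u b)                  ≡⟨ cong₂ (λ x y → w * (x * u a + y * u b)) (νu≡1 b) (νu≡1 a) ⟩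
  w * (1ℚ * u a + 1ℚ * u b)                                                ≡⟨ solve 3 (λ w a b → w :* (con 1ℚ :* a :+ con 1ℚ :* b) := w :* (a :+ b)) refl w (u a) (u b) ⟩
  w * (u a + u b)                                                          ∎
  where
  open ≡-Reasoning
  open ℚSolver
  w = u (suc (a ℕ.+ b))

u-half : ∀ N → u (suc (N ℕ.+ N)) ≡ ½ * u N
u-half N = begin
  w                                      ≡⟨ solve 1 (λ w → w := con ½ :* (con 1ℚ :+ con 1ℚ) :* w) refl w ⟩
  ½ * (1ℚ + 1ℚ) * w                      ≡⟨ cong (λ x → ½ * (x + x) * w) (νu≡1 N) ⟨
  ½ * (ν (suc N) * u N + ν (suc N) * u N) * w
    ≡⟨ solve 4 (λ h x y w → h :* (x :* y :+ x :* y) :* w := h :* x :* (w :* (y :+ y))) refl ½ (ν (suc N)) (u N) w ⟩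
  ½ * ν (suc N) * (w * (u N + u N))      ≡⟨ cong (½ * ν (suc N) *_) (u-mul N N) ⟨
  ½ * ν (suc N) * (u N * u N)            ≡⟨ solve 3 (λ h x y → h :* x :* (y :* y) := h :* ((x :* y) :* y)) refl ½ (ν (suc N)) (u N) ⟩
  ½ * ((ν (suc N) * u N) * u N)          ≡⟨ cong (λ x → ½ * (x * u N)) (νu≡1 N) ⟩
  ½ * (1ℚ * u N)                         ≡⟨ cong (½ *_) (ℚ.*-identityˡ (u N)) ⟩
  ½ * u N                                ∎
  where
  open ≡-Reasoning
  open ℚSolver
  w = u (suc (N ℕ.+ N))

𝓗 : ℕ → ℚ
𝓗 N = ∑< N u

0≤𝓗 : ∀ N → 0ℚ ≤ 𝓗 N
0≤𝓗 = ∑<-nonneg 0≤u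

0≤ν : ∀ n → 0ℚ ≤ ν n
0≤ν zero    = ℚ.≤-refl
0≤ν (suc n) = subst (0ℚ ≤_) (sym (ν-+ 1 n)) (+-mono-nonneg 0≤1 (0≤ν n))

-- Since 𝓗 (n + 1)^{m+1} - 𝓗 n^{m+1} ≤ (m + 1) 𝓗 (n + 1)^m u n, powers of 𝓗 are negligible by induction on the
-- exponent, using Cesàro means.
𝓗^-vanishing : ∀ m → Vanishing (λ N → 𝓗 N ^ m * u N)
𝓗^-vanishing zero    = vanishing-mono (λ N → ℚ.≤-reflexive (ℚ.*-identityˡ (u N))) u-vanishing
𝓗^-vanishing (suc m) = vanishing-mono (λ N → *-monoʳ (u N) (0≤u N) (bound N)) (vanishing-mean a-nonneg a-vanishing)
  where
  a : ℕ → ℚ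
  a n = ν (suc m) * (𝓗 (suc n) ^ m * u n)
  a-nonneg : ∀ n → 0ℚ ≤ a n
  a-nonneg n = *-nonneg (0≤ν (suc m)) (*-nonneg (^-nonneg (0≤𝓗 (suc n)) m) (0≤u n))
  shifted : Vanishing (λ n → 𝓗 (suc n) ^ m * u (suc n))
  shifted δ 0<δ = proj₁ (𝓗^-vanishing m δ 0<δ) , λ n M≤n → proj₂ (𝓗^-vanishing m δ 0<δ) (suc n) (ℕ.m≤n⇒m≤1+n M≤n)
  a-vanishing : Vanishing a
  a-vanishing = vanishing-scale (ν (suc m)) (0≤ν (suc m)) (λ n → *-nonneg (^-nonneg (0≤𝓗 (suc n)) m) (0≤u n))
    (vanishing-mono (λ n → ℚ.≤-trans (*-monoˡ (𝓗 (suc n) ^ m) (^-nonneg (0≤𝓗 (suc n)) m) (u≤2u n))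
      (ℚ.≤-reflexive (ℚ.*-distribˡ-+ (𝓗 (suc n) ^ m) (u (suc n)) (u (suc n))))) (vanishing-+ shifted shifted))
  step : ∀ y d → 0ℚ ≤ y → 0ℚ ≤ d → ∀ m → (y + d) ^ suc m ≤ y ^ suc m + ν (suc m) * ((y + d) ^ m * d)
  step y d 0≤y 0≤d zero    = ℚ.≤-reflexive (solve 2 (λ y d → (y :+ d) :* con 1ℚ := y :* con 1ℚ :+ con 1ℚ :* (con 1ℚ :* d)) refl y d)
    where open ℚSolver
  step y d 0≤y 0≤d (suc m) = begin
    (y + d) * (y + d) ^ suc m
      ≤⟨ *-monoˡ (y + d) 0≤y+d (step y d 0≤y 0≤d m) ⟩
    (y + d) * (y ^ suc m + ν (suc m) * ((y + d) ^ m * d))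
      ≡⟨ solve 5 (λ y d p n q → (y :+ d) :* (p :+ n :* (q :* d)) := y :* p :+ (d :* p :+ n :* ((y :+ d) :* q :* d))) refl y d (y ^ suc m) (ν (suc m)) ((y + d) ^ m) ⟩
    y * y ^ suc m + (d * y ^ suc m + ν (suc m) * ((y + d) ^ suc m * d))
      ≤⟨ ℚ.+-monoʳ-≤ (y * y ^ suc m) (ℚ.+-monoˡ-≤ (ν (suc m) * ((y + d) ^ suc m * d)) (*-monoˡ d 0≤d (^-mono 0≤y (≤-+ʳ 0≤d) (suc m)))) ⟩
    y * y ^ suc m + (d * (y + d) ^ suc m + ν (suc m) * ((y + d) ^ suc m * d))
      ≡⟨ cong (y * y ^ suc m +_) (trans (solve 3 (λ d q n → d :* q :+ n :* (q :* d) := (con 1ℚ :+ n) :* (q :* d)) refl d ((y + d) ^ suc m) (ν (suc m)))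
           (cong (_* ((y + d) ^ suc m * d)) (sym (ν-+ 1 (suc m))))) ⟩
    y * y ^ suc m + ν (suc (suc m)) * ((y + d) ^ suc m * d) ∎
    where
    open ℚ.≤-Reasoning
    open ℚSolver
    0≤y+d = +-mono-nonneg 0≤y 0≤d
  bound : ∀ N → 𝓗 N ^ suc m ≤ ∑< N a
  bound zero    = ℚ.≤-reflexive (ℚ.*-zeroˡ (0ℚ ^ m))
  bound (suc N) = ℚ.≤-trans (step (𝓗 N) (u N) (0≤𝓗 N) (0≤u N) m) (ℚ.+-monoˡ-≤ (a N) (bound N))

-- Null sequences

record Null (s : ℕ → ℚ) : Set where
  constructor mkNull
  field
    vanishes : Vanishing (λ n → ∣ s n ∣)

open Null

null-bound : ∀ {s} t → (∀ n → ∣ s n ∣ ≤ t n) → Vanishing t → Null s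
null-bound t e vt = mkNull (vanishing-mono e vt)

null-resp : ∀ {s t} → (∀ n → s n ≡ t n) → Null s → Null t
null-resp e ns = null-bound _ (λ n → ℚ.≤-reflexive (cong ∣_∣ (sym (e n)))) (vanishes ns)

null-0 : ∀ {s} → (∀ n → s n ≡ 0ℚ) → Null s
null-0 e = mkNull (λ δ 0<δ → 0 , λ n _ → ℚ.≤-trans (ℚ.≤-reflexive (cong ∣_∣ (e n))) (ℚ.<⇒≤ 0<δ))

null-+ : ∀ {s t} → Null s → Null t → Null (λ n → s n + t n)
null-+ {s} {t} ns nt = null-bound _ (λ n → ℚ.∣p+q∣≤∣p∣+∣q∣ (s n) (t n)) (vanishing-+ (vanishes ns) (vanishes nt))

null-neg : ∀ {s} → Null s → Null (λ n → - s n)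
null-neg {s} ns = null-bound _ (λ n → ℚ.≤-reflexive (ℚ.∣-p∣≡∣p∣ (s n))) (vanishes ns)

record Bounded (s : ℕ → ℚ) : Set where
  constructor mkBounded
  field
    {bound}     : ℚ
    0≤bound     : 0ℚ ≤ bound
    eventually≤ : ∃ λ N → ∀ n → N ℕ.≤ n → ∣ s n ∣ ≤ bound

null-*ˡ : ∀ {s t} → Bounded s → Null t → Null (λ n → s n * t n)
null-*ˡ {s} {t} (mkBounded {B} 0≤B (N , bs)) nt = mkNull (λ δ 0<δ →
  let (M , p) = vanishing-scale B 0≤B (λ n → ℚ.0≤∣p∣ (t n)) (vanishes nt) δ 0<δ in
  N ℕ.⊔ M , λ n ≤n → begin
    ∣ s n * t n ∣        ≡⟨ ℚ.∣p*q∣≡∣p∣*∣q∣ (s n) (t n) ⟩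
    ∣ s n ∣ * ∣ t n ∣    ≤⟨ *-monoʳ ∣ t n ∣ (ℚ.0≤∣p∣ (t n)) (bs n (ℕ.m⊔n≤o⇒m≤o N M ≤n)) ⟩
    B * ∣ t n ∣          ≤⟨ p n (ℕ.m⊔n≤o⇒n≤o N M ≤n) ⟩
    δ                    ∎)
  where open ℚ.≤-Reasoning

bounded-const : ∀ c → Bounded (λ _ → c)
bounded-const c = mkBounded (ℚ.0≤∣p∣ c) (0 , λ _ _ → ℚ.≤-refl)

null-*-const : ∀ {s} c → Null s → Null (λ n → c * s n)
null-*-const c = null-*ˡ (bounded-const c)

null-anti : ∀ m {s : ℕ → ℕ → ℕ → ℚ} → (∀ i j → i ℕ.+ j ≡ m → Null (s i j)) → Null (λ n → anti (λ i j → s i j n) m)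
null-anti zero    ns = ns 0 0 refl
null-anti (suc m) ns = null-+ (ns 0 (suc m) refl) (null-anti m (λ i j e → ns (suc i) j (cong suc e)))

infix 4 _∼_
record _∼_ (s t : ℕ → ℚ) : Set where
  constructor mk∼
  field
    null : Null (λ n → s n - t n)

open _∼_

∼-reflexive : ∀ {s t} → (∀ n → s n ≡ t n) → s ∼ t
∼-reflexive {s} {t} e = mk∼ (null-0 (λ n → trans (cong (_- t n) (e n)) (ℚ.+-inverseʳ (t n))))

∼-refl : ∀ {s} → s ∼ s
∼-refl = ∼-reflexive (λ _ → refl)

∼-sym : ∀ {s t} → s ∼ t → t ∼ s
∼-sym {s} {t} e = mk∼ (null-resp (λ n → solve 2 (λ a b → :- (a :- b) := b :- a) refl (s n) (t n)) (null-neg (null e)))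
  where open ℚSolver

∼-trans : ∀ {r s t} → r ∼ s → s ∼ t → r ∼ t
∼-trans {r} {s} {t} e e′ = mk∼ (null-resp (λ n → solve 3 (λ a b c → (a :- b) :+ (b :- c) := a :- c) refl (r n) (s n) (t n)) (null-+ (null e) (null e′)))
  where open ℚSolver

∼-+ : ∀ {s s′ t t′} → s ∼ s′ → t ∼ t′ → (λ n → s n + t n) ∼ (λ n → s′ n + t′ n)
∼-+ {s} {s′} {t} {t′} e e′ = mk∼ (null-resp (λ n → solve 4 (λ a b c d → (a :- b) :+ (c :- d) := (a :+ c) :- (b :+ d)) refl (s n) (s′ n) (t n) (t′ n)) (null-+ (null e) (null e′)))
  where open ℚSolver

∼-*-const : ∀ c {s t} → s ∼ t → (λ n → c * s n) ∼ (λ n → c * t n)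
∼-*-const c {s} {t} e = mk∼ (null-resp (λ n → solve 3 (λ c a b → c :* (a :- b) := c :* a :- c :* b) refl c (s n) (t n)) (null-*-const c (null e)))
  where open ℚSolver

null⇒∼0 : ∀ {s} → Null s → s ∼ (λ _ → 0ℚ)
null⇒∼0 {s} ns = mk∼ (null-resp (λ n → sym (ℚ.+-identityʳ (s n))) ns)

∼-bounded : ∀ {s t} → s ∼ t → Bounded t → Bounded s
∼-bounded {s} {t} e (mkBounded {B} 0≤B (N , bt)) = mkBounded (+-mono-nonneg 0≤1 0≤B) (M ℕ.⊔ N , λ n ≤n → begin
  ∣ s n ∣                      ≡⟨ cong ∣_∣ (solve 2 (λ a b → a := (a :- b) :+ b) refl (s n) (t n)) ⟩
  ∣ (s n - t n) + t n ∣        ≤⟨ ℚ.∣p+q∣≤∣p∣+∣q∣ (s n - t n) (t n) ⟩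
  ∣ s n - t n ∣ + ∣ t n ∣      ≤⟨ ℚ.+-mono-≤ (proj₂ (vanishes (null e) 1ℚ 0<1) n (ℕ.m⊔n≤o⇒m≤o M N ≤n)) (bt n (ℕ.m⊔n≤o⇒n≤o M N ≤n)) ⟩
  1ℚ + B                       ∎)
  where
  open ℚ.≤-Reasoning
  open ℚSolver
  0<1 : 0ℚ < 1ℚ
  0<1 = ℚ.positive⁻¹ 1ℚ
  M = proj₁ (vanishes (null e) 1ℚ 0<1)

∼-* : ∀ {s s′ t t′} → Bounded s′ → Bounded t → s ∼ s′ → t ∼ t′ → (λ n → s n * t n) ∼ (λ n → s′ n * t′ n)
∼-* {s} {s′} {t} {t′} bs′ bt e e′ = mk∼ (null-resp
  (λ n → solve 4 (λ a b c d → c :* (a :- b) :+ b :* (c :- d) := a :* c :- b :* d) refl (s n) (s′ n) (t n) (t′ n))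
  (null-+ (null-*ˡ bt (null e)) (null-*ˡ bs′ (null e′))))
  where open ℚSolver

-- Bounds for the error terms

ε⁻ ε⁺ : ℕ → ℕ → ℚ
ε⁻ N a = ∑< (suc a) (λ i → u (N ℕ.∸ suc i))
ε⁺ N a = ∑< (suc a) (λ i → u (N ℕ.+ i))

ε₀≡ : ∀ N a → ε N 0 a ≡ ε⁻ N a + ε⁺ N a
ε₀≡ N a = cong (ε⁻ N a +_) (Σ-cong′ (suc a) (λ i → ℚ.*-identityʳ (u (N ℕ.+ i))))

ε⁺≤ε⁻ : ∀ N a → ε⁺ N a ≤ ε⁻ N a
ε⁺≤ε⁻ N a = ∑<-mono (suc a) (λ i _ → u-antitone (ℕ.≤-trans (ℕ.m∸n≤m N (suc i)) (ℕ.m≤m+n N i)))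

0≤ε : ∀ N l a → 0ℚ ≤ ε N l a
0≤ε N l a = +-mono-nonneg (∑<-nonneg (λ i → 0≤scalar (0≤u (N ℕ.∸ suc i)) l) (suc a))
  (∑<-nonneg (λ i → ^-nonneg (0≤u (N ℕ.+ i)) (suc l)) (suc a))
  where
  0≤scalar : ∀ {c} → 0ℚ ≤ c → ∀ l → 0ℚ ≤ scalar c l
  0≤scalar 0≤c zero    = 0≤c
  0≤scalar 0≤c (suc l) = ℚ.≤-refl

ε₀-mono : ∀ N {a b} → a ℕ.≤ b → ε N 0 a ≤ ε N 0 b
ε₀-mono N a≤b = ℚ.+-mono-≤ (∑<-≤ (λ i → 0≤u (N ℕ.∸ suc i)) (ℕ.s≤s a≤b))
  (∑<-≤ (λ i → ^-nonneg (0≤u (N ℕ.+ i)) 1) (ℕ.s≤s a≤b))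

-- `ε⁻ N a` is not small for `a` near N, but its product with `u a` is. Replace `u a` by the larger
-- `u i` in the i-th summand; the two denominators of the new product add up to N + 1, so `u-mul`
-- extracts a factor `u N`.
u*ε⁻≤ : ∀ N a → a ℕ.< N → u a * ε⁻ N a ≤ (𝓗 N + 𝓗 N) * u N
u*ε⁻≤ N a a<N = begin
  u a * ε⁻ N a
    ≡⟨ sym (Σ-*ˡ (suc a) (u a) _) ⟩
  ∑< (suc a) (λ i → u a * u (N ℕ.∸ suc i))
    ≤⟨ ∑<-mono (suc a) (λ { i (ℕ.s≤s i≤a) → *-monoʳ (u (N ℕ.∸ suc i)) (0≤u (N ℕ.∸ suc i)) (u-antitone i≤a) }) ⟩
  ∑< (suc a) (λ i → u i * u (N ℕ.∸ suc i))
    ≡⟨ Σ-cong (suc a) (λ i i≤a → trans (u-mul i (N ℕ.∸ suc i))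
         (cong (λ m → u m * (u i + u (N ℕ.∸ suc i))) (ℕ.m+[n∸m]≡n (ℕ.<-≤-trans i≤a a<N)))) ⟩
  ∑< (suc a) (λ i → u N * (u i + u (N ℕ.∸ suc i)))
    ≡⟨ trans (Σ-*ˡ (suc a) (u N) _) (trans (cong (u N *_) (Σ-+ (suc a) u _)) (ℚ.*-comm (u N) _)) ⟩
  (𝓗 (suc a) + ε⁻ N a) * u N
    ≤⟨ *-monoʳ (u N) (0≤u N) (ℚ.+-mono-≤ (∑<-≤ 0≤u a<N)
         (subst (ε⁻ N a ≤_) (trans (ℚ.+-comm (ε⁻ N a) _) (Σ-rev (suc a) N u a<N)) (≤-+ʳ (0≤𝓗 (N ℕ.∸ suc a))))) ⟩
  (𝓗 N + 𝓗 N) * u N ∎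
  where open ℚ.≤-Reasoning

η : ℕ → ℚ
η N = (𝓗 N + 𝓗 N) * u N + (𝓗 N + 𝓗 N) * u N

0≤𝓗u : ∀ N → 0ℚ ≤ (𝓗 N + 𝓗 N) * u N
0≤𝓗u N = *-nonneg (+-mono-nonneg (0≤𝓗 N) (0≤𝓗 N)) (0≤u N)

0≤η : ∀ N → 0ℚ ≤ η N
0≤η N = +-mono-nonneg (0≤𝓗u N) (0≤𝓗u N)

u*ε₀≤η : ∀ N a → a ℕ.< N → u a * ε N 0 a ≤ η N
u*ε₀≤η N a a<N = begin
  u a * ε N 0 a                ≡⟨ trans (cong (u a *_) (ε₀≡ N a)) (ℚ.*-distribˡ-+ (u a) (ε⁻ N a) (ε⁺ N a)) ⟩
  u a * ε⁻ N a + u a * ε⁺ N a  ≤⟨ ℚ.+-monoʳ-≤ (u a * ε⁻ N a) (*-monoˡ (u a) (0≤u a) (ε⁺≤ε⁻ N a)) ⟩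
  u a * ε⁻ N a + u a * ε⁻ N a  ≤⟨ ℚ.+-mono-≤ (u*ε⁻≤ N a a<N) (u*ε⁻≤ N a a<N) ⟩
  η N                          ∎
  where open ℚ.≤-Reasoning

-- The reciprocals below N are constant in t. Those above N enter at least squared, and one of the
-- factors is at most `u N`, the rest at most `u i`.
ε₊≤η : ∀ N l a → a ℕ.< N → ε N (suc l) a ≤ η N
ε₊≤η N l a a<N = begin
  ∑< (suc a) (λ _ → 0ℚ) + ∑< (suc a) (λ i → u (N ℕ.+ i) ^ suc (suc l))
    ≡⟨ trans (cong (_+ ∑< (suc a) (λ i → u (N ℕ.+ i) ^ suc (suc l))) (Σ-0 (suc a))) (ℚ.+-identityˡ _) ⟩
  ∑< (suc a) (λ i → u (N ℕ.+ i) * u (N ℕ.+ i) ^ suc l)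
    ≤⟨ ∑<-mono (suc a) (λ i _ → *-mono-nonneg (pow-nonneg (N ℕ.+ i) (suc l)) (0≤u N) (u-antitone (ℕ.m≤m+n N i))
         (ℚ.≤-trans (pow≤u (N ℕ.+ i) l) (u-antitone (ℕ.m≤n+m i N)))) ⟩
  ∑< (suc a) (λ i → u N * u i)
    ≡⟨ trans (Σ-*ˡ (suc a) (u N) u) (ℚ.*-comm (u N) _) ⟩
  𝓗 (suc a) * u N
    ≤⟨ *-monoʳ (u N) (0≤u N) (ℚ.≤-trans (∑<-≤ 0≤u a<N) (≤-+ʳ (0≤𝓗 N))) ⟩
  (𝓗 N + 𝓗 N) * u N
    ≤⟨ ≤-+ʳ (0≤𝓗u N) ⟩
  η N ∎
  where open ℚ.≤-Reasoning

𝓗^η-vanishing : ∀ m → Vanishing (λ N → 𝓗 N ^ m * η N)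
𝓗^η-vanishing m = vanishing-mono (λ N → ℚ.≤-reflexive (solve 3 (λ p h u →
    p :* ((h :+ h) :* u :+ (h :+ h) :* u) := ((h :* p) :* u :+ (h :* p) :* u) :+ ((h :* p) :* u :+ (h :* p) :* u)) refl (𝓗 N ^ m) (𝓗 N) (u N)))
  (vanishing-+ (vanishing-+ v v) (vanishing-+ v v))
  where
  open ℚSolver
  v = 𝓗^-vanishing (suc m)

W-nonneg : ∀ κ M {w} → (∀ a → 0ℚ ≤ w a) → 0ℚ ≤ W κ M w
W-nonneg []       M 0≤w = 0≤w M
W-nonneg (k ∷ ks) M 0≤w = ∑<-nonneg (λ a → *-nonneg (pow-nonneg a (val k)) (W-nonneg ks a 0≤w)) M

W-step≤ : ∀ k ks {M N w X} → (∀ a → 0ℚ ≤ w a) → M ℕ.≤ N → 0ℚ ≤ X → (∀ a → a ℕ.< M → W ks a w ≤ X) → W (k ∷ ks) M w ≤ 𝓗 N * X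
W-step≤ (1+ k) ks {M} {N} {w} {X} 0≤w M≤N 0≤X bound = begin
  ∑< M (λ a → u a ^ suc k * W ks a w)  ≤⟨ ∑<-mono M (λ a a<M → *-mono-nonneg (W-nonneg ks a 0≤w) (0≤u a) (pow≤u a k) (bound a a<M)) ⟩
  ∑< M (λ a → u a * X)                 ≡⟨ Σ-*ʳ M X u ⟩
  𝓗 M * X                              ≤⟨ *-monoʳ X 0≤X (∑<-≤ 0≤u M≤N) ⟩
  𝓗 N * X                              ∎
  where open ℚ.≤-Reasoning

𝓗^*-nonneg : ∀ N m {c} → 0ℚ ≤ c → 0ℚ ≤ 𝓗 N ^ m * c
𝓗^*-nonneg N m 0≤c = *-nonneg (^-nonneg (0≤𝓗 N) m) 0≤c

W≤ : ∀ κ {M N w c} → (∀ a → 0ℚ ≤ w a) → 0ℚ ≤ c → M ℕ.≤ N → (∀ a → a ℕ.≤ M → w a ≤ c) → W κ M w ≤ 𝓗 N ^ length κ * c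
W≤ []       {M} {c = c} 0≤w 0≤c M≤N w≤c = ℚ.≤-trans (w≤c M ℕ.≤-refl) (ℚ.≤-reflexive (sym (ℚ.*-identityˡ c)))
W≤ (k ∷ ks) {M} {N} {w} {c} 0≤w 0≤c M≤N w≤c = ℚ.≤-trans
  (W-step≤ k ks 0≤w M≤N (𝓗^*-nonneg N (length ks) 0≤c) (λ a a<M →
    W≤ ks 0≤w 0≤c (ℕ.≤-trans (ℕ.<⇒≤ a<M) M≤N) (λ b b≤a → w≤c b (ℕ.≤-trans b≤a (ℕ.<⇒≤ a<M)))))
  (ℚ.≤-reflexive (sym (ℚ.*-assoc (𝓗 N) (𝓗 N ^ length ks) c)))

W∷≤ : ∀ k ks {N w c} → (∀ a → 0ℚ ≤ w a) → 0ℚ ≤ c → (∀ a → a ℕ.< N → w a ≤ c) → W (k ∷ ks) N w ≤ 𝓗 N ^ length (k ∷ ks) * c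
W∷≤ k ks {N} {w} {c} 0≤w 0≤c w≤c = ℚ.≤-trans
  (W-step≤ k ks 0≤w ℕ.≤-refl (𝓗^*-nonneg N (length ks) 0≤c) (λ a a<N →
    W≤ ks 0≤w 0≤c (ℕ.<⇒≤ a<N) (λ b b≤a → w≤c b (ℕ.≤-<-trans b≤a a<N))))
  (ℚ.≤-reflexive (sym (ℚ.*-assoc (𝓗 N) (𝓗 N ^ length ks) c)))

Big : Index → Set
Big = Any (λ k → 2 ℕ.≤ val k)

-- An exponent of at least 2 provides a spare factor `u a`. By monotonicity the weight can be moved
-- up from the smallest variable to `a`, where `u*ε₀≤η` applies; all other sums cost a factor `𝓗 N`
-- each.
W-big≤ : ∀ κ {M N} → Big κ → M ℕ.≤ N → W κ M (ε N 0) ≤ 𝓗 N ^ length κ * η N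
W-big≤ (k ∷ ks) {M} {N} (there big) M≤N = ℚ.≤-trans
  (W-step≤ k ks (0≤ε N 0) M≤N (𝓗^*-nonneg N (length ks) (0≤η N)) (λ a a<M → W-big≤ ks big (ℕ.≤-trans (ℕ.<⇒≤ a<M) M≤N)))
  (ℚ.≤-reflexive (sym (ℚ.*-assoc (𝓗 N) (𝓗 N ^ length ks) (η N))))
W-big≤ ((1+ suc k) ∷ ks) {M} {N} (here _) M≤N = begin
  ∑< M (λ a → u a * u a ^ suc k * W ks a (ε N 0))
    ≤⟨ ∑<-mono M (λ a a<M → bound a (ℕ.<-≤-trans a<M M≤N)) ⟩
  ∑< M (λ a → u a * (𝓗 N ^ length ks * η N))
    ≡⟨ Σ-*ʳ M (𝓗 N ^ length ks * η N) u ⟩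
  𝓗 M * (𝓗 N ^ length ks * η N)
    ≤⟨ *-monoʳ (𝓗 N ^ length ks * η N) (𝓗^*-nonneg N (length ks) (0≤η N)) (∑<-≤ 0≤u M≤N) ⟩
  𝓗 N * (𝓗 N ^ length ks * η N)
    ≡⟨ sym (ℚ.*-assoc (𝓗 N) (𝓗 N ^ length ks) (η N)) ⟩
  𝓗 N ^ suc (length ks) * η N ∎
  where
  open ℚ.≤-Reasoning
  open ℚSolver
  bound : ∀ a → a ℕ.< N → u a * u a ^ suc k * W ks a (ε N 0) ≤ u a * (𝓗 N ^ length ks * η N)
  bound a a<N = begin
    u a * u a ^ suc k * W ks a (ε N 0)
      ≤⟨ *-mono-nonneg (W-nonneg ks a (0≤ε N 0)) (*-nonneg (0≤u a) (0≤u a)) (*-monoˡ (u a) (0≤u a) (pow≤u a k))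
           (W≤ ks (0≤ε N 0) (0≤ε N 0 a) (ℕ.<⇒≤ a<N) (λ b b≤a → ε₀-mono N b≤a)) ⟩
    u a * u a * (𝓗 N ^ length ks * ε N 0 a)
      ≡⟨ solve 3 (λ x h e → x :* x :* (h :* e) := x :* (h :* (x :* e))) refl (u a) (𝓗 N ^ length ks) (ε N 0 a) ⟩
    u a * (𝓗 N ^ length ks * (u a * ε N 0 a))
      ≤⟨ *-monoˡ (u a) (0≤u a) (*-monoˡ (𝓗 N ^ length ks) (^-nonneg (0≤𝓗 N) (length ks)) (u*ε₀≤η N a a<N)) ⟩
    u a * (𝓗 N ^ length ks * η N) ∎
W-big≤ ((1+ zero) ∷ ks) (here (ℕ.s≤s ())) M≤N

null-nonneg : ∀ {s} t → (∀ n → 0ℚ ≤ s n) → (∀ n → s n ≤ t n) → Vanishing t → Null s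
null-nonneg {s} t 0≤s s≤t = null-bound t (λ n → subst (_≤ t n) (sym (ℚ.0≤p⇒∣p∣≡p (0≤s n))) (s≤t n))

W-ε₊-null : ∀ κ l → κ ≢ [] → Null (λ N → W κ N (ε N (suc l)))
W-ε₊-null []       l κ≢[] with () ← κ≢[] refl
W-ε₊-null (k ∷ ks) l _    = null-nonneg _ (λ N → W-nonneg (k ∷ ks) N (0≤ε N (suc l)))
  (λ N → W∷≤ k ks (0≤ε N (suc l)) (0≤η N) (λ a a<N → ε₊≤η N l a a<N)) (𝓗^η-vanishing (suc (length ks)))

W-big-null : ∀ κ → Big κ → Null (λ N → W κ N (ε N 0))
W-big-null κ big = null-nonneg _ (λ N → W-nonneg κ N (0≤ε N 0)) (λ N → W-big≤ κ big ℕ.≤-refl) (𝓗^η-vanishing (length κ))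

tailˢ-null : ∀ {φ : ℕ → Index → ℚ} κ n → (∀ p → length p ≡ length κ → Null (λ N → φ N p)) → Null (λ N → tailˢ (φ N) κ n)
tailˢ-null []       zero    e = e [] refl
tailˢ-null []       (suc n) e = null-0 (λ _ → refl)
tailˢ-null (k ∷ ks) n       e = null-anti n (λ l m _ → null-*-const (binomial (val k) l)
  (tailˢ-null ks m (λ p eq → e ((k ⊕ l) ∷ p) (cong suc eq))))

-- In positive degree some exponent is raised and thereby becomes at least 2.
tailˢ-null-big : ∀ (φ : ℕ → Index → ℚ) κ n → Big κ ⊎ n ≢ 0 → (∀ p → Big p → Null (λ N → φ N p)) → Null (λ N → tailˢ (φ N) κ n)
tailˢ-null-big φ []       zero    (inj₂ n≢0) e with () ← n≢0 refl
tailˢ-null-big φ []       (suc n) _          e = null-0 (λ _ → refl)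
tailˢ-null-big φ (k ∷ ks) n       big        e = null-anti n (λ l m l+m≡n → null-*-const (binomial (val k) l) (go l m l+m≡n big))
  where
  2≤ : ∀ k l → 2 ℕ.≤ val (k ⊕ suc l)
  2≤ (1+ k) l = ℕ.s≤s (subst (1 ℕ.≤_) (sym (ℕ.+-suc k l)) (ℕ.s≤s ℕ.z≤n))
  2≤′ : ∀ k → 2 ℕ.≤ val k → 2 ℕ.≤ val (k ⊕ 0)
  2≤′ (1+ k) 2≤k = subst (λ m → 2 ℕ.≤ suc m) (sym (ℕ.+-identityʳ k)) 2≤k
  go : ∀ l m → l ℕ.+ m ≡ n → Big (k ∷ ks) ⊎ n ≢ 0 → Null (λ N → tailˢ (λ p → φ N ((k ⊕ l) ∷ p)) ks m)
  go (suc l) m _    _                     = tailˢ-null ks m (λ p _ → e _ (here (2≤ k l)))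
  go zero    m _    (inj₁ (here 2≤k))     = tailˢ-null ks m (λ p _ → e _ (here (2≤′ k 2≤k)))
  go zero    m _    (inj₁ (there big))    = tailˢ-null-big (λ N p → φ N ((k ⊕ 0) ∷ p)) ks m (inj₁ big) (λ p b → e _ (there b))
  go zero    m refl (inj₂ m≢0)            = tailˢ-null-big (λ N p → φ N ((k ⊕ 0) ∷ p)) ks m (inj₂ m≢0) (λ p b → e _ (there b))

reverse≢[] : ∀ (κ : Index) → κ ≢ [] → reverse κ ≢ []
reverse≢[] []       κ≢[] _ = κ≢[] refl
reverse≢[] (k ∷ ks) _    e with () ← trans (sym (length-reverse (k ∷ ks))) (cong length e)

𝓔⁺-null : ∀ n κ → κ ≢ [] → Big κ ⊎ n ≢ 0 → Null (λ N → 𝓔⁺ N n κ)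
𝓔⁺-null zero    κ κ≢[] (inj₁ big) = W-big-null (reverse κ) (Any.reverse⁺ big)
𝓔⁺-null zero    κ κ≢[] (inj₂ 0≢0) with () ← 0≢0 refl
𝓔⁺-null (suc n) κ κ≢[] _          = W-ε₊-null (reverse κ) n (reverse≢[] κ κ≢[])

𝓔⁻-null : ∀ n κ → κ ≢ [] → Big κ ⊎ n ≢ 0 → Null (λ N → 𝓔⁻ N n κ)
𝓔⁻-null n κ κ≢[] big = null-*-const (sgn κ) (null-anti n term)
  where
  term : ∀ j l → j ℕ.+ l ≡ n → Null (λ N → tailˢ (λ p → W p N (ε N l)) κ j)
  term j zero    j+0≡n = tailˢ-null-big (λ N p → W p N (ε N 0)) κ j
    (subst (λ m → Big κ ⊎ m ≢ 0) (sym (trans (sym (ℕ.+-identityʳ j)) j+0≡n)) big) (λ p → W-big-null p)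
  term j (suc l) _     = tailˢ-null κ j (λ p eq → W-ε₊-null p l (λ { refl → κ≢[] (empty-length κ (sym eq)) }))
    where
    empty-length : ∀ (κ : Index) → length κ ≡ 0 → κ ≡ []
    empty-length [] _ = refl

-- The constant error at (1 , ... , 1)

-- The analogue of `W (ones (suc r))` with weak inequalities between the variables. For it, unlike
-- for `W`, the passage from N to N + 1 closes up exactly.
V : ℕ → ℕ → (ℕ → ℚ) → ℚ
V zero    M w = ∑< M (λ a → u a * w a)
V (suc r) M w = ∑< M (λ a → u a * V r (suc a) w)

ones : ℕ → Index
ones r = replicate r (1+ 0)

W-ones : ∀ r M w → W (ones (suc r)) M w ≡ ∑< M (λ a → u a * W (ones r) a w)
W-ones r M w = Σ-cong′ M (λ a → cong (_* W (ones r) a w) (ℚ.*-identityʳ (u a)))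

V-nonneg : ∀ r M {w} → (∀ a → 0ℚ ≤ w a) → 0ℚ ≤ V r M w
V-nonneg zero    M 0≤w = ∑<-nonneg (λ a → *-nonneg (0≤u a) (0≤w a)) M
V-nonneg (suc r) M 0≤w = ∑<-nonneg (λ a → *-nonneg (0≤u a) (V-nonneg r (suc a) 0≤w)) M

V-≤suc : ∀ r M {w} → (∀ a → 0ℚ ≤ w a) → V r M w ≤ V r (suc M) w
V-≤suc zero    M 0≤w = ≤-+ʳ (*-nonneg (0≤u M) (0≤w M))
V-≤suc (suc r) M 0≤w = ≤-+ʳ (*-nonneg (0≤u M) (V-nonneg r (suc M) 0≤w))

W≤V : ∀ r M {w} → (∀ a → 0ℚ ≤ w a) → W (ones (suc r)) M w ≤ V r M w
W≤V zero    M 0≤w = ℚ.≤-reflexive (W-ones 0 M _)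
W≤V (suc r) M {w} 0≤w = ℚ.≤-trans (ℚ.≤-reflexive (W-ones (suc r) M w))
  (∑<-mono M (λ a _ → *-monoˡ (u a) (0≤u a) (ℚ.≤-trans (W≤V r a 0≤w) (V-≤suc r a 0≤w))))

-- Two equal variables produce a product `u a * ε N 0 a`, which is at most `η N`. Each of the `r`
-- possible coincidences contributes at most `𝓗 N ^ r * η N`.
V≤W+ : ∀ r M N → M ℕ.≤ N → V r M (ε N 0) ≤ W (ones (suc r)) M (ε N 0) + ν r * (𝓗 N ^ r * η N)
V≤W+ zero    M N M≤N = ℚ.≤-reflexive (trans (sym (W-ones 0 M (ε N 0)))
  (sym (trans (cong (W (ones 1) M (ε N 0) +_) (ℚ.*-zeroˡ (1ℚ * η N))) (ℚ.+-identityʳ _))))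
V≤W+ (suc r) M N M≤N = begin
  ∑< M (λ a → u a * V r (suc a) (ε N 0))
    ≤⟨ ∑<-mono M (λ a a<M → *-monoˡ (u a) (0≤u a) (bound a (ℕ.<-≤-trans a<M M≤N))) ⟩
  ∑< M (λ a → u a * (W (ones (suc r)) a (ε N 0) + (X + ν r * X)))
    ≡⟨ trans (Σ-cong′ M (λ a → ℚ.*-distribˡ-+ (u a) (W (ones (suc r)) a (ε N 0)) (X + ν r * X))) (Σ-+ M _ _) ⟩
  ∑< M (λ a → u a * W (ones (suc r)) a (ε N 0)) + ∑< M (λ a → u a * (X + ν r * X))
    ≡⟨ cong₂ _+_ (sym (W-ones (suc r) M (ε N 0))) (Σ-*ʳ M (X + ν r * X) u) ⟩
  W (ones (suc (suc r))) M (ε N 0) + 𝓗 M * (X + ν r * X)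
    ≤⟨ ℚ.+-monoʳ-≤ (W (ones (suc (suc r))) M (ε N 0)) (*-monoʳ (X + ν r * X) 0≤X+ (∑<-≤ 0≤u M≤N)) ⟩
  W (ones (suc (suc r))) M (ε N 0) + 𝓗 N * (X + ν r * X)
    ≡⟨ cong (W (ones (suc (suc r))) M (ε N 0) +_) (trans
         (solve 4 (λ h p e n → h :* (p :* e :+ n :* (p :* e)) := (con 1ℚ :+ n) :* (h :* p :* e)) refl (𝓗 N) (𝓗 N ^ r) (η N) (ν r))
         (cong (_* (𝓗 N ^ suc r * η N)) (sym (ν-+ 1 r)))) ⟩
  W (ones (suc (suc r))) M (ε N 0) + ν (suc r) * (𝓗 N ^ suc r * η N) ∎
  where
  open ℚ.≤-Reasoning
  open ℚSolver
  X = 𝓗 N ^ r * η N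
  0≤X = 𝓗^*-nonneg N r (0≤η N)
  0≤X+ : 0ℚ ≤ X + ν r * X
  0≤X+ = +-mono-nonneg 0≤X (*-nonneg (0≤ν r) 0≤X)
  bound : ∀ a → a ℕ.< N → V r (suc a) (ε N 0) ≤ W (ones (suc r)) a (ε N 0) + (X + ν r * X)
  bound a a<N = begin
    V r (suc a) (ε N 0)
      ≤⟨ V≤W+ r (suc a) N a<N ⟩
    W (ones (suc r)) a (ε N 0) + u a ^ 1 * W (ones r) a (ε N 0) + ν r * X
      ≤⟨ ℚ.+-monoˡ-≤ (ν r * X) (ℚ.+-monoʳ-≤ (W (ones (suc r)) a (ε N 0)) last) ⟩
    W (ones (suc r)) a (ε N 0) + X + ν r * X
      ≡⟨ ℚ.+-assoc (W (ones (suc r)) a (ε N 0)) X (ν r * X) ⟩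
    W (ones (suc r)) a (ε N 0) + (X + ν r * X) ∎
    where
    last : u a ^ 1 * W (ones r) a (ε N 0) ≤ X
    last = begin
      u a ^ 1 * W (ones r) a (ε N 0)
        ≤⟨ *-monoˡ (u a ^ 1) (pow-nonneg a 1) (W≤ (ones r) (0≤ε N 0) (0≤ε N 0 a) (ℕ.<⇒≤ a<N) (λ b b≤a → ε₀-mono N b≤a)) ⟩
      u a ^ 1 * (𝓗 N ^ length (ones r) * ε N 0 a)
        ≡⟨ cong (λ m → u a ^ 1 * (𝓗 N ^ m * ε N 0 a)) (length-ones r) ⟩
      u a ^ 1 * (𝓗 N ^ r * ε N 0 a)
        ≡⟨ solve 3 (λ x h e → x :* con 1ℚ :* (h :* e) := h :* (x :* e)) refl (u a) (𝓗 N ^ r) (ε N 0 a) ⟩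
      𝓗 N ^ r * (u a * ε N 0 a)
        ≤⟨ *-monoˡ (𝓗 N ^ r) (^-nonneg (0≤𝓗 N) r) (u*ε₀≤η N a a<N) ⟩
      X ∎
      where
      length-ones : ∀ r → length (ones r) ≡ r
      length-ones zero    = refl
      length-ones (suc r) = cong suc (length-ones r)

W∼V : ∀ r → (λ N → W (ones (suc r)) N (ε N 0)) ∼ (λ N → V r N (ε N 0))
W∼V r = ∼-sym (mk∼ (null-nonneg (λ N → ν r * (𝓗 N ^ r * η N))
  (λ N → subst (_≤ V r N (ε N 0) - W (ones (suc r)) N (ε N 0)) (ℚ.+-inverseʳ (W (ones (suc r)) N (ε N 0)))
    (ℚ.+-monoˡ-≤ (- W (ones (suc r)) N (ε N 0)) (W≤V r N (0≤ε N 0))))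
  (λ N → subst (V r N (ε N 0) - W (ones (suc r)) N (ε N 0) ≤_)
    (solve 2 (λ w x → (w :+ x) :- w := x) refl (W (ones (suc r)) N (ε N 0)) (ν r * (𝓗 N ^ r * η N)))
    (ℚ.+-monoˡ-≤ (- W (ones (suc r)) N (ε N 0)) (V≤W+ r N N ℕ.≤-refl)))
  (vanishing-scale (ν r) (0≤ν r) (λ N → 𝓗^*-nonneg N r (0≤η N)) (𝓗^η-vanishing r))))
  where open ℚSolver

-- A relation for the sum over the innermost variable is carried through the outer sums; the weight
-- `x` then sits at the next variable, so its sum has one variable less.
V-lin : ∀ B c w w′ x → (∀ a → a ℕ.< B → V 0 (suc a) w + c * x a ≡ V 0 (suc a) w′) →
  ∀ r M → M ℕ.≤ B → V (suc r) M w + c * V r M x ≡ V (suc r) M w′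
V-lin B c w w′ x e r M M≤B = go r M M≤B
  where
  combine : ∀ M (f g : ℕ → ℚ) → ∑< M (λ a → u a * f a) + c * ∑< M (λ a → u a * g a) ≡ ∑< M (λ a → u a * (f a + c * g a))
  combine M f g = trans (cong (∑< M (λ a → u a * f a) +_) (sym (Σ-*ˡ M c _))) (trans (sym (Σ-+ M (λ a → u a * f a) (λ a → c * (u a * g a))))
    (Σ-cong′ M (λ a → solve 4 (λ u f c g → u :* f :+ c :* (u :* g) := u :* (f :+ c :* g)) refl (u a) (f a) c (g a))))
    where open ℚSolver
  go : ∀ r M → M ℕ.≤ B → V (suc r) M w + c * V r M x ≡ V (suc r) M w′
  go zero    M M≤B = trans (combine M (λ a → V 0 (suc a) w) x) (Σ-cong M (λ a a<M → cong (u a *_) (e a (ℕ.<-≤-trans a<M M≤B))))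
  go (suc r) M M≤B = trans (combine M (λ a → V (suc r) (suc a) w) (λ a → V r (suc a) x))
    (Σ-cong M (λ a a<M → cong (u a *_) (go r (suc a) (ℕ.<-≤-trans a<M M≤B))))

-- The passage from N to N + 1 shows that V r N (ε⁻ N) = ∑_{n ≤ N} n^{-r-2}, a formula of
-- Maesaka, Seki and Watanabe.
module _ (N : ℕ) where

  u*ε⁻-suc : ∀ a → a ℕ.< N → u a * ε⁻ (suc N) a + u N * u (N ℕ.∸ suc a) ≡ u a * ε⁻ N a
  u*ε⁻-suc a a<N = begin
    u a * ε⁻ (suc N) a + u N * w      ≡⟨ cong (λ x → u a * x + u N * w) (Σ-front a _) ⟩
    u a * (u N + X) + u N * w         ≡⟨ solve 4 (λ a n x w → a :* (n :+ x) :+ n :* w := a :* x :+ n :* (a :+ w)) refl (u a) (u N) X w ⟩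
    u a * X + u N * (u a + w)         ≡⟨ cong (u a * X +_) (trans (cong (λ m → u m * (u a + w)) (sym (ℕ.m+[n∸m]≡n a<N))) (sym (u-mul a (N ℕ.∸ suc a)))) ⟩
    u a * X + u a * w                 ≡⟨ ℚ.*-distribˡ-+ (u a) X w ⟨
    u a * ε⁻ N a                      ∎
    where
    open ≡-Reasoning
    open ℚSolver
    w = u (N ℕ.∸ suc a)
    X = ∑< a (λ i → u (N ℕ.∸ suc i))

  V₀-ε⁻-suc : ∀ M → M ℕ.≤ N → V 0 M (ε⁻ (suc N)) + u N * ∑< M (λ i → u (N ℕ.∸ suc i)) ≡ V 0 M (ε⁻ N)
  V₀-ε⁻-suc M M≤N = trans (cong (V 0 M (ε⁻ (suc N)) +_) (sym (Σ-*ˡ M (u N) _)))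
    (trans (sym (Σ-+ M _ _)) (Σ-cong M (λ a a<M → u*ε⁻-suc a (ℕ.<-≤-trans a<M M≤N))))

  V-ε⁻-suc : ∀ r → V r (suc N) (ε⁻ (suc N)) ≡ V r N (ε⁻ N) + u N ^ suc (suc r)
  V-ε⁻-suc zero = begin
    V 0 N (ε⁻ (suc N)) + u N * ε⁻ (suc N) N       ≡⟨ cong (λ x → V 0 N (ε⁻ (suc N)) + u N * x) (Σ-front N _) ⟩
    V 0 N (ε⁻ (suc N)) + u N * (u N + X)          ≡⟨ solve 3 (λ v n x → v :+ n :* (n :+ x) := (v :+ n :* x) :+ n :* (n :* con 1ℚ)) refl (V 0 N (ε⁻ (suc N))) (u N) X ⟩
    V 0 N (ε⁻ (suc N)) + u N * X + u N ^ 2        ≡⟨ cong (_+ u N ^ 2) (V₀-ε⁻-suc N ℕ.≤-refl) ⟩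
    V 0 N (ε⁻ N) + u N ^ 2                        ∎
    where
    open ≡-Reasoning
    open ℚSolver
    X = ∑< N (λ i → u (N ℕ.∸ suc i))
  V-ε⁻-suc (suc r) = begin
    V (suc r) N (ε⁻ (suc N)) + u N * V r (suc N) (ε⁻ (suc N))
      ≡⟨ cong (λ x → V (suc r) N (ε⁻ (suc N)) + u N * x) (V-ε⁻-suc r) ⟩
    V (suc r) N (ε⁻ (suc N)) + u N * (V r N (ε⁻ N) + u N ^ suc (suc r))
      ≡⟨ solve 4 (λ v n w p → v :+ n :* (w :+ p) := (v :+ n :* w) :+ n :* p) refl (V (suc r) N (ε⁻ (suc N))) (u N) (V r N (ε⁻ N)) (u N ^ suc (suc r)) ⟩
    V (suc r) N (ε⁻ (suc N)) + u N * V r N (ε⁻ N) + u N ^ suc (suc (suc r))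
      ≡⟨ cong (_+ u N ^ suc (suc (suc r))) (V-lin N (u N) (ε⁻ (suc N)) (ε⁻ N) (ε⁻ N) (λ a a<N → V₀-ε⁻-suc (suc a) a<N) r N ℕ.≤-refl) ⟩
    V (suc r) N (ε⁻ N) + u N ^ suc (suc (suc r)) ∎
    where
    open ≡-Reasoning
    open ℚSolver

  u*ε⁺-suc : ∀ a → u a * ε⁺ (suc N) a + u N * u (suc N ℕ.+ a) ≡ u a * ε⁺ N a
  u*ε⁺-suc a = begin
    u a * (X + w) + u N * w           ≡⟨ solve 4 (λ a n x w → a :* (x :+ w) :+ n :* w := a :* x :+ w :* (a :+ n)) refl (u a) (u N) X w ⟩
    u a * X + w * (u a + u N)         ≡⟨ cong (u a * X +_) (trans (cong (λ m → u (suc m) * (u a + u N)) (ℕ.+-comm N a)) (sym (u-mul a N))) ⟩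
    u a * X + u a * u N               ≡⟨ solve 3 (λ a x n → a :* x :+ a :* n := a :* (n :+ x)) refl (u a) X (u N) ⟩
    u a * (u N + X)                   ≡⟨ cong (u a *_) (cong₂ _+_ (cong u (sym (ℕ.+-identityʳ N))) (Σ-cong′ a (λ i → cong u (sym (ℕ.+-suc N i))))) ⟩
    u a * (u (N ℕ.+ 0) + ∑< a (λ i → u (N ℕ.+ suc i)))  ≡⟨ cong (u a *_) (Σ-front a _) ⟨
    u a * ε⁺ N a                      ∎
    where
    open ≡-Reasoning
    open ℚSolver
    w = u (suc N ℕ.+ a)
    X = ∑< a (λ i → u (suc N ℕ.+ i))

  V₀-ε⁺-suc : ∀ M → V 0 M (ε⁺ (suc N)) + u N * ∑< M (λ i → u (suc N ℕ.+ i)) ≡ V 0 M (ε⁺ N)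
  V₀-ε⁺-suc M = trans (cong (V 0 M (ε⁺ (suc N)) +_) (sym (Σ-*ˡ M (u N) _)))
    (trans (sym (Σ-+ M _ _)) (Σ-cong′ M u*ε⁺-suc))

  -- The new summand with largest variable contains 1/(2N + 2) = ½ 1/(N + 1), the origin of the
  -- factor ½ in `V-ε⁺`.
  V₀-ε⁺ : V 0 (suc N) (ε⁺ (suc N)) ≡ V 0 N (ε⁺ N) + ½ * (u N * u N)
  V₀-ε⁺ = begin
    V 0 N (ε⁺ (suc N)) + u N * (X + u (suc N ℕ.+ N))   ≡⟨ cong (λ x → V 0 N (ε⁺ (suc N)) + u N * (X + x)) (u-half N) ⟩
    V 0 N (ε⁺ (suc N)) + u N * (X + ½ * u N)           ≡⟨ solve 4 (λ v n x h → v :+ n :* (x :+ h :* n) := (v :+ n :* x) :+ h :* (n :* n)) refl (V 0 N (ε⁺ (suc N))) (u N) X ½ ⟩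
    V 0 N (ε⁺ (suc N)) + u N * X + ½ * (u N * u N)     ≡⟨ cong (_+ ½ * (u N * u N)) (V₀-ε⁺-suc N) ⟩
    V 0 N (ε⁺ N) + ½ * (u N * u N)                     ∎
    where
    open ≡-Reasoning
    open ℚSolver
    X = ∑< N (λ i → u (suc N ℕ.+ i))

  -- The weight in the correction term of `V₀-ε⁺-suc` is `ε⁺ (suc N)` itself. It absorbs the part of
  -- depth one less, so the recursion descends by two, exactly as the one for `star`.
  V-ε⁺-suc : ∀ r → V (suc (suc r)) (suc N) (ε⁺ (suc N)) ≡ V (suc (suc r)) N (ε⁺ N) + u N * (u N * V r (suc N) (ε⁺ (suc N)))
  V-ε⁺-suc r = begin
    V (suc (suc r)) N w + u N * (V (suc r) N w + u N * V r (suc N) w)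
      ≡⟨ solve 4 (λ v n x y → v :+ n :* (x :+ n :* y) := (v :+ n :* x) :+ n :* (n :* y)) refl (V (suc (suc r)) N w) (u N) (V (suc r) N w) (V r (suc N) w) ⟩
    V (suc (suc r)) N w + u N * V (suc r) N w + u N * (u N * V r (suc N) w)
      ≡⟨ cong (_+ u N * (u N * V r (suc N) w)) (V-lin N (u N) w (ε⁺ N) w (λ a _ → V₀-ε⁺-suc (suc a)) (suc r) N ℕ.≤-refl) ⟩
    V (suc (suc r)) N (ε⁺ N) + u N * (u N * V r (suc N) w) ∎
    where
    open ≡-Reasoning
    open ℚSolver
    w = ε⁺ (suc N)

V-ε⁻ : ∀ r N → V r N (ε⁻ N) ≡ ∑< N (λ n → u n ^ suc (suc r))
V-ε⁻ zero    zero    = refl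
V-ε⁻ (suc r) zero    = refl
V-ε⁻ r       (suc N) = trans (V-ε⁻-suc N r) (cong (_+ u N ^ suc (suc r)) (V-ε⁻ r N))

-- The coefficients of ∏_{n ≤ N} 1 / (1 - t²/n²).
star : ℕ → ℚ[[t]]
star N       zero          = 1ℚ
star N       (suc zero)    = 0ℚ
star zero    (suc (suc m)) = 0ℚ
star (suc N) (suc (suc m)) = star N (suc (suc m)) + u N * (u N * star (suc N) m)

double : ℕ → ℕ
double zero    = zero
double (suc c) = suc (suc (double c))

V-ε⁺ : ∀ c N → V (double c) N (ε⁺ N) ≡ ½ * star N (double (suc c))
V-ε⁺ zero    zero    = refl
V-ε⁺ (suc c) zero    = refl
V-ε⁺ zero    (suc N) = trans (V₀-ε⁺ N) (trans (cong (_+ ½ * (u N * u N)) (V-ε⁺ zero N))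
  (solve 3 (λ h s n → h :* s :+ h :* (n :* n) := h :* (s :+ n :* (n :* con 1ℚ))) refl ½ (star N 2) (u N)))
  where open ℚSolver
V-ε⁺ (suc c) (suc N) = trans (V-ε⁺-suc N (double c)) (trans (cong₂ (λ x y → x + u N * (u N * y)) (V-ε⁺ (suc c) N) (V-ε⁺ c (suc N)))
  (solve 4 (λ h s n y → h :* s :+ n :* (n :* (h :* y)) := h :* (s :+ n :* (n :* y))) refl ½ (star N (double (suc (suc c)))) (u N) (star (suc N) (double (suc c)))))
  where open ℚSolver

V-ε₀ : ∀ r N → V r N (ε N 0) ≡ V r N (ε⁻ N) + V r N (ε⁺ N)
V-ε₀ r N = go r N
  where
  go : ∀ r M → V r M (ε N 0) ≡ V r M (ε⁻ N) + V r M (ε⁺ N)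
  go zero    M = trans (Σ-cong′ M (λ a → trans (cong (u a *_) (ε₀≡ N a)) (ℚ.*-distribˡ-+ (u a) (ε⁻ N a) (ε⁺ N a)))) (Σ-+ M _ _)
  go (suc r) M = trans (Σ-cong′ M (λ a → trans (cong (u a *_) (go r (suc a))) (ℚ.*-distribˡ-+ (u a) (V r (suc a) (ε⁻ N)) (V r (suc a) (ε⁺ N))))) (Σ-+ M _ _)

W-ones∼ : ∀ c → (λ N → W (ones (suc (double c))) N (ε N 0)) ∼ (λ N → ∑< N (λ n → u n ^ double (suc c)) + ½ * star N (double (suc c)))
W-ones∼ c = ∼-trans (W∼V (double c)) (∼-reflexive (λ N → trans (V-ε₀ (double c) N) (cong₂ _+_ (V-ε⁻ (double c) N) (V-ε⁺ c N))))

-- Sums over lists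

∑ₗ : {A : Set} → List A → (A → ℚ) → ℚ
∑ₗ []       f = 0ℚ
∑ₗ (x ∷ xs) f = f x + ∑ₗ xs f

∑ₗ-++ : {A : Set} (xs ys : List A) (f : A → ℚ) → ∑ₗ (xs ++ ys) f ≡ ∑ₗ xs f + ∑ₗ ys f
∑ₗ-++ []       ys f = sym (ℚ.+-identityˡ _)
∑ₗ-++ (x ∷ xs) ys f = trans (cong (f x +_) (∑ₗ-++ xs ys f)) (sym (ℚ.+-assoc (f x) _ _))

∑ₗ-map : {A B : Set} (h : A → B) (xs : List A) (f : B → ℚ) → ∑ₗ (map h xs) f ≡ ∑ₗ xs (λ a → f (h a))
∑ₗ-map h []       f = refl
∑ₗ-map h (x ∷ xs) f = cong (f (h x) +_) (∑ₗ-map h xs f)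

∑ₗ-cong : {A : Set} (xs : List A) {f g : A → ℚ} → (∀ a → f a ≡ g a) → ∑ₗ xs f ≡ ∑ₗ xs g
∑ₗ-cong []       e = refl
∑ₗ-cong (x ∷ xs) e = cong₂ _+_ (e x) (∑ₗ-cong xs e)

∑ₗ-*ˡ : {A : Set} (xs : List A) (c : ℚ) (f : A → ℚ) → ∑ₗ xs (λ a → c * f a) ≡ c * ∑ₗ xs f
∑ₗ-*ˡ []       c f = sym (ℚ.*-zeroʳ c)
∑ₗ-*ˡ (x ∷ xs) c f = trans (cong (c * f x +_) (∑ₗ-*ˡ xs c f)) (sym (ℚ.*-distribˡ-+ c (f x) _))

∑ₗ-∑< : {A : Set} (xs : List A) (n : ℕ) (f : A → ℕ → ℚ) → ∑ₗ xs (λ a → ∑< n (f a)) ≡ ∑< n (λ i → ∑ₗ xs (λ a → f a i))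
∑ₗ-∑< []       n f = sym (Σ-0 n)
∑ₗ-∑< (x ∷ xs) n f = trans (cong (∑< n (f x) +_) (∑ₗ-∑< xs n f)) (sym (Σ-+ n (f x) _))

-- Sequences of rationals that converge to elements of 𝒵 and of ζ(2) 𝒵

∑-seq : {A : Set} (xs : List A) (f : A → ℝ) (N : ℕ) → seq (∑ xs f) N ≡ ∑ₗ xs (λ a → seq (f a) N)
∑-seq []       f N = refl
∑-seq (x ∷ xs) f N = cong (seq (f x) N +_) (∑-seq xs f N)

weighted : ℕ → ℚ × ∃ Admissible → ℚ
weighted N (c , k , _) = c * ζ≤ k N

opaque
  eval : 𝓗⁰ → ℕ → ℚ
  eval w N = ∑ₗ w (weighted N)

  eval-def : ∀ w N → eval w N ≡ ∑ₗ w (weighted N)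
  eval-def w N = refl

seq-Z : ∀ w N → seq (Z w) N ≡ eval w N
seq-Z w N = trans (∑-seq w (λ ca → fromℚ (proj₁ ca) Defs.* ζ (proj₂ (proj₂ ca))) N) (sym (eval-def w N))

eval-++ : ∀ w w′ N → eval (w ++ w′) N ≡ eval w N + eval w′ N
eval-++ w w′ N = trans (eval-def (w ++ w′) N) (trans (∑ₗ-++ w w′ (weighted N)) (sym (cong₂ _+_ (eval-def w N) (eval-def w′ N))))

eval-∷ : ∀ c {k} (a : Admissible k) w N → eval ((c , k , a) ∷ w) N ≡ c * ζ≤ k N + eval w N
eval-∷ c {k} a w N = trans (eval-def ((c , k , a) ∷ w) N) (cong (c * ζ≤ k N +_) (sym (eval-def w N)))

-- Membership is a property of sequences up to null sequences. Convergence of `s` is then a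
-- consequence of the approximation and never has to be shown separately.
record 𝒵ˢ (s : ℕ → ℚ) : Set where
  constructor mk𝒵
  field
    {witness} : 𝓗⁰
    approx    : s ∼ eval witness

record 𝒥ˢ (s : ℕ → ℚ) : Set where
  constructor mk𝒥
  field
    {quotient} : 𝓗⁰
    approx     : s ∼ (λ N → ζ≤ (1+ 1 ∷ []) N * eval quotient N)

eval-bounded : ∀ w → Bounded (eval w)
eval-bounded w = mkBounded (ℚ.<⇒≤ 0<B) (N , λ n N≤n → subst (λ x → ∣ x ∣ ≤ B) (seq-Z w n) (b n N≤n))
  where
  cb = cauchy-bounded (seq (Z w)) (cauchy (Z w))
  B = proj₁ cb
  0<B = proj₁ (proj₂ cb)
  N = proj₁ (proj₂ (proj₂ cb))
  b = proj₂ (proj₂ (proj₂ cb))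

𝒵-bounded : ∀ {s} → 𝒵ˢ s → Bounded s
𝒵-bounded (mk𝒵 {w} e) = ∼-bounded e (eval-bounded w)

𝒵-∼ : ∀ {s t} → s ∼ t → 𝒵ˢ t → 𝒵ˢ s
𝒵-∼ e (mk𝒵 e′) = mk𝒵 (∼-trans e e′)

𝒵-resp : ∀ {s t} → (∀ n → s n ≡ t n) → 𝒵ˢ t → 𝒵ˢ s
𝒵-resp e = 𝒵-∼ (∼-reflexive e)

𝒵-0 : 𝒵ˢ (λ _ → 0ℚ)
𝒵-0 = mk𝒵 {witness = []} (∼-reflexive (λ N → sym (eval-def [] N)))

𝒵-+ : ∀ {s t} → 𝒵ˢ s → 𝒵ˢ t → 𝒵ˢ (λ n → s n + t n)
𝒵-+ (mk𝒵 {w} e) (mk𝒵 {w′} e′) = mk𝒵 {witness = w ++ w′} (∼-trans (∼-+ e e′) (∼-reflexive (λ N → sym (eval-++ w w′ N))))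

scaleL : ∀ {A : Set} → ℚ → Lin A → Lin A
scaleL c = map (λ (d , a) → c * d , a)

eval-scale : ∀ c w N → eval (scaleL c w) N ≡ c * eval w N
eval-scale c w N = trans (eval-def (scaleL c w) N) (trans (∑ₗ-map (λ (d , a) → c * d , a) w (weighted N))
  (trans (∑ₗ-cong w (λ (d , k , _) → ℚ.*-assoc c d (ζ≤ k N))) (trans (∑ₗ-*ˡ w c (weighted N)) (cong (c *_) (sym (eval-def w N))))))

𝒵-scale : ∀ c {s} → 𝒵ˢ s → 𝒵ˢ (λ n → c * s n)
𝒵-scale c (mk𝒵 {w} e) = mk𝒵 {witness = scaleL c w} (∼-trans (∼-*-const c e) (∼-reflexive (λ N → sym (eval-scale c w N))))

𝒵-ζ : ∀ {k} → Admissible k → 𝒵ˢ (ζ≤ k)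
𝒵-ζ {k} a = mk𝒵 {witness = (1ℚ , k , a) ∷ []} (∼-reflexive (λ N → sym (trans (eval-∷ 1ℚ a [] N)
  (trans (cong (1ℚ * ζ≤ k N +_) (eval-def [] N)) (trans (ℚ.+-identityʳ _) (ℚ.*-identityˡ (ζ≤ k N)))))))

𝒵-const : ∀ c → 𝒵ˢ (λ _ → c)
𝒵-const c = 𝒵-resp (λ _ → sym (ℚ.*-identityʳ c)) (𝒵-scale c (𝒵-ζ empty))

𝒵-∑ₗ : {A : Set} (xs : List A) {f : ℕ → A → ℚ} → All (λ a → 𝒵ˢ (λ N → f N a)) xs → 𝒵ˢ (λ N → ∑ₗ xs (f N))
𝒵-∑ₗ []       []       = 𝒵-0
𝒵-∑ₗ (x ∷ xs) (p ∷ ps) = 𝒵-+ p (𝒵-∑ₗ xs ps)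

product-of-sums : ∀ N f g → ∑< N f * ∑< N g ≡ ∑< N (λ n → f n * ∑< n g + (g n * ∑< n f + f n * g n))
product-of-sums zero    f g = ℚ.*-zeroˡ 0ℚ
product-of-sums (suc N) f g = trans
  (solve 4 (λ F f G g → (F :+ f) :* (G :+ g) := F :* G :+ (f :* G :+ (g :* F :+ f :* g))) refl (∑< N f) (f N) (∑< N g) (g N))
  (cong (_+ (f N * ∑< N g + (g N * ∑< N f + f N * g N))) (product-of-sums N f g))
  where open ℚSolver

-- The product formula is exact for every N: compare the largest variables of the two factors. Equal
-- ones merge, which adds their exponents.
W₁-harmonic : ∀ p q N → W₁ N p * W₁ N q ≡ ∑ₗ (harmonicʳ p q) (W₁ N)
W₁-harmonic []      q       N = trans (ℚ.*-identityˡ (W₁ N q)) (sym (ℚ.+-identityʳ (W₁ N q)))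
W₁-harmonic (a ∷ p) []      N = trans (ℚ.*-identityʳ (W₁ N (a ∷ p))) (sym (ℚ.+-identityʳ (W₁ N (a ∷ p))))
W₁-harmonic (a ∷ p) (b ∷ q) N = begin
  W₁ N (a ∷ p) * W₁ N (b ∷ q)
    ≡⟨ product-of-sums N _ _ ⟩
  ∑< N (λ n → x n * X n * W₁ n (b ∷ q) + (y n * Y n * W₁ n (a ∷ p) + x n * X n * (y n * Y n)))
    ≡⟨ Σ-cong′ N (λ n → trans (solve 6 (λ x X y Y P Q → x :* X :* Q :+ (y :* Y :* P :+ x :* X :* (y :* Y))
           := x :* (X :* Q) :+ (y :* (P :* Y) :+ (x :* y) :* (X :* Y))) refl (x n) (X n) (y n) (Y n) (W₁ n (a ∷ p)) (W₁ n (b ∷ q)))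
         (cong₂ _+_ (term a p (b ∷ q) n) (cong₂ _+_ (term b (a ∷ p) q n)
           (trans (cong (_* (X n * Y n)) (sym (u^⊕⁺ a b n))) (term (a ⊕⁺ b) p q n))))) ⟩
  ∑< N (λ n → A n + (B n + C n))
    ≡⟨ trans (Σ-+ N A _) (cong (∑< N A +_) (Σ-+ N B C)) ⟩
  ∑< N A + (∑< N B + ∑< N C)
    ≡⟨ cong₂ _+_ (collect a (harmonicʳ p (b ∷ q))) (cong₂ _+_ (collect b (harmonicʳ (a ∷ p) q)) (collect (a ⊕⁺ b) (harmonicʳ p q))) ⟩
  ∑ₗ (map (a ∷_) (harmonicʳ p (b ∷ q))) (W₁ N) + (∑ₗ (map (b ∷_) (harmonicʳ (a ∷ p) q)) (W₁ N) + ∑ₗ (map (a ⊕⁺ b ∷_) (harmonicʳ p q)) (W₁ N))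
    ≡⟨ trans (∑ₗ-++ (map (a ∷_) (harmonicʳ p (b ∷ q))) _ (W₁ N)) (cong (∑ₗ (map (a ∷_) (harmonicʳ p (b ∷ q))) (W₁ N) +_) (∑ₗ-++ (map (b ∷_) (harmonicʳ (a ∷ p) q)) _ (W₁ N))) ⟨
  ∑ₗ (harmonicʳ (a ∷ p) (b ∷ q)) (W₁ N) ∎
  where
  open ≡-Reasoning
  open ℚSolver
  x y X Y A B C : ℕ → ℚ
  x n = u n ^ val a
  y n = u n ^ val b
  X n = W₁ n p
  Y n = W₁ n q
  A n = u n ^ val a * ∑ₗ (harmonicʳ p (b ∷ q)) (W₁ n)
  B n = u n ^ val b * ∑ₗ (harmonicʳ (a ∷ p) q) (W₁ n)
  C n = u n ^ val (a ⊕⁺ b) * ∑ₗ (harmonicʳ p q) (W₁ n)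
  term : ∀ c p q n → u n ^ val c * (W₁ n p * W₁ n q) ≡ u n ^ val c * ∑ₗ (harmonicʳ p q) (W₁ n)
  term c p q n = cong (u n ^ val c *_) (W₁-harmonic p q n)
  u^⊕⁺ : ∀ a b n → u n ^ val (a ⊕⁺ b) ≡ u n ^ val a * u n ^ val b
  u^⊕⁺ (1+ a) b n = ^-homo-* (u n) (suc a) (val b)
  collect : ∀ c vs → ∑< N (λ n → u n ^ val c * ∑ₗ vs (W₁ n)) ≡ ∑ₗ (map (c ∷_) vs) (W₁ N)
  collect c vs = trans (Σ-cong′ N (λ n → sym (∑ₗ-*ˡ vs (u n ^ val c) (W₁ n))))
    (trans (sym (∑ₗ-∑< vs N (λ v n → u n ^ val c * W₁ n v))) (sym (∑ₗ-map (c ∷_) vs (W₁ N))))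

data Admissibleʳ : Index → Set where
  empty   : Admissibleʳ []
  first≥2 : ∀ {k ks} → 2 ℕ.≤ val k → Admissibleʳ (k ∷ ks)

admissible-reverse : ∀ {p} → Admissibleʳ p → Admissible (reverse p)
admissible-reverse empty                  = empty
admissible-reverse (first≥2 {k} {ks} 2≤k) = subst Admissible (sym (unfold-reverse k ks)) (last≥2 (reverse ks) k 2≤k)

reverse-admissible : ∀ {k} → Admissible k → Admissibleʳ (reverse k)
reverse-admissible empty            = empty
reverse-admissible (last≥2 k l 2≤l) = subst Admissibleʳ (sym (reverse-++ k (l ∷ []))) (first≥2 2≤l)

𝒵-W₁ : ∀ {p} → Admissibleʳ p → 𝒵ˢ (λ N → W₁ N p)
𝒵-W₁ {p} a = 𝒵-resp (λ N → sym (trans (cong (λ q → ζʳ≤ q N) (reverse-involutive p)) (ζʳ≤≡W p N))) (𝒵-ζ (admissible-reverse a))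

harmonic-admissible : ∀ {p q} → Admissibleʳ p → Admissibleʳ q → All Admissibleʳ (harmonicʳ p q)
harmonic-admissible             empty           a               = a ∷ []
harmonic-admissible             (first≥2 2≤a)   empty           = first≥2 2≤a ∷ []
harmonic-admissible {a ∷ p} {b ∷ q} (first≥2 2≤a) (first≥2 2≤b) =
  All.++⁺ (prefixed a 2≤a (harmonicʳ p (b ∷ q)))
    (All.++⁺ (prefixed b 2≤b (harmonicʳ (a ∷ p) q)) (prefixed (a ⊕⁺ b) (⊕⁺-≥2 a 2≤a) (harmonicʳ p q)))
  where
  prefixed : ∀ c → 2 ℕ.≤ val c → ∀ vs → All Admissibleʳ (map (c ∷_) vs)
  prefixed c 2≤c []       = []
  prefixed c 2≤c (v ∷ vs) = first≥2 2≤c ∷ prefixed c 2≤c vs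
  ⊕⁺-≥2 : ∀ a → 2 ℕ.≤ val a → 2 ℕ.≤ val (a ⊕⁺ b)
  ⊕⁺-≥2 (1+ a) 2≤a = ℕ.≤-trans 2≤a (ℕ.m≤m+n (suc a) (val b))

𝒵-* : ∀ {s t} → 𝒵ˢ s → 𝒵ˢ t → 𝒵ˢ (λ n → s n * t n)
𝒵-* (mk𝒵 {w} e) (mk𝒵 {w′} e′) = 𝒵-∼ (∼-* (eval-bounded w) (𝒵-bounded (mk𝒵 {witness = w′} e′)) e e′) (go w)
  where
  basis : ∀ {k l} → Admissible k → Admissible l → 𝒵ˢ (λ N → ζ≤ k N * ζ≤ l N)
  basis {k} {l} a b = 𝒵-resp (λ N → trans (cong₂ _*_ (ζʳ≤≡W (reverse k) N) (ζʳ≤≡W (reverse l) N)) (W₁-harmonic (reverse k) (reverse l) N))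
    (𝒵-∑ₗ (harmonicʳ (reverse k) (reverse l)) (All.map 𝒵-W₁ (harmonic-admissible (reverse-admissible a) (reverse-admissible b))))
  row : ∀ {k} → Admissible k → ∀ w′ → 𝒵ˢ (λ N → ζ≤ k N * eval w′ N)
  row {k} a []                 = 𝒵-resp (λ N → trans (cong (ζ≤ k N *_) (eval-def [] N)) (ℚ.*-zeroʳ (ζ≤ k N))) 𝒵-0
  row {k} a ((d , l , b) ∷ w′) = 𝒵-resp (λ N → trans (cong (ζ≤ k N *_) (eval-∷ d b w′ N)) (solve 4 (λ x d y r → x :* (d :* y :+ r) := d :* (x :* y) :+ x :* r) refl (ζ≤ k N) d (ζ≤ l N) (eval w′ N)))
    (𝒵-+ (𝒵-scale d (basis a b)) (row a w′))
    where open ℚSolver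
  go : ∀ w → 𝒵ˢ (λ N → eval w N * eval w′ N)
  go []                = 𝒵-resp (λ N → trans (cong (_* eval w′ N) (eval-def [] N)) (ℚ.*-zeroˡ (eval w′ N))) 𝒵-0
  go ((c , k , a) ∷ w) = 𝒵-resp (λ N → trans (cong (_* eval w′ N) (eval-∷ c a w N)) (solve 4 (λ c x r y → (c :* x :+ r) :* y := c :* (x :* y) :+ r :* y) refl c (ζ≤ k N) (eval w N) (eval w′ N)))
    (𝒵-+ (𝒵-scale c (row a w′)) (go w))
    where open ℚSolver

𝒥-∼ : ∀ {s t} → s ∼ t → 𝒥ˢ t → 𝒥ˢ s
𝒥-∼ e (mk𝒥 e′) = mk𝒥 (∼-trans e e′)

𝒥-resp : ∀ {s t} → (∀ n → s n ≡ t n) → 𝒥ˢ t → 𝒥ˢ s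
𝒥-resp e = 𝒥-∼ (∼-reflexive e)

𝒥-0 : 𝒥ˢ (λ _ → 0ℚ)
𝒥-0 = mk𝒥 {quotient = []} (∼-reflexive (λ N → sym (trans (cong (ζ≤ (1+ 1 ∷ []) N *_) (eval-def [] N)) (ℚ.*-zeroʳ (ζ≤ (1+ 1 ∷ []) N)))))

null⇒𝒥 : ∀ {s} → Null s → 𝒥ˢ s
null⇒𝒥 ns = 𝒥-∼ (null⇒∼0 ns) 𝒥-0

ζ2-𝒵 : 𝒵ˢ (ζ≤ (1+ 1 ∷ []))
ζ2-𝒵 = 𝒵-ζ two-admissible

𝒥-intro : ∀ {t} → 𝒵ˢ t → 𝒥ˢ (λ N → ζ≤ (1+ 1 ∷ []) N * t N)
𝒥-intro (mk𝒵 {w} e) = mk𝒥 {quotient = w} (∼-* (𝒵-bounded ζ2-𝒵) (𝒵-bounded (mk𝒵 {witness = w} e)) ∼-refl e)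

𝒥-+ : ∀ {s t} → 𝒥ˢ s → 𝒥ˢ t → 𝒥ˢ (λ n → s n + t n)
𝒥-+ (mk𝒥 {w} e) (mk𝒥 {w′} e′) = mk𝒥 {quotient = w ++ w′} (∼-trans (∼-+ e e′)
  (∼-reflexive (λ N → sym (trans (cong (ζ≤ (1+ 1 ∷ []) N *_) (eval-++ w w′ N)) (ℚ.*-distribˡ-+ (ζ≤ (1+ 1 ∷ []) N) (eval w N) (eval w′ N))))))

𝒥⇒𝒵 : ∀ {s} → 𝒥ˢ s → 𝒵ˢ s
𝒥⇒𝒵 (mk𝒥 {w} e) = 𝒵-∼ e (𝒵-* ζ2-𝒵 (mk𝒵 {witness = w} ∼-refl))

𝒥-* : ∀ {s t} → 𝒥ˢ s → 𝒵ˢ t → 𝒥ˢ (λ n → s n * t n)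
𝒥-* {s} {t} i@(mk𝒥 {w} e) zt = 𝒥-∼ (∼-* (𝒵-bounded (𝒵-* ζ2-𝒵 (mk𝒵 {witness = w} ∼-refl))) (𝒵-bounded zt) e ∼-refl)
  (𝒥-resp (λ N → ℚ.*-assoc (ζ≤ (1+ 1 ∷ []) N) (eval w N) (t N)) (𝒥-intro (𝒵-* (mk𝒵 {witness = w} ∼-refl) zt)))

𝒥-*ˡ : ∀ {s t} → 𝒵ˢ s → 𝒥ˢ t → 𝒥ˢ (λ n → s n * t n)
𝒥-*ˡ {s} {t} zs it = 𝒥-resp (λ n → ℚ.*-comm (s n) (t n)) (𝒥-* it zs)

𝒥-scale : ∀ c {s} → 𝒥ˢ s → 𝒥ˢ (λ n → c * s n)
𝒥-scale c = 𝒥-*ˡ (𝒵-const c)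

𝒥-neg : ∀ {s} → 𝒥ˢ s → 𝒥ˢ (λ n → - s n)
𝒥-neg {s} i = 𝒥-resp (λ n → solve 1 (λ x → :- x := con (- 1ℚ) :* x) refl (s n)) (𝒥-scale (- 1ℚ) i)
  where open ℚSolver

𝒥-∑< : ∀ m {s : ℕ → ℕ → ℚ} → (∀ i → i ℕ.< m → 𝒥ˢ (s i)) → 𝒥ˢ (λ n → ∑< m (λ i → s i n))
𝒥-∑< zero    e = 𝒥-0
𝒥-∑< (suc m) e = 𝒥-+ (𝒥-∑< m (λ i i<m → e i (ℕ.m<n⇒m<1+n i<m))) (e m ℕ.≤-refl)

𝒥-anti : ∀ m {s : ℕ → ℕ → ℕ → ℚ} → (∀ i j → i ℕ.+ j ≡ m → 𝒥ˢ (s i j)) → 𝒥ˢ (λ n → anti (λ i j → s i j n) m)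
𝒥-anti zero    e = e 0 0 refl
𝒥-anti (suc m) e = 𝒥-+ (e 0 (suc m) refl) (𝒥-anti m (λ i j eq → e (suc i) j (cong suc eq)))

𝒵-anti : ∀ m {s : ℕ → ℕ → ℕ → ℚ} → (∀ i j → i ℕ.+ j ≡ m → 𝒵ˢ (s i j)) → 𝒵ˢ (λ n → anti (λ i j → s i j n) m)
𝒵-anti zero    e = e 0 0 refl
𝒵-anti (suc m) e = 𝒵-+ (e 0 (suc m) refl) (𝒵-anti m (λ i j eq → e (suc i) j (cong suc eq)))

-- Even zeta values

power-sum : ℕ → ℕ → ℚ
power-sum k N = ∑< N (λ n → u n ^ k)

W₁-single : ∀ k N → W₁ N (k ∷ []) ≡ power-sum (val k) N
W₁-single k N = Σ-cong′ N (λ n → ℚ.*-identityʳ (u n ^ val k))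

tailˢ-at-0 : ∀ φ κ → tailˢ φ κ 0 ≡ φ κ
tailˢ-at-0 φ []            = refl
tailˢ-at-0 φ ((1+ k) ∷ ks) = trans (ℚ.*-identityˡ _) (trans (tailˢ-at-0 (λ p → φ ((1+ (k ℕ.+ 0)) ∷ p)) ks)
  (cong (λ m → φ ((1+ m) ∷ ks)) (ℕ.+-identityʳ k)))

𝒮-single : ∀ c N → 𝒮 (W₁ N) (c ∷ []) 0 ≡ (sgn (c ∷ []) + 1ℚ) * W₁ N (c ∷ [])
𝒮-single c N = trans (cong (λ x → sgn (c ∷ []) * (1ℚ * x) + 1ℚ * (W₁ N (c ∷ []) * 1ℚ)) (tailˢ-at-0 (W₁ N) (c ∷ [])))
  (solve 2 (λ s w → s :* (con 1ℚ :* w) :+ con 1ℚ :* (w :* con 1ℚ) := (s :+ con 1ℚ) :* w) refl (sgn (c ∷ [])) (W₁ N (c ∷ [])))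
  where open ℚSolver

-- With an even total exponent both double sums occur with sign +, and together they are a product
-- minus a single sum, by the harmonic product.
𝒮-pair : ∀ a b N → sgn (a ∷ b ∷ []) ≡ 1ℚ →
  𝒮 (W₁ N) (a ∷ b ∷ []) 0 ≡ (sgn (b ∷ []) + 1ℚ) * (W₁ N (a ∷ []) * W₁ N (b ∷ [])) - W₁ N (a ⊕⁺ b ∷ [])
𝒮-pair a b N even = begin
  sgn (a ∷ b ∷ []) * (1ℚ * tailˢ (W₁ N) (a ∷ b ∷ []) 0) + (sgn (b ∷ []) * (W₁ N (a ∷ []) * tailˢ (W₁ N) (b ∷ []) 0) + 1ℚ * (W₁ N (b ∷ a ∷ []) * 1ℚ))
    ≡⟨ cong₂ _+_ (cong₂ (λ x y → x * (1ℚ * y)) even (tailˢ-at-0 (W₁ N) (a ∷ b ∷ [])))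
         (cong (λ x → sgn (b ∷ []) * (W₁ N (a ∷ []) * x) + 1ℚ * (W₁ N (b ∷ a ∷ []) * 1ℚ)) (tailˢ-at-0 (W₁ N) (b ∷ []))) ⟩
  1ℚ * (1ℚ * W₁ N (a ∷ b ∷ [])) + (sgn (b ∷ []) * (W₁ N (a ∷ []) * W₁ N (b ∷ [])) + 1ℚ * (W₁ N (b ∷ a ∷ []) * 1ℚ))
    ≡⟨ solve 5 (λ x y z s p → con 1ℚ :* (con 1ℚ :* x) :+ (s :* p :+ con 1ℚ :* (y :* con 1ℚ))
           := s :* p :+ (x :+ (y :+ (z :+ con 0ℚ))) :- z) refl (W₁ N (a ∷ b ∷ [])) (W₁ N (b ∷ a ∷ [])) (W₁ N (a ⊕⁺ b ∷ [])) (sgn (b ∷ [])) (W₁ N (a ∷ []) * W₁ N (b ∷ [])) ⟩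
  sgn (b ∷ []) * (W₁ N (a ∷ []) * W₁ N (b ∷ [])) + ∑ₗ (harmonicʳ (a ∷ []) (b ∷ [])) (W₁ N) - W₁ N (a ⊕⁺ b ∷ [])
    ≡⟨ cong (λ x → sgn (b ∷ []) * (W₁ N (a ∷ []) * W₁ N (b ∷ [])) + x - W₁ N (a ⊕⁺ b ∷ [])) (W₁-harmonic (a ∷ []) (b ∷ []) N) ⟨
  sgn (b ∷ []) * (W₁ N (a ∷ []) * W₁ N (b ∷ [])) + W₁ N (a ∷ []) * W₁ N (b ∷ []) - W₁ N (a ⊕⁺ b ∷ [])
    ≡⟨ solve 3 (λ s p z → s :* p :+ p :- z := (s :+ con 1ℚ) :* p :- z) refl (sgn (b ∷ [])) (W₁ N (a ∷ []) * W₁ N (b ∷ [])) (W₁ N (a ⊕⁺ b ∷ [])) ⟩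
  (sgn (b ∷ []) + 1ℚ) * (W₁ N (a ∷ []) * W₁ N (b ∷ [])) - W₁ N (a ⊕⁺ b ∷ []) ∎
  where
  open ≡-Reasoning
  open ℚSolver

sign-even : ∀ c → (- 1ℚ) ^ double c ≡ 1ℚ
sign-even zero    = refl
sign-even (suc c) = cong (λ x → - 1ℚ * (- 1ℚ * x)) (sign-even c)

sign-odd : ∀ c → (- 1ℚ) ^ suc (double c) ≡ - 1ℚ
sign-odd c = cong (- 1ℚ *_) (sign-even c)

data Parity : ℕ → Set where
  even : ∀ i → Parity (double i)
  odd  : ∀ i → Parity (suc (double i))

parity : ∀ n → Parity n
parity zero    = even 0
parity (suc n) with parity n
... | even i = odd i
... | odd i  = even (suc i)

double-∸ : ∀ q i → double q ℕ.∸ double i ≡ double (q ℕ.∸ i)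
double-∸ zero    zero    = refl
double-∸ zero    (suc i) = refl
double-∸ (suc q) zero    = refl
double-∸ (suc q) (suc i) = double-∸ q i

double-cancel-< : ∀ q i → suc (double i) ℕ.< double q → i ℕ.< q
double-cancel-< (suc q) zero    _                     = ℕ.s≤s ℕ.z≤n
double-cancel-< (suc q) (suc i) (ℕ.s≤s (ℕ.s≤s lt)) = ℕ.s≤s (double-cancel-< q i lt)

-- Euler: ζ(2n) ∈ ζ(2) 𝒵.  For n ≥ 2 the cyclic sum formula for the index (2n - 1) is the recursion
-- 2 ∑ ζ(2i) ζ(2n - 2i) = (2n + 1) ζ(2n).
even-power-sum-𝒥 : ∀ q → 𝒥ˢ (power-sum (double (suc q)))
even-power-sum-𝒥 = <-rec _ step
  where
  step : ∀ q → (∀ {i} → i ℕ.< q → 𝒥ˢ (power-sum (double (suc i)))) → 𝒥ˢ (power-sum (double (suc q)))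
  step zero    _  = 𝒥-resp (λ N → sym (trans (ℚ.*-identityʳ (ζ≤ (1+ 1 ∷ []) N)) (trans (ζʳ≤≡W (1+ 1 ∷ []) N) (W₁-single (1+ 1) N))))
    (𝒥-intro (𝒵-const 1ℚ))
  step (suc q-1) IH = 𝒥-resp solved (𝒥-scale (u (suc (suc d)))
    (𝒥-+ X-𝒥 (null⇒𝒥 (null-+ (𝓔⁺-null 0 (k ∷ []) (λ ()) (inj₁ big)) (null-neg (𝓔⁻-null 0 (k ∷ []) (λ ()) (inj₁ big)))))))
    where
    q = suc q-1
    d = double q
    k : ℕ⁺
    k = 1+ d
    big : Big (k ∷ [])
    big = here (ℕ.s≤s (ℕ.s≤s ℕ.z≤n))
    P : ℕ → ℚ
    P = power-sum (suc (suc d))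
    b : ℕ → ℕ⁺
    b j = k ⊖ j
    -- For even j the exponent k - j is odd and the coefficient is 0, which also removes the
    -- divergent sum at j = 0. For odd j it is 2, and both j + 1 and k - j are even.
    X : ℕ → ℕ → ℚ
    X j N = (sgn (b j ∷ []) + 1ℚ) * (W₁ N ((1+ j) ∷ []) * W₁ N (b j ∷ []))
    W₁≡P : ∀ c N → val c ≡ suc (suc d) → W₁ N (c ∷ []) ≡ P N
    W₁≡P c N e = trans (W₁-single c N) (cong (λ m → power-sum m N) e)
    sum≡ : ∀ j → j ℕ.≤ d → j ℕ.+ suc (d ℕ.∸ j) ≡ suc d
    sum≡ j j≤d = trans (ℕ.+-suc j (d ℕ.∸ j)) (cong suc (ℕ.m+[n∸m]≡n j≤d))
    sgn-2 : ∀ i j → suc i ℕ.+ (suc j ℕ.+ 0) ≡ suc (suc d) → sgn ((1+ i) ∷ (1+ j) ∷ []) ≡ 1ℚ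
    sgn-2 i j e = trans (cong ((- 1ℚ) ^_) e) (sign-even (suc q))
    𝓛-sum : ∀ N → 𝓛 (W₁ N) 0 k [] ≡ ∑< d (λ j → X j N) - ν d * P N
    𝓛-sum N = trans (Σ-cong d (λ j j<d → trans
        (𝒮-pair (1+ j) (b j) N (sgn-2 j (d ℕ.∸ j) (cong suc (trans (cong (j ℕ.+_) (ℕ.+-identityʳ (suc (d ℕ.∸ j)))) (sum≡ j (ℕ.<⇒≤ j<d))))))
        (cong (λ x → X j N - x) (W₁≡P ((1+ j) ⊕⁺ b j) N (cong suc (sum≡ j (ℕ.<⇒≤ j<d)))))))
      (trans (Σ-+ d (λ j → X j N) (λ _ → - P N)) (cong (∑< d (λ j → X j N) +_) (Σ-const d)))
      where
      open ℚSolver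
      Σ-const : ∀ m → ∑< m (λ _ → - P N) ≡ - (ν m * P N)
      Σ-const zero    = sym (trans (cong -_ (ℚ.*-zeroˡ (P N))) refl)
      Σ-const (suc m) = trans (cong (_+ - P N) (Σ-const m)) (trans
        (solve 2 (λ n p → :- (n :* p) :+ :- p := :- ((con 1ℚ :+ n) :* p)) refl (ν m) (P N)) (cong (λ x → - (x * P N)) (sym (ν-+ 1 m))))
    𝓡-sum : ∀ N → 𝓡 (W₁ N) 0 k [] ≡ ν 3 * P N
    𝓡-sum N = trans (cong₂ _+_ (cong₂ _+_ (single (k ⊕ 0 ⊕ 1) (cong suc (trans (ℕ.+-comm (d ℕ.+ 0) 1) (cong suc (ℕ.+-identityʳ d))))) pair)
        (single (k ⊕ 1) (cong suc (ℕ.+-comm d 1))))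
      (solve 1 (λ p → (con (1ℚ + 1ℚ) :* p :+ (:- p)) :+ con (1ℚ + 1ℚ) :* p := con (ν 3) :* p) refl (P N))
      where
      open ℚSolver
      single : ∀ c → val c ≡ suc (suc d) → 𝒮 (W₁ N) (c ∷ []) 0 ≡ (1ℚ + 1ℚ) * P N
      single c e = trans (𝒮-single c N) (cong₂ (λ x y → (x + 1ℚ) * y)
        (trans (cong ((- 1ℚ) ^_) (trans (ℕ.+-identityʳ (val c)) e)) (sign-even (suc q))) (W₁≡P c N e))
      -- The divergent `W₁ N ((1+ 0) ∷ [])` occurs with the coefficient -1 + 1, since k is odd.
      pair : 𝒮 (W₁ N) ((1+ 0) ∷ k ∷ []) 0 ≡ - P N
      pair = trans (𝒮-pair (1+ 0) k N (sgn-2 0 d (cong (λ m → suc (suc m)) (ℕ.+-identityʳ d))))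
        (trans (cong₂ (λ x y → (x + 1ℚ) * (W₁ N ((1+ 0) ∷ []) * W₁ N (k ∷ [])) - y)
          (trans (cong ((- 1ℚ) ^_) (ℕ.+-identityʳ (suc d))) (sign-odd q)) (W₁≡P ((1+ 0) ⊕⁺ k) N refl))
          (solve 2 (λ x p → con (- 1ℚ + 1ℚ) :* x :- p := :- p) refl (W₁ N ((1+ 0) ∷ []) * W₁ N (k ∷ [])) (P N)))
    X-𝒥 : 𝒥ˢ (λ N → ∑< d (λ j → X j N))
    X-𝒥 = 𝒥-∑< d (λ j j<d → by-parity j (parity j) j<d)
      where
      by-parity : ∀ j → Parity j → j ℕ.< d → 𝒥ˢ (X j)
      by-parity .(double i) (even i) j<d = 𝒥-resp (λ N → trans (cong (λ x → (x + 1ℚ) * (W₁ N ((1+ double i) ∷ []) * W₁ N (b (double i) ∷ [])))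
        (trans (cong ((- 1ℚ) ^_) (ℕ.+-identityʳ (suc (d ℕ.∸ double i)))) (trans (cong (λ m → (- 1ℚ) ^ suc m) (double-∸ q i)) (sign-odd (q ℕ.∸ i)))))
        (ℚ.*-zeroˡ (W₁ N ((1+ double i) ∷ []) * W₁ N (b (double i) ∷ [])))) 𝒥-0
      by-parity .(suc (double i)) (odd i) j<d = 𝒥-scale (sgn (b (suc (double i)) ∷ []) + 1ℚ)
        (𝒥-* (𝒥-resp (W₁-single (1+ suc (double i))) (IH (double-cancel-< q i j<d)))
          (𝒵-W₁ {b (suc (double i)) ∷ []} (first≥2 (ℕ.s≤s (ℕ.m<n⇒0<n∸m j<d)))))
    -- The single sums contribute - d P on the left and 3 P on the right, so (d + 3) P is the sum of
    -- the `X j` up to the errors.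
    solved : ∀ N → P N ≡ u (suc (suc d)) * (∑< d (λ j → X j N) + (𝓔⁺ N 0 (k ∷ []) + - 𝓔⁻ N 0 (k ∷ [])))
    solved N = begin
      P N
        ≡⟨ trans (cong (_* P N) (νu≡1 (suc (suc d)))) (ℚ.*-identityˡ (P N)) ⟨
      ν (suc (suc (suc d))) * u (suc (suc d)) * P N
        ≡⟨ cong (λ x → x * u (suc (suc d)) * P N) (ν-+ 3 d) ⟩
      (ν 3 + ν d) * u (suc (suc d)) * P N
        ≡⟨ solve 7 (λ n3 nd w p x e f → (n3 :+ nd) :* w :* p := w :* ((n3 :* p :+ con 0ℚ :+ (f :+ con 0ℚ)) :+ (nd :* p :- f))) refl
             (ν 3) (ν d) (u (suc (suc d))) (P N) (∑< d (λ j → X j N)) (𝓔⁺ N 0 (k ∷ [])) (𝓔⁻ N 0 (k ∷ [])) ⟩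
      u (suc (suc d)) * ((ν 3 * P N + 0ℚ + (𝓔⁻ N 0 (k ∷ []) + 0ℚ)) + (ν d * P N - 𝓔⁻ N 0 (k ∷ [])))
        ≡⟨ cong (λ x → u (suc (suc d)) * (x + (ν d * P N - 𝓔⁻ N 0 (k ∷ []))))
             (trans (cong (λ x → x + 0ℚ + (𝓔⁻ N 0 (k ∷ []) + 0ℚ)) (sym (𝓡-sum N)))
               (trans (sym (truncated-cyclic-sum N 0 (k ∷ []))) (cong (λ x → x + 0ℚ + (𝓔⁺ N 0 (k ∷ []) + 0ℚ)) (𝓛-sum N)))) ⟩
      u (suc (suc d)) * ((∑< d (λ j → X j N) - ν d * P N + 0ℚ + (𝓔⁺ N 0 (k ∷ []) + 0ℚ)) + (ν d * P N - 𝓔⁻ N 0 (k ∷ [])))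
        ≡⟨ solve 6 (λ nd w p x e f → w :* ((x :- nd :* p :+ con 0ℚ :+ (e :+ con 0ℚ)) :+ (nd :* p :- f)) := w :* (x :+ (e :+ :- f))) refl
             (ν d) (u (suc (suc d))) (P N) (∑< d (λ j → X j N)) (𝓔⁺ N 0 (k ∷ [])) (𝓔⁻ N 0 (k ∷ [])) ⟩
      u (suc (suc d)) * (∑< d (λ j → X j N) + (𝓔⁺ N 0 (k ∷ []) + - 𝓔⁻ N 0 (k ∷ []))) ∎
      where
      open ≡-Reasoning
      open ℚSolver

-- The power series ∏_{n ≤ N} (1 - t²/n²)

linear-factor quadratic-factor : ℚ → ℚ[[t]]
linear-factor c zero          = 1ℚ
linear-factor c (suc zero)    = c
linear-factor c (suc (suc m)) = 0ℚ
quadratic-factor c zero                = 1ℚ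
quadratic-factor c (suc zero)          = 0ℚ
quadratic-factor c (suc (suc zero))    = - (c * c)
quadratic-factor c (suc (suc (suc m))) = 0ℚ

linear-factor-⋆ : ∀ c g m → (linear-factor c ⋆ g) (suc m) ≡ g (suc m) + c * g m
linear-factor-⋆ c g m = cong₂ _+_ (ℚ.*-identityˡ (g (suc m)))
  (⋆-scalar (λ i → linear-factor c (suc i)) g (λ _ → refl) m)

quadratic-factor-⋆ : ∀ c g m → (quadratic-factor c ⋆ g) (suc (suc m)) ≡ g (suc (suc m)) - c * (c * g m)
quadratic-factor-⋆ c g m = trans (cong₂ (λ x y → x + (0ℚ * g (suc m) + y)) (ℚ.*-identityˡ (g (suc (suc m))))
    (⋆-scalar (λ i → quadratic-factor c (suc (suc i))) g (λ _ → refl) m))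
  (solve 4 (λ x y c z → x :+ (con 0ℚ :* y :+ (:- (c :* c)) :* z) := x :- c :* (c :* z)) refl (g (suc (suc m))) (g (suc m)) c (g m))
  where open ℚSolver

sinc : ℕ → ℚ[[t]]
sinc zero    = δ₀
sinc (suc N) = quadratic-factor (u N) ⋆ sinc N

⋆-congʳ : ∀ f {g k} → (∀ i → g i ≡ k i) → ∀ n → (f ⋆ g) n ≡ (f ⋆ k) n
⋆-congʳ f e n = anti-cong′ n (λ i j → cong (f i *_) (e j))

⋆-congˡ : ∀ {f g} k → (∀ i → f i ≡ g i) → ∀ n → (f ⋆ k) n ≡ (g ⋆ k) n
⋆-congˡ k e n = anti-cong′ n (λ i j → cong (_* k j) (e i))

sinc⋆star : ∀ N m → (sinc N ⋆ star N) m ≡ δ₀ m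
sinc⋆star zero    m = trans (⋆-identityˡ (star 0) m) (star-0 m)
  where
  star-0 : ∀ m → star 0 m ≡ δ₀ m
  star-0 zero          = refl
  star-0 (suc zero)    = refl
  star-0 (suc (suc m)) = refl
sinc⋆star (suc N) m = trans (⋆-congˡ (star (suc N)) (⋆-comm (quadratic-factor (u N)) (sinc N)) m)
  (trans (⋆-assoc (sinc N) (quadratic-factor (u N)) (star (suc N)) m)
    (trans (⋆-congʳ (sinc N) star-suc m) (sinc⋆star N m)))
  where
  star-suc : ∀ m → (quadratic-factor (u N) ⋆ star (suc N)) m ≡ star N m
  star-suc zero          = refl
  star-suc (suc zero)    = refl
  star-suc (suc (suc m)) = trans (quadratic-factor-⋆ (u N) (star (suc N)) m)
    (solve 2 (λ x y → x :+ y :- y := x) refl (star N (suc (suc m))) (u N * (u N * star (suc N) m)))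
    where open ℚSolver

-- The Euler operator t d/dt, a derivation for `⋆`.
θ : ℚ[[t]] → ℚ[[t]]
θ f m = ν m * f m

θ-⋆ : ∀ f g n → θ (f ⋆ g) n ≡ (θ f ⋆ g) n + (f ⋆ θ g) n
θ-⋆ f g n = trans (sym (anti-*ˡ n (ν n) _)) (trans
  (anti-cong n (λ i j i+j≡n → trans (cong (_* (f i * g j)) (trans (cong ν (sym i+j≡n)) (ν-+ i j)))
    (solve 4 (λ x y f g → (x :+ y) :* (f :* g) := x :* f :* g :+ f :* (y :* g)) refl (ν i) (ν j) (f i) (g j))))
  (anti-+ n _ _))
  where open ℚSolver

-- The series c²t²/(1 - c²t²), which is -½ times the logarithmic derivative t q′/q of q = 1 - c²t².
geometric : ℚ → ℚ[[t]]
geometric c zero          = 0ℚ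
geometric c (suc zero)    = 0ℚ
geometric c (suc (suc m)) = c * (c * (δ₀ m + geometric c m))

geometrics : ℕ → ℚ[[t]]
geometrics N m = ∑< N (λ n → geometric (u n) m)

-2ℚ : ℚ
-2ℚ = - (1ℚ + 1ℚ)

-- Newton's identities, in the form of the logarithmic derivative of the product.
θ-sinc : ∀ N n → θ (sinc N) n ≡ -2ℚ * (sinc N ⋆ geometrics N) n
θ-sinc zero    n = trans (θ-δ₀ n) (sym (trans (cong (-2ℚ *_) (⋆-identityˡ (geometrics 0) n)) refl))
  where
  θ-δ₀ : ∀ n → ν n * δ₀ n ≡ 0ℚ
  θ-δ₀ zero    = refl
  θ-δ₀ (suc n) = ℚ.*-zeroʳ (ν (suc n))
θ-sinc (suc N) n = begin
  θ (q ⋆ s) n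
    ≡⟨ θ-⋆ q s n ⟩
  (θ q ⋆ s) n + (q ⋆ θ s) n
    ≡⟨ cong₂ _+_ (trans (⋆-congˡ s θ-q n) (scaleˡ (q ⋆ e) s n)) (trans (⋆-congʳ q (θ-sinc N) n) (scaleʳ q (s ⋆ g) n)) ⟩
  -2ℚ * (q ⋆ e ⋆ s) n + -2ℚ * (q ⋆ (s ⋆ g)) n
    ≡⟨ cong₂ (λ x y → -2ℚ * x + -2ℚ * y) qes (sym (⋆-assoc q s g n)) ⟩
  -2ℚ * (q ⋆ s ⋆ e) n + -2ℚ * (q ⋆ s ⋆ g) n
    ≡⟨ solve 3 (λ c x y → c :* x :+ c :* y := c :* (y :+ x)) refl -2ℚ ((q ⋆ s ⋆ e) n) ((q ⋆ s ⋆ g) n) ⟩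
  -2ℚ * ((q ⋆ s ⋆ g) n + (q ⋆ s ⋆ e) n)
    ≡⟨ cong (-2ℚ *_) (⋆-distribˡ (q ⋆ s) g e n) ⟨
  -2ℚ * (q ⋆ s ⋆ geometrics (suc N)) n ∎
  where
  open ≡-Reasoning
  open ℚSolver
  q = quadratic-factor (u N)
  s = sinc N
  e = geometric (u N)
  g = geometrics N
  scaleˡ : ∀ f g n → ((λ i → -2ℚ * f i) ⋆ g) n ≡ -2ℚ * (f ⋆ g) n
  scaleˡ f g n = trans (anti-cong′ n (λ i j → ℚ.*-assoc -2ℚ (f i) (g j))) (anti-*ˡ n -2ℚ _)
  scaleʳ : ∀ f g n → (f ⋆ (λ i → -2ℚ * g i)) n ≡ -2ℚ * (f ⋆ g) n
  scaleʳ f g n = trans (⋆-comm f (λ i → -2ℚ * g i) n) (trans (scaleˡ g f n) (cong (-2ℚ *_) (⋆-comm g f n)))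
  qes : (q ⋆ e ⋆ s) n ≡ (q ⋆ s ⋆ e) n
  qes = trans (⋆-assoc q e s n) (trans (⋆-congʳ q (⋆-comm e s) n) (sym (⋆-assoc q s e n)))
  θ-q : ∀ m → θ q m ≡ -2ℚ * (q ⋆ e) m
  θ-q zero                = refl
  θ-q (suc zero)          = refl
  θ-q (suc (suc zero))    = trans (solve 1 (λ c → con (ν 2) :* :- (c :* c) := con -2ℚ :* (c :* (c :* con (1ℚ + 0ℚ)) :- c :* (c :* con 0ℚ))) refl (u N))
    (cong (-2ℚ *_) (sym (quadratic-factor-⋆ (u N) e 0)))
  θ-q (suc (suc (suc m))) = trans (ℚ.*-zeroʳ (ν (suc (suc (suc m))))) (sym (trans (cong (-2ℚ *_) (quadratic-factor-⋆ (u N) e (suc m)))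
    (solve 2 (λ c x → con -2ℚ :* (c :* (c :* (con 0ℚ :+ x)) :- c :* (c :* x)) := con 0ℚ) refl (u N) (e (suc m)))))

geometric-even : ∀ c i → geometric c (double (suc i)) ≡ c ^ double (suc i)
geometric-even c zero    = refl
geometric-even c (suc i) = cong (λ x → c * (c * x)) (trans (ℚ.+-identityˡ _) (geometric-even c i))

geometric-odd : ∀ c i → geometric c (suc (double i)) ≡ 0ℚ
geometric-odd c zero    = refl
geometric-odd c (suc i) = trans (cong (λ x → c * (c * (0ℚ + x))) (geometric-odd c i)) (solve 1 (λ c → c :* (c :* con (0ℚ + 0ℚ)) := con 0ℚ) refl c)
  where open ℚSolver

geometrics-𝒥 : ∀ m → 𝒥ˢ (λ N → geometrics N m)
geometrics-𝒥 m = go m (parity m)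
  where
  go : ∀ m → Parity m → 𝒥ˢ (λ N → geometrics N m)
  go .(double zero)       (even zero)    = 𝒥-resp Σ-0 𝒥-0
  go .(double (suc i))    (even (suc i)) = 𝒥-resp (λ N → Σ-cong′ N (λ n → geometric-even (u n) i)) (even-power-sum-𝒥 i)
  go .(suc (double i))    (odd i)        = 𝒥-resp (λ N → trans (Σ-cong′ N (λ n → geometric-odd (u n) i)) (Σ-0 N)) 𝒥-0

sinc-suc : ∀ c N → sinc N (suc c) ≡ u c * (-2ℚ * anti (λ i j → sinc N i * geometrics N (suc j)) c)
sinc-suc c N = begin
  sinc N (suc c)
    ≡⟨ trans (cong (_* sinc N (suc c)) (νu≡1 c)) (ℚ.*-identityˡ _) ⟨
  ν (suc c) * u c * sinc N (suc c)
    ≡⟨ solve 3 (λ n w x → n :* w :* x := w :* (n :* x)) refl (ν (suc c)) (u c) (sinc N (suc c)) ⟩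
  u c * θ (sinc N) (suc c)
    ≡⟨ cong (u c *_) (θ-sinc N (suc c)) ⟩
  u c * (-2ℚ * (sinc N ⋆ geometrics N) (suc c))
    ≡⟨ cong (λ x → u c * (-2ℚ * x)) (trans (anti-last c (λ i j → sinc N i * geometrics N j)) (trans (cong (anti (λ i j → sinc N i * geometrics N (suc j)) c +_)
         (trans (cong (sinc N (suc c) *_) (Σ-0 N)) (ℚ.*-zeroʳ (sinc N (suc c))))) (ℚ.+-identityʳ (anti (λ i j → sinc N i * geometrics N (suc j)) c)))) ⟩
  u c * (-2ℚ * anti (λ i j → sinc N i * geometrics N (suc j)) c) ∎
  where
  open ≡-Reasoning
  open ℚSolver

sinc-0 : ∀ N → sinc N 0 ≡ 1ℚ
sinc-0 zero    = refl
sinc-0 (suc N) = trans (ℚ.*-identityˡ _) (sinc-0 N)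

sinc-𝒵 : ∀ c → 𝒵ˢ (λ N → sinc N c)
sinc-𝒵 = <-rec _ λ where
  zero    _  → 𝒵-resp sinc-0 (𝒵-const 1ℚ)
  (suc c) IH → 𝒵-resp (sinc-suc c) (𝒵-scale (u c) (𝒵-scale -2ℚ (𝒵-anti c (λ i j i+j≡c →
    𝒵-* (IH (ℕ.s≤s (ℕ.m+n≤o⇒m≤o i (ℕ.≤-reflexive i+j≡c)))) (𝒥⇒𝒵 (geometrics-𝒥 (suc j)))))))

sinc-𝒥 : ∀ c → 𝒥ˢ (λ N → sinc N (suc c))
sinc-𝒥 c = 𝒥-resp (sinc-suc c) (𝒥-scale (u c) (𝒥-scale -2ℚ (𝒥-anti c (λ i j _ → 𝒥-*ˡ (sinc-𝒵 i) (geometrics-𝒥 (suc j))))))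

star-suc-anti : ∀ c N → star N (suc c) ≡ - 1ℚ * anti (λ i j → sinc N (suc i) * star N j) c
star-suc-anti c N = begin
  star N (suc c)                                          ≡⟨ solve 2 (λ s x → s := con 1ℚ :* s :+ x :- x) refl (star N (suc c)) A ⟩
  1ℚ * star N (suc c) + A - A                             ≡⟨ cong (λ x → x * star N (suc c) + A - A) (sinc-0 N) ⟨
  (sinc N ⋆ star N) (suc c) - A                           ≡⟨ cong (_- A) (sinc⋆star N (suc c)) ⟩
  0ℚ - A                                                  ≡⟨ solve 1 (λ x → con 0ℚ :- x := con (- 1ℚ) :* x) refl A ⟩
  - 1ℚ * A                                                ∎
  where
  open ≡-Reasoning
  open ℚSolver
  A = anti (λ i j → sinc N (suc i) * star N j) c

star-𝒵 : ∀ c → 𝒵ˢ (λ N → star N c)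
star-𝒵 = <-rec _ λ where
  zero    _  → 𝒵-const 1ℚ
  (suc c) IH → 𝒵-resp (star-suc-anti c) (𝒵-scale (- 1ℚ) (𝒵-anti c (λ i j i+j≡c →
    𝒵-* (sinc-𝒵 (suc i)) (IH (ℕ.s≤s (ℕ.m+n≤o⇒n≤o i (ℕ.≤-reflexive i+j≡c)))))))

star-𝒥 : ∀ c → 𝒥ˢ (λ N → star N (suc c))
star-𝒥 c = 𝒥-resp (star-suc-anti c) (𝒥-scale (- 1ℚ) (𝒥-anti c (λ i j _ → 𝒥-* (sinc-𝒥 i) (star-𝒵 j))))

-- The error term

rot-𝒥 : (R : Index → Set) → (∀ k q → R (k ∷ q) → R (q ∷ʳ k)) → ∀ {G : ℕ → ℕ⁺ → Index → ℚ} →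
  (∀ k ks → R (k ∷ ks) → 𝒥ˢ (λ N → G N k ks)) → ∀ κ → R κ → 𝒥ˢ (λ N → rot (G N) [] κ)
rot-𝒥 R rotate {G} e κ Rκ = go [] κ (subst R (sym (++-identityʳ κ)) Rκ)
  where
  go : ∀ p q → R (q ++ p) → 𝒥ˢ (λ N → rot (G N) p q)
  go p []      _ = 𝒥-0
  go p (k ∷ q) r = 𝒥-+ (e k (q ++ p) r) (go (p ∷ʳ k) q (subst R (++-assoc q p (k ∷ [])) (rotate k (q ++ p) r)))

rot-- : ∀ G G′ p q → rot (λ k ks → G k ks - G′ k ks) p q ≡ rot G p q - rot G′ p q
rot-- G G′ p []      = refl
rot-- G G′ p (k ∷ q) = trans (cong (G k (q ++ p) - G′ k (q ++ p) +_) (rot-- G G′ (p ∷ʳ k) q))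
  (solve 4 (λ a b c d → (a :- b) :+ (c :- d) := (a :+ c) :- (b :+ d)) refl (G k (q ++ p)) (G′ k (q ++ p)) (rot G (p ∷ʳ k) q) (rot G′ (p ∷ʳ k) q))
  where open ℚSolver

reverse-ones : ∀ r → reverse (ones r) ≡ ones r
reverse-ones r = trans (go r 0) (cong ones (ℕ.+-identityʳ r))
  where
  go : ∀ r s → reverseAcc (ones s) (ones r) ≡ ones (r ℕ.+ s)
  go zero    s = refl
  go (suc r) s = trans (go r (suc s)) (cong ones (ℕ.+-suc r s))

-- For an index of 1s the two errors are the same sum up to the sign (-1)^r. They cancel for even r;
-- for odd r the limit is -2 times ζ(r + 1) plus half a coefficient of ∏ 1/(1 - t²/n²), and both lie
-- in ζ(2) 𝒵.
𝓔-ones-𝒥 : ∀ r → 𝒥ˢ (λ N → 𝓔⁻ N 0 (ones r) - 𝓔⁺ N 0 (ones r))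
𝓔-ones-𝒥 r = 𝒥-resp (λ N → cong₂ _-_
    (cong (_* tailˢ (λ p → W p N (ε N 0)) (ones r) 0) (sgn-ones r))
    (cong (λ κ → W κ N (ε N 0)) (reverse-ones r)))
  (𝒥-resp (λ N → trans (cong (λ x → (- 1ℚ) ^ r * x - W (ones r) N (ε N 0)) (tailˢ-at-0 (λ p → W p N (ε N 0)) (ones r)))
      (solve 2 (λ s w → s :* w :- w := (s :- con 1ℚ) :* w) refl ((- 1ℚ) ^ r) (W (ones r) N (ε N 0)))) (go r (parity r)))
  where
  open ℚSolver
  sgn-ones : ∀ r → sgn (ones r) ≡ (- 1ℚ) ^ r
  sgn-ones zero    = refl
  sgn-ones (suc r) = cong (- 1ℚ *_) (sgn-ones r)
  go : ∀ r → Parity r → 𝒥ˢ (λ N → ((- 1ℚ) ^ r - 1ℚ) * W (ones r) N (ε N 0))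
  go .(double c)       (even c) = 𝒥-resp (λ N → trans (cong (λ x → (x - 1ℚ) * W (ones (double c)) N (ε N 0)) (sign-even c))
    (ℚ.*-zeroˡ (W (ones (double c)) N (ε N 0)))) 𝒥-0
  go .(suc (double c)) (odd c)  = 𝒥-scale ((- 1ℚ) ^ suc (double c) - 1ℚ)
    (𝒥-∼ (W-ones∼ c) (𝒥-+ (even-power-sum-𝒥 c) (𝒥-scale ½ (star-𝒥 (suc (double c))))))

∷ʳ-All : ∀ {P : ℕ⁺ → Set} k (q : Index) → All P (k ∷ q) → All P (q ∷ʳ k)
∷ʳ-All k q (pk ∷ pq) = All.++⁺ pq (pk ∷ [])

error-𝒥 : ∀ n κ → κ ≢ [] → 𝒥ˢ (λ N → rot (λ k ks → 𝓔⁻ N n (k ∷ ks)) [] κ - rot (λ k ks → 𝓔⁺ N n (k ∷ ks)) [] κ)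
error-𝒥 n κ κ≢[] = 𝒥-resp (λ N → sym (rot-- (λ k ks → 𝓔⁻ N n (k ∷ ks)) (λ k ks → 𝓔⁺ N n (k ∷ ks)) [] κ)) (by-cases n κ (big? κ))
  where
  big? : ∀ κ → Big κ ⊎ All (_≡ 1+ 0) κ
  big? []                 = inj₂ []
  big? ((1+ suc m) ∷ κ)   = inj₁ (here (ℕ.s≤s (ℕ.s≤s ℕ.z≤n)))
  big? ((1+ zero) ∷ κ)    with big? κ
  ... | inj₁ big  = inj₁ (there big)
  ... | inj₂ ones = inj₂ (refl ∷ ones)
  all-ones : ∀ {κ} → All (_≡ 1+ 0) κ → κ ≡ ones (length κ)
  all-ones []         = refl
  all-ones (refl ∷ a) = cong ((1+ 0) ∷_) (all-ones a)
  null-case : ∀ n k ks → Big (k ∷ ks) ⊎ n ≢ 0 → 𝒥ˢ (λ N → 𝓔⁻ N n (k ∷ ks) - 𝓔⁺ N n (k ∷ ks))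
  null-case n k ks big = null⇒𝒥 (null-+ (𝓔⁻-null n (k ∷ ks) (λ ()) big) (null-neg (𝓔⁺-null n (k ∷ ks) (λ ()) big)))
  by-cases : ∀ n κ → Big κ ⊎ All (_≡ 1+ 0) κ → 𝒥ˢ (λ N → rot (λ k ks → 𝓔⁻ N n (k ∷ ks) - 𝓔⁺ N n (k ∷ ks)) [] κ)
  by-cases n       κ (inj₁ big)  = rot-𝒥 Big (λ k q → Any.++-comm (k ∷ []) q) (λ k ks b → null-case n k ks (inj₁ b)) κ big
  by-cases (suc n) κ (inj₂ _)    = rot-𝒥 (λ _ → ℕ) (λ _ _ r → r) (λ k ks _ → null-case (suc n) k ks (inj₂ (λ ()))) κ 0
  by-cases zero    κ (inj₂ all)  = rot-𝒥 (All (_≡ 1+ 0)) ∷ʳ-All (λ k ks a →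
    subst (λ κ → 𝒥ˢ (λ N → 𝓔⁻ N 0 κ - 𝓔⁺ N 0 κ)) (sym (all-ones a)) (𝓔-ones-𝒥 (length (k ∷ ks)))) κ all

-- Power series in ∂ and the pairing behind ζŜ

-- γ acts on functions of indices as the power series γ(∂) in the operator ∂ with
-- (∂ φ) (1 ∷ p) = φ p and (∂ φ) p = 0 for all other p.
∂ : (Index → ℚ) → Index → ℚ
∂ φ []                = 0ℚ
∂ φ ((1+ zero) ∷ p)   = φ p
∂ φ ((1+ suc k) ∷ p)  = 0ℚ

act : ℚ[[t]] → (Index → ℚ) → Index → ℚ
act γ φ []               = γ 0 * φ []
act γ φ ((1+ zero) ∷ p)  = γ 0 * φ ((1+ 0) ∷ p) + act (λ i → γ (suc i)) φ p
act γ φ ((1+ suc k) ∷ p) = γ 0 * φ ((1+ suc k) ∷ p)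

act-∂ : ∀ γ φ p → act γ φ p ≡ γ 0 * φ p + ∂ (act (λ i → γ (suc i)) φ) p
act-∂ γ φ []               = sym (ℚ.+-identityʳ (γ 0 * φ []))
act-∂ γ φ ((1+ zero) ∷ p)  = refl
act-∂ γ φ ((1+ suc k) ∷ p) = sym (ℚ.+-identityʳ (γ 0 * φ ((1+ suc k) ∷ p)))

act-cong : ∀ {γ δ φ ψ} p → (∀ i → γ i ≡ δ i) → (∀ p → φ p ≡ ψ p) → act γ φ p ≡ act δ ψ p
act-cong []               e e′ = cong₂ _*_ (e 0) (e′ [])
act-cong ((1+ zero) ∷ p)  e e′ = cong₂ _+_ (cong₂ _*_ (e 0) (e′ ((1+ 0) ∷ p))) (act-cong p (λ i → e (suc i)) e′)
act-cong ((1+ suc k) ∷ p) e e′ = cong₂ _*_ (e 0) (e′ ((1+ suc k) ∷ p))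

act-linearˡ : ∀ c γ δ φ p → act (λ i → c * γ i + δ i) φ p ≡ c * act γ φ p + act δ φ p
act-linearˡ c γ δ φ []               = solve 4 (λ c g d x → (c :* g :+ d) :* x := c :* (g :* x) :+ d :* x) refl c (γ 0) (δ 0) (φ [])
  where open ℚSolver
act-linearˡ c γ δ φ ((1+ zero) ∷ p)  = trans (cong ((c * γ 0 + δ 0) * φ ((1+ 0) ∷ p) +_) (act-linearˡ c (λ i → γ (suc i)) (λ i → δ (suc i)) φ p))
  (solve 6 (λ c g d x a b → (c :* g :+ d) :* x :+ (c :* a :+ b) := c :* (g :* x :+ a) :+ (d :* x :+ b)) refl
    c (γ 0) (δ 0) (φ ((1+ 0) ∷ p)) (act (λ i → γ (suc i)) φ p) (act (λ i → δ (suc i)) φ p))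
  where open ℚSolver
act-linearˡ c γ δ φ ((1+ suc k) ∷ p) = solve 4 (λ c g d x → (c :* g :+ d) :* x := c :* (g :* x) :+ d :* x) refl c (γ 0) (δ 0) (φ ((1+ suc k) ∷ p))
  where open ℚSolver

act-⋆ : ∀ γ δ φ p → act γ (act δ φ) p ≡ act (γ ⋆ δ) φ p
act-⋆ γ δ φ []               = sym (ℚ.*-assoc (γ 0) (δ 0) (φ []))
act-⋆ γ δ φ ((1+ zero) ∷ p)  = begin
  γ 0 * (δ 0 * φ ((1+ 0) ∷ p) + act (λ i → δ (suc i)) φ p) + act (λ i → γ (suc i)) (act δ φ) p
    ≡⟨ cong (γ 0 * (δ 0 * φ ((1+ 0) ∷ p) + act (λ i → δ (suc i)) φ p) +_) (act-⋆ (λ i → γ (suc i)) δ φ p) ⟩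
  γ 0 * (δ 0 * φ ((1+ 0) ∷ p) + act (λ i → δ (suc i)) φ p) + act ((λ i → γ (suc i)) ⋆ δ) φ p
    ≡⟨ solve 5 (λ g d x a b → g :* (d :* x :+ a) :+ b := g :* d :* x :+ (g :* a :+ b)) refl
         (γ 0) (δ 0) (φ ((1+ 0) ∷ p)) (act (λ i → δ (suc i)) φ p) (act ((λ i → γ (suc i)) ⋆ δ) φ p) ⟩
  γ 0 * δ 0 * φ ((1+ 0) ∷ p) + (γ 0 * act (λ i → δ (suc i)) φ p + act ((λ i → γ (suc i)) ⋆ δ) φ p)
    ≡⟨ cong (γ 0 * δ 0 * φ ((1+ 0) ∷ p) +_) (act-linearˡ (γ 0) (λ i → δ (suc i)) ((λ i → γ (suc i)) ⋆ δ) φ p) ⟨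
  act (γ ⋆ δ) φ ((1+ 0) ∷ p) ∎
  where
  open ≡-Reasoning
  open ℚSolver
act-⋆ γ δ φ ((1+ suc k) ∷ p) = sym (ℚ.*-assoc (γ 0) (δ 0) (φ ((1+ suc k) ∷ p)))

act-0 : ∀ γ φ p → (∀ i → γ i ≡ 0ℚ) → act γ φ p ≡ 0ℚ
act-0 γ φ []               e = trans (cong (_* φ []) (e 0)) (ℚ.*-zeroˡ (φ []))
act-0 γ φ ((1+ zero) ∷ p)  e = trans (cong₂ _+_ (trans (cong (_* φ ((1+ 0) ∷ p)) (e 0)) (ℚ.*-zeroˡ (φ ((1+ 0) ∷ p)))) (act-0 _ φ p (λ i → e (suc i)))) refl
act-0 γ φ ((1+ suc k) ∷ p) e = trans (cong (_* φ ((1+ suc k) ∷ p)) (e 0)) (ℚ.*-zeroˡ (φ ((1+ suc k) ∷ p)))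

act-δ₀ : ∀ φ p → act δ₀ φ p ≡ φ p
act-δ₀ φ []               = ℚ.*-identityˡ (φ [])
act-δ₀ φ ((1+ zero) ∷ p)  = trans (cong₂ _+_ (ℚ.*-identityˡ (φ ((1+ 0) ∷ p))) (act-0 _ φ p (λ _ → refl))) (ℚ.+-identityʳ (φ ((1+ 0) ∷ p)))
act-δ₀ φ ((1+ suc k) ∷ p) = ℚ.*-identityˡ (φ ((1+ suc k) ∷ p))

∂-act : ∀ γ ψ q → act γ (∂ ψ) q ≡ ∂ (act γ ψ) q
∂-act γ ψ []               = ℚ.*-zeroʳ (γ 0)
∂-act γ ψ ((1+ zero) ∷ q)  = trans (cong (γ 0 * ψ q +_) (∂-act (λ i → γ (suc i)) ψ q)) (sym (act-∂ γ ψ q))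
∂-act γ ψ ((1+ suc k) ∷ q) = ℚ.*-zeroʳ (γ 0)

-- An exponent 1 raised by l > 0 is annihilated by ∂, and l = 0 has coefficient 1. Hence ∂ commutes
-- with the tail sum.
tailˢ-act : ∀ γ φ q n → tailˢ (act γ φ) q n ≡ act γ (λ q → tailˢ φ q n) q
tailˢ-act γ φ []               zero    = refl
tailˢ-act γ φ []               (suc n) = sym (ℚ.*-zeroʳ (γ 0))
tailˢ-act γ φ ((1+ suc k) ∷ q) n       = tailˢ-*ˡ (γ 0) φ ((1+ suc k) ∷ q) n
tailˢ-act γ φ ((1+ zero) ∷ q)  n       = begin
  anti (λ l m → binomial 1 l * tailˢ (λ p → act γ φ ((1+ l) ∷ p)) q m) n
    ≡⟨ anti-cong′ n (λ { zero m → cong (1ℚ *_) (trans (tailˢ-+ (λ p → γ 0 * φ ((1+ 0) ∷ p)) (act (λ i → γ (suc i)) φ) q m)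
         (cong₂ _+_ (tailˢ-*ˡ (γ 0) (λ p → φ ((1+ 0) ∷ p)) q m) (tailˢ-act (λ i → γ (suc i)) φ q m)))
       ; (suc l) m → cong (binomial 1 (suc l) *_) (trans (tailˢ-*ˡ (γ 0) (λ p → φ ((1+ suc l) ∷ p)) q m) (sym (ℚ.+-identityʳ _))) }) ⟩
  anti (λ l m → binomial 1 l * (γ 0 * tailˢ (λ p → φ ((1+ l) ∷ p)) q m + extra l m)) n
    ≡⟨ anti-cong′ n (λ l m → solve 4 (λ b g x y → b :* (g :* x :+ y) := g :* (b :* x) :+ b :* y) refl (binomial 1 l) (γ 0) (tailˢ (λ p → φ ((1+ l) ∷ p)) q m) (extra l m)) ⟩
  anti (λ l m → γ 0 * (binomial 1 l * tailˢ (λ p → φ ((1+ l) ∷ p)) q m) + binomial 1 l * extra l m) n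
    ≡⟨ trans (anti-+ n _ _) (cong₂ _+_ (anti-*ˡ n (γ 0) _) (extra-sum n)) ⟩
  γ 0 * tailˢ φ ((1+ 0) ∷ q) n + act (λ i → γ (suc i)) (λ q → tailˢ φ q n) q ∎
  where
  open ≡-Reasoning
  open ℚSolver
  extra : ℕ → ℕ → ℚ
  extra zero    m = act (λ i → γ (suc i)) (λ q → tailˢ φ q m) q
  extra (suc l) m = 0ℚ
  extra-sum : ∀ n → anti (λ l m → binomial 1 l * extra l m) n ≡ extra 0 n
  extra-sum zero    = ℚ.*-identityˡ (extra 0 0)
  extra-sum (suc n) = trans (cong₂ _+_ (ℚ.*-identityˡ (extra 0 (suc n)))
    (trans (anti-cong′ n (λ l m → ℚ.*-zeroʳ (binomial 1 (suc l)))) (anti-0 n))) (ℚ.+-identityʳ (extra 0 (suc n)))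

-- `𝒮 φ κ n` is the pairing of `φ` with `λ q → tailˢ φ q n`, at `[]` and `κ`.
pairing : (Index → ℚ) → (Index → ℚ) → Index → Index → ℚ
pairing φ ψ = cuts (λ p q → sgn q * (φ p * ψ q))

pairing-congˡ : ∀ ψ {φ φ′} p κ → (∀ p → φ p ≡ φ′ p) → pairing φ ψ p κ ≡ pairing φ′ ψ p κ
pairing-congˡ ψ p κ e = cuts-cong (λ p q → cong (λ x → sgn q * (x * ψ q)) (e p)) p κ

pairing-congʳ : ∀ φ {ψ ψ′} p κ → (∀ q → ψ q ≡ ψ′ q) → pairing φ ψ p κ ≡ pairing φ ψ′ p κ
pairing-congʳ φ p κ e = cuts-cong (λ p q → cong (λ x → sgn q * (φ p * x)) (e q)) p κ

cuts-+ : ∀ F G p κ → cuts (λ p q → F p q + G p q) p κ ≡ cuts F p κ + cuts G p κ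
cuts-+ F G p []      = refl
cuts-+ F G p (k ∷ q) = trans (cong (F p (k ∷ q) + G p (k ∷ q) +_) (cuts-+ F G (k ∷ p) q))
  (+-exchange (F p (k ∷ q)) (G p (k ∷ q)) (cuts F (k ∷ p) q) (cuts G (k ∷ p) q))

cuts-*ˡ : ∀ c F p κ → cuts (λ p q → c * F p q) p κ ≡ c * cuts F p κ
cuts-*ˡ c F p []      = refl
cuts-*ˡ c F p (k ∷ q) = trans (cong (c * F p (k ∷ q) +_) (cuts-*ˡ c F (k ∷ p) q)) (sym (ℚ.*-distribˡ-+ c (F p (k ∷ q)) (cuts F (k ∷ p) q)))

-- Moving a 1 across the cut changes the sign, so ∂ is antisymmetric for the pairing.
pairing-∂ : ∀ φ ψ p κ → pairing (∂ φ) ψ p κ + pairing φ (∂ ψ) p κ ≡ sgn κ * (∂ φ p * ψ κ)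
pairing-∂ φ ψ p []               = solve 2 (λ x y → con 1ℚ :* x :+ con 1ℚ :* (y :* con 0ℚ) := con 1ℚ :* x) refl (∂ φ p * ψ []) (φ p)
  where open ℚSolver
pairing-∂ φ ψ p (k@(1+ zero) ∷ q)  = begin
  (sgn (k ∷ q) * (∂ φ p * ψ (k ∷ q)) + pairing (∂ φ) ψ (k ∷ p) q) + (sgn (k ∷ q) * (φ p * ψ q) + pairing φ (∂ ψ) (k ∷ p) q)
    ≡⟨ +-exchange (sgn (k ∷ q) * (∂ φ p * ψ (k ∷ q))) _ (sgn (k ∷ q) * (φ p * ψ q)) _ ⟩
  (sgn (k ∷ q) * (∂ φ p * ψ (k ∷ q)) + sgn (k ∷ q) * (φ p * ψ q)) + (pairing (∂ φ) ψ (k ∷ p) q + pairing φ (∂ ψ) (k ∷ p) q)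
    ≡⟨ cong₂ (λ x y → (sgn (k ∷ q) * (∂ φ p * ψ (k ∷ q)) + x * (φ p * ψ q)) + y) (sgn-∷ k q) (pairing-∂ φ ψ (k ∷ p) q) ⟩
  (sgn (k ∷ q) * (∂ φ p * ψ (k ∷ q)) + (- 1ℚ) ^ 1 * sgn q * (φ p * ψ q)) + sgn q * (φ p * ψ q)
    ≡⟨ solve 3 (λ x s y → (x :+ con (- 1ℚ) :* con 1ℚ :* s :* y) :+ s :* y := x) refl (sgn (k ∷ q) * (∂ φ p * ψ (k ∷ q))) (sgn q) (φ p * ψ q) ⟩
  sgn (k ∷ q) * (∂ φ p * ψ (k ∷ q)) ∎
  where
  open ≡-Reasoning
  open ℚSolver
pairing-∂ φ ψ p (k@(1+ suc _) ∷ q) = begin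
  (sgn (k ∷ q) * (∂ φ p * ψ (k ∷ q)) + pairing (∂ φ) ψ (k ∷ p) q) + (sgn (k ∷ q) * (φ p * 0ℚ) + pairing φ (∂ ψ) (k ∷ p) q)
    ≡⟨ +-exchange (sgn (k ∷ q) * (∂ φ p * ψ (k ∷ q))) _ (sgn (k ∷ q) * (φ p * 0ℚ)) _ ⟩
  (sgn (k ∷ q) * (∂ φ p * ψ (k ∷ q)) + sgn (k ∷ q) * (φ p * 0ℚ)) + (pairing (∂ φ) ψ (k ∷ p) q + pairing φ (∂ ψ) (k ∷ p) q)
    ≡⟨ cong (sgn (k ∷ q) * (∂ φ p * ψ (k ∷ q)) + sgn (k ∷ q) * (φ p * 0ℚ) +_) (pairing-∂ φ ψ (k ∷ p) q) ⟩
  (sgn (k ∷ q) * (∂ φ p * ψ (k ∷ q)) + sgn (k ∷ q) * (φ p * 0ℚ)) + sgn q * (0ℚ * ψ q)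
    ≡⟨ solve 5 (λ x s y r z → (x :+ s :* (y :* con 0ℚ)) :+ r :* (con 0ℚ :* z) := x) refl (sgn (k ∷ q) * (∂ φ p * ψ (k ∷ q))) (sgn (k ∷ q)) (φ p) (sgn q) (ψ q) ⟩
  sgn (k ∷ q) * (∂ φ p * ψ (k ∷ q)) ∎
  where
  open ≡-Reasoning
  open ℚSolver

alternate : ℚ[[t]] → ℚ[[t]]
alternate γ i = (- 1ℚ) ^ i * γ i

pairing-linearʳ : ∀ c φ ψ ψ′ p κ → pairing φ (λ q → c * ψ q + ψ′ q) p κ ≡ c * pairing φ ψ p κ + pairing φ ψ′ p κ
pairing-linearʳ c φ ψ ψ′ p κ = trans (cuts-cong (λ p q → solve 5 (λ s x c y z → s :* (x :* (c :* y :+ z)) := c :* (s :* (x :* y)) :+ s :* (x :* z)) refl (sgn q) (φ p) c (ψ q) (ψ′ q)) p κ)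
  (trans (cuts-+ _ _ p κ) (cong (_+ pairing φ ψ′ p κ) (cuts-*ˡ c (λ p q → sgn q * (φ p * ψ q)) p κ)))
  where open ℚSolver

pairing-linearˡ : ∀ c φ φ′ ψ p κ → pairing (λ p → c * φ p + φ′ p) ψ p κ ≡ c * pairing φ ψ p κ + pairing φ′ ψ p κ
pairing-linearˡ c φ φ′ ψ p κ = trans (cuts-cong (λ p q → solve 5 (λ s x c y z → s :* ((c :* x :+ y) :* z) := c :* (s :* (x :* z)) :+ s :* (y :* z)) refl (sgn q) (φ p) c (φ′ p) (ψ q)) p κ)
  (trans (cuts-+ _ _ p κ) (cong (_+ pairing φ′ ψ p κ) (cuts-*ˡ c (λ p q → sgn q * (φ p * ψ q)) p κ)))
  where open ℚSolver

-- At `p = []` the boundary term of `pairing-∂` vanishes, so the adjoint of γ(∂) is γ(-∂). The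
-- series γ is infinite; the induction removes one ∂ at a time and ends because ∂ is nilpotent on
-- indices of bounded length.
pairing-act : ∀ γ φ ψ κ → pairing (act γ φ) ψ [] κ ≡ pairing φ (act (alternate γ) ψ) [] κ
pairing-act γ φ ψ κ = go (suc (length κ)) γ ψ (λ q q+d≤ → contradiction q (length κ) q+d≤)
  where
  contradiction : ∀ q m → length q ℕ.+ suc m ℕ.≤ m → ψ q ≡ 0ℚ
  contradiction q m le with () ← ℕ.<-irrefl refl (ℕ.≤-trans (ℕ.m≤n+m (suc m) (length q)) le)
  pairing-0 : ∀ φ ψ p κ → (∀ q → length q ℕ.≤ length κ → ψ q ≡ 0ℚ) → pairing φ ψ p κ ≡ 0ℚ
  pairing-0 φ ψ p κ e = zero-cuts p κ (λ p q q≤ → trans (cong (λ x → sgn q * (φ p * x)) (e q q≤))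
    (solve 2 (λ s x → s :* (x :* con 0ℚ) := con 0ℚ) refl (sgn q) (φ p)))
    where
    open ℚSolver
    zero-cuts : ∀ {F} p κ → (∀ p q → length q ℕ.≤ length κ → F p q ≡ 0ℚ) → cuts F p κ ≡ 0ℚ
    zero-cuts p []      e = e p [] ℕ.≤-refl
    zero-cuts p (k ∷ q) e = cong₂ _+_ (e p (k ∷ q) ℕ.≤-refl) (zero-cuts (k ∷ p) q (λ p r r≤ → e p r (ℕ.m≤n⇒m≤1+n r≤)))
  act-vanish : ∀ γ ψ q → (∀ r → length r ℕ.≤ length q → ψ r ≡ 0ℚ) → act γ ψ q ≡ 0ℚ
  act-vanish γ ψ []               e = trans (cong (γ 0 *_) (e [] ℕ.≤-refl)) (ℚ.*-zeroʳ (γ 0))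
  act-vanish γ ψ ((1+ zero) ∷ q)  e = cong₂ _+_ (trans (cong (γ 0 *_) (e ((1+ 0) ∷ q) ℕ.≤-refl)) (ℚ.*-zeroʳ (γ 0)))
    (act-vanish (λ i → γ (suc i)) ψ q (λ r r≤ → e r (ℕ.m≤n⇒m≤1+n r≤)))
  act-vanish γ ψ ((1+ suc k) ∷ q) e = trans (cong (γ 0 *_) (e ((1+ suc k) ∷ q) ℕ.≤-refl)) (ℚ.*-zeroʳ (γ 0))
  -- `ψ` vanishes on indices of length at most `length κ - d`, and each ∂ extends this range by one.
  -- Initially d = `length κ` + 1 and nothing is required; at d = 0 every index in the pairing is
  -- covered.
  go : ∀ d γ ψ → (∀ q → length q ℕ.+ d ℕ.≤ length κ → ψ q ≡ 0ℚ) → pairing (act γ φ) ψ [] κ ≡ pairing φ (act (alternate γ) ψ) [] κ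
  go zero    γ ψ e = trans (pairing-0 (act γ φ) ψ [] κ (λ q q≤ → e q (subst (ℕ._≤ length κ) (sym (ℕ.+-identityʳ (length q))) q≤)))
    (sym (pairing-0 φ (act (alternate γ) ψ) [] κ (λ q q≤ → act-vanish (alternate γ) ψ q (λ r r≤ → e r (subst (ℕ._≤ length κ) (sym (ℕ.+-identityʳ (length r))) (ℕ.≤-trans r≤ q≤))))))
  go (suc d) γ ψ e = begin
    pairing (act γ φ) ψ [] κ
      ≡⟨ pairing-congˡ ψ [] κ (act-∂ γ φ) ⟩
    pairing (λ p → γ 0 * φ p + ∂ (act γ′ φ) p) ψ [] κ
      ≡⟨ pairing-linearˡ (γ 0) φ (∂ (act γ′ φ)) ψ [] κ ⟩
    γ 0 * pairing φ ψ [] κ + pairing (∂ (act γ′ φ)) ψ [] κ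
      ≡⟨ cong (γ 0 * pairing φ ψ [] κ +_) (trans (solve 2 (λ x y → x := (x :+ y) :- y) refl (pairing (∂ (act γ′ φ)) ψ [] κ) (pairing (act γ′ φ) (∂ ψ) [] κ))
           (cong₂ _-_ (trans (pairing-∂ (act γ′ φ) ψ [] κ) (solve 2 (λ s x → s :* (con 0ℚ :* x) := con 0ℚ) refl (sgn κ) (ψ κ))) (go d γ′ (∂ ψ) e∂))) ⟩
    γ 0 * pairing φ ψ [] κ + (0ℚ - pairing φ (act (alternate γ′) (∂ ψ)) [] κ)
      ≡⟨ solve 3 (λ g x y → g :* x :+ (con 0ℚ :- y) := con (- 1ℚ) :* y :+ g :* x) refl (γ 0) (pairing φ ψ [] κ) (pairing φ (act (alternate γ′) (∂ ψ)) [] κ) ⟩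
    - 1ℚ * pairing φ (act (alternate γ′) (∂ ψ)) [] κ + γ 0 * pairing φ ψ [] κ
      ≡⟨ trans (pairing-linearʳ (- 1ℚ) φ (act (alternate γ′) (∂ ψ)) (λ q → γ 0 * ψ q) [] κ) (cong (- 1ℚ * pairing φ (act (alternate γ′) (∂ ψ)) [] κ +_)
           (trans (cuts-cong (λ p q → solve 4 (λ s x g y → s :* (x :* (g :* y)) := g :* (s :* (x :* y))) refl (sgn q) (φ p) (γ 0) (ψ q)) [] κ)
             (cuts-*ˡ (γ 0) (λ p q → sgn q * (φ p * ψ q)) [] κ))) ⟨
    pairing φ (λ q → - 1ℚ * act (alternate γ′) (∂ ψ) q + γ 0 * ψ q) [] κ
      ≡⟨ pairing-congʳ φ [] κ expand ⟨
    pairing φ (act (alternate γ) ψ) [] κ ∎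
    where
    open ≡-Reasoning
    open ℚSolver
    γ′ : ℚ[[t]]
    γ′ i = γ (suc i)
    e∂ : ∀ q → length q ℕ.+ d ℕ.≤ length κ → ∂ ψ q ≡ 0ℚ
    e∂ []               _  = refl
    e∂ ((1+ zero) ∷ q)  le = e q (subst (ℕ._≤ length κ) (sym (ℕ.+-suc (length q) d)) le)
    e∂ ((1+ suc k) ∷ q) _  = refl
    expand : ∀ q → act (alternate γ) ψ q ≡ - 1ℚ * act (alternate γ′) (∂ ψ) q + γ 0 * ψ q
    expand q = trans (act-∂ (alternate γ) ψ q) (trans (cong₂ _+_ (cong (_* ψ q) (ℚ.*-identityˡ (γ 0)))
        (trans (sym (∂-act (λ i → alternate γ (suc i)) ψ q)) (trans
          (act-cong q (λ i → trans (ℚ.*-assoc (- 1ℚ) ((- 1ℚ) ^ i) (γ′ i)) (sym (ℚ.+-identityʳ (- 1ℚ * alternate γ′ i)))) (λ _ → refl))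
          (trans (act-linearˡ (- 1ℚ) (alternate γ′) (λ _ → 0ℚ) (∂ ψ) q) (cong (- 1ℚ * act (alternate γ′) (∂ ψ) q +_) (act-0 (λ _ → 0ℚ) (∂ ψ) q (λ _ → refl)))))))
      (solve 2 (λ x y → x :+ (y :+ con 0ℚ) := y :+ x) refl (γ 0 * ψ q) (- 1ℚ * act (alternate γ′) (∂ ψ) q)))

𝒮-act : ∀ γ φ κ n → 𝒮 (act γ φ) κ n ≡ pairing φ (act (alternate γ ⋆ γ) (λ q → tailˢ φ q n)) [] κ
𝒮-act γ φ κ n = trans (pairing-congʳ (act γ φ) [] κ (λ q → tailˢ-act γ φ q n))
  (trans (pairing-act γ φ (act γ (λ q → tailˢ φ q n)) κ) (pairing-congʳ φ [] κ (act-⋆ (alternate γ) γ (λ q → tailˢ φ q n))))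

∂-𝒥 : ∀ {χ : ℕ → Index → ℚ} → (∀ q → 𝒥ˢ (λ N → χ N q)) → ∀ q → 𝒥ˢ (λ N → ∂ (χ N) q)
∂-𝒥 χ-𝒥 []                = 𝒥-0
∂-𝒥 χ-𝒥 ((1+ zero) ∷ q)   = χ-𝒥 q
∂-𝒥 χ-𝒥 ((1+ suc k) ∷ q)  = 𝒥-0

act-𝒥 : ∀ (γ : ℕ → ℚ[[t]]) (ψ : ℕ → Index → ℚ) → (∀ i → 𝒥ˢ (λ N → γ N i)) → (∀ q → 𝒵ˢ (λ N → ψ N q)) → ∀ q → 𝒥ˢ (λ N → act (γ N) (ψ N) q)
act-𝒥 γ ψ γ-𝒥 ψ-𝒵 []                = 𝒥-* (γ-𝒥 0) (ψ-𝒵 [])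
act-𝒥 γ ψ γ-𝒥 ψ-𝒵 ((1+ zero) ∷ q)   = 𝒥-+ (𝒥-* (γ-𝒥 0) (ψ-𝒵 ((1+ 0) ∷ q))) (act-𝒥 (λ N i → γ N (suc i)) ψ (λ i → γ-𝒥 (suc i)) ψ-𝒵 q)
act-𝒥 γ ψ γ-𝒥 ψ-𝒵 ((1+ suc k) ∷ q)  = 𝒥-* (γ-𝒥 0) (ψ-𝒵 ((1+ suc k) ∷ q))

tailˢ-𝒵 : ∀ (φ : ℕ → Index → ℚ) → (∀ p → 𝒵ˢ (λ N → φ N p)) → ∀ q n → 𝒵ˢ (λ N → tailˢ (φ N) q n)
tailˢ-𝒵 φ φ-𝒵 []      zero    = φ-𝒵 []
tailˢ-𝒵 φ φ-𝒵 []      (suc n) = 𝒵-0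
tailˢ-𝒵 φ φ-𝒵 (k ∷ q) n       = 𝒵-anti n (λ l m _ → 𝒵-scale (binomial (val k) l) (tailˢ-𝒵 (λ N p → φ N ((k ⊕ l) ∷ p)) (λ p → φ-𝒵 ((k ⊕ l) ∷ p)) q m))

∼-anti : ∀ n {s t : ℕ → ℕ → ℕ → ℚ} → (∀ i j → s i j ∼ t i j) → (λ N → anti (λ i j → s i j N) n) ∼ (λ N → anti (λ i j → t i j N) n)
∼-anti zero    e = e 0 0
∼-anti (suc n) e = ∼-+ (e 0 (suc n)) (∼-anti n (λ i j → e (suc i) j))

tailˢ-∼ : ∀ (φ ψ : ℕ → Index → ℚ) → (∀ p → (λ N → φ N p) ∼ (λ N → ψ N p)) → ∀ q n → (λ N → tailˢ (φ N) q n) ∼ (λ N → tailˢ (ψ N) q n)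
tailˢ-∼ φ ψ e []      zero    = e []
tailˢ-∼ φ ψ e []      (suc n) = ∼-refl
tailˢ-∼ φ ψ e (k ∷ q) n       = ∼-anti n (λ l m → ∼-*-const (binomial (val k) l) (tailˢ-∼ (λ N p → φ N ((k ⊕ l) ∷ p)) (λ N p → ψ N ((k ⊕ l) ∷ p)) (λ p → e ((k ⊕ l) ∷ p)) q m))

cuts-𝒥 : ∀ {F : ℕ → Index → Index → ℚ} → (∀ p q → 𝒥ˢ (λ N → F N p q)) → ∀ p κ → 𝒥ˢ (λ N → cuts (F N) p κ)
cuts-𝒥 e p []      = e p []
cuts-𝒥 e p (k ∷ q) = 𝒥-+ (e p (k ∷ q)) (cuts-𝒥 e (k ∷ p) q)

cuts-∼ : ∀ {F G : ℕ → Index → Index → ℚ} → (∀ p q → (λ N → F N p q) ∼ (λ N → G N p q)) → ∀ p κ → (λ N → cuts (F N) p κ) ∼ (λ N → cuts (G N) p κ)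
cuts-∼ e p []      = e p []
cuts-∼ e p (k ∷ q) = ∼-+ (e p (k ∷ q)) (cuts-∼ e (k ∷ p) q)

-- From sums over positions to sums over cuts and rotations

∑ₗ-upTo : ∀ m f → ∑ₗ (upTo m) f ≡ ∑< m f
∑ₗ-upTo m f = from id m
  where
  from : ∀ g m → ∑ₗ (applyUpTo g m) f ≡ ∑< m (λ i → f (g i))
  from g zero    = refl
  from g (suc m) = trans (cong (f (g 0) +_) (from (g ∘ suc) m)) (sym (Σ-front m (λ i → f (g i))))

cuts≡take-drop : ∀ F p q → cuts F p q ≡ ∑< (suc (length q)) (λ i → F (reverse (take i q) ++ p) (drop i q))
cuts≡take-drop F p []      = sym (ℚ.+-identityˡ (F p []))
cuts≡take-drop F p (k ∷ q) = trans (cong (F p (k ∷ q) +_) (trans (cuts≡take-drop F (k ∷ p) q)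
    (Σ-cong′ (suc (length q)) (λ i → cong (λ r → F r (drop i q)) (sym (trans (cong (_++ p) (unfold-reverse k (take i q))) (++-assoc (reverse (take i q)) (k ∷ []) p)))))))
  (sym (Σ-front (suc (length q)) (λ i → F (reverse (take i (k ∷ q)) ++ p) (drop i (k ∷ q)))))

rot≡allFin : ∀ G κ → ∑ₗ (allFin (length κ)) (λ i → G (lookup κ i) (cyclic-rest κ i)) ≡ rot G [] κ
rot≡allFin G κ = go [] κ id _ (λ i → refl)
  where
  -- `H` remains a function of the positions in the whole index while `q` shrinks; `f` embeds the
  -- positions that are left.
  go : ∀ {A : Set} p q (f : Fin (length q) → A) (H : A → ℚ) →
    (∀ i → H (f i) ≡ G (lookup q i) (drop (suc (toℕ i)) q ++ (p ++ take (toℕ i) q))) → ∑ₗ (tabulate f) H ≡ rot G p q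
  go p []      f H e = refl
  go p (k ∷ q) f H e = cong₂ _+_
    (trans (e fzero) (cong (λ r → G k (q ++ r)) (++-identityʳ p)))
    (go (p ∷ʳ k) q (f ∘ fsuc) H (λ i → trans (e (fsuc i))
      (cong (λ r → G (lookup q i) (drop (suc (toℕ i)) q ++ r)) (sym (++-assoc p (k ∷ []) (take (toℕ i) q))))))

rot-+ : ∀ G G′ p q → rot (λ k ks → G k ks + G′ k ks) p q ≡ rot G p q + rot G′ p q
rot-+ G G′ p []      = refl
rot-+ G G′ p (k ∷ q) = trans (cong (G k (q ++ p) + G′ k (q ++ p) +_) (rot-+ G G′ (p ∷ʳ k) q))
  (+-exchange (G k (q ++ p)) (G′ k (q ++ p)) (rot G (p ∷ʳ k) q) (rot G′ (p ∷ʳ k) q))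

module _ (Ξ : Index → ℝ[[t]]) where

  LHSₜ RHSₜ : Index → ℝ[[t]]
  LHSₜ k = ∑ₜ[ i ∈ allFin (length k) ] ∑ₜ[ j ∈ upTo (val (lookup k i) ℕ.∸ 1) ]
    Ξ ((1+ j) ∷ cyclic-rest k i ∷ʳ (lookup k i ⊖ j))
  RHSₜ k = (∑ₜ[ i ∈ allFin (length k) ] ∑∞[ j ]
      (Ξ ((lookup k i ⊕ j ⊕ 1) ∷ cyclic-rest k i) +ₜ Ξ ((1+ j) ∷ cyclic-rest k i ∷ʳ lookup k i)) ·tʲ)
    +ₜ (∑ₜ[ i ∈ allFin (length k) ] Ξ (cyclic-rest k i ∷ʳ (lookup k i ⊕ 1)))

  module _ (κ : Index) (n N : ℕ) (σ : Index → ℕ → ℚ) (σ≡ : ∀ κ m → seq (Ξ κ m) N ≡ σ κ m) where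

    seq-LHSₜ : seq (LHSₜ κ n) N ≡ rot (λ k ks → ∑< (val k ℕ.∸ 1) (λ j → σ ((1+ j) ∷ ks ∷ʳ (k ⊖ j)) n)) [] κ
    seq-LHSₜ = trans (∑-seq (allFin (length κ)) (λ i → row (lookup κ i) (cyclic-rest κ i)) N)
      (trans (∑ₗ-cong (allFin (length κ)) (λ i → step (lookup κ i) (cyclic-rest κ i)))
        (rot≡allFin (λ k ks → ∑< (val k ℕ.∸ 1) (λ j → σ ((1+ j) ∷ ks ∷ʳ (k ⊖ j)) n)) κ))
      where
      row : ℕ⁺ → Index → ℝ
      row k ks = ∑ (upTo (val k ℕ.∸ 1)) (λ j → Ξ ((1+ j) ∷ ks ∷ʳ (k ⊖ j)) n)
      step : ∀ k ks → seq (row k ks) N ≡ ∑< (val k ℕ.∸ 1) (λ j → σ ((1+ j) ∷ ks ∷ʳ (k ⊖ j)) n)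
      step k ks = trans (∑-seq (upTo (val k ℕ.∸ 1)) (λ j → Ξ ((1+ j) ∷ ks ∷ʳ (k ⊖ j)) n) N)
        (trans (∑ₗ-cong (upTo (val k ℕ.∸ 1)) (λ j → σ≡ ((1+ j) ∷ ks ∷ʳ (k ⊖ j)) n))
          (∑ₗ-upTo (val k ℕ.∸ 1) (λ j → σ ((1+ j) ∷ ks ∷ʳ (k ⊖ j)) n)))

    seq-RHSₜ : seq (RHSₜ κ n) N ≡ rot (λ k ks → anti (λ j m → σ ((k ⊕ j ⊕ 1) ∷ ks) m + σ ((1+ j) ∷ ks ∷ʳ k) m) n + σ (ks ∷ʳ (k ⊕ 1)) n) [] κ
    seq-RHSₜ = trans (cong₂ _+_
        (trans (∑-seq (allFin (length κ)) (λ i → row (lookup κ i) (cyclic-rest κ i)) N)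
          (trans (∑ₗ-cong (allFin (length κ)) (λ i → step (lookup κ i) (cyclic-rest κ i))) (rot≡allFin 𝓡₁ κ)))
        (trans (∑-seq (allFin (length κ)) (λ i → Ξ (cyclic-rest κ i ∷ʳ (lookup κ i ⊕ 1)) n) N)
          (trans (∑ₗ-cong (allFin (length κ)) (λ i → σ≡ (cyclic-rest κ i ∷ʳ (lookup κ i ⊕ 1)) n)) (rot≡allFin 𝓡₂ κ))))
      (sym (rot-+ 𝓡₁ 𝓡₂ [] κ))
      where
      𝓡₁ 𝓡₂ : ℕ⁺ → Index → ℚ
      𝓡₁ k ks = anti (λ j m → σ ((k ⊕ j ⊕ 1) ∷ ks) m + σ ((1+ j) ∷ ks ∷ʳ k) m) n
      𝓡₂ k ks = σ (ks ∷ʳ (k ⊕ 1)) n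
      row : ℕ⁺ → Index → ℝ
      row k ks = (∑∞[ j ] (Ξ ((k ⊕ j ⊕ 1) ∷ ks) +ₜ Ξ ((1+ j) ∷ ks ∷ʳ k)) ·tʲ) n
      step : ∀ k ks → seq (row k ks) N ≡ 𝓡₁ k ks
      step k ks = trans (∑-seq (upTo (suc n)) (λ j → (Ξ ((k ⊕ j ⊕ 1) ∷ ks) +ₜ Ξ ((1+ j) ∷ ks ∷ʳ k)) (n ℕ.∸ j)) N)
        (trans (∑ₗ-cong (upTo (suc n)) (λ j → cong₂ _+_ (σ≡ ((k ⊕ j ⊕ 1) ∷ ks) (n ℕ.∸ j)) (σ≡ ((1+ j) ∷ ks ∷ʳ k) (n ℕ.∸ j))))
          (trans (∑ₗ-upTo (suc n) (λ j → σ ((k ⊕ j ⊕ 1) ∷ ks) (n ℕ.∸ j) + σ ((1+ j) ∷ ks ∷ʳ k) (n ℕ.∸ j))) (sym (anti-as-∑ n _))))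

  cyclic-formula-from-sequences : ∀ κ (σ : ℕ → Index → ℕ → ℚ) → (∀ κ m N → seq (Ξ κ m) N ≡ σ N κ m) →
    (∀ n → 𝒥ˢ (λ N → rot (λ k ks → ∑< (val k ℕ.∸ 1) (λ j → σ N ((1+ j) ∷ ks ∷ʳ (k ⊖ j)) n)) [] κ
      - rot (λ k ks → anti (λ j m → σ N ((k ⊕ j ⊕ 1) ∷ ks) m + σ N ((1+ j) ∷ ks ∷ʳ k) m) n + σ N (ks ∷ʳ (k ⊕ 1)) n) [] κ)) →
    (∑ₜ[ i ∈ allFin (length κ) ] ∑ₜ[ j ∈ upTo (val (lookup κ i) ℕ.∸ 1) ]
      Ξ ((1+ j) ∷ cyclic-rest κ i ∷ʳ (lookup κ i ⊖ j)))
    ≡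
    (∑ₜ[ i ∈ allFin (length κ) ] ∑∞[ j ]
      (Ξ ((lookup κ i ⊕ j ⊕ 1) ∷ cyclic-rest κ i) +ₜ Ξ ((1+ j) ∷ cyclic-rest κ i ∷ʳ lookup κ i)) ·tʲ)
    +ₜ (∑ₜ[ i ∈ allFin (length κ) ] Ξ (cyclic-rest κ i ∷ʳ (lookup κ i ⊕ 1)))
    [modζ2]
  cyclic-formula-from-sequences κ σ σ≡ d n = Z quotient , (quotient , mk≈ (λ ε 0<ε → 0 , λ N _ →
      subst (_< ε) (sym (cong ∣_∣ (ℚ.+-inverseʳ (seq (Z quotient) N)))) 0<ε)) , mk≈ close
    where
    open 𝒥ˢ (𝒥-resp (λ N → cong₂ _-_ (seq-LHSₜ κ n N (σ N) (λ κ m → σ≡ κ m N)) (seq-RHSₜ κ n N (σ N) (λ κ m → σ≡ κ m N))) (d n))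
    half< : ∀ {ε} → 0ℚ < ε → ½ * ε < ε
    half< {ε} 0<ε = subst₂ _<_ (ℚ.+-identityʳ (½ * ε)) (halves ε) (ℚ.+-monoʳ-< (½ * ε) (halve-pos 0<ε))
    close : ∀ ε → 0ℚ < ε → ∃ λ M → ∀ N → M ℕ.≤ N →
      ∣ (seq (LHSₜ κ n) N - seq (RHSₜ κ n) N) - ζ≤ (1+ 1 ∷ []) N * seq (Z quotient) N ∣ < ε
    -- `Vanishing` yields a weak inequality and equality of reals asks for a strict one, hence the
    -- bound ½ ε.
    close ε 0<ε = let (M , bound) = vanishes (null approx) (½ * ε) (halve-pos 0<ε) in
      M , λ N M≤N → ℚ.≤-<-trans (subst (λ x → ∣ (seq (LHSₜ κ n) N - seq (RHSₜ κ n) N) - ζ≤ (1+ 1 ∷ []) N * x ∣ ≤ ½ * ε) (sym (seq-Z quotient N)) (bound N M≤N)) (half< 0<ε)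

-- Truncated sums against regularized values

module _ (Z• : Index → ℝ[T]) where

  ζʳ : ℕ → Index → ℚ
  ζʳ N p = seq (Symmetric.ζ• Z• (reverse p)) N

  -- A comparison of the truncated sums with regularized values: W₁ N = P N (∂) (φ N), where φ N
  -- converges to Symmetric.ζ• Z• and P N (- t) P N (t) is 1 modulo ζ(2).
  record Comparison : Set where
    field
      φ      : ℕ → Index → ℚ
      P      : ℕ → ℚ[[t]]
      W₁≡    : ∀ N p → W₁ N p ≡ act (P N) (φ N) p
      φ-𝒵    : ∀ p → 𝒵ˢ (λ N → φ N p)
      φ∼ζʳ   : ∀ p → (λ N → φ N p) ∼ (λ N → ζʳ N p)
      PP⁻-0  : ∀ N → (alternate (P N) ⋆ P N) 0 ≡ 1ℚ
      PP⁻-𝒥  : ∀ c → 𝒥ˢ (λ N → (alternate (P N) ⋆ P N) (suc c))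

  tail-series≡tailˢ : ∀ s n N → seq (Symmetric.tail-series Z• s n) N ≡ tailˢ (ζʳ N) s n
  tail-series≡tailˢ s n N = trans
    (∑-seq (compositions (length s) n) (λ l → fromℕ (product (zipWith (λ k l → (val k ℕ.+ l ℕ.∸ 1) choose l) s l)) Defs.* Symmetric.ζ• Z• (reverse (zipWith _⊕_ s l))) N)
    (trans (∑ₗ-cong (compositions (length s) n) (λ l → seq-fromℕ-* (product (zipWith (λ k l → (val k ℕ.+ l ℕ.∸ 1) choose l) s l)) (Symmetric.ζ• Z• (reverse (zipWith _⊕_ s l))))) (go s n (ζʳ N)))
    where
    seq-fromℕ-* : ∀ m x → seq (fromℕ m Defs.* x) N ≡ ν m * seq x N
    seq-fromℕ-* m x = refl
    coefficient : Index → List ℕ → ℕ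
    coefficient s l = product (zipWith (λ k l → (val k ℕ.+ l ℕ.∸ 1) choose l) s l)
    ν-* : ∀ m n → ν (m ℕ.* n) ≡ ν m * ν n
    ν-* zero    n = sym (ℚ.*-zeroˡ (ν n))
    ν-* (suc m) n = trans (ν-+ n (m ℕ.* n)) (trans (cong (ν n +_) (ν-* m n)) (trans
      (solve 2 (λ x y → y :+ x :* y := (con 1ℚ :+ x) :* y) refl (ν m) (ν n)) (cong (_* ν n) (sym (ν-+ 1 m)))))
      where open ℚSolver
    ∑ₗ-concatMap : {A B : Set} (h : A → List B) (xs : List A) (f : B → ℚ) → ∑ₗ (concatMap h xs) f ≡ ∑ₗ xs (λ a → ∑ₗ (h a) f)
    ∑ₗ-concatMap h []       f = refl
    ∑ₗ-concatMap h (x ∷ xs) f = trans (∑ₗ-++ (h x) (concatMap h xs) f) (cong (∑ₗ (h x) f +_) (∑ₗ-concatMap h xs f))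
    go : ∀ s n (φ : Index → ℚ) → ∑ₗ (compositions (length s) n) (λ l → ν (coefficient s l) * φ (zipWith _⊕_ s l)) ≡ tailˢ φ s n
    go []      zero    φ = trans (ℚ.+-identityʳ (1ℚ * φ [])) (ℚ.*-identityˡ (φ []))
    go []      (suc n) φ = refl
    go (k ∷ s) n       φ = begin
      ∑ₗ (concatMap (λ l → map (l ∷_) (compositions (length s) (n ℕ.∸ l))) (upTo (suc n))) F
        ≡⟨ ∑ₗ-concatMap (λ l → map (l ∷_) (compositions (length s) (n ℕ.∸ l))) (upTo (suc n)) F ⟩
      ∑ₗ (upTo (suc n)) (λ l → ∑ₗ (map (l ∷_) (compositions (length s) (n ℕ.∸ l))) F)
        ≡⟨ ∑ₗ-cong (upTo (suc n)) (λ l → trans (∑ₗ-map (l ∷_) (compositions (length s) (n ℕ.∸ l)) F)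
             (trans (∑ₗ-cong (compositions (length s) (n ℕ.∸ l)) (λ l′ → trans
               (cong (_* φ ((k ⊕ l) ∷ zipWith _⊕_ s l′)) (ν-* ((val k ℕ.+ l ℕ.∸ 1) choose l) (coefficient s l′)))
               (ℚ.*-assoc (binomial (val k) l) (ν (coefficient s l′)) (φ ((k ⊕ l) ∷ zipWith _⊕_ s l′)))))
             (trans (∑ₗ-*ˡ (compositions (length s) (n ℕ.∸ l)) (binomial (val k) l) _)
               (cong (binomial (val k) l *_) (go s (n ℕ.∸ l) (λ p → φ ((k ⊕ l) ∷ p))))))) ⟩
      ∑ₗ (upTo (suc n)) (λ l → binomial (val k) l * tailˢ (λ p → φ ((k ⊕ l) ∷ p)) s (n ℕ.∸ l))
        ≡⟨ ∑ₗ-upTo (suc n) _ ⟩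
      ∑< (suc n) (λ l → binomial (val k) l * tailˢ (λ p → φ ((k ⊕ l) ∷ p)) s (n ℕ.∸ l))
        ≡⟨ anti-as-∑ n _ ⟨
      tailˢ φ (k ∷ s) n ∎
      where
      open ≡-Reasoning
      F : List ℕ → ℚ
      F l = ν (coefficient (k ∷ s) l) * φ (zipWith _⊕_ (k ∷ s) l)

  ζŜ≡𝒮 : ∀ κ n N → seq ((Symmetric.ζŜ Z•) κ n) N ≡ 𝒮 (ζʳ N) κ n
  ζŜ≡𝒮 κ n N = begin
    seq ((Symmetric.ζŜ Z•) κ n) N
      ≡⟨ ∑-seq (upTo (suc (length κ))) (λ i → fromℚ ((- 1ℚ) ^ sum (map val (drop i κ))) Defs.* Symmetric.ζ• Z• (take i κ) Defs.* Symmetric.tail-series Z• (drop i κ) n) N ⟩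
    ∑ₗ (upTo (suc (length κ))) (λ i → sgn (drop i κ) * seq (Symmetric.ζ• Z• (take i κ)) N * seq (Symmetric.tail-series Z• (drop i κ) n) N)
      ≡⟨ ∑ₗ-cong (upTo (suc (length κ))) (λ i → trans (cong₂ (λ x y → sgn (drop i κ) * x * y)
           (cong (λ p → seq (Symmetric.ζ• Z• p) N) (sym (trans (cong reverse (++-identityʳ (reverse (take i κ)))) (reverse-involutive (take i κ)))))
           (tail-series≡tailˢ (drop i κ) n N)) (ℚ.*-assoc (sgn (drop i κ)) _ _)) ⟩
    ∑ₗ (upTo (suc (length κ))) (λ i → F (reverse (take i κ) ++ []) (drop i κ))
      ≡⟨ trans (∑ₗ-upTo (suc (length κ)) (λ i → F (reverse (take i κ) ++ []) (drop i κ))) (sym (cuts≡take-drop F [] κ)) ⟩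
    𝒮 (ζʳ N) κ n ∎
    where
    open ≡-Reasoning
    F : Index → Index → ℚ
    F p q = sgn q * (ζʳ N p * tailˢ (ζʳ N) q n)

  module _ (C : Comparison) where

    open Comparison C

    -- The divergence of `W₁` is confined to `P`, which enters only through P(-t) P(t) = 1 + t Q(t)
    -- with the coefficients of Q in ζ(2) 𝒵. The term 1 reproduces `φ`, and the factor t leaves the
    -- pairing of `φ` with `∂ rest`.
    𝒮-comparison : ∀ κ n → 𝒥ˢ (λ N → 𝒮 (ζʳ N) κ n - 𝒮 (W₁ N) κ n)
    𝒮-comparison κ n = 𝒥-resp (λ N → solve 3 (λ a b c → a :- b := (a :- c) :+ :- (b :- c)) refl (𝒮 (ζʳ N) κ n) (𝒮 (W₁ N) κ n) (𝒮 (φ N) κ n))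
      (𝒥-+ (null⇒𝒥 (null ζʳ∼φ)) (𝒥-neg (𝒥-resp difference (cuts-𝒥 (λ p q → 𝒥-scale (sgn q) (𝒥-*ˡ (φ-𝒵 p) (∂-𝒥 rest-𝒥 q))) [] κ))))
      where
      open ℚSolver
      ζʳ∼φ : (λ N → 𝒮 (ζʳ N) κ n) ∼ (λ N → 𝒮 (φ N) κ n)
      ζʳ∼φ = cuts-∼ (λ p q → ∼-*-const (sgn q) (∼-* (𝒵-bounded (φ-𝒵 p)) (∼-bounded (tail∼ q) (𝒵-bounded (tailˢ-𝒵 φ φ-𝒵 q n))) (∼-sym (φ∼ζʳ p)) (tail∼ q))) [] κ
        where
        tail∼ : ∀ q → (λ N → tailˢ (ζʳ N) q n) ∼ (λ N → tailˢ (φ N) q n)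
        tail∼ q = tailˢ-∼ ζʳ φ (λ p → ∼-sym (φ∼ζʳ p)) q n
      Q : ℕ → ℚ[[t]]
      Q N i = (alternate (P N) ⋆ P N) (suc i)
      ψ rest : ℕ → Index → ℚ
      ψ N q = tailˢ (φ N) q n
      rest N = act (Q N) (ψ N)
      rest-𝒥 : ∀ q → 𝒥ˢ (λ N → rest N q)
      rest-𝒥 = act-𝒥 Q ψ PP⁻-𝒥 (λ q → tailˢ-𝒵 φ φ-𝒵 q n)
      difference : ∀ N → 𝒮 (W₁ N) κ n - 𝒮 (φ N) κ n ≡ cuts (λ p q → sgn q * (φ N p * ∂ (rest N) q)) [] κ
      difference N = begin
        𝒮 (W₁ N) κ n - 𝒮 (φ N) κ n
          ≡⟨ cong (_- 𝒮 (φ N) κ n) (trans (cuts-cong (λ p q → cong₂ (λ x y → sgn q * (x * y)) (W₁≡ N p) (tailˢ-cong q n (W₁≡ N))) [] κ) (𝒮-act (P N) (φ N) κ n)) ⟩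
        pairing (φ N) (act (alternate (P N) ⋆ P N) (ψ N)) [] κ - 𝒮 (φ N) κ n
          ≡⟨ cong (_- 𝒮 (φ N) κ n) (pairing-congʳ (φ N) [] κ (λ q → trans (act-∂ (alternate (P N) ⋆ P N) (ψ N) q) (cong (λ x → x * ψ N q + ∂ (rest N) q) (PP⁻-0 N)))) ⟩
        pairing (φ N) (λ q → 1ℚ * ψ N q + ∂ (rest N) q) [] κ - 𝒮 (φ N) κ n
          ≡⟨ cong (_- 𝒮 (φ N) κ n) (pairing-linearʳ 1ℚ (φ N) (ψ N) (∂ (rest N)) [] κ) ⟩
        1ℚ * 𝒮 (φ N) κ n + pairing (φ N) (∂ (rest N)) [] κ - 𝒮 (φ N) κ n
          ≡⟨ solve 2 (λ x y → con 1ℚ :* x :+ y :- x := y) refl (𝒮 (φ N) κ n) (pairing (φ N) (∂ (rest N)) [] κ) ⟩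
        pairing (φ N) (∂ (rest N)) [] κ ∎
        where open ≡-Reasoning

    𝓛-comparison : ∀ n k ks → 𝒥ˢ (λ N → 𝓛 (ζʳ N) n k ks - 𝓛 (W₁ N) n k ks)
    𝓛-comparison n k ks = 𝒥-resp (λ N → ∑<-- (val k ℕ.∸ 1) (λ j → 𝒮 (ζʳ N) ((1+ j) ∷ ks ∷ʳ (k ⊖ j)) n) (λ j → 𝒮 (W₁ N) ((1+ j) ∷ ks ∷ʳ (k ⊖ j)) n))
      (𝒥-∑< (val k ℕ.∸ 1) (λ j _ → 𝒮-comparison ((1+ j) ∷ ks ∷ʳ (k ⊖ j)) n))
      where
      ∑<-- : ∀ m f g → ∑< m f - ∑< m g ≡ ∑< m (λ i → f i - g i)
      ∑<-- zero    f g = refl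
      ∑<-- (suc m) f g = trans (solve 4 (λ a b c d → (a :+ b) :- (c :+ d) := (a :- c) :+ (b :- d)) refl (∑< m f) (f m) (∑< m g) (g m)) (cong (_+ (f m - g m)) (∑<-- m f g))
        where open ℚSolver

    𝓡-comparison : ∀ n k ks → 𝒥ˢ (λ N → 𝓡 (ζʳ N) n k ks - 𝓡 (W₁ N) n k ks)
    𝓡-comparison n k ks = 𝒥-resp (λ N → trans
        (solve 4 (λ a b c d → (a :+ b) :- (c :+ d) := (a :- c) :+ (b :- d)) refl (anti (X (ζʳ N)) n) (Y (ζʳ N)) (anti (X (W₁ N)) n) (Y (W₁ N)))
        (cong (_+ (Y (ζʳ N) - Y (W₁ N))) (anti-- n (X (ζʳ N)) (X (W₁ N)))))
      (𝒥-+ (𝒥-anti n (λ j m _ → 𝒥-resp (λ N → solve 4 (λ a b c d → (a :+ b) :- (c :+ d) := (a :- c) :+ (b :- d)) refl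
          (𝒮 (ζʳ N) ((k ⊕ j ⊕ 1) ∷ ks) m) (𝒮 (ζʳ N) ((1+ j) ∷ ks ∷ʳ k) m) (𝒮 (W₁ N) ((k ⊕ j ⊕ 1) ∷ ks) m) (𝒮 (W₁ N) ((1+ j) ∷ ks ∷ʳ k) m))
          (𝒥-+ (𝒮-comparison ((k ⊕ j ⊕ 1) ∷ ks) m) (𝒮-comparison ((1+ j) ∷ ks ∷ʳ k) m))))
        (𝒮-comparison (ks ∷ʳ (k ⊕ 1)) n))
      where
      open ℚSolver
      X : (Index → ℚ) → ℕ → ℕ → ℚ
      X φ j m = 𝒮 φ ((k ⊕ j ⊕ 1) ∷ ks) m + 𝒮 φ ((1+ j) ∷ ks ∷ʳ k) m
      Y : (Index → ℚ) → ℚ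
      Y φ = 𝒮 φ (ks ∷ʳ (k ⊕ 1)) n
      anti-- : ∀ n F G → anti F n - anti G n ≡ anti (λ i j → F i j - G i j) n
      anti-- zero    F G = refl
      anti-- (suc n) F G = trans (solve 4 (λ a b c d → (a :+ b) :- (c :+ d) := (a :- c) :+ (b :- d)) refl (F 0 (suc n)) (anti (λ i → F (suc i)) n) (G 0 (suc n)) (anti (λ i → G (suc i)) n))
        (cong (F 0 (suc n) - G 0 (suc n) +_) (anti-- n (λ i → F (suc i)) (λ i → G (suc i))))

    rot-comparison : ∀ (G : (Index → ℚ) → ℕ⁺ → Index → ℚ) → (∀ k ks → 𝒥ˢ (λ N → G (ζʳ N) k ks - G (W₁ N) k ks)) →
      ∀ κ → 𝒥ˢ (λ N → rot (G (ζʳ N)) [] κ - rot (G (W₁ N)) [] κ)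
    rot-comparison G e κ = 𝒥-resp (λ N → sym (rot-- (G (ζʳ N)) (G (W₁ N)) [] κ)) (rot-𝒥 (λ _ → ℕ) (λ _ _ r → r) (λ k ks _ → e k ks) κ 0)

    cyclic-difference-𝒥 : ∀ κ → κ ≢ [] → ∀ n → 𝒥ˢ (λ N → rot (𝓛 (ζʳ N) n) [] κ - rot (𝓡 (ζʳ N) n) [] κ)
    cyclic-difference-𝒥 κ κ≢[] n = 𝒥-resp (λ N → trans
        (solve 6 (λ a b c d e f → a :- b := (a :- c) :+ (:- (b :- d) :+ ((c :+ e) :- (d :+ f) :+ (f :- e)))) refl
          (rot (𝓛 (ζʳ N) n) [] κ) (rot (𝓡 (ζʳ N) n) [] κ) (rot (𝓛 (W₁ N) n) [] κ) (rot (𝓡 (W₁ N) n) [] κ) (E⁺ N) (E⁻ N))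
        (cong (λ x → (rot (𝓛 (ζʳ N) n) [] κ - rot (𝓛 (W₁ N) n) [] κ) + (- (rot (𝓡 (ζʳ N) n) [] κ - rot (𝓡 (W₁ N) n) [] κ) + (x + (E⁻ N - E⁺ N))))
          (trans (cong (_- (rot (𝓡 (W₁ N) n) [] κ + E⁻ N)) (truncated-cyclic-sum N n κ)) (ℚ.+-inverseʳ (rot (𝓡 (W₁ N) n) [] κ + E⁻ N)))))
      (𝒥-+ (rot-comparison (λ φ → 𝓛 φ n) (𝓛-comparison n) κ) (𝒥-+ (𝒥-neg (rot-comparison (λ φ → 𝓡 φ n) (𝓡-comparison n) κ))
        (𝒥-resp (λ N → ℚ.+-identityˡ (E⁻ N - E⁺ N)) (error-𝒥 n κ κ≢[]))))
      where
      open ℚSolver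
      E⁺ E⁻ : ℕ → ℚ
      E⁺ N = rot (λ k ks → 𝓔⁺ N n (k ∷ ks)) [] κ
      E⁻ N = rot (λ k ks → 𝓔⁻ N n (k ∷ ks)) [] κ

-- Relations between regularized values

seq-coeff-+ₚ : ∀ p q N → seq (coeff (p +ₚ q) 0) N ≡ seq (coeff p 0) N + seq (coeff q 0) N
seq-coeff-+ₚ []      q       N = sym (ℚ.+-identityˡ _)
seq-coeff-+ₚ (a ∷ p) []      N = sym (ℚ.+-identityʳ _)
seq-coeff-+ₚ (a ∷ p) (b ∷ q) N = refl

seq-coeff-·ₚ : ∀ c p N → seq (coeff (c ·ₚ p) 0) N ≡ seq c N * seq (coeff p 0) N
seq-coeff-·ₚ c []      N = sym (ℚ.*-zeroʳ (seq c N))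
seq-coeff-·ₚ c (a ∷ p) N = refl

seq-coeff-*ₚ : ∀ p q N → seq (coeff (p *ₚ q) 0) N ≡ seq (coeff p 0) N * seq (coeff q 0) N
seq-coeff-*ₚ []      q N = sym (ℚ.*-zeroˡ (seq (coeff q 0) N))
seq-coeff-*ₚ (a ∷ p) q N = trans (seq-coeff-+ₚ (a ·ₚ q) (0ℝ ∷ p *ₚ q) N)
  (trans (ℚ.+-identityʳ _) (seq-coeff-·ₚ a q N))

≈⇒∼ : ∀ {x y} → x Defs.≈ y → seq x ∼ seq y
≈⇒∼ (mk≈ e) = mk∼ (mkNull (λ δ 0<δ → proj₁ (e δ 0<δ) , λ n M≤n → ℚ.<⇒≤ (proj₂ (e δ 0<δ) n M≤n)))

seq-bounded : ∀ x → Bounded (seq x)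
seq-bounded x = mkBounded (ℚ.<⇒≤ (proj₁ (proj₂ cb))) (proj₂ (proj₂ cb))
  where cb = cauchy-bounded (seq x) (cauchy x)

module _ (• : Product) (Z• : Index → ℝ[T]) (reg : IsRegularization • Z•) where

  ζˢ : ℕ → Index → ℚ
  ζˢ N k = seq (Symmetric.ζ• Z• k) N

  ζˢ-admissible : ∀ {k} → Admissible k → (λ N → ζˢ N k) ∼ ζ≤ k
  ζˢ-admissible {k} a = ≈⇒∼ {coeff (Z• k) 0} {ζ a} (proj₁ reg a 0)

  weightedˢ : ℕ → ℚ × Index → ℚ
  weightedˢ N (c , k) = c * ζˢ N k

  seq-linearₚ : ∀ (xs : Lin Index) N → seq (coeff (linearₚ Z• xs) 0) N ≡ ∑ₗ xs (weightedˢ N)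
  seq-linearₚ []             N = refl
  seq-linearₚ ((c , k) ∷ xs) N = trans (seq-coeff-+ₚ (fromℚ c ·ₚ Z• k) (linearₚ Z• xs) N)
    (cong₂ _+_ (seq-coeff-·ₚ (fromℚ c) (Z• k) N) (seq-linearₚ xs N))

  single : Index → 𝓗¹
  single k = (1ℚ , k) ∷ []

  seq-single : ∀ k N → seq (coeff (linearₚ Z• (single k)) 0) N ≡ ζˢ N k
  seq-single k N = trans (seq-linearₚ (single k) N) (trans (ℚ.+-identityʳ (1ℚ * ζˢ N k)) (ℚ.*-identityˡ (ζˢ N k)))

  seq-single-product : ∀ k l N → seq (coeff (linearₚ Z• (single k ⟨ • ⟩ single l)) 0) N ≡ ∑ₗ (basisProduct • k l) (ζˢ N)
  seq-single-product k l N = trans (seq-linearₚ (single k ⟨ • ⟩ single l) N)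
    (trans (drop-[] (map (1ℚ ,_) (basisProduct • k l) ++ [])) (trans (drop-[] (map (1ℚ ,_) (basisProduct • k l)))
      (trans (∑ₗ-map (1ℚ ,_) (basisProduct • k l) (weightedˢ N)) (∑ₗ-cong (basisProduct • k l) (λ k → ℚ.*-identityˡ (ζˢ N k))))))
    where
    drop-[] : ∀ xs → ∑ₗ (xs ++ []) (weightedˢ N) ≡ ∑ₗ xs (weightedˢ N)
    drop-[] xs = trans (∑ₗ-++ xs [] (weightedˢ N)) (ℚ.+-identityʳ (∑ₗ xs (weightedˢ N)))

  ζˢ-product : ∀ k l → (λ N → ∑ₗ (basisProduct • k l) (ζˢ N)) ∼ (λ N → ζˢ N k * ζˢ N l)
  ζˢ-product k l = ∼-trans (∼-reflexive (λ N → sym (seq-single-product k l N)))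
    (∼-trans (≈⇒∼ {coeff (linearₚ Z• (single k ⟨ • ⟩ single l)) 0} {coeff (linearₚ Z• (single k) *ₚ linearₚ Z• (single l)) 0} (proj₂ (proj₂ reg) (single k) (single l) 0))
      (∼-reflexive (λ N → trans (seq-coeff-*ₚ (linearₚ Z• (single k)) (linearₚ Z• (single l)) N) (cong₂ _*_ (seq-single k N) (seq-single l N)))))

  -- Taking constant terms is multiplicative and `Z•` sends y to T, whose constant term is 0. These
  -- relations, together with the admissible values, determine ζ•.
  ζˢ-y-product : ∀ l → Null (λ N → ∑ₗ (basisProduct • (1+ 0 ∷ []) l) (ζˢ N))
  ζˢ-y-product l = null-resp (λ N → ℚ.+-identityʳ (∑ₗ (basisProduct • (1+ 0 ∷ []) l) (ζˢ N))) (null (∼-trans (ζˢ-product (1+ 0 ∷ []) l)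
    (∼-trans (∼-* (bounded-const 0ℚ) (seq-bounded (coeff (Z• l) 0)) ζˢ-y (∼-refl {λ N → ζˢ N l})) (∼-reflexive (λ N → ℚ.*-zeroˡ (ζˢ N l))))))
    where
    ζˢ-y : (λ N → ζˢ N (1+ 0 ∷ [])) ∼ (λ _ → 0ℚ)
    ζˢ-y = ≈⇒∼ {coeff (Z• (1+ 0 ∷ [])) 0} {0ℝ} (proj₁ (proj₂ reg) 0)

record _≈𝒵_ (s t : ℕ → ℚ) : Set where
  constructor mk≈𝒵
  field
    in-𝒵  : 𝒵ˢ s
    limit : s ∼ t

-- Two families satisfy the same relation in the limit, in which `a` has the invertible coefficient
-- j + 1. Agreement, and membership in 𝒵, pass from the other terms to `a`.
determine : ∀ {A : Set} (vs : List A) (φ ψ : ℕ → A → ℚ) (a : A) j →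
  Null (λ N → ν (suc j) * φ N a + ∑ₗ vs (φ N)) → Null (λ N → ν (suc j) * ψ N a + ∑ₗ vs (ψ N)) →
  All (λ v → (λ N → φ N v) ≈𝒵 (λ N → ψ N v)) vs → (λ N → φ N a) ≈𝒵 (λ N → ψ N a)
determine {A} vs φ ψ a j nφ nψ all = mk≈𝒵 (𝒵-∼ (solved φ nφ) (𝒵-scale (- u j) (𝒵-∑ₗ vs (All.map _≈𝒵_.in-𝒵 all))))
  (∼-trans (solved φ nφ) (∼-trans (∼-*-const (- u j) (∼-∑ₗ vs all)) (∼-sym (solved ψ nψ))))
  where
  open ℚSolver
  solved : ∀ φ → Null (λ N → ν (suc j) * φ N a + ∑ₗ vs (φ N)) → (λ N → φ N a) ∼ (λ N → - u j * ∑ₗ vs (φ N))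
  solved φ n = mk∼ (null-resp (λ N → trans
    (solve 4 (λ w n x s → w :* (n :* x :+ s) := (n :* w) :* x :- (:- w) :* s) refl (u j) (ν (suc j)) (φ N a) (∑ₗ vs (φ N)))
    (trans (cong (λ x → x * φ N a - - u j * ∑ₗ vs (φ N)) (νu≡1 j)) (cong (_- - u j * ∑ₗ vs (φ N)) (ℚ.*-identityˡ (φ N a))))) (null-*-const (u j) n))
  ∼-∑ₗ : ∀ vs → All (λ v → (λ N → φ N v) ≈𝒵 (λ N → ψ N v)) vs → (λ N → ∑ₗ vs (φ N)) ∼ (λ N → ∑ₗ vs (ψ N))
  ∼-∑ₗ []       []       = ∼-refl
  ∼-∑ₗ (v ∷ vs) (e ∷ es) = ∼-+ (_≈𝒵_.limit e) (∼-∑ₗ vs es)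

-- At most `m` entries 1 precede an admissible rest, in right-to-left reading. The bound `m`
-- measures the distance from convergence and carries the induction in the harmonic case.
data Lead : ℕ → Index → Set where
  adm : ∀ {m p} → Admissibleʳ p → Lead m p
  one : ∀ {m p} → Lead m p → Lead (suc m) ((1+ 0) ∷ p)

Lead-mono : ∀ {m n p} → m ℕ.≤ n → Lead m p → Lead n p
Lead-mono m≤n         (adm a) = adm a
Lead-mono (ℕ.s≤s m≤n) (one l) = one (Lead-mono m≤n l)

lead : ∀ p → ∃ λ m → Lead m p
lead []                = 0 , adm empty
lead ((1+ zero) ∷ p)   = suc (proj₁ (lead p)) , one (proj₂ (lead p))
lead ((1+ suc k) ∷ p)  = 0 , adm (first≥2 (ℕ.s≤s (ℕ.s≤s ℕ.z≤n)))

split-lead : ∀ {m p} → Lead m p → ∃ λ j → ∃ λ p₀ → j ℕ.≤ m × Admissibleʳ p₀ × p ≡ ones j ++ p₀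
split-lead (adm a) = 0 , _ , ℕ.z≤n , a , refl
split-lead (one l) with split-lead l
... | (j , p₀ , j≤m , a , refl) = suc j , p₀ , ℕ.s≤s j≤m , a , refl

-- The harmonic case

y∗_ : Index → List Index
y∗ p = harmonicʳ ((1+ 0) ∷ []) p

others : ℕ → Index → List Index
others zero    []       = []
others zero    (k ∷ ks) = map (k ∷_) (y∗ ks) ++ (((1+ 0) ⊕⁺ k) ∷ ks) ∷ []
others (suc m) p        = map ((1+ 0) ∷_) (others m p) ++ ((1+ 1) ∷ ones m ++ p) ∷ []

-- A new 1 has m + 1 places among the leading 1s, all giving the same index. If it is placed further
-- inside or merged with an entry, the number of leading 1s does not grow; see `others-lead`.
∑-y∗ : ∀ m p F → ∑ₗ (y∗ (ones m ++ p)) F ≡ ν (suc m) * F (ones (suc m) ++ p) + ∑ₗ (others m p) F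
∑-y∗ zero    []       F = cong (_+ 0ℚ) (sym (ℚ.*-identityˡ (F ((1+ 0) ∷ []))))
∑-y∗ zero    (k ∷ ks) F = cong (_+ ∑ₗ (others 0 (k ∷ ks)) F) (sym (ℚ.*-identityˡ (F ((1+ 0) ∷ k ∷ ks))))
∑-y∗ (suc m) p        F = begin
  F₁ + ∑ₗ (map ((1+ 0) ∷_) (y∗ (ones m ++ p)) ++ two ∷ []) F
    ≡⟨ cong (F₁ +_) (trans (∑ₗ-++ (map ((1+ 0) ∷_) (y∗ (ones m ++ p))) (two ∷ []) F)
         (cong (_+ (F two + 0ℚ)) (trans (∑ₗ-map ((1+ 0) ∷_) (y∗ (ones m ++ p)) F) (∑-y∗ m p (λ v → F ((1+ 0) ∷ v)))))) ⟩
  F₁ + (ν (suc m) * F₁ + ∑ₗ (others m p) (λ v → F ((1+ 0) ∷ v)) + (F two + 0ℚ))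
    ≡⟨ solve 4 (λ f n s t → f :+ (n :* f :+ s :+ t) := (con 1ℚ :+ n) :* f :+ (s :+ t)) refl F₁ (ν (suc m)) (∑ₗ (others m p) (λ v → F ((1+ 0) ∷ v))) (F two + 0ℚ) ⟩
  (1ℚ + ν (suc m)) * F₁ + (∑ₗ (others m p) (λ v → F ((1+ 0) ∷ v)) + (F two + 0ℚ))
    ≡⟨ cong₂ (λ x y → x * F₁ + y) (ν-+ 1 (suc m)) (trans (∑ₗ-++ (map ((1+ 0) ∷_) (others m p)) (two ∷ []) F) (cong (_+ (F two + 0ℚ)) (∑ₗ-map ((1+ 0) ∷_) (others m p) F))) ⟨
  ν (suc (suc m)) * F₁ + ∑ₗ (others (suc m) p) F ∎
  where
  open ≡-Reasoning
  open ℚSolver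
  F₁ = F (ones (suc (suc m)) ++ p)
  two : Index
  two = (1+ 1) ∷ ones m ++ p

others-lead : ∀ m {p} → Admissibleʳ p → All (Lead m) (others m p)
others-lead zero    empty = []
others-lead zero    (first≥2 {k} {ks} 2≤k) = All.++⁺ (prefixed (y∗ ks)) (adm (first≥2 (ℕ.m≤n⇒m≤1+n 2≤k)) ∷ [])
  where
  prefixed : ∀ vs → All (Lead 0) (map (k ∷_) vs)
  prefixed []       = []
  prefixed (v ∷ vs) = adm (first≥2 2≤k) ∷ prefixed vs
others-lead (suc m) a = All.++⁺ (All.map⁺ (All.map one (others-lead m a))) (adm (first≥2 (ℕ.s≤s (ℕ.s≤s ℕ.z≤n))) ∷ [])

exp-series : ℚ → ℚ[[t]]
exp-series h zero    = 1ℚ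
exp-series h (suc c) = u c * (h * exp-series h c)

exp-series-suc : ∀ h c → ν (suc c) * exp-series h (suc c) ≡ h * exp-series h c
exp-series-suc h c = trans (sym (ℚ.*-assoc (ν (suc c)) (u c) (h * exp-series h c)))
  (trans (cong (_* (h * exp-series h c)) (νu≡1 c)) (ℚ.*-identityˡ (h * exp-series h c)))

exp-series-inverse : ∀ h n → (exp-series (- h) ⋆ exp-series h) n ≡ δ₀ n
exp-series-inverse h zero    = refl
exp-series-inverse h (suc n) = begin
  x                          ≡⟨ trans (cong (_* x) (trans (ℚ.*-comm (u n) (ν (suc n))) (νu≡1 n))) (ℚ.*-identityˡ x) ⟨
  u n * ν (suc n) * x        ≡⟨ ℚ.*-assoc (u n) (ν (suc n)) x ⟩
  u n * (ν (suc n) * x)      ≡⟨ cong (u n *_) (trans (θ-⋆ f g (suc n)) (trans (cong₂ _+_ left right)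
                                  (solve 2 (λ h y → (:- h) :* y :+ h :* y := con 0ℚ) refl h ((f ⋆ g) n)))) ⟩
  u n * 0ℚ                   ≡⟨ ℚ.*-zeroʳ (u n) ⟩
  0ℚ                         ∎
  where
  open ≡-Reasoning
  open ℚSolver
  f = exp-series (- h)
  g = exp-series h
  x = (f ⋆ g) (suc n)
  left : (θ f ⋆ g) (suc n) ≡ - h * (f ⋆ g) n
  left = trans (cong₂ _+_ (ℚ.*-zeroˡ (g (suc n))) (anti-cong′ n (λ i j → trans (cong (_* g j) (exp-series-suc (- h) i)) (ℚ.*-assoc (- h) (f i) (g j)))))
    (trans (ℚ.+-identityˡ _) (anti-*ˡ n (- h) (λ i j → f i * g j)))
  right : (f ⋆ θ g) (suc n) ≡ h * (f ⋆ g) n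
  right = trans (anti-last n (λ i j → f i * θ g j)) (trans (cong₂ _+_
      (trans (anti-cong′ n (λ i j → trans (cong (f i *_) (exp-series-suc h j)) (solve 3 (λ f h g → f :* (h :* g) := h :* (f :* g)) refl (f i) h (g j)))) (anti-*ˡ n h (λ i j → f i * g j)))
      (ℚ.*-zeroʳ (f (suc n)))) (ℚ.+-identityʳ (h * (f ⋆ g) n)))

alternate-exp : ∀ h i → alternate (exp-series h) i ≡ exp-series (- h) i
alternate-exp h zero    = refl
alternate-exp h (suc i) = trans (solve 4 (λ e w h x → (con (- 1ℚ) :* e) :* (w :* (h :* x)) := w :* ((:- h) :* (e :* x))) refl ((- 1ℚ) ^ i) (u i) h (exp-series h i))
  (cong (λ x → u i * (- h * x)) (alternate-exp h i))
  where open ℚSolver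

-- The regularized truncated sums annihilate y ∗ w: the operator exp(- 𝓗 ∂) is applied to
-- the relation ∂ (y ∗ w) = w + y ∗ ∂ w.
module _ (N : ℕ) where

  ∑∂-y∗ : ∀ (χ : Index → ℚ) k ks → ∑ₗ (y∗ (k ∷ ks)) (∂ χ) ≡ χ (k ∷ ks) + ∂ (λ l → ∑ₗ (y∗ l) χ) (k ∷ ks)
  ∑∂-y∗ χ k@(1+ zero)  ks = cong (χ (k ∷ ks) +_) (trans (∑ₗ-++ (map (k ∷_) (y∗ ks)) _ (∂ χ)) (trans (ℚ.+-identityʳ _) (∑ₗ-map (k ∷_) (y∗ ks) (∂ χ))))
  ∑∂-y∗ χ k@(1+ suc m) ks = cong (χ (k ∷ ks) +_) (trans (∑ₗ-++ (map (k ∷_) (y∗ ks)) _ (∂ χ))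
    (trans (cong₂ _+_ (trans (∑ₗ-map (k ∷_) (y∗ ks) (∂ χ)) (∑ₗ-0 (y∗ ks))) refl) refl))
    where
    ∑ₗ-0 : ∀ {A : Set} (xs : List A) → ∑ₗ xs (λ _ → 0ℚ) ≡ 0ℚ
    ∑ₗ-0 []       = refl
    ∑ₗ-0 (x ∷ xs) = trans (ℚ.+-identityˡ _) (∑ₗ-0 xs)

  -- The hypothesis is the recursion for the coefficients of exp(- 𝓗 t) without its initial c terms.
  -- A leading 1 of `w` shifts the series once more, so the induction needs all c; the case of
  -- interest is c = 0.
  act-y∗ : ∀ c γ → (∀ i → ν (suc (c ℕ.+ i)) * γ (suc i) + 𝓗 N * γ i ≡ 0ℚ) → ∀ w →
    ∑ₗ (y∗ w) (act γ (W₁ N)) + ν c * act (λ i → γ (suc i)) (W₁ N) w ≡ 0ℚ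
  act-y∗ c γ e w = begin
    ∑ₗ (y∗ w) (act γ (W₁ N)) + ν c * act γ′ (W₁ N) w
      ≡⟨ cong (_+ ν c * act γ′ (W₁ N) w) (trans (∑ₗ-cong (y∗ w) (act-∂ γ (W₁ N))) (trans (∑ₗ-+ (y∗ w) _ _) (cong (_+ ∑ₗ (y∗ w) (∂ χ)) (trans (∑ₗ-*ˡ (y∗ w) (γ 0) (W₁ N))
           (cong (γ 0 *_) (trans (sym (W₁-harmonic ((1+ 0) ∷ []) w N)) (cong (_* W₁ N w) (trans (W₁-single (1+ 0) N) (Σ-cong′ N (λ n → ℚ.*-identityʳ (u n))))))))))) ⟩
    γ 0 * (𝓗 N * W₁ N w) + ∑ₗ (y∗ w) (∂ χ) + ν c * χ w
      ≡⟨ rest w ⟩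
    0ℚ ∎
    where
    open ≡-Reasoning
    open ℚSolver
    γ′ : ℚ[[t]]
    γ′ i = γ (suc i)
    χ : Index → ℚ
    χ = act γ′ (W₁ N)
    ∑ₗ-+ : ∀ (xs : List Index) f g → ∑ₗ xs (λ a → f a + g a) ≡ ∑ₗ xs f + ∑ₗ xs g
    ∑ₗ-+ []       f g = refl
    ∑ₗ-+ (x ∷ xs) f g = trans (cong (f x + g x +_) (∑ₗ-+ xs f g)) (+-exchange (f x) (g x) (∑ₗ xs f) (∑ₗ xs g))
    e₀ : (1ℚ + ν c) * γ 1 + 𝓗 N * γ 0 ≡ 0ℚ
    e₀ = trans (cong (λ x → x * γ 1 + 𝓗 N * γ 0) (trans (sym (ν-+ 1 c)) (cong (λ m → ν (suc m)) (sym (ℕ.+-identityʳ c))))) (e 0)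
    rest : ∀ w → γ 0 * (𝓗 N * W₁ N w) + ∑ₗ (y∗ w) (∂ χ) + ν c * χ w ≡ 0ℚ
    rest []                     = trans (solve 4 (λ g h g′ n → g :* (h :* con 1ℚ) :+ (g′ :* con 1ℚ :+ con 0ℚ) :+ n :* (g′ :* con 1ℚ) := (con 1ℚ :+ n) :* g′ :+ h :* g) refl (γ 0) (𝓗 N) (γ 1) (ν c)) e₀
    rest w@(k@(1+ suc m) ∷ ks)  = trans (cong (λ x → γ 0 * (𝓗 N * W₁ N w) + x + ν c * χ w) (∑∂-y∗ χ k ks))
      (trans (solve 5 (λ g h x g′ n → g :* (h :* x) :+ (g′ :* x :+ con 0ℚ) :+ n :* (g′ :* x) := ((con 1ℚ :+ n) :* g′ :+ h :* g) :* x) refl (γ 0) (𝓗 N) (W₁ N w) (γ 1) (ν c))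
        (trans (cong (_* W₁ N w) e₀) (ℚ.*-zeroˡ (W₁ N w))))
    rest w@(k@(1+ zero) ∷ ks)   = trans (cong (λ x → γ 0 * (𝓗 N * W₁ N w) + x + ν c * χ w) (∑∂-y∗ χ k ks))
      (trans (solve 7 (λ g h x g′ n y s → g :* (h :* x) :+ ((g′ :* x :+ y) :+ s) :+ n :* (g′ :* x :+ y) := ((con 1ℚ :+ n) :* g′ :+ h :* g) :* x :+ (s :+ (con 1ℚ :+ n) :* y)) refl
          (γ 0) (𝓗 N) (W₁ N w) (γ 1) (ν c) (act (λ i → γ (suc (suc i))) (W₁ N) ks) (∑ₗ (y∗ ks) χ))
        (cong₂ _+_ (trans (cong (_* W₁ N w) e₀) (ℚ.*-zeroˡ (W₁ N w)))
          (trans (cong (λ x → ∑ₗ (y∗ ks) χ + x * act (λ i → γ (suc (suc i))) (W₁ N) ks) (sym (ν-+ 1 c)))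
            (act-y∗ (suc c) γ′ (λ i → trans (cong (λ m → ν (suc m) * γ (suc (suc i)) + 𝓗 N * γ (suc i)) (sym (ℕ.+-suc c i))) (e (suc i))) ks))))

act-admissible : ∀ γ φ {p} → γ 0 ≡ 1ℚ → Admissibleʳ p → act γ φ p ≡ φ p
act-admissible γ φ         e empty                     = trans (cong (_* φ []) e) (ℚ.*-identityˡ (φ []))
act-admissible γ φ {p}     e (first≥2 {1+ suc k} _)    = trans (cong (_* φ p) e) (ℚ.*-identityˡ (φ p))
act-admissible γ φ         e (first≥2 {1+ zero} (ℕ.s≤s ()))

W₁∼ζʳ : ∀ • Z• → IsRegularization • Z• → ∀ {p} → Admissibleʳ p → (λ N → W₁ N p) ≈𝒵 (λ N → ζʳ Z• N p)
W₁∼ζʳ • Z• reg {p} a = mk≈𝒵 (𝒵-W₁ a) (∼-sym (∼-trans (ζˢ-admissible • Z• reg (admissible-reverse a))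
  (∼-reflexive (λ N → trans (cong (λ q → ζʳ≤ q N) (reverse-involutive p)) (ζʳ≤≡W p N)))))

module _ (Z• : Index → ℝ[T]) (reg : IsRegularization ∗ Z•) where

  private
    φ∗ : ℕ → Index → ℚ
    φ∗ N = act (exp-series (- 𝓗 N)) (W₁ N)

  ζʳ-y∗ : ∀ w → Null (λ N → ∑ₗ (y∗ w) (ζʳ Z• N))
  ζʳ-y∗ w = null-resp (λ N → trans (∑ₗ-map reverse (harmonicʳ ((1+ 0) ∷ []) (reverse (reverse w))) (ζˢ ∗ Z• reg N))
    (cong (λ p → ∑ₗ (harmonicʳ ((1+ 0) ∷ []) p) (ζʳ Z• N)) (reverse-involutive w))) (ζˢ-y-product ∗ Z• reg (reverse w))

  φ∗-y∗ : ∀ w N → ∑ₗ (y∗ w) (φ∗ N) ≡ 0ℚ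
  φ∗-y∗ w N = trans (solve 2 (λ x y → x := x :+ con 0ℚ :* y) refl (∑ₗ (y∗ w) (φ∗ N)) (act (λ i → exp-series (- 𝓗 N) (suc i)) (W₁ N) w))
    (act-y∗ N 0 (exp-series (- 𝓗 N)) (λ i → trans (cong (_+ 𝓗 N * exp-series (- 𝓗 N) i) (exp-series-suc (- 𝓗 N) i))
      (solve 2 (λ h x → (:- h) :* x :+ h :* x := con 0ℚ) refl (𝓗 N) (exp-series (- 𝓗 N) i))) w)
    where open ℚSolver

  -- Both families agree in the limit on admissible indices and annihilate all y ∗ w. With j leading
  -- 1s in front of an admissible rest, the relation for y ∗ w reduces one more 1 to indices with at
  -- most j of them.
  φ∗∼ζʳ : ∀ m {p} → Lead m p → (λ N → φ∗ N p) ≈𝒵 (λ N → ζʳ Z• N p)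
  φ∗∼ζʳ m {p} (adm a) = mk≈𝒵 (𝒵-resp (λ N → act-admissible (exp-series (- 𝓗 N)) (W₁ N) refl a) in-𝒵)
    (∼-trans (∼-reflexive (λ N → act-admissible (exp-series (- 𝓗 N)) (W₁ N) refl a)) limit)
    where open _≈𝒵_ (W₁∼ζʳ ∗ Z• reg a)
  φ∗∼ζʳ (suc m) (one l) = step (split-lead l)
    where
    step : ∀ {p} → (∃ λ j → ∃ λ p₀ → j ℕ.≤ m × Admissibleʳ p₀ × p ≡ ones j ++ p₀) → (λ N → φ∗ N ((1+ 0) ∷ p)) ≈𝒵 (λ N → ζʳ Z• N ((1+ 0) ∷ p))
    step (j , p₀ , j≤m , a , refl) = determine (others j p₀) φ∗ (ζʳ Z•) (ones (suc j) ++ p₀) j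
      (null-0 (λ N → trans (sym (∑-y∗ j p₀ (φ∗ N))) (φ∗-y∗ (ones j ++ p₀) N)))
      (null-resp (λ N → ∑-y∗ j p₀ (ζʳ Z• N)) (ζʳ-y∗ (ones j ++ p₀)))
      (All.map (λ l′ → φ∗∼ζʳ m (Lead-mono j≤m l′)) (others-lead j a))

  harmonic-comparison : Comparison Z•
  harmonic-comparison = record
    { φ     = φ∗
    ; P     = λ N → exp-series (𝓗 N)
    ; W₁≡   = λ N p → sym (trans (act-⋆ (exp-series (𝓗 N)) (exp-series (- 𝓗 N)) (W₁ N) p)
        (trans (act-cong {ψ = W₁ N} p (λ i → trans (⋆-comm (exp-series (𝓗 N)) (exp-series (- 𝓗 N)) i) (exp-series-inverse (𝓗 N) i)) (λ _ → refl)) (act-δ₀ (W₁ N) p)))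
    ; φ-𝒵   = λ p → _≈𝒵_.in-𝒵 (φ∗∼ζʳ (proj₁ (lead p)) (proj₂ (lead p)))
    ; φ∼ζʳ  = λ p → _≈𝒵_.limit (φ∗∼ζʳ (proj₁ (lead p)) (proj₂ (lead p)))
    ; PP⁻-0 = λ N → refl
    ; PP⁻-𝒥 = λ c → 𝒥-resp (λ N → trans (⋆-congˡ (exp-series (𝓗 N)) (alternate-exp (𝓗 N)) (suc c)) (exp-series-inverse (𝓗 N) (suc c))) 𝒥-0
    }

-- The shuffle case

y⧢_ : Word → List Word
y⧢ w = shuffleʳ (𝔶 ∷ []) w

-- Like indices and words in harmonicʳ and shuffleʳ, words are now read from right to left.
wordʳ : Index → Word
wordʳ []              = []
wordʳ ((1+ n) ∷ p) = replicate n 𝔵 ++ 𝔶 ∷ wordʳ p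

-- The reversed words of non-empty indices, that is, the lists of letters that end in 𝔶.
data Good : Word → Set where
  [𝔶]  : Good (𝔶 ∷ [])
  𝔶∷_  : ∀ {w} → Good w → Good (𝔶 ∷ w)
  𝔵∷_  : ∀ {w} → Good w → Good (𝔵 ∷ w)

good-index : ∀ {w} → Good w → ∃ λ n → ∃ λ p → w ≡ wordʳ ((1+ n) ∷ p)
good-index [𝔶]    = 0 , [] , refl
good-index (𝔶∷ g) = let (n , p , e) = good-index g in 0 , (1+ n) ∷ p , cong (𝔶 ∷_) e
good-index (𝔵∷ g) = let (n , p , e) = good-index g in suc n , p , cong (𝔵 ∷_) e

wordʳ-good : ∀ n p → Good (wordʳ ((1+ n) ∷ p))
wordʳ-good (suc n) p                = 𝔵∷ wordʳ-good n p
wordʳ-good zero    []               = [𝔶]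
wordʳ-good zero    ((1+ m) ∷ p)     = 𝔶∷ wordʳ-good m p

y⧢-good : ∀ {w} → Good w → All Good (y⧢ w)
y⧢-good [𝔶]    = (𝔶∷ [𝔶]) ∷ (𝔶∷ [𝔶]) ∷ []
y⧢-good (𝔶∷ g) = (𝔶∷ (𝔶∷ g)) ∷ All.map⁺ (All.map 𝔶∷_ (y⧢-good g))
y⧢-good (𝔵∷ g) = (𝔶∷ (𝔵∷ g)) ∷ All.map⁺ (All.map 𝔵∷_ (y⧢-good g))

z-reverse : ∀ p → z (reverse p) ≡ reverse (wordʳ p)
z-reverse []              = refl
z-reverse ((1+ n) ∷ p) = begin
  z (reverse ((1+ n) ∷ p))                                       ≡⟨ cong z (unfold-reverse (1+ n) p) ⟩
  z (reverse p ++ (1+ n) ∷ [])                                   ≡⟨ concatMap-++ _ (reverse p) ((1+ n) ∷ []) ⟩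
  z (reverse p) ++ ((𝔶 ∷ replicate n 𝔵) ++ [])                   ≡⟨ cong₂ _++_ (z-reverse p) (++-identityʳ (𝔶 ∷ replicate n 𝔵)) ⟩
  reverse (wordʳ p) ++ (𝔶 ∷ replicate n 𝔵)                       ≡⟨ ++-assoc (reverse (wordʳ p)) (𝔶 ∷ []) (replicate n 𝔵) ⟨
  (reverse (wordʳ p) ++ 𝔶 ∷ []) ++ replicate n 𝔵                 ≡⟨ cong₂ _++_ (unfold-reverse 𝔶 (wordʳ p)) (reverse-replicate n) ⟨
  reverse (𝔶 ∷ wordʳ p) ++ reverse (replicate n 𝔵)               ≡⟨ reverse-++ (replicate n 𝔵) (𝔶 ∷ wordʳ p) ⟨
  reverse (wordʳ ((1+ n) ∷ p))                                   ∎
  where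
  open ≡-Reasoning
  snoc : ∀ n → replicate n 𝔵 ++ 𝔵 ∷ [] ≡ 𝔵 ∷ replicate n 𝔵
  snoc zero    = refl
  snoc (suc n) = cong (𝔵 ∷_) (snoc n)
  reverse-replicate : ∀ n → reverse (replicate n 𝔵) ≡ replicate n 𝔵
  reverse-replicate zero    = refl
  reverse-replicate (suc n) = trans (unfold-reverse 𝔵 (replicate n 𝔵)) (trans (cong (_++ 𝔵 ∷ []) (reverse-replicate n)) (snoc n))

-- The coefficients of the multiple polylogarithm Li_w, for w a reversed word.
li : Word → ℚ[[t]]
li []      = δ₀
li (a ∷ w) zero = 0ℚ
li (𝔵 ∷ w) (suc n) = u n * li w (suc n)
li (𝔶 ∷ w) (suc n) = u n * ∑< (suc n) (li w)

li-y : ℚ[[t]]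
li-y zero    = 0ℚ
li-y (suc n) = u n

li-[𝔶] : ∀ n → li (𝔶 ∷ []) n ≡ li-y n
li-[𝔶] zero    = refl
li-[𝔶] (suc n) = trans (cong (u n *_) (trans (Σ-front n δ₀) (trans (cong (1ℚ +_) (Σ-0 n)) (ℚ.+-identityʳ 1ℚ)))) (ℚ.*-identityʳ (u n))

-- The derivatives t d/dt Li_{wx} = Li_w and t d/dt Li_{wy} = t/(1 - t) Li_w.
derive : Letter → ℚ[[t]] → ℚ[[t]]
derive 𝔵 f n = f n
derive 𝔶 f n = ∑< n f

li-at-0 : ∀ {w} → Good w → li w 0 ≡ 0ℚ
li-at-0 [𝔶]    = refl
li-at-0 (𝔶∷ _) = refl
li-at-0 (𝔵∷ _) = refl

-- The condition for 𝔵 excludes the empty word, whose constant coefficient 1 cannot come from a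
-- derivative t d/dt.
θ-li : ∀ a w → (a ≡ 𝔵 → Good w) → ∀ n → θ (li (a ∷ w)) n ≡ derive a (li w) n
θ-li 𝔵 w g zero    = trans (ℚ.*-zeroˡ 0ℚ) (sym (li-at-0 (g refl)))
θ-li 𝔶 w g zero    = ℚ.*-zeroˡ 0ℚ
θ-li 𝔵 w g (suc n) = trans (sym (ℚ.*-assoc (ν (suc n)) (u n) (li w (suc n)))) (trans (cong (_* li w (suc n)) (νu≡1 n)) (ℚ.*-identityˡ (li w (suc n))))
θ-li 𝔶 w g (suc n) = trans (sym (ℚ.*-assoc (ν (suc n)) (u n) (∑< (suc n) (li w)))) (trans (cong (_* ∑< (suc n) (li w)) (νu≡1 n)) (ℚ.*-identityˡ (∑< (suc n) (li w))))

-- `derive a` is multiplication by 1 or by t/(1 - t).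
derive-⋆ : ∀ a f g n → (derive a f ⋆ g) n ≡ derive a (f ⋆ g) n
derive-⋆ 𝔵 f g n = refl
derive-⋆ 𝔶 f g zero    = ℚ.*-zeroˡ (g 0)
derive-⋆ 𝔶 f g (suc n) = begin
  0ℚ * g (suc n) + anti (λ i j → ∑< (suc i) f * g j) n
    ≡⟨ trans (cong (_+ anti (λ i j → ∑< (suc i) f * g j) n) (ℚ.*-zeroˡ (g (suc n)))) (ℚ.+-identityˡ _) ⟩
  anti (λ i j → ∑< (suc i) f * g j) n
    ≡⟨ go n f ⟩
  ∑< (suc n) (f ⋆ g) ∎
  where
  open ≡-Reasoning
  go : ∀ n f → anti (λ i j → ∑< (suc i) f * g j) n ≡ ∑< (suc n) (f ⋆ g)
  go zero    f = trans (cong (_* g 0) (ℚ.+-identityˡ (f 0))) (sym (ℚ.+-identityˡ (f 0 * g 0)))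
  go (suc n) f = begin
    (0ℚ + f 0) * g (suc n) + anti (λ i j → ∑< (suc (suc i)) f * g j) n
      ≡⟨ cong₂ _+_ (cong (_* g (suc n)) (ℚ.+-identityˡ (f 0))) (anti-cong′ n (λ i j → trans (cong (_* g j) (trans (Σ-front (suc i) f) (ℚ.+-comm (f 0) _)))
           (ℚ.*-distribʳ-+ (g j) (∑< (suc i) (λ i → f (suc i))) (f 0)))) ⟩
    f 0 * g (suc n) + anti (λ i j → ∑< (suc i) (λ i → f (suc i)) * g j + f 0 * g j) n
      ≡⟨ cong (f 0 * g (suc n) +_) (trans (anti-+ n _ _) (cong₂ _+_ (go n (λ i → f (suc i))) (trans (anti-as-∑ n _) (reversed n)))) ⟩
    f 0 * g (suc n) + (∑< (suc n) ((λ i → f (suc i)) ⋆ g) + ∑< (suc n) (λ j → f 0 * g j))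
      ≡⟨ solve 3 (λ x y z → x :+ (y :+ z) := (z :+ x) :+ y) refl (f 0 * g (suc n)) (∑< (suc n) ((λ i → f (suc i)) ⋆ g)) (∑< (suc n) (λ j → f 0 * g j)) ⟩
    ∑< (suc (suc n)) (λ j → f 0 * g j) + ∑< (suc n) ((λ i → f (suc i)) ⋆ g)
      ≡⟨ cong (_+ ∑< (suc n) ((λ i → f (suc i)) ⋆ g)) (Σ-front (suc n) (λ j → f 0 * g j)) ⟩
    f 0 * g 0 + ∑< (suc n) (λ j → f 0 * g (suc j)) + ∑< (suc n) ((λ i → f (suc i)) ⋆ g)
      ≡⟨ trans (ℚ.+-assoc (f 0 * g 0) _ _) (cong (f 0 * g 0 +_) (sym (Σ-+ (suc n) (λ j → f 0 * g (suc j)) ((λ i → f (suc i)) ⋆ g)))) ⟩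
    f 0 * g 0 + ∑< (suc n) (λ j → f 0 * g (suc j) + ((λ i → f (suc i)) ⋆ g) j)
      ≡⟨ Σ-front (suc n) (f ⋆ g) ⟨
    ∑< (suc (suc n)) (f ⋆ g) ∎
    where
    open ℚSolver
    reversed : ∀ n → ∑< (suc n) (λ i → f 0 * g (n ℕ.∸ i)) ≡ ∑< (suc n) (λ j → f 0 * g j)
    reversed n = trans (sym (trans (cong (_+ ∑< (suc n) (λ i → f 0 * g (n ℕ.∸ i))) (cong (λ k → ∑< k (λ j → f 0 * g j)) (ℕ.n∸n≡0 (suc n)))) (ℚ.+-identityˡ _)))
      (Σ-rev (suc n) (suc n) (λ j → f 0 * g j) ℕ.≤-refl)

θ-injective : ∀ {f g} → f 0 ≡ g 0 → (∀ n → θ f n ≡ θ g n) → ∀ n → f n ≡ g n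
θ-injective         e₀ e zero    = e₀
θ-injective {f} {g} e₀ e (suc n) = trans (divide f) (trans (cong (u n *_) (e (suc n))) (sym (divide g)))
  where
  divide : ∀ f → f (suc n) ≡ u n * θ f (suc n)
  divide f = trans (trans (sym (ℚ.*-identityˡ (f (suc n)))) (cong (_* f (suc n)) (trans (sym (νu≡1 n)) (ℚ.*-comm (ν (suc n)) (u n))))) (ℚ.*-assoc (u n) (ν (suc n)) (f (suc n)))

-- The shuffle product of iterated integrals is the product of power series.
li-y⧢ : ∀ {w} → Good w → ∀ n → ∑ₗ (y⧢ w) (λ v → li v n) ≡ (li w ⋆ li-y) n
li-y⧢ {w} g = step g
  where
  open ≡-Reasoning
  θ-li-y : ∀ n → θ li-y n ≡ derive 𝔶 δ₀ n
  θ-li-y n = trans (cong (ν n *_) (sym (li-[𝔶] n))) (θ-li 𝔶 [] (λ ()) n)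
  ∑-map : ∀ a w n → θ (λ n → ∑ₗ (map (a ∷_) (y⧢ w)) (λ v → li v n)) n ≡ ∑ₗ (y⧢ w) (λ v → θ (li (a ∷ v)) n)
  ∑-map a w n = trans (cong (ν n *_) (∑ₗ-map (a ∷_) (y⧢ w) (λ v → li v n))) (sym (∑ₗ-*ˡ (y⧢ w) (ν n) (λ v → li (a ∷ v) n)))
  derive-∑ₗ : ∀ a (vs : List Word) n → ∑ₗ vs (λ v → derive a (li v) n) ≡ derive a (λ n → ∑ₗ vs (λ v → li v n)) n
  derive-∑ₗ 𝔵 vs n = refl
  derive-∑ₗ 𝔶 vs n = ∑ₗ-∑< vs n li
  derive-cong : ∀ a {f g} → (∀ n → f n ≡ g n) → ∀ n → derive a f n ≡ derive a g n
  derive-cong 𝔵 e n = e n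
  derive-cong 𝔶 e n = Σ-cong′ n e
  ∑ₗ-All : ∀ {P : Word → Set} {vs : List Word} {f g : Word → ℚ} → (∀ {v} → P v → f v ≡ g v) → All P vs → ∑ₗ vs f ≡ ∑ₗ vs g
  ∑ₗ-All e []       = refl
  ∑ₗ-All e (p ∷ ps) = cong₂ _+_ (e p) (∑ₗ-All e ps)
  conv-with-y : ∀ f n → (f ⋆ θ li-y) n ≡ derive 𝔶 f n
  conv-with-y f n = trans (⋆-congʳ f θ-li-y n) (trans (⋆-comm f (derive 𝔶 δ₀) n) (trans (derive-⋆ 𝔶 δ₀ f n) (derive-cong 𝔶 (⋆-identityˡ f) n)))
  zero-value : ∀ a w → ∑ₗ (y⧢ (a ∷ w)) (λ v → li v 0) ≡ (li (a ∷ w) ⋆ li-y) 0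
  zero-value a w = trans (cong (0ℚ +_) (trans (∑ₗ-map (a ∷_) (y⧢ w) (λ v → li v 0)) (zeros (y⧢ w)))) (sym (ℚ.*-zeroˡ 0ℚ))
    where
    zeros : ∀ vs → ∑ₗ vs (λ v → li (a ∷ v) 0) ≡ 0ℚ
    zeros []       = refl
    zeros (v ∷ vs) = trans (ℚ.+-identityˡ _) (zeros vs)
  induction : ∀ a w → (a ≡ 𝔵 → Good w) → (a ≡ 𝔵 → All Good (y⧢ w)) → (∀ n → ∑ₗ (y⧢ w) (λ v → li v n) ≡ (li w ⋆ li-y) n) →
    ∀ n → ∑ₗ (y⧢ (a ∷ w)) (λ v → li v n) ≡ (li (a ∷ w) ⋆ li-y) n
  induction a w good goods IH = θ-injective (zero-value a w) (λ n → begin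
    ν n * (li (𝔶 ∷ a ∷ w) n + ∑ₗ (map (a ∷_) (y⧢ w)) (λ v → li v n))
      ≡⟨ ℚ.*-distribˡ-+ (ν n) (li (𝔶 ∷ a ∷ w) n) (∑ₗ (map (a ∷_) (y⧢ w)) (λ v → li v n)) ⟩
    θ (li (𝔶 ∷ a ∷ w)) n + θ (λ n → ∑ₗ (map (a ∷_) (y⧢ w)) (λ v → li v n)) n
      ≡⟨ cong₂ _+_ (θ-li 𝔶 (a ∷ w) (λ ()) n) (trans (∑-map a w n) (trans (derived a goods n) (trans (derive-∑ₗ a (y⧢ w) n) (derive-cong a IH n)))) ⟩
    derive 𝔶 (li (a ∷ w)) n + derive a (li w ⋆ li-y) n
      ≡⟨ cong₂ _+_ (conv-with-y (li (a ∷ w)) n) (trans (⋆-congˡ li-y (θ-li a w good) n) (derive-⋆ a (li w) li-y n)) ⟨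
    (li (a ∷ w) ⋆ θ li-y) n + (θ (li (a ∷ w)) ⋆ li-y) n
      ≡⟨ trans (ℚ.+-comm ((li (a ∷ w) ⋆ θ li-y) n) ((θ (li (a ∷ w)) ⋆ li-y) n)) (sym (θ-⋆ (li (a ∷ w)) li-y n)) ⟩
    θ (li (a ∷ w) ⋆ li-y) n ∎)
    where
    derived : ∀ a → (a ≡ 𝔵 → All Good (y⧢ w)) → ∀ n → ∑ₗ (y⧢ w) (λ v → θ (li (a ∷ v)) n) ≡ ∑ₗ (y⧢ w) (λ v → derive a (li v) n)
    derived 𝔵 goods n = ∑ₗ-All (λ {v} g → θ-li 𝔵 v (λ _ → g) n) (goods refl)
    derived 𝔶 goods n = ∑ₗ-cong (y⧢ w) (λ v → θ-li 𝔶 v (λ ()) n)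
  base : ∀ n → ∑ₗ (y⧢ []) (λ v → li v n) ≡ (li [] ⋆ li-y) n
  base n = trans (ℚ.+-identityʳ (li (𝔶 ∷ []) n)) (trans (li-[𝔶] n) (sym (⋆-identityˡ li-y n)))
  step : ∀ {w} → Good w → ∀ n → ∑ₗ (y⧢ w) (λ v → li v n) ≡ (li w ⋆ li-y) n
  step [𝔶]        = induction 𝔶 [] (λ ()) (λ ()) base
  step (𝔶∷_ {w} g) = induction 𝔶 w (λ ()) (λ ()) (step g)
  step (𝔵∷_ {w} g) = induction 𝔵 w (λ _ → g) (λ _ → y⧢-good g) (step g)

-- A summation formula for complete symmetric functions

-- The complete homogeneous symmetric functions of u 0 , … , u (N - 1).
h : ℕ → ℚ[[t]]
h zero    m       = δ₀ m
h (suc N) zero    = 1ℚ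
h (suc N) (suc m) = h N (suc m) + u N * h (suc N) m

h-0 : ∀ N → h N 0 ≡ 1ℚ
h-0 zero    = refl
h-0 (suc N) = refl

-- Multiplication by the variable, with 0 in degree 0, so that the recursion `h-suc` includes degree
-- 0.
h⁻ : ℕ → ℚ[[t]]
h⁻ N zero    = 0ℚ
h⁻ N (suc m) = h N m

h-suc : ∀ m N → h (suc N) m ≡ h N m + u N * h⁻ (suc N) m
h-suc zero    N = sym (trans (cong₂ _+_ (h-0 N) (ℚ.*-zeroʳ (u N))) (ℚ.+-identityʳ 1ℚ))
h-suc (suc m) N = refl

h-nonneg : ∀ N m → 0ℚ ≤ h N m
h-nonneg zero    zero    = 0≤1
h-nonneg zero    (suc m) = ℚ.≤-refl
h-nonneg (suc N) zero    = 0≤1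
h-nonneg (suc N) (suc m) = +-mono-nonneg (h-nonneg N (suc m)) (*-nonneg (0≤u N) (h-nonneg (suc N) m))

h≤𝓗^ : ∀ N m → h N m ≤ 𝓗 N ^ m
h≤𝓗^ zero    zero    = ℚ.≤-refl
h≤𝓗^ zero    (suc m) = ℚ.≤-reflexive (sym (ℚ.*-zeroˡ (0ℚ ^ m)))
h≤𝓗^ (suc N) zero    = ℚ.≤-refl
h≤𝓗^ (suc N) (suc m) = begin
  h N (suc m) + u N * h (suc N) m              ≤⟨ ℚ.+-mono-≤ (h≤𝓗^ N (suc m)) (*-monoˡ (u N) (0≤u N) (h≤𝓗^ (suc N) m)) ⟩
  𝓗 N * 𝓗 N ^ m + u N * 𝓗 (suc N) ^ m          ≤⟨ ℚ.+-monoˡ-≤ (u N * 𝓗 (suc N) ^ m) (*-monoˡ (𝓗 N) (0≤𝓗 N) (^-mono (0≤𝓗 N) (≤-+ʳ (0≤u N)) m)) ⟩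
  𝓗 N * 𝓗 (suc N) ^ m + u N * 𝓗 (suc N) ^ m    ≡⟨ ℚ.*-distribʳ-+ (𝓗 (suc N) ^ m) (𝓗 N) (u N) ⟨
  𝓗 (suc N) ^ suc m                            ∎
  where open ℚ.≤-Reasoning

differences : (ℕ → ℚ) → ℕ → ℕ → ℚ
differences f a M = ∑< M (λ j → (u j - u (a ℕ.+ j)) * f (suc (a ℕ.+ j)))

partial-fraction : ∀ a j → u j * u (suc a ℕ.+ j) ≡ u a * (u j - u (suc a ℕ.+ j))
partial-fraction a j = begin
  u j * w                       ≡⟨ solve 3 (λ a j w → j :* w := w :* (a :+ j) :- a :* w) refl (u a) (u j) w ⟩
  w * (u a + u j) - u a * w     ≡⟨ cong (_- u a * w) (u-mul a j) ⟨
  u a * u j - u a * w           ≡⟨ solve 3 (λ a j w → a :* j :- a :* w := a :* (j :- w)) refl (u a) (u j) w ⟩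
  u a * (u j - w)               ∎
  where
  open ≡-Reasoning
  open ℚSolver
  w = u (suc a ℕ.+ j)

-- Summation by parts for the step from `a` to `a + 1`. The increments of `f` carry a factor `u`,
-- which `partial-fraction` turns into `u a` times differences again; the shift of the range leaves
-- the boundary term at `a + M`.
differences-suc : ∀ (f f⁻ : ℕ → ℚ) → (∀ n → f (suc n) ≡ f n + u n * f⁻ (suc n)) → ∀ a M →
  differences f (suc a) M + f (suc (a ℕ.+ M)) * u (a ℕ.+ M) ≡ differences f a M + u a * differences f⁻ (suc a) M + u a * f (suc a)
differences-suc f f⁻ e a zero    = trans (cong (λ n → 0ℚ + f (suc n) * u n) (ℕ.+-identityʳ a))
  (solve 2 (λ x y → con 0ℚ :+ x :* y := con 0ℚ :+ y :* con 0ℚ :+ y :* x) refl (f (suc a)) (u a))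
  where open ℚSolver
differences-suc f f⁻ e a (suc M) = begin
  D + (u M - v) * f (suc (suc n)) + f (suc (a ℕ.+ suc M)) * u (a ℕ.+ suc M)
    ≡⟨ cong (λ k → D + (u M - v) * f (suc (suc n)) + f (suc k) * u k) (ℕ.+-suc a M) ⟩
  D + (u M - v) * f (suc (suc n)) + f (suc (suc n)) * v
    ≡⟨ solve 4 (λ d x v f → d :+ (x :- v) :* f :+ f :* v := d :+ x :* f) refl D (u M) v (f (suc (suc n))) ⟩
  D + u M * f (suc (suc n))
    ≡⟨ cong (λ x → D + u M * x) (e (suc n)) ⟩
  D + u M * (f (suc n) + v * f⁻ (suc (suc n)))
    ≡⟨ solve 6 (λ d x g v f⁻ w → d :+ x :* (g :+ v :* f⁻) := (d :+ g :* w) :+ (x :- w) :* g :+ (x :* v) :* f⁻) refl D (u M) (f (suc n)) v (f⁻ (suc (suc n))) (u n) ⟩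
  (D + f (suc n) * u n) + (u M - u n) * f (suc n) + u M * v * f⁻ (suc (suc n))
    ≡⟨ cong₂ (λ x y → x + (u M - u n) * f (suc n) + y * f⁻ (suc (suc n))) (differences-suc f f⁻ e a M) (partial-fraction a M) ⟩
  (D₀ + u a * D⁻ + u a * f (suc a)) + (u M - u n) * f (suc n) + u a * (u M - v) * f⁻ (suc (suc n))
    ≡⟨ solve 7 (λ d a d⁻ x y z f → (d :+ a :* d⁻ :+ x) :+ y :+ a :* z :* f := (d :+ y) :+ a :* (d⁻ :+ z :* f) :+ x) refl D₀ (u a) D⁻ (u a * f (suc a)) ((u M - u n) * f (suc n)) (u M - v) (f⁻ (suc (suc n))) ⟩
  differences f a (suc M) + u a * differences f⁻ (suc a) (suc M) + u a * f (suc a) ∎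
  where
  open ≡-Reasoning
  open ℚSolver
  n = a ℕ.+ M
  v = u (suc n)
  D = differences f (suc a) M
  D₀ = differences f a M
  D⁻ = differences f⁻ (suc a) M

-- The boundary terms of `differences-suc`, accumulated over the recursion in `a` and `m`; they are
-- the price of a finite M.
remainder : ℕ → ℕ → ℕ → ℚ
remainder m       zero    M = 0ℚ
remainder zero    (suc a) M = remainder zero a M + h (suc (a ℕ.+ M)) 0 * u (a ℕ.+ M)
remainder (suc m) (suc a) M = remainder (suc m) a M + (u a * remainder m (suc a) M + h (suc (a ℕ.+ M)) (suc m) * u (a ℕ.+ M))

-- As M grows, ∑_{j < M} (u j - u (a + j)) h (a + j + 1) m tends to (m + 1) h a (m + 1).
differences-h : ∀ m a M → differences (λ n → h n m) a M + remainder m a M ≡ ν (suc m) * h a (suc m)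
differences-h m       zero    M = trans (cong₂ _+_ (trans (Σ-cong′ M (λ j → trans (cong (_* h (suc j) m) (ℚ.+-inverseʳ (u j))) (ℚ.*-zeroˡ (h (suc j) m)))) (Σ-0 M)) refl)
  (sym (ℚ.*-zeroʳ (ν (suc m))))
differences-h zero    (suc a) M = begin
  D₁ + (E + x)                            ≡⟨ solve 3 (λ d e x → d :+ (e :+ x) := (d :+ x) :+ e) refl D₁ E x ⟩
  (D₁ + x) + E                            ≡⟨ cong (_+ E) (differences-suc (λ n → h n 0) (λ n → h⁻ n 0) (h-suc 0) a M) ⟩
  (D₀ + u a * D⁻ + u a * 1ℚ) + E          ≡⟨ cong (λ y → (D₀ + u a * y + u a * 1ℚ) + E) (trans (Σ-cong′ M (λ j → ℚ.*-zeroʳ (u j - u (suc a ℕ.+ j)))) (Σ-0 M)) ⟩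
  (D₀ + u a * 0ℚ + u a * 1ℚ) + E          ≡⟨ solve 3 (λ d a e → (d :+ a :* con 0ℚ :+ a :* con 1ℚ) :+ e := (d :+ e) :+ a :* con 1ℚ) refl D₀ (u a) E ⟩
  (D₀ + E) + u a * 1ℚ                     ≡⟨ cong (_+ u a * 1ℚ) (differences-h zero a M) ⟩
  ν 1 * h a 1 + u a * 1ℚ                  ≡⟨ solve 2 (λ y a → con 1ℚ :* y :+ a :* con 1ℚ := con 1ℚ :* (y :+ a :* con 1ℚ)) refl (h a 1) (u a) ⟩
  ν 1 * h (suc a) 1                       ∎
  where
  open ≡-Reasoning
  open ℚSolver
  D₁ = differences (λ n → h n 0) (suc a) M
  D₀ = differences (λ n → h n 0) a M
  D⁻ = differences (λ n → h⁻ n 0) (suc a) M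
  E = remainder 0 a M
  x = h (suc (a ℕ.+ M)) 0 * u (a ℕ.+ M)
differences-h (suc m) (suc a) M = begin
  D₁ + (E + (u a * E⁻ + x))
    ≡⟨ solve 5 (λ d e a e⁻ x → d :+ (e :+ (a :* e⁻ :+ x)) := (d :+ x) :+ (e :+ a :* e⁻)) refl D₁ E (u a) E⁻ x ⟩
  (D₁ + x) + (E + u a * E⁻)
    ≡⟨ cong (_+ (E + u a * E⁻)) (differences-suc (λ n → h n (suc m)) (λ n → h⁻ n (suc m)) (h-suc (suc m)) a M) ⟩
  (D₀ + u a * D⁻ + u a * y) + (E + u a * E⁻)
    ≡⟨ solve 6 (λ d a d⁻ y e e⁻ → (d :+ a :* d⁻ :+ a :* y) :+ (e :+ a :* e⁻) := (d :+ e) :+ a :* ((d⁻ :+ e⁻) :+ y)) refl D₀ (u a) D⁻ y E E⁻ ⟩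
  (D₀ + E) + u a * ((D⁻ + E⁻) + y)
    ≡⟨ cong₂ (λ p q → p + u a * (q + y)) (differences-h (suc m) a M) (differences-h m (suc a) M) ⟩
  ν (suc (suc m)) * h a (suc (suc m)) + u a * (ν (suc m) * y + y)
    ≡⟨ cong (λ n → n * h a (suc (suc m)) + u a * (ν (suc m) * y + y)) (ν-+ 1 (suc m)) ⟩
  (1ℚ + ν (suc m)) * h a (suc (suc m)) + u a * (ν (suc m) * y + y)
    ≡⟨ solve 4 (λ n z a y → (con 1ℚ :+ n) :* z :+ a :* (n :* y :+ y) := (con 1ℚ :+ n) :* (z :+ a :* y)) refl (ν (suc m)) (h a (suc (suc m))) (u a) y ⟩
  (1ℚ + ν (suc m)) * h (suc a) (suc (suc m))
    ≡⟨ cong (_* h (suc a) (suc (suc m))) (ν-+ 1 (suc m)) ⟨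
  ν (suc (suc m)) * h (suc a) (suc (suc m)) ∎
  where
  open ≡-Reasoning
  open ℚSolver
  D₁ = differences (λ n → h n (suc m)) (suc a) M
  D₀ = differences (λ n → h n (suc m)) a M
  D⁻ = differences (λ n → h n m) (suc a) M
  E = remainder (suc m) a M
  E⁻ = remainder m (suc a) M
  x = h (suc (a ℕ.+ M)) (suc m) * u (a ℕ.+ M)
  y = h (suc a) (suc m)

remainder-nonneg : ∀ m a M → 0ℚ ≤ remainder m a M
remainder-nonneg m       zero    M = ℚ.≤-refl
remainder-nonneg zero    (suc a) M = +-mono-nonneg (remainder-nonneg zero a M) (*-nonneg (h-nonneg (suc (a ℕ.+ M)) 0) (0≤u (a ℕ.+ M)))
remainder-nonneg (suc m) (suc a) M = +-mono-nonneg (remainder-nonneg (suc m) a M)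
  (+-mono-nonneg (*-nonneg (0≤u a) (remainder-nonneg m (suc a) M)) (*-nonneg (h-nonneg (suc (a ℕ.+ M)) (suc m)) (0≤u (a ℕ.+ M))))

module _ (N M : ℕ) where

  private
    D : ℕ → ℚ
    D a = ∑< a (λ i → u (i ℕ.+ M))

    0≤D : ∀ a → 0ℚ ≤ D a
    0≤D a = ∑<-nonneg (λ i → 0≤u (i ℕ.+ M)) a

    h≤ : ∀ m {n} → n ℕ.≤ N → h n m ≤ 𝓗 N ^ m
    h≤ m {n} n≤N = ℚ.≤-trans (h≤𝓗^ n m) (^-mono (0≤𝓗 n) (∑<-≤ 0≤u n≤N) m)

  -- Each boundary term is a value of `h`, bounded by a power of `𝓗 N`, times some `u (i + M)`.
  -- Contributions of lower degree come with factors `u i`, whose sum supplies the missing power of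
  -- `𝓗 N`.
  remainder≤ : ∀ m a → a ℕ.+ M ℕ.≤ N → remainder m a M ≤ ν (suc m) * (𝓗 N ^ m * D a)
  remainder≤ zero    zero    _      = ℚ.≤-refl
  remainder≤ zero    (suc a) a+M<N = ℚ.≤-trans (ℚ.+-mono-≤ (remainder≤ zero a (ℕ.<⇒≤ a+M<N)) ℚ.≤-refl)
    (ℚ.≤-reflexive (solve 2 (λ d v → con 1ℚ :* (con 1ℚ :* d) :+ con 1ℚ :* v := con 1ℚ :* (con 1ℚ :* (d :+ v))) refl (D a) (u (a ℕ.+ M))))
    where open ℚSolver
  remainder≤ (suc m) a a+M≤N = begin
    remainder (suc m) a M                       ≤⟨ go a a+M≤N ⟩
    𝓗 a * (c * D a) + x * D a                   ≤⟨ ℚ.+-monoˡ-≤ (x * D a) (*-monoʳ (c * D a) (*-nonneg 0≤c (0≤D a)) (∑<-≤ 0≤u (ℕ.≤-trans (ℕ.m≤m+n a M) a+M≤N))) ⟩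
    𝓗 N * (c * D a) + x * D a                   ≡⟨ solve 4 (λ y n p d → y :* (n :* p :* d) :+ y :* p :* d := (con 1ℚ :+ n) :* (y :* p :* d)) refl (𝓗 N) (ν (suc m)) (𝓗 N ^ m) (D a) ⟩
    (1ℚ + ν (suc m)) * (x * D a)                ≡⟨ cong (_* (x * D a)) (ν-+ 1 (suc m)) ⟨
    ν (suc (suc m)) * (x * D a)                 ∎
    where
    open ℚ.≤-Reasoning
    open ℚSolver
    c = ν (suc m) * 𝓗 N ^ m
    x = 𝓗 N ^ suc m
    0≤c : 0ℚ ≤ c
    0≤c = *-nonneg (0≤ν (suc m)) (^-nonneg (0≤𝓗 N) m)
    go : ∀ a → a ℕ.+ M ℕ.≤ N → remainder (suc m) a M ≤ 𝓗 a * (c * D a) + x * D a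
    go zero    _     = ℚ.≤-reflexive (solve 2 (λ c x → con 0ℚ := con 0ℚ :* (c :* con 0ℚ) :+ x :* con 0ℚ) refl c x)
    go (suc a) a+M<N = begin
      remainder (suc m) a M + (u a * remainder m (suc a) M + h (suc (a ℕ.+ M)) (suc m) * v)
        ≤⟨ ℚ.+-mono-≤ (go a (ℕ.<⇒≤ a+M<N)) (ℚ.+-mono-≤ (*-monoˡ (u a) (0≤u a) (ℚ.≤-trans (remainder≤ m (suc a) a+M<N) (ℚ.≤-reflexive (sym (ℚ.*-assoc (ν (suc m)) (𝓗 N ^ m) (D (suc a)))))))
             (*-monoʳ v (0≤u (a ℕ.+ M)) (h≤ (suc m) a+M<N))) ⟩
      (𝓗 a * (c * D a) + x * D a) + (u a * (c * D (suc a)) + x * v)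
        ≤⟨ ℚ.+-monoˡ-≤ (u a * (c * D (suc a)) + x * v) (ℚ.+-monoˡ-≤ (x * D a) (*-monoˡ (𝓗 a) (0≤𝓗 a) (*-monoˡ c 0≤c (≤-+ʳ (0≤u (a ℕ.+ M)))))) ⟩
      (𝓗 a * (c * D (suc a)) + x * D a) + (u a * (c * D (suc a)) + x * v)
        ≡⟨ solve 6 (λ y e x d a v → (y :* e :+ x :* d) :+ (a :* e :+ x :* v) := (y :+ a) :* e :+ x :* (d :+ v)) refl (𝓗 a) (c * D (suc a)) x (D a) (u a) v ⟩
      𝓗 (suc a) * (c * D (suc a)) + x * D (suc a) ∎
      where v = u (a ℕ.+ M)

D≡ε⁻ : ∀ N a → a ℕ.< N → ∑< (suc a) (λ i → u (i ℕ.+ (N ℕ.∸ suc a))) ≡ ε⁻ N a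
D≡ε⁻ N a a<N = +-cancelˡ (𝓗 (N ℕ.∸ suc a)) _ _ (trans
    (cong (𝓗 (N ℕ.∸ suc a) +_) (Σ-cong′ (suc a) (λ i → cong u (ℕ.+-comm i (N ℕ.∸ suc a)))))
    (trans (sym (Σ-split (N ℕ.∸ suc a) (suc a) u)) (trans (cong 𝓗 (ℕ.m∸n+n≡m a<N)) (sym (Σ-rev (suc a) N u a<N)))))

li-nonneg : ∀ w n → 0ℚ ≤ li w n
li-nonneg []      zero    = 0≤1
li-nonneg []      (suc n) = ℚ.≤-refl
li-nonneg (a ∷ w) zero    = ℚ.≤-refl
li-nonneg (𝔵 ∷ w) (suc n) = *-nonneg (0≤u n) (li-nonneg w (suc n))
li-nonneg (𝔶 ∷ w) (suc n) = *-nonneg (0≤u n) (∑<-nonneg (li-nonneg w) (suc n))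

∑-li≤ : ∀ w {n N} → n ℕ.≤ N → ∑< (suc n) (li w) ≤ 𝓗 N ^ length w
∑-li≤ []      {n} n≤N = ℚ.≤-reflexive (trans (Σ-front n δ₀) (trans (cong (1ℚ +_) (Σ-0 n)) (ℚ.+-identityʳ 1ℚ)))
∑-li≤ (a ∷ w) {n} {N} n≤N = begin
  ∑< (suc n) (li (a ∷ w))              ≡⟨ trans (Σ-front n (li (a ∷ w))) (ℚ.+-identityˡ (∑< n (λ i → li (a ∷ w) (suc i)))) ⟩
  ∑< n (λ i → li (a ∷ w) (suc i))      ≤⟨ ∑<-mono n (λ i i<n → bound a i (ℕ.<-≤-trans i<n n≤N)) ⟩
  ∑< n (λ i → u i * 𝓗 N ^ length w)    ≡⟨ Σ-*ʳ n (𝓗 N ^ length w) u ⟩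
  𝓗 n * 𝓗 N ^ length w                 ≤⟨ *-monoʳ (𝓗 N ^ length w) (^-nonneg (0≤𝓗 N) (length w)) (∑<-≤ 0≤u n≤N) ⟩
  𝓗 N * 𝓗 N ^ length w                 ∎
  where
  open ℚ.≤-Reasoning
  bound : ∀ a i → i ℕ.< N → li (a ∷ w) (suc i) ≤ u i * 𝓗 N ^ length w
  bound 𝔵 i i<N = *-monoˡ (u i) (0≤u i) (ℚ.≤-trans
    (subst (_≤ ∑< (suc (suc i)) (li w)) (ℚ.+-identityˡ (li w (suc i))) (ℚ.+-monoˡ-≤ (li w (suc i)) (∑<-nonneg (li-nonneg w) (suc i))))
    (∑-li≤ w i<N))
  bound 𝔶 i i<N = *-monoˡ (u i) (0≤u i) (∑-li≤ w (ℕ.<⇒≤ i<N))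

-- Truncated sums for the shuffle regularization

-- A truncated sum of Kaneko and Yamamoto for the word w followed by x and the index (1 , … , 1) of length m.  Up to
-- the sign (-1)^m it converges to the shuffle regularization of the word yᵐxw, read from right to left.
conjoint : ℕ → Word → ℕ → ℚ
conjoint N w m = ∑< N (λ n → u n * h (suc n) m * li w (suc n))

-- The coefficients for y sh w are those of the product of the two polylogarithms, so the left side
-- runs over i + j ≤ N. A partial fraction of 1/(j (i + j)) detaches 1/i, and the sum over j is
-- evaluated by `differences-h`; its bound N - i causes the remainder.
conjoint-y⧢ : ∀ N {w} → Good w → ∀ m →
  ∑ₗ (y⧢ w) (λ v → conjoint N v m) + ∑< N (λ i → li w (suc i) * (u i * remainder m (suc i) (N ℕ.∸ suc i))) ≡ ν (suc m) * conjoint N w (suc m)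
conjoint-y⧢ N {w} g m = begin
  ∑ₗ (y⧢ w) (λ v → conjoint N v m) + R
    ≡⟨ cong (_+ R) (trans (∑ₗ-∑< (y⧢ w) N (λ v n → u n * h (suc n) m * li v (suc n)))
         (Σ-cong′ N (λ n → trans (∑ₗ-*ˡ (y⧢ w) (u n * h (suc n) m) (λ v → li v (suc n))) (cong (u n * h (suc n) m *_) (li-y⧢ g (suc n)))))) ⟩
  ∑< N (λ n → K (suc n) * (li w ⋆ li-y) (suc n)) + R
    ≡⟨ cong (_+ R) (trans (sym (trans (Σ-front N (λ n → K n * (li w ⋆ li-y) n)) (trans (cong (_+ ∑< N (λ n → K (suc n) * (li w ⋆ li-y) (suc n))) (ℚ.*-zeroˡ ((li w ⋆ li-y) 0))) (ℚ.+-identityˡ (∑< N (λ n → K (suc n) * (li w ⋆ li-y) (suc n)))))))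
         (trans (Σ-cong′ (suc N) distribute) (∑-anti N F))) ⟩
  ∑< (suc N) (λ i → ∑< (suc (N ℕ.∸ i)) (F i)) + R
    ≡⟨ cong (_+ R) (trans (Σ-front N (λ i → ∑< (suc (N ℕ.∸ i)) (F i))) (trans (cong₂ _+_ first (Σ-cong N rest)) (ℚ.+-identityˡ (∑< N (λ i → li w (suc i) * (u i * differences (λ n → h n m) (suc i) (N ℕ.∸ suc i))))))) ⟩
  ∑< N (λ i → li w (suc i) * (u i * differences (λ n → h n m) (suc i) (N ℕ.∸ suc i))) + R
    ≡⟨ sym (Σ-+ N _ _) ⟩
  ∑< N (λ i → li w (suc i) * (u i * differences (λ n → h n m) (suc i) (N ℕ.∸ suc i)) + li w (suc i) * (u i * remainder m (suc i) (N ℕ.∸ suc i)))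
    ≡⟨ Σ-cong′ N (λ i → trans (solve 4 (λ l x d e → l :* (x :* d) :+ l :* (x :* e) := l :* (x :* (d :+ e))) refl (li w (suc i)) (u i) (differences (λ n → h n m) (suc i) (N ℕ.∸ suc i)) (remainder m (suc i) (N ℕ.∸ suc i)))
         (trans (cong (λ y → li w (suc i) * (u i * y)) (differences-h m (suc i) (N ℕ.∸ suc i)))
           (solve 4 (λ l x n y → l :* (x :* (n :* y)) := n :* (x :* y :* l)) refl (li w (suc i)) (u i) (ν (suc m)) (h (suc i) (suc m))))) ⟩
  ∑< N (λ i → ν (suc m) * (u i * h (suc i) (suc m) * li w (suc i)))
    ≡⟨ Σ-*ˡ N (ν (suc m)) (λ i → u i * h (suc i) (suc m) * li w (suc i)) ⟩
  ν (suc m) * conjoint N w (suc m) ∎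
  where
  open ≡-Reasoning
  open ℚSolver
  R = ∑< N (λ i → li w (suc i) * (u i * remainder m (suc i) (N ℕ.∸ suc i)))
  K : ℕ → ℚ
  K zero    = 0ℚ
  K (suc n) = u n * h (suc n) m
  F : ℕ → ℕ → ℚ
  F i j = li w i * (li-y j * K (i ℕ.+ j))
  distribute : ∀ n → K n * (li w ⋆ li-y) n ≡ anti F n
  distribute n = trans (sym (anti-*ˡ n (K n) (λ i j → li w i * li-y j))) (anti-cong n (λ i j i+j≡n → trans
    (solve 3 (λ k x y → k :* (x :* y) := x :* (y :* k)) refl (K n) (li w i) (li-y j)) (cong (λ k → li w i * (li-y j * K k)) (sym i+j≡n))))
  first : ∑< (suc N) (F 0) ≡ 0ℚ
  first = trans (Σ-cong′ (suc N) (λ j → trans (cong (_* (li-y j * K j)) (li-at-0 g)) (ℚ.*-zeroˡ (li-y j * K j)))) (Σ-0 (suc N))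
  rest : ∀ i → i ℕ.< N → ∑< (suc (N ℕ.∸ suc i)) (F (suc i)) ≡ li w (suc i) * (u i * differences (λ n → h n m) (suc i) (N ℕ.∸ suc i))
  rest i i<N = trans (Σ-*ˡ (suc M) (li w (suc i)) (λ j → li-y j * K (suc i ℕ.+ j))) (cong (li w (suc i) *_)
    (trans (Σ-front M (λ j → li-y j * K (suc i ℕ.+ j))) (trans (trans (cong (_+ ∑< M (λ j → u j * K (suc i ℕ.+ suc j))) (ℚ.*-zeroˡ (K (suc i ℕ.+ 0)))) (ℚ.+-identityˡ _))
      (trans (Σ-cong′ M (λ j → trans (cong (λ k → u j * K (suc k)) (ℕ.+-suc i j)) (trans (sym (ℚ.*-assoc (u j) (u (suc i ℕ.+ j)) (h (suc (suc i ℕ.+ j)) m)))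
        (trans (cong (_* h (suc (suc i ℕ.+ j)) m) (partial-fraction i j)) (ℚ.*-assoc (u i) (u j - u (suc i ℕ.+ j)) (h (suc (suc i ℕ.+ j)) m)))))) (Σ-*ˡ M (u i) _)))))
    where M = N ℕ.∸ suc i

-- With M = `N ∸ suc i` the bound for the remainder involves `ε⁻ N i`. The factor `u i` makes it
-- negligible by `u*ε⁻≤`, and the sum of the coefficients `li w` is at most a power of `𝓗 N`.
conjoint-y⧢-null : ∀ {w} → Good w → ∀ m → Null (λ N → ∑ₗ (y⧢ w) (λ v → conjoint N v m) - ν (suc m) * conjoint N w (suc m))
conjoint-y⧢-null {w} g m = null-resp (λ N → trans (solve 2 (λ x r → :- r := x :- (x :+ r)) refl (∑ₗ (y⧢ w) (λ v → conjoint N v m)) (R N))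
    (cong (λ y → ∑ₗ (y⧢ w) (λ v → conjoint N v m) - y) (conjoint-y⧢ N g m)))
  (null-neg (null-nonneg (λ N → ν (suc m) * (𝓗 N ^ (length w ℕ.+ m) * η N)) R-nonneg R≤
    (vanishing-scale (ν (suc m)) (0≤ν (suc m)) (λ N → 𝓗^*-nonneg N (length w ℕ.+ m) (0≤η N)) (𝓗^η-vanishing (length w ℕ.+ m)))))
  where
  open ℚSolver
  R : ℕ → ℚ
  R N = ∑< N (λ i → li w (suc i) * (u i * remainder m (suc i) (N ℕ.∸ suc i)))
  R-nonneg : ∀ N → 0ℚ ≤ R N
  R-nonneg N = ∑<-nonneg (λ i → *-nonneg (li-nonneg w (suc i)) (*-nonneg (0≤u i) (remainder-nonneg m (suc i) (N ℕ.∸ suc i)))) N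
  R≤ : ∀ N → R N ≤ ν (suc m) * (𝓗 N ^ (length w ℕ.+ m) * η N)
  R≤ N = begin
    R N
      ≤⟨ ∑<-mono N (λ i i<N → *-monoˡ (li w (suc i)) (li-nonneg w (suc i)) (small i i<N)) ⟩
    ∑< N (λ i → li w (suc i) * c)
      ≡⟨ Σ-*ʳ N c (λ i → li w (suc i)) ⟩
    ∑< N (λ i → li w (suc i)) * c
      ≤⟨ *-monoʳ c 0≤c (ℚ.≤-trans (subst (∑< N (λ i → li w (suc i)) ≤_) (trans (ℚ.+-comm (∑< N (λ i → li w (suc i))) (li w 0)) (sym (Σ-front N (li w)))) (≤-+ʳ (li-nonneg w 0))) (∑-li≤ w {N} {N} ℕ.≤-refl)) ⟩
    𝓗 N ^ length w * c
      ≡⟨ trans (solve 4 (λ p n q e → p :* (n :* (q :* e)) := n :* (p :* q :* e)) refl (𝓗 N ^ length w) (ν (suc m)) (𝓗 N ^ m) (η N))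
           (cong (λ p → ν (suc m) * (p * η N)) (sym (^-homo-* (𝓗 N) (length w) m))) ⟩
    ν (suc m) * (𝓗 N ^ (length w ℕ.+ m) * η N) ∎
    where
    open ℚ.≤-Reasoning
    c = ν (suc m) * (𝓗 N ^ m * η N)
    0≤c : 0ℚ ≤ c
    0≤c = *-nonneg (0≤ν (suc m)) (𝓗^*-nonneg N m (0≤η N))
    small : ∀ i → i ℕ.< N → u i * remainder m (suc i) (N ℕ.∸ suc i) ≤ c
    small i i<N = begin
      u i * remainder m (suc i) (N ℕ.∸ suc i)
        ≤⟨ *-monoˡ (u i) (0≤u i) (remainder≤ N (N ℕ.∸ suc i) m (suc i) (ℕ.≤-reflexive (ℕ.m+[n∸m]≡n i<N))) ⟩
      u i * (ν (suc m) * (𝓗 N ^ m * ∑< (suc i) (λ k → u (k ℕ.+ (N ℕ.∸ suc i)))))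
        ≡⟨ cong (λ x → u i * (ν (suc m) * (𝓗 N ^ m * x))) (D≡ε⁻ N i i<N) ⟩
      u i * (ν (suc m) * (𝓗 N ^ m * ε⁻ N i))
        ≡⟨ solve 4 (λ x n p e → x :* (n :* (p :* e)) := n :* (p :* (x :* e))) refl (u i) (ν (suc m)) (𝓗 N ^ m) (ε⁻ N i) ⟩
      ν (suc m) * (𝓗 N ^ m * (u i * ε⁻ N i))
        ≤⟨ *-monoˡ (ν (suc m)) (0≤ν (suc m)) (*-monoˡ (𝓗 N ^ m) (^-nonneg (0≤𝓗 N) m) (ℚ.≤-trans (u*ε⁻≤ N i i<N) (≤-+ʳ (0≤𝓗u N)))) ⟩
      c ∎

-- The product ∏ (1 + t/n) and its inverse

⋆-exchange : ∀ a b c d n → ((a ⋆ b) ⋆ (c ⋆ d)) n ≡ ((a ⋆ c) ⋆ (b ⋆ d)) n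
⋆-exchange a b c d n = begin
  ((a ⋆ b) ⋆ (c ⋆ d)) n      ≡⟨ ⋆-assoc a b (c ⋆ d) n ⟩
  (a ⋆ (b ⋆ (c ⋆ d))) n      ≡⟨ ⋆-congʳ a (λ i → trans (sym (⋆-assoc b c d i)) (trans (⋆-congˡ d (⋆-comm b c) i) (⋆-assoc c b d i))) n ⟩
  (a ⋆ (c ⋆ (b ⋆ d))) n      ≡⟨ ⋆-assoc a c (b ⋆ d) n ⟨
  ((a ⋆ c) ⋆ (b ⋆ d)) n      ∎
  where open ≡-Reasoning

alternate-⋆ : ∀ f g n → alternate (f ⋆ g) n ≡ (alternate f ⋆ alternate g) n
alternate-⋆ f g n = trans (sym (anti-*ˡ n ((- 1ℚ) ^ n) (λ i j → f i * g j))) (anti-cong n (λ i j i+j≡n → trans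
  (cong (_* (f i * g j)) (trans (cong ((- 1ℚ) ^_) (sym i+j≡n)) (^-homo-* (- 1ℚ) i j)))
  (solve 4 (λ s t x y → (s :* t) :* (x :* y) := (s :* x) :* (t :* y)) refl ((- 1ℚ) ^ i) ((- 1ℚ) ^ j) (f i) (g j))))
  where open ℚSolver

-- ∏_{n ≤ N} (1 + t/n)
rising : ℕ → ℚ[[t]]
rising zero    = δ₀
rising (suc N) = linear-factor (u N) ⋆ rising N

linear-factor-alternate-h : ∀ N n → (linear-factor (u N) ⋆ alternate (h (suc N))) n ≡ alternate (h N) n
linear-factor-alternate-h N zero    = trans (ℚ.*-identityˡ (1ℚ * 1ℚ)) (cong (1ℚ *_) (sym (h-0 N)))
linear-factor-alternate-h N (suc m) = trans (linear-factor-⋆ (u N) (alternate (h (suc N))) m)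
  (solve 4 (λ s x c y → (con (- 1ℚ) :* s) :* (x :+ c :* y) :+ c :* (s :* y) := (con (- 1ℚ) :* s) :* x) refl ((- 1ℚ) ^ m) (h N (suc m)) (u N) (h (suc N) m))
  where open ℚSolver

alternate-δ₀ : ∀ n → alternate δ₀ n ≡ δ₀ n
alternate-δ₀ zero    = refl
alternate-δ₀ (suc n) = ℚ.*-zeroʳ ((- 1ℚ) ^ suc n)

-- `alternate (h N)` is ∏ 1/(1 + t/n); one factor cancels at each step.
rising-h : ∀ N n → (rising N ⋆ alternate (h N)) n ≡ δ₀ n
rising-h zero    n = trans (⋆-identityˡ (alternate (h 0)) n) (alternate-δ₀ n)
rising-h (suc N) n = trans (⋆-congˡ (alternate (h (suc N))) (⋆-comm (linear-factor (u N)) (rising N)) n)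
  (trans (⋆-assoc (rising N) (linear-factor (u N)) (alternate (h (suc N))) n)
    (trans (⋆-congʳ (rising N) (linear-factor-alternate-h N) n) (rising-h N n)))

rising-sinc : ∀ N n → (alternate (rising N) ⋆ rising N) n ≡ sinc N n
rising-sinc zero    n = trans (⋆-comm (alternate δ₀) δ₀ n) (trans (⋆-identityˡ (alternate δ₀) n) (alternate-δ₀ n))
rising-sinc (suc N) n = begin
  (alternate (c ⋆ rising N) ⋆ (c ⋆ rising N)) n
    ≡⟨ ⋆-congˡ (c ⋆ rising N) (alternate-⋆ c (rising N)) n ⟩
  ((alternate c ⋆ alternate (rising N)) ⋆ (c ⋆ rising N)) n
    ≡⟨ ⋆-exchange (alternate c) (alternate (rising N)) c (rising N) n ⟩
  ((alternate c ⋆ c) ⋆ (alternate (rising N) ⋆ rising N)) n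
    ≡⟨ trans (⋆-congˡ (alternate (rising N) ⋆ rising N) quadratic n) (⋆-congʳ (quadratic-factor (u N)) (rising-sinc N) n) ⟩
  sinc (suc N) n ∎
  where
  open ≡-Reasoning
  open ℚSolver
  c = linear-factor (u N)
  quadratic : ∀ n → (alternate c ⋆ c) n ≡ quadratic-factor (u N) n
  quadratic n = trans (⋆-comm (alternate c) c n) (go n)
    where
    go : ∀ n → (c ⋆ alternate c) n ≡ quadratic-factor (u N) n
    go zero                = refl
    go (suc zero)          = trans (linear-factor-⋆ (u N) (alternate c) 0) (solve 1 (λ x → con (- 1ℚ) :* con 1ℚ :* x :+ x :* (con 1ℚ :* con 1ℚ) := con 0ℚ) refl (u N))
    go (suc (suc zero))    = trans (linear-factor-⋆ (u N) (alternate c) 1) (solve 2 (λ x s → s :* con 0ℚ :+ x :* (con (- 1ℚ) :* con 1ℚ :* x) := :- (x :* x)) refl (u N) ((- 1ℚ) ^ 2))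
    go (suc (suc (suc n))) = trans (linear-factor-⋆ (u N) (alternate c) (suc (suc n)))
      (solve 3 (λ x s t → s :* con 0ℚ :+ x :* (t :* con 0ℚ) := con 0ℚ) refl (u N) ((- 1ℚ) ^ suc (suc (suc n))) ((- 1ℚ) ^ suc (suc n)))

act-+ : ∀ γ φ ψ p → act γ (λ p → φ p + ψ p) p ≡ act γ φ p + act γ ψ p
act-+ γ φ ψ []               = ℚ.*-distribˡ-+ (γ 0) (φ []) (ψ [])
act-+ γ φ ψ ((1+ zero) ∷ p)  = trans (cong₂ _+_ (ℚ.*-distribˡ-+ (γ 0) (φ ((1+ 0) ∷ p)) (ψ ((1+ 0) ∷ p))) (act-+ (λ i → γ (suc i)) φ ψ p))
  (+-exchange (γ 0 * φ ((1+ 0) ∷ p)) (γ 0 * ψ ((1+ 0) ∷ p)) (act (λ i → γ (suc i)) φ p) (act (λ i → γ (suc i)) ψ p))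
act-+ γ φ ψ ((1+ suc k) ∷ p) = ℚ.*-distribˡ-+ (γ 0) (φ ((1+ suc k) ∷ p)) (ψ ((1+ suc k) ∷ p))

-- Chains of `W₁ (suc n)` with the new value as largest variable: exponent 1 there is the operator
-- `u n` times ∂, larger exponents make up `top`.
top : ℕ → Index → ℚ
top n []               = 0ℚ
top n ((1+ zero) ∷ p)  = 0ℚ
top n ((1+ suc k) ∷ p) = u n ^ suc (suc k) * W₁ n p

W₁-suc : ∀ N p → W₁ (suc N) p ≡ act (linear-factor (u N)) (W₁ N) p + top N p
W₁-suc N []               = refl
W₁-suc N ((1+ zero) ∷ p)  = trans (cong (W₁ N ((1+ 0) ∷ p) +_) (cong (_* W₁ N p) (ℚ.*-identityʳ (u N))))
  (sym (trans (ℚ.+-identityʳ (1ℚ * W₁ N ((1+ 0) ∷ p) + act (λ i → linear-factor (u N) (suc i)) (W₁ N) p)) (cong₂ _+_ (ℚ.*-identityˡ (W₁ N ((1+ 0) ∷ p)))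
    (trans (act-∂ (λ i → linear-factor (u N) (suc i)) (W₁ N) p) (trans (cong (u N * W₁ N p +_) (vanish p)) (ℚ.+-identityʳ (u N * W₁ N p)))))))
  where
  vanish : ∀ p → ∂ (act (λ i → linear-factor (u N) (suc (suc i))) (W₁ N)) p ≡ 0ℚ
  vanish []               = refl
  vanish ((1+ zero) ∷ p)  = act-0 (λ i → linear-factor (u N) (suc (suc i))) (W₁ N) p (λ _ → refl)
  vanish ((1+ suc k) ∷ p) = refl
W₁-suc N ((1+ suc k) ∷ p) = cong (_+ u N ^ suc (suc k) * W₁ N p) (sym (ℚ.*-identityˡ (W₁ N ((1+ suc k) ∷ p))))

-- This is the inverse of `rising N`, as a series in ∂, applied to `W₁ N`. By `W₁-suc` the factor 1
-- + `u N` ∂ cancels against the inverse, so only the terms `top` accumulate, and the result is a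
-- single sum comparable with `conjoint`.
φ⧢ : ℕ → Index → ℚ
φ⧢ zero    p = W₁ 0 p
φ⧢ (suc N) p = φ⧢ N p + act (alternate (h (suc N))) (top N) p

W₁≡act-φ⧢ : ∀ N p → W₁ N p ≡ act (rising N) (φ⧢ N) p
W₁≡act-φ⧢ zero    p = sym (act-δ₀ (W₁ 0) p)
W₁≡act-φ⧢ (suc N) p = begin
  W₁ (suc N) p
    ≡⟨ W₁-suc N p ⟩
  act c (W₁ N) p + top N p
    ≡⟨ cong₂ _+_ (trans (act-cong p (λ _ → refl) (W₁≡act-φ⧢ N)) (act-⋆ c (rising N) (φ⧢ N) p))
         (sym (trans (act-cong {ψ = top N} p (rising-h (suc N)) (λ _ → refl)) (act-δ₀ (top N) p))) ⟩
  act (rising (suc N)) (φ⧢ N) p + act (rising (suc N) ⋆ alternate (h (suc N))) (top N) p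
    ≡⟨ cong (act (rising (suc N)) (φ⧢ N) p +_) (act-⋆ (rising (suc N)) (alternate (h (suc N))) (top N) p) ⟨
  act (rising (suc N)) (φ⧢ N) p + act (rising (suc N)) (act (alternate (h (suc N))) (top N)) p
    ≡⟨ act-+ (rising (suc N)) (φ⧢ N) (act (alternate (h (suc N))) (top N)) p ⟨
  act (rising (suc N)) (φ⧢ (suc N)) p ∎
  where
  open ≡-Reasoning
  c = linear-factor (u N)

φ⧢-[] : ∀ N → φ⧢ N [] ≡ 1ℚ
φ⧢-[] zero    = refl
φ⧢-[] (suc N) = trans (cong₂ _+_ (φ⧢-[] N) (ℚ.*-zeroʳ (alternate (h (suc N)) 0))) (ℚ.+-identityʳ 1ℚ)

φ⧢-ones : ∀ m N → φ⧢ N (ones (suc m)) ≡ 0ℚ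
φ⧢-ones m zero    = refl
φ⧢-ones m (suc N) = cong₂ _+_ (φ⧢-ones m N) (act-top-ones (suc m) (alternate (h (suc N))))
  where
  act-top-ones : ∀ m γ → act γ (top N) (ones m) ≡ 0ℚ
  act-top-ones zero    γ = ℚ.*-zeroʳ (γ 0)
  act-top-ones (suc m) γ = cong₂ _+_ (ℚ.*-zeroʳ (γ 0)) (act-top-ones m (λ i → γ (suc i)))

li-wordʳ : ∀ j ks n → li (wordʳ ((1+ j) ∷ ks)) (suc n) ≡ u n ^ suc j * W₁ n ks
∑-li-wordʳ : ∀ ks n → ∑< (suc n) (li (wordʳ ks)) ≡ W₁ n ks
li-wordʳ zero    ks n = trans (cong (u n *_) (∑-li-wordʳ ks n)) (cong (_* W₁ n ks) (sym (ℚ.*-identityʳ (u n))))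
li-wordʳ (suc j) ks n = trans (cong (u n *_) (li-wordʳ j ks n)) (sym (ℚ.*-assoc (u n) (u n ^ suc j) (W₁ n ks)))
∑-li-wordʳ []               n = trans (Σ-front n δ₀) (trans (cong (1ℚ +_) (Σ-0 n)) (ℚ.+-identityʳ 1ℚ))
∑-li-wordʳ ((1+ j) ∷ ks) n = trans (Σ-front n (li (wordʳ ((1+ j) ∷ ks)))) (trans (cong₂ _+_ (li-at-0 (wordʳ-good j ks)) (Σ-cong′ n (li-wordʳ j ks)))
  (ℚ.+-identityˡ (W₁ n ((1+ j) ∷ ks))))

-- `top` requires a leading exponent of at least 2, so exactly m letters 1 have to be deleted: the
-- coefficient (-1)^m h of degree m is selected. One factor 1/n of that exponent is the letter x in
-- front of the word.
φ⧢-conjoint : ∀ m k ks N → φ⧢ N (ones m ++ (1+ suc k) ∷ ks) ≡ (- 1ℚ) ^ m * conjoint N (wordʳ ((1+ k) ∷ ks)) m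
φ⧢-conjoint m k ks zero    = trans (W₁-0 m) (sym (ℚ.*-zeroʳ ((- 1ℚ) ^ m)))
  where
  W₁-0 : ∀ m → W₁ 0 (ones m ++ (1+ suc k) ∷ ks) ≡ 0ℚ
  W₁-0 zero    = refl
  W₁-0 (suc m) = refl
φ⧢-conjoint m k ks (suc N) = trans (cong₂ _+_ (φ⧢-conjoint m k ks N) (trans (act-top m (alternate (h (suc N)))) (trans
    (cong (λ x → alternate (h (suc N)) m * x) (trans (ℚ.*-assoc (u N) (u N ^ suc k) (W₁ N ks)) (cong (u N *_) (sym (li-wordʳ k ks N)))))
    (solve 4 (λ s y x l → (s :* y) :* (x :* l) := s :* (x :* y :* l)) refl ((- 1ℚ) ^ m) (h (suc N) m) (u N) (li (wordʳ ((1+ k) ∷ ks)) (suc N))))))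
  (sym (ℚ.*-distribˡ-+ ((- 1ℚ) ^ m) (conjoint N (wordʳ ((1+ k) ∷ ks)) m) (u N * h (suc N) m * li (wordʳ ((1+ k) ∷ ks)) (suc N))))
  where
  open ℚSolver
  act-top : ∀ m γ → act γ (top N) (ones m ++ (1+ suc k) ∷ ks) ≡ γ m * (u N ^ suc (suc k) * W₁ N ks)
  act-top zero    γ = refl
  act-top (suc m) γ = trans (cong₂ _+_ (ℚ.*-zeroʳ (γ 0)) (act-top m (λ i → γ (suc i)))) (ℚ.+-identityˡ (γ (suc m) * (u N ^ suc (suc k) * W₁ N ks)))

𝔶s : ℕ → Word
𝔶s m = replicate m 𝔶

wordʳ-ones : ∀ m p → wordʳ (ones m ++ p) ≡ 𝔶s m ++ wordʳ p
wordʳ-ones zero    p = refl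
wordʳ-ones (suc m) p = cong (𝔶 ∷_) (wordʳ-ones m p)

∑-y⧢-𝔶s : ∀ m (F : Word → ℚ) → ∑ₗ (y⧢ 𝔶s m) F ≡ ν (suc m) * F (𝔶s (suc m))
∑-y⧢-𝔶s zero    F = trans (ℚ.+-identityʳ (F (𝔶 ∷ []))) (sym (ℚ.*-identityˡ (F (𝔶 ∷ []))))
∑-y⧢-𝔶s (suc m) F = begin
  F₁ + ∑ₗ (map (𝔶 ∷_) (y⧢ 𝔶s m)) F    ≡⟨ cong (F₁ +_) (trans (∑ₗ-map (𝔶 ∷_) (y⧢ 𝔶s m) F) (∑-y⧢-𝔶s m (λ v → F (𝔶 ∷ v)))) ⟩
  F₁ + ν (suc m) * F₁                  ≡⟨ solve 2 (λ f n → f :+ n :* f := (con 1ℚ :+ n) :* f) refl F₁ (ν (suc m)) ⟩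
  (1ℚ + ν (suc m)) * F₁                ≡⟨ cong (_* F₁) (ν-+ 1 (suc m)) ⟨
  ν (suc (suc m)) * F₁                 ∎
  where
  open ≡-Reasoning
  open ℚSolver
  F₁ = F (𝔶s (suc (suc m)))

-- The new 𝔶 has m + 1 places before the first 𝔵, and otherwise is shuffled into `w`. The relation
-- has the shape of `conjoint-y⧢`.
∑-y⧢ : ∀ m w (F : Word → ℚ) → ∑ₗ (y⧢ (𝔶s m ++ 𝔵 ∷ w)) F ≡ ν (suc m) * F (𝔶s (suc m) ++ 𝔵 ∷ w) + ∑ₗ (y⧢ w) (λ v → F (𝔶s m ++ 𝔵 ∷ v))
∑-y⧢ zero    w F = cong₂ _+_ (sym (ℚ.*-identityˡ (F (𝔶 ∷ 𝔵 ∷ w)))) (∑ₗ-map (𝔵 ∷_) (y⧢ w) F)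
∑-y⧢ (suc m) w F = begin
  F₁ + ∑ₗ (map (𝔶 ∷_) (y⧢ (𝔶s m ++ 𝔵 ∷ w))) F    ≡⟨ cong (F₁ +_) (trans (∑ₗ-map (𝔶 ∷_) (y⧢ (𝔶s m ++ 𝔵 ∷ w)) F) (∑-y⧢ m w (λ v → F (𝔶 ∷ v)))) ⟩
  F₁ + (ν (suc m) * F₁ + S)                       ≡⟨ solve 3 (λ f n s → f :+ (n :* f :+ s) := (con 1ℚ :+ n) :* f :+ s) refl F₁ (ν (suc m)) S ⟩
  (1ℚ + ν (suc m)) * F₁ + S                       ≡⟨ cong (λ n → n * F₁ + S) (ν-+ 1 (suc m)) ⟨
  ν (suc (suc m)) * F₁ + S                        ∎
  where
  open ≡-Reasoning
  open ℚSolver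
  F₁ = F (𝔶s (suc (suc m)) ++ 𝔵 ∷ w)
  S = ∑ₗ (y⧢ w) (λ v → F (𝔶s (suc m) ++ 𝔵 ∷ v))

-- Comparison for the shuffle regularization

module _ (Z• : Index → ℝ[T]) (reg : IsRegularization sh Z•) where

  private
    ζʷ : ℕ → Word → ℚ
    ζʷ N v = ζˢ sh Z• reg N (z⁻¹ (reverse v))

  ζʷ-wordʳ : ∀ p N → ζʷ N (wordʳ p) ≡ ζʳ Z• N p
  ζʷ-wordʳ p N = cong (ζˢ sh Z• reg N) (trans (cong z⁻¹ (sym (z-reverse p))) (z⁻¹-z (reverse p)))

  ζʷ-y⧢ : ∀ p → Null (λ N → ∑ₗ (y⧢ wordʳ p) (ζʷ N))
  ζʷ-y⧢ p = null-resp (λ N → trans (∑ₗ-map z⁻¹ (map reverse (words N)) (ζˢ sh Z• reg N))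
      (trans (∑ₗ-map reverse (words N) (λ v → ζˢ sh Z• reg N (z⁻¹ v)))
        (cong (λ w → ∑ₗ (y⧢ w) (ζʷ N)) (trans (cong reverse (z-reverse p)) (reverse-involutive (wordʳ p))))))
    (ζˢ-y-product sh Z• reg (reverse p))
    where
    words : ℕ → List Word
    words _ = shuffleʳ (𝔶 ∷ []) (reverse (z (reverse p)))

  ζʷ-y⧢-good : ∀ {v} → Good v → Null (λ N → ∑ₗ (y⧢ v) (ζʷ N))
  ζʷ-y⧢-good g = step (good-index g)
    where
    step : ∀ {v} → (∃ λ n → ∃ λ p → v ≡ wordʳ ((1+ n) ∷ p)) → Null (λ N → ∑ₗ (y⧢ v) (ζʷ N))
    step (n , p , refl) = ζʷ-y⧢ ((1+ n) ∷ p)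

  private
    C Ψ : ℕ → ℕ × Word → ℚ
    C N (m , w) = (- 1ℚ) ^ m * conjoint N w m
    Ψ N (m , w) = ζʷ N (𝔶s m ++ 𝔵 ∷ w)

  -- Both families satisfy the same relation for y sh yᵐxw. It lowers `m` while the words become
  -- longer, so the induction is on `m` for all good words at once.
  conjoint≈ζʷ : ∀ m {w} → Good w → (λ N → C N (m , w)) ≈𝒵 (λ N → Ψ N (m , w))
  conjoint≈ζʷ zero {w} g = base (good-index g)
    where
    base : ∀ {w} → (∃ λ n → ∃ λ p → w ≡ wordʳ ((1+ n) ∷ p)) → (λ N → C N (0 , w)) ≈𝒵 (λ N → Ψ N (0 , w))
    base (n , p , refl) = mk≈𝒵 (𝒵-resp C≡ in-𝒵) (∼-trans (∼-reflexive C≡) (∼-trans limit (∼-reflexive (λ N → sym (ζʷ-wordʳ κ N)))))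
      where
      κ : Index
      κ = (1+ suc n) ∷ p
      open _≈𝒵_ (W₁∼ζʳ sh Z• reg {κ} (first≥2 (ℕ.s≤s (ℕ.s≤s ℕ.z≤n))))
      C≡ : ∀ N → C N (0 , wordʳ ((1+ n) ∷ p)) ≡ W₁ N κ
      C≡ N = trans (ℚ.*-identityˡ (conjoint N (wordʳ ((1+ n) ∷ p)) 0)) (Σ-cong′ N (λ i → trans
        (cong₂ _*_ (ℚ.*-identityʳ (u i)) (li-wordʳ n p i)) (sym (ℚ.*-assoc (u i) (u i ^ suc n) (W₁ i p)))))
  conjoint≈ζʷ (suc m) {w} g = determine (map (m ,_) (y⧢ w)) C Ψ (suc m , w) m
    (null-resp C-relation (null-*-const ((- 1ℚ) ^ m) (conjoint-y⧢-null g m)))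
    (null-resp Ψ-relation (ζʷ-y⧢-good (good m)))
    (All.map⁺ (All.map (conjoint≈ζʷ m) (y⧢-good g)))
    where
    open ℚSolver
    good : ∀ m → Good (𝔶s m ++ 𝔵 ∷ w)
    good zero    = 𝔵∷ g
    good (suc m) = 𝔶∷ good m
    C-relation : ∀ N → (- 1ℚ) ^ m * (∑ₗ (y⧢ w) (λ v → conjoint N v m) - ν (suc m) * conjoint N w (suc m)) ≡ ν (suc m) * C N (suc m , w) + ∑ₗ (map (m ,_) (y⧢ w)) (C N)
    C-relation N = trans (solve 4 (λ s x n y → s :* (x :- n :* y) := n :* ((con (- 1ℚ) :* s) :* y) :+ s :* x) refl
        ((- 1ℚ) ^ m) (∑ₗ (y⧢ w) (λ v → conjoint N v m)) (ν (suc m)) (conjoint N w (suc m)))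
      (cong (ν (suc m) * C N (suc m , w) +_) (trans (sym (∑ₗ-*ˡ (y⧢ w) ((- 1ℚ) ^ m) (λ v → conjoint N v m))) (sym (∑ₗ-map (m ,_) (y⧢ w) (C N)))))
    Ψ-relation : ∀ N → ∑ₗ (y⧢ (𝔶s m ++ 𝔵 ∷ w)) (ζʷ N) ≡ ν (suc m) * Ψ N (suc m , w) + ∑ₗ (map (m ,_) (y⧢ w)) (Ψ N)
    Ψ-relation N = trans (∑-y⧢ m w (ζʷ N)) (cong (ν (suc m) * Ψ N (suc m , w) +_) (sym (∑ₗ-map (m ,_) (y⧢ w) (Ψ N))))

  φ⧢∼ζʳ : ∀ p → (λ N → φ⧢ N p) ≈𝒵 (λ N → ζʳ Z• N p)
  φ⧢∼ζʳ p = step (split-lead (proj₂ (lead p)))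
    where
    nonadmissible : ∀ m {p₀} → Admissibleʳ p₀ → (λ N → φ⧢ N (ones m ++ p₀)) ≈𝒵 (λ N → ζʷ N (wordʳ (ones m ++ p₀)))
    nonadmissible zero    empty = mk≈𝒵 (𝒵-resp φ⧢-[] in-𝒵) (∼-trans (∼-reflexive φ⧢-[]) (∼-trans limit (∼-reflexive (λ N → sym (ζʷ-wordʳ [] N)))))
      where open _≈𝒵_ (W₁∼ζʳ sh Z• reg {[]} empty)
    -- Since y sh yᵐ is (m + 1) times the word yᵐ⁺¹, the regularized value tends to 0, while `φ⧢` is
    -- 0 for every N.
    nonadmissible (suc m) empty = determine [] (λ N p → φ⧢ N p) (λ N p → ζʷ N (wordʳ p)) (ones (suc m) ++ []) m
      (null-0 (λ N → trans (ℚ.+-identityʳ (ν (suc m) * φ⧢ N (ones (suc m) ++ []))) (trans (cong (ν (suc m) *_) (trans (cong (φ⧢ N) (++-identityʳ (ones (suc m)))) (φ⧢-ones m N))) (ℚ.*-zeroʳ (ν (suc m))))))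
      (null-resp (λ N → trans (trans (cong (λ w → ∑ₗ (y⧢ w) (ζʷ N)) (word m)) (∑-y⧢-𝔶s m (ζʷ N)))
        (trans (cong (λ w → ν (suc m) * ζʷ N w) (sym (word (suc m)))) (sym (ℚ.+-identityʳ (ν (suc m) * ζʷ N (wordʳ (ones (suc m) ++ []))))))) (ζʷ-y⧢ (ones m ++ [])))
      []
      where
      word : ∀ m → wordʳ (ones m ++ []) ≡ 𝔶s m
      word m = trans (wordʳ-ones m []) (++-identityʳ (𝔶s m))
    nonadmissible m (first≥2 {1+ suc k} {ks} _) = mk≈𝒵 (𝒵-resp (φ⧢-conjoint m k ks) in-𝒵) (∼-trans (∼-reflexive (φ⧢-conjoint m k ks))
        (∼-trans limit (∼-reflexive (λ N → cong (ζʷ N) (sym (wordʳ-ones m ((1+ suc k) ∷ ks)))))))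
      where open _≈𝒵_ (conjoint≈ζʷ m (wordʳ-good k ks))
    nonadmissible m (first≥2 {1+ zero} (ℕ.s≤s ()))
    step : ∀ {p m} → (∃ λ j → ∃ λ p₀ → j ℕ.≤ m × Admissibleʳ p₀ × p ≡ ones j ++ p₀) → (λ N → φ⧢ N p) ≈𝒵 (λ N → ζʳ Z• N p)
    step (j , p₀ , _ , a , refl) = mk≈𝒵 in-𝒵 (∼-trans limit (∼-reflexive (ζʷ-wordʳ (ones j ++ p₀))))
      where open _≈𝒵_ (nonadmissible j a)

  shuffle-comparison : Comparison Z•
  shuffle-comparison = record
    { φ     = φ⧢
    ; P     = rising
    ; W₁≡   = W₁≡act-φ⧢
    ; φ-𝒵   = λ p → _≈𝒵_.in-𝒵 (φ⧢∼ζʳ p)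
    ; φ∼ζʳ  = λ p → _≈𝒵_.limit (φ⧢∼ζʳ p)
    ; PP⁻-0 = λ N → trans (rising-sinc N 0) (sinc-0 N)
    ; PP⁻-𝒥 = λ c → 𝒥-resp (λ N → rising-sinc N (suc c)) (sinc-𝒥 c)
    }

theorem6p1 : (• : Product) (Z• : Index → ℝ[T]) → IsRegularization • Z• →
    (k : Index) → k ≢ [] →
    (∑ₜ[ i ∈ allFin (length k) ] ∑ₜ[ j ∈ upTo (val (lookup k i) ∸ 1) ]
    Symmetric.ζŜ Z• ((1+ j) ∷ cyclic-rest k i ∷ʳ (lookup k i ⊖ j)))
    ≡
    (∑ₜ[ i ∈ allFin (length k) ] ∑∞[ j ]
    (Symmetric.ζŜ Z• ((lookup k i ⊕ j ⊕ 1) ∷ cyclic-rest k i)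
    +ₜ Symmetric.ζŜ Z• ((1+ j) ∷ cyclic-rest k i ∷ʳ lookup k i)) ·tʲ)
    +ₜ (∑ₜ[ i ∈ allFin (length k) ] Symmetric.ζŜ Z• (cyclic-rest k i ∷ʳ (lookup k i ⊕ 1)))
    [modζ2]
theorem6p1 • Z• reg k k≢[] = cyclic-formula-from-sequences (Symmetric.ζŜ Z•) k (λ N → 𝒮 (ζʳ Z• N)) (ζŜ≡𝒮 Z•)
  (cyclic-difference-𝒥 Z• (comparison • reg) k k≢[])
  where
  comparison : ∀ • → IsRegularization • Z• → Comparison Z•
  comparison ∗  = harmonic-comparison Z•
  comparison sh = shuffle-comparison Z•
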